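{- Let $\Gamma$ be a finite connected non-complete simple undirected graph of prime valency $p$. Then $\Gamma$ is $2$-geodesic transitive if and only if either $\Gamma$ is $2$-arc transitive, or $p\equiv 1\pmod 4$ and $\Gamma\in\mathcal{C}(p)$.
   Context: A $2$-arc is a vertex triple $(u,v,w)$ with $v$ adjacent to both $u$ and $w$ and $u\neq w$; it is a $2$-geodesic if moreover $u,w$ are not adjacent. An arc is an ordered pair of adjacent vertices. A non-complete graph is $2$-arc transitive (resp. $2$-geodesic transitive) if its automorphism group is transitive on arcs and on $2$-arcs (resp. on arcs and on $2$-geodesics). For a finite group $G$, a core-free subgroup $H$ and $g\in G$ with $G=\langle H,g\rangle$ and $HgH=Hg^{ -1}H$, the coset graph $\mathrm{Cos}(G,H,HgH)$ has vertex set $\{Hx : x\in G\}$, with $Hx$ adjacent to $Hy$ iff $yx^{ -1}\in HgH$. The family $\mathcal{C}(p)$ (for $p\equiv1\pmod 4$ prime): $\mathcal{C}(5)$ consists only of the icosahedron. For $p>5$, $\mathcal{C}(p)$ consists of the coset graphs $\mathrm{Cos}(G,H,HgH)$ where $G=PSL(2,p)$; $a\in G$ has order $p$, $N_G(\langle a\rangle)=\langle a\rangle{:}\langle b\rangle\cong Z_p{:}Z_{(p-1)/2}$ with $b$ of order $(p-1)/2$; $N_G(\langle b^2\rangle)=\langle b\rangle{:}\langle c\rangle\cong D_{p-1}$ with $c$ of order $2$; $H=\langle a\rangle{:}\langle b^2\rangle$ and $g=cb^{2i}$ for some integer $i$. -}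

module Defs where

import Data.Nat as ℕ
open import Data.Nat using (ℕ; _+_; _*_; _∸_; _<_; NonZero)
open import Data.Nat.DivMod using (_mod_; _/_)
open import Data.Nat.Primality using (Prime; prime⇒nonZero)
open import Data.Fin using (Fin; toℕ; zero; suc)
open import Data.Bool using (Bool; true; false)
open import Data.List using (List; length; filterᵇ; allFin)
open import Data.Product using (Σ; ∃; _×_; _,_; proj₁)
open import Data.Sum using (_⊎_)
open import Data.Fin.Permutation using (Permutation′; _⟨$⟩ʳ_)
open import Function.Bundles using (_↔_; Inverse)
open import Relation.Nullary using (¬_)
open import Relation.Binary.PropositionalEquality using (_≡_; _≢_; refl)

record Graph (n : ℕ) : Set where
  field
    adj    : Fin n → Fin n → Bool
    sym    : ∀ u v → adj u v ≡ adj v u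
    irrefl : ∀ u → adj u u ≡ false
open Graph public

data Reach {n : ℕ} (Γ : Graph n) : Fin n → Fin n → Set where
  here : ∀ {u} → Reach Γ u u
  step : ∀ {u v w} → adj Γ u v ≡ true → Reach Γ v w → Reach Γ u w

Connected : ∀ {n} → Graph n → Set
Connected Γ = ∀ u v → Reach Γ u v

NonComplete : ∀ {n} → Graph n → Set
NonComplete Γ = ∃ λ u → ∃ λ v → u ≢ v × adj Γ u v ≡ false

valency : ∀ {n} → Graph n → Fin n → ℕ
valency {n} Γ u = length (filterᵇ (adj Γ u) (allFin n))

Regular : ∀ {n} → Graph n → ℕ → Set
Regular Γ k = ∀ u → valency Γ u ≡ k

IsAut : ∀ {n} → Graph n → Permutation′ n → Set
IsAut Γ σ = ∀ u v → adj Γ (σ ⟨$⟩ʳ u) (σ ⟨$⟩ʳ v) ≡ adj Γ u v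

IsArc : ∀ {n} → Graph n → Fin n → Fin n → Set
IsArc Γ u v = adj Γ u v ≡ true

Is2Arc : ∀ {n} → Graph n → Fin n → Fin n → Fin n → Set
Is2Arc Γ u v w = adj Γ u v ≡ true × adj Γ v w ≡ true × u ≢ w

Is2Geodesic : ∀ {n} → Graph n → Fin n → Fin n → Fin n → Set
Is2Geodesic Γ u v w = Is2Arc Γ u v w × adj Γ u w ≡ false

ArcTransitive : ∀ {n} → Graph n → Set
ArcTransitive Γ = ∀ u v u' v' → IsArc Γ u v → IsArc Γ u' v' →
  ∃ λ σ → IsAut Γ σ × σ ⟨$⟩ʳ u ≡ u' × σ ⟨$⟩ʳ v ≡ v'

TripleTransitive : ∀ {n} → Graph n → (Fin n → Fin n → Fin n → Set) → Set
TripleTransitive Γ P = ∀ u v w u' v' w' → P u v w → P u' v' w' →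
  ∃ λ σ → IsAut Γ σ × σ ⟨$⟩ʳ u ≡ u' × σ ⟨$⟩ʳ v ≡ v' × σ ⟨$⟩ʳ w ≡ w'

TwoArcTransitive : ∀ {n} → Graph n → Set
TwoArcTransitive Γ = ArcTransitive Γ × TripleTransitive Γ (Is2Arc Γ)

TwoGeodesicTransitive : ∀ {n} → Graph n → Set
TwoGeodesicTransitive Γ = ArcTransitive Γ × TripleTransitive Γ (Is2Geodesic Γ)

Isomorphic : ∀ {n m} → Graph n → Graph m → Set
Isomorphic {n} {m} Γ Δ = Σ (Fin n ↔ Fin m) λ f →
  ∀ u v → adj Δ (Inverse.to f u) (Inverse.to f v) ≡ adj Γ u v

-- The icosahedron: vertex 0 (top), 1..5 upper pentagon, 6..10 lower
-- pentagon, 11 (bottom).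

icoAdjℕ : ℕ → ℕ → Bool
icoAdjℕ 0 1 = true
icoAdjℕ 0 2 = true
icoAdjℕ 0 3 = true
icoAdjℕ 0 4 = true
icoAdjℕ 0 5 = true
icoAdjℕ 1 2 = true
icoAdjℕ 2 3 = true
icoAdjℕ 3 4 = true
icoAdjℕ 4 5 = true
icoAdjℕ 1 5 = true
icoAdjℕ 6 7 = true
icoAdjℕ 7 8 = true
icoAdjℕ 8 9 = true
icoAdjℕ 9 10 = true
icoAdjℕ 6 10 = true
icoAdjℕ 1 6 = true
icoAdjℕ 1 7 = true
icoAdjℕ 2 7 = true
icoAdjℕ 2 8 = true
icoAdjℕ 3 8 = true
icoAdjℕ 3 9 = true
icoAdjℕ 4 9 = true
icoAdjℕ 4 10 = true
icoAdjℕ 5 10 = true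
icoAdjℕ 5 6 = true
icoAdjℕ 6 11 = true
icoAdjℕ 7 11 = true
icoAdjℕ 8 11 = true
icoAdjℕ 9 11 = true
icoAdjℕ 10 11 = true
icoAdjℕ _ _ = false

open import Data.Bool using (_∨_)

icoAdj : Fin 12 → Fin 12 → Bool
icoAdj u v = icoAdjℕ (toℕ u) (toℕ v) ∨ icoAdjℕ (toℕ v) (toℕ u)

icosahedron : Graph 12
icosahedron = record { adj = icoAdj ; sym = symm ; irrefl = irr }
  where
  open import Data.Fin.Properties using (all?)
  open import Data.Bool.Properties using (∨-comm)
  symm : ∀ u v → icoAdj u v ≡ icoAdj v u
  symm u v = ∨-comm (icoAdjℕ (toℕ u) (toℕ v)) (icoAdjℕ (toℕ v) (toℕ u))
  irr : ∀ u → icoAdj u u ≡ false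
  irr zero = refl
  irr (suc zero) = refl
  irr (suc (suc zero)) = refl
  irr (suc (suc (suc zero))) = refl
  irr (suc (suc (suc (suc zero)))) = refl
  irr (suc (suc (suc (suc (suc zero))))) = refl
  irr (suc (suc (suc (suc (suc (suc zero)))))) = refl
  irr (suc (suc (suc (suc (suc (suc (suc zero))))))) = refl
  irr (suc (suc (suc (suc (suc (suc (suc (suc zero)))))))) = refl
  irr (suc (suc (suc (suc (suc (suc (suc (suc (suc zero))))))))) = refl
  irr (suc (suc (suc (suc (suc (suc (suc (suc (suc (suc zero)))))))))) = refl
  irr (suc (suc (suc (suc (suc (suc (suc (suc (suc (suc (suc zero))))))))))) = refl

-- 2x2 matrices over Z_p; PSL(2,p) = SL(2,p)/{±I}, represented by
-- SL(2,p)-matrices up to sign.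

module Mat (p : ℕ) .{{_ : NonZero p}} where

  record M : Set where
    constructor mat
    field
      e11 e12 e21 e22 : Fin p
  open M public

  [_] : ℕ → Fin p
  [ x ] = x mod p

  _·_ : M → M → M
  mat a b c d · mat a' b' c' d' =
    mat [ toℕ a * toℕ a' + toℕ b * toℕ c' ] [ toℕ a * toℕ b' + toℕ b * toℕ d' ]
        [ toℕ c * toℕ a' + toℕ d * toℕ c' ] [ toℕ c * toℕ b' + toℕ d * toℕ d' ]

  neg : Fin p → Fin p
  neg x = [ p ∸ toℕ x ]

  one : M
  one = mat [ 1 ] [ 0 ] [ 0 ] [ 1 ]

  Det1 : M → Set
  Det1 (mat a b c d) = [ toℕ a * toℕ d ] ≡ [ toℕ b * toℕ c + 1 ]

  inv : M → M
  inv (mat a b c d) = mat d (neg b) (neg c) a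

  -ₘ_ : M → M
  -ₘ (mat a b c d) = mat (neg a) (neg b) (neg c) (neg d)

  _≈_ : M → M → Set
  x ≈ y = x ≡ y ⊎ x ≡ -ₘ y

  _^_ : M → ℕ → M
  x ^ ℕ.zero = one
  x ^ ℕ.suc k = x · (x ^ k)

  -- the group G = PSL(2,p): elements are SL(2,p) matrices
  G : Set
  G = Σ M Det1

  HasOrder : M → ℕ → Set
  HasOrder x m = 0 < m × (x ^ m) ≈ one × (∀ k → 0 < k → k < m → ¬ ((x ^ k) ≈ one))

  InCyc : M → M → Set
  InCyc x y = ∃ λ k → y ≈ (x ^ k)

  InNormalizer : (M → Set) → M → Set
  InNormalizer K x = ∀ y → Det1 y → (K y → K (x · (y · inv x))) × (K (x · (y · inv x)) → K y)

  data Gen (S : M → Set) : M → Set where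
    gen-one : Gen S one
    gen-el  : ∀ {x} → S x → Gen S x
    gen-inv : ∀ {x} → Gen S x → Gen S (inv x)
    gen-mul : ∀ {x y} → Gen S x → Gen S y → Gen S (x · y)
    gen-≈   : ∀ {x y} → Gen S x → y ≈ x → Gen S y

  InDouble : (M → Set) → M → M → Set
  InDouble H g x = ∃ λ h₁ → ∃ λ h₂ → H h₁ × H h₂ × x ≈ (h₁ · (g · h₂))

  -- Γ is isomorphic to Cos(G,H,HgH): an onto map φ : G → V(Γ) with
  -- φ x = φ y ⇔ Hx = Hy (⇔ x y⁻¹ ∈ H), and φ x ~ φ y ⇔ y x⁻¹ ∈ HgH.
  IsoCoset : ∀ {n} → Graph n → (M → Set) → M → Set
  IsoCoset {n} Γ H g = Σ (G → Fin n) λ φ →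
    (∀ v → ∃ λ x → φ x ≡ v) ×
    (∀ x y → (φ x ≡ φ y → H (proj₁ x · inv (proj₁ y)))
           × (H (proj₁ x · inv (proj₁ y)) → φ x ≡ φ y)) ×
    (∀ x y → (adj Γ (φ x) (φ y) ≡ true → InDouble H g (proj₁ y · inv (proj₁ x)))
           × (InDouble H g (proj₁ y · inv (proj₁ x)) → adj Γ (φ x) (φ y) ≡ true))


  CoreFree : (M → Set) → Set
  CoreFree H = ∀ x → Det1 x → (∀ y → Det1 y → H (inv y · (x · y))) → x ≈ one

  -- The data defining a member of 𝒞(p) for p > 5:
  --  a of order p, N_G(⟨a⟩) = ⟨a⟩:⟨b⟩ with b of order (p-1)/2,
  --  N_G(⟨b²⟩) = ⟨b⟩:⟨c⟩ ≅ D_{p-1} with c of order 2,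
  --  H = ⟨a⟩:⟨b²⟩, g = c b^{2i}, and G = ⟨H,g⟩, HgH = Hg⁻¹H, H core-free.
  InCosetFamily : ∀ {n} → Graph n → Set
  InCosetFamily Γ =
    Σ M λ a → Σ M λ b → Σ M λ c → Σ ℕ λ i →
      let H : M → Set
          H x = ∃ λ j → ∃ λ k → x ≈ ((a ^ j) · ((b ^ 2) ^ k))
          g = c · ((b ^ 2) ^ i)
      in Det1 a × Det1 b × Det1 c ×
         HasOrder a p ×
         HasOrder b ((p ∸ 1) / 2) ×
         (∀ x → Det1 x → (InNormalizer (InCyc a) x → ∃ λ j → ∃ λ k → x ≈ ((a ^ j) · (b ^ k)))
                        × ((∃ λ j → ∃ λ k → x ≈ ((a ^ j) · (b ^ k))) → InNormalizer (InCyc a) x)) ×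
         HasOrder c 2 ×
         (c · (b · inv c)) ≈ inv b ×
         (∀ x → Det1 x → (InNormalizer (InCyc (b ^ 2)) x → ∃ λ j → ∃ λ k → x ≈ ((b ^ j) · (c ^ k)))
                        × ((∃ λ j → ∃ λ k → x ≈ ((b ^ j) · (c ^ k))) → InNormalizer (InCyc (b ^ 2)) x)) ×
         CoreFree H ×
         (∀ x → Det1 x → Gen (λ y → H y ⊎ y ≡ g) x) ×
         (∀ x → (InDouble H g x → InDouble H (inv g) x) × (InDouble H (inv g) x → InDouble H g x)) ×
         IsoCoset Γ H g

-- Γ ∈ 𝒞(p)  (meaningful for primes p ≡ 1 mod 4)
InC : ∀ {n} (p : ℕ) → Prime p → Graph n → Set
InC p pr Γ =
  (p ≡ 5 × Isomorphic Γ icosahedron) ⊎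
  (5 < p × Mat.InCosetFamily p {{prime⇒nonZero pr}} Γ)

{-# OPTIONS --safe #-}
-- Without triangles 2-geodesics are the 2-arcs, so suppose that Γ is 2-geodesic transitive with a triangle and a 2-geodesic.
-- By Cauchy's theorem the graph induced on the p neighbours of a vertex is a Cayley graph of F = ℤ/p, and its
-- automorphisms are affine: an operator summing h (x + u) - h x over the connection set (or its complement) commutes
-- with them, hence they respect the degree of polynomial functions. Transitivity on 2-geodesics makes the set S of
-- nonneighbours of 0 a coset of a subgroup of F*, counting edges between the first and the second neighbourhood forces
-- |S| = (p - 1)/2, and so the local graph is the Paley graph and p ≡ 1 (mod 4). Counting again, every vertex at
-- distance two from u has exactly one neighbour at distance three, which is the same for all of them. Hence Γ is an
-- antipodal double cover of the complete graph on the projective line: its vertices are the nonzero vectors of F²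
-- modulo nonzero squares, with v adjacent to w when det (v, w) is a square. Conversely every linear map of square determinant
-- acts on this model, which gives transitivity on 2-geodesics. Finally the model is the coset graph of PSL(2,p) on the
-- stabiliser of a vector up to squares; in the other direction a is ± unipotent since the entries of a^j are functions
-- of j ∈ F, the normaliser of ⟨a⟩ is the stabiliser of its eigenline, and g moves this line because G = ⟨H, g⟩.
module Submission where

-- By Burnside's theorem a transitive permutation group of prime degree is affine or 2-transitive,
-- and a local graph with both edges and non-edges excludes the latter; the operator argument is an
-- elementary substitute. It works for a connection set of fewer than p/2 elements, whence the
-- choice between the neighbours and the nonneighbours of 0, and it rests on the fact that
-- differences act nilpotently on all functions F → F. Primality also drives the count. Let k = |S|,
-- and let c be the number of common neighbours of two vertices at distance two. The second
-- neighbourhood of a vertex has p k / c elements, and 0 < c < p forces c to divide k; comparison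
-- with the local graph gives p < c + 2 k, so p < 3 k, which leaves room for a single coset besides
-- S. The determinant form of the model carries a factor s, because HgH fixes adjacency only
-- relative to the square class of det (e, e g). The prime 5 stands apart because there b² is
-- trivial in PSL(2,5), so that its normaliser is the whole group.

-- Arithmetic of the prime field F = ℤ/p.

module Field where

  open import Data.Nat as ℕ using (ℕ; zero; suc; NonZero)
  import Data.Nat.Properties as ℕ
  open import Data.Nat.DivMod using (_mod_; m%n<n; m<n⇒m%n≡m; %-distribˡ-+; %-distribˡ-*; n%n≡0; m*n%n≡0)
  open import Data.Nat.Divisibility using (_∣_; m%n≡0⇒n∣m; ∣⇒≤)
  open import Data.Nat.Primality using (Prime; prime⇒nonZero; prime⇒nonTrivial)
  open import Data.Nat.Coprimality using (prime⇒coprime; coprime-Bézout)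
  open import Data.Nat.GCD using (module Bézout)
  open import Data.Integer as ℤ using (ℤ; -[1+_])
  import Data.Integer.Properties as ℤ
  open import Data.Fin as Fin using (Fin; toℕ)
  open import Data.Fin.Properties as Fin using (toℕ-fromℕ<; toℕ-injective; toℕ<n)
  open import Data.Product using (∃; _,_; proj₁; proj₂)
  open import Data.Sum as Sum using (_⊎_; inj₁; inj₂)
  open import Data.Maybe using (Maybe; just; nothing)
  open import Relation.Nullary using (Dec; yes; no; contradiction)
  open import Relation.Binary.PropositionalEquality hiding (setoid; [_])
  open import Algebra.Bundles using (CommutativeRing)

  -- The ring solver with integer coefficients, so that numerals compute even though the ring is opaque.
  module IntegerSolver {ℓ} (R : CommutativeRing ℓ ℓ) where
    open CommutativeRing R renaming (refl to ≈-refl; sym to ≈-sym; trans to ≈-trans; reflexive to ≈-reflexive)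
    open import Algebra.Solver.Ring.AlmostCommutativeRing
    open import Algebra.Properties.Semiring.Mult.TCOptimised semiring using (×-homo-+; 1+×; ×1-homo-*; _×_)
    open import Algebra.Properties.Ring ring using (-‿distribˡ-*; -‿distribʳ-*; -‿+-comm; -0#≈0#; -‿involutive)
    open import Algebra.Properties.AbelianGroup +-abelianGroup using (xyx⁻¹≈y)
    open import Relation.Binary.Reasoning.Setoid setoid

    fromℤ : ℤ → Carrier
    fromℤ (ℤ.+ n)    = n × 1#
    fromℤ -[1+ n ] = - (suc n × 1#)

    fromℤ-⊖ : ∀ m n → fromℤ (m ℤ.⊖ n) ≈ m × 1# - n × 1#
    fromℤ-⊖ m zero = begin
      fromℤ (m ℤ.⊖ 0) ≡⟨ cong fromℤ (ℤ.⊖-≥ {m} ℕ.z≤n) ⟩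
      m × 1#          ≈⟨ +-identityʳ _ ⟨
      m × 1# + 0#     ≈⟨ +-congˡ -0#≈0# ⟨
      m × 1# - 0#     ∎
    fromℤ-⊖ zero (suc n) = ≈-sym (+-identityˡ _)
    fromℤ-⊖ (suc m) (suc n) = begin
      fromℤ (suc m ℤ.⊖ suc n)                  ≡⟨ cong fromℤ (ℤ.[1+m]⊖[1+n]≡m⊖n m n) ⟩
      fromℤ (m ℤ.⊖ n)                          ≈⟨ fromℤ-⊖ m n ⟩
      m × 1# - n × 1#                          ≈⟨ xyx⁻¹≈y 1# _ ⟨
      1# + (m × 1# - n × 1#) - 1#              ≈⟨ +-congʳ (+-assoc _ _ _) ⟨
      1# + m × 1# - n × 1# - 1#                ≈⟨ +-assoc _ _ _ ⟩
      1# + m × 1# + (- (n × 1#) - 1#)          ≈⟨ +-congˡ (+-comm _ _) ⟩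
      1# + m × 1# + (- 1# - n × 1#)            ≈⟨ +-congˡ (-‿+-comm _ _) ⟩
      1# + m × 1# - (1# + n × 1#)              ≈⟨ +-cong (1+× m 1#) (-‿cong (1+× n 1#)) ⟨
      suc m × 1# - suc n × 1#                  ∎

    fromℤ-neg : ∀ i → fromℤ (ℤ.- i) ≈ - fromℤ i
    fromℤ-neg (ℤ.+ zero)  = ≈-sym -0#≈0#
    fromℤ-neg (ℤ.+ suc n) = ≈-refl
    fromℤ-neg -[1+ n ]  = ≈-sym (-‿involutive _)

    fromℤ-+ : ∀ i j → fromℤ (i ℤ.+ j) ≈ fromℤ i + fromℤ j
    fromℤ-+ (ℤ.+ m) (ℤ.+ n) = ×-homo-+ 1# m n
    fromℤ-+ (ℤ.+ m) -[1+ n ] = fromℤ-⊖ m (suc n)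
    fromℤ-+ -[1+ m ] (ℤ.+ n) = ≈-trans (fromℤ-⊖ n (suc m)) (+-comm _ _)
    fromℤ-+ -[1+ m ] -[1+ n ] = begin
      - (suc (suc (m ℕ.+ n)) × 1#)      ≡⟨ cong (λ k → - (k × 1#)) (cong suc (sym (ℕ.+-suc m n))) ⟩
      - ((suc m ℕ.+ suc n) × 1#)        ≈⟨ -‿cong (×-homo-+ 1# (suc m) (suc n)) ⟩
      - (suc m × 1# + suc n × 1#)       ≈⟨ -‿+-comm _ _ ⟨
      - (suc m × 1#) - suc n × 1#       ∎

    fromℤ-* : ∀ i j → fromℤ (i ℤ.* j) ≈ fromℤ i * fromℤ j
    fromℤ-* (ℤ.+ m) (ℤ.+ n) = ≈-trans (≈-reflexive (cong fromℤ (sym (ℤ.pos-* m n)))) (×1-homo-* m n)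
    fromℤ-* (ℤ.+ m) -[1+ n ] = begin
      fromℤ (ℤ.+ m ℤ.* -[1+ n ])        ≡⟨ cong fromℤ (trans (sym (ℤ.neg-distribʳ-* (ℤ.+ m) (ℤ.+ suc n))) (cong ℤ.-_ (sym (ℤ.pos-* m (suc n))))) ⟩
      fromℤ (ℤ.- (ℤ.+ (m ℕ.* suc n)))   ≈⟨ fromℤ-neg (ℤ.+ (m ℕ.* suc n)) ⟩
      - ((m ℕ.* suc n) × 1#)          ≈⟨ -‿cong (×1-homo-* m (suc n)) ⟩
      - (m × 1# * (suc n × 1#))       ≈⟨ -‿distribʳ-* _ _ ⟩
      m × 1# * - (suc n × 1#)         ∎
    fromℤ-* -[1+ m ] (ℤ.+ n) = begin
      fromℤ (-[1+ m ] ℤ.* ℤ.+ n)        ≡⟨ cong fromℤ (trans (sym (ℤ.neg-distribˡ-* (ℤ.+ suc m) (ℤ.+ n))) (cong ℤ.-_ (sym (ℤ.pos-* (suc m) n)))) ⟩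
      fromℤ (ℤ.- (ℤ.+ (suc m ℕ.* n)))   ≈⟨ fromℤ-neg (ℤ.+ (suc m ℕ.* n)) ⟩
      - ((suc m ℕ.* n) × 1#)          ≈⟨ -‿cong (×1-homo-* (suc m) n) ⟩
      - (suc m × 1# * (n × 1#))       ≈⟨ -‿distribˡ-* _ _ ⟩
      - (suc m × 1#) * (n × 1#)       ∎
    fromℤ-* -[1+ m ] -[1+ n ] = begin
      (suc m ℕ.* suc n) × 1#                ≈⟨ ×1-homo-* (suc m) (suc n) ⟩
      suc m × 1# * (suc n × 1#)             ≈⟨ -‿involutive _ ⟨
      - - (suc m × 1# * (suc n × 1#))       ≈⟨ -‿cong (-‿distribˡ-* _ _) ⟩
      - (- (suc m × 1#) * (suc n × 1#))     ≈⟨ -‿distribʳ-* _ _ ⟩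
      - (suc m × 1#) * - (suc n × 1#)       ∎

    morphism : ℤ.+-*-rawRing -Raw-AlmostCommutative⟶ fromCommutativeRing R
    morphism = record
      { ⟦_⟧ = fromℤ ; +-homo = fromℤ-+ ; *-homo = fromℤ-* ; -‿homo = fromℤ-neg
      ; 0-homo = ≈-refl ; 1-homo = ≈-refl }

    coefficients? : (i j : ℤ) → Maybe (fromℤ i ≈ fromℤ j)
    coefficients? i j with i ℤ.≟ j
    ... | yes i≡j = just (≈-reflexive (cong fromℤ i≡j))
    ... | no _    = nothing

    open import Algebra.Solver.Ring ℤ.+-*-rawRing (fromCommutativeRing R) morphism coefficients? public

    num : ∀ {n} → ℕ → Polynomial n
    num k = con (ℤ.+ k)

  module PrimeField (p : ℕ) (pr : Prime p) where

    instance
      p-nonZero : NonZero p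
      p-nonZero = prime⇒nonZero pr

    F : Set
    F = Fin p

    infix  8 -_
    infixl 7 _*_
    infixl 6 _+_ _-_
    infix  9 _⁻¹
    infix  4 _≟_

    -- Opaque, so that `mod` is not unfolded during conversion checking. The `-def` equations link
    -- these operations with those of `Mat`.
    opaque
      [_] : ℕ → F
      [ n ] = n mod p

      _+_ _*_ : F → F → F
      x + y = [ toℕ x ℕ.+ toℕ y ]
      x * y = [ toℕ x ℕ.* toℕ y ]

      neg : F → F
      neg x = [ p ℕ.∸ toℕ x ]

      []-def : ∀ n → [ n ] ≡ n mod p
      []-def n = refl

      +-def : ∀ x y → x + y ≡ [ toℕ x ℕ.+ toℕ y ]
      +-def x y = refl

      *-def : ∀ x y → x * y ≡ [ toℕ x ℕ.* toℕ y ]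
      *-def x y = refl

      neg-def : ∀ x → neg x ≡ [ p ℕ.∸ toℕ x ]
      neg-def x = refl

    0# 1# : F
    0# = [ 0 ]
    1# = [ 1 ]

    -_ : F → F
    - x = neg x

    _-_ : F → F → F
    x - y = x + neg y

    opaque
      unfolding [_]

      toℕ-[] : ∀ n → toℕ [ n ] ≡ n ℕ.% p
      toℕ-[] n = toℕ-fromℕ< (m%n<n n p)

      []-cong : ∀ {m n} → m ℕ.% p ≡ n ℕ.% p → [ m ] ≡ [ n ]
      []-cong {m} {n} e = toℕ-injective (trans (toℕ-[] m) (trans e (sym (toℕ-[] n))))

      []-toℕ : ∀ x → [ toℕ x ] ≡ x
      []-toℕ x = toℕ-injective (trans (toℕ-[] _) (m<n⇒m%n≡m (toℕ<n x)))

      []-+ : ∀ m n → [ m ℕ.+ n ] ≡ [ m ] + [ n ]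
      []-+ m n = []-cong (trans (%-distribˡ-+ m n p)
        (cong (ℕ._% p) (sym (cong₂ ℕ._+_ (toℕ-[] m) (toℕ-[] n)))))

      []-* : ∀ m n → [ m ℕ.* n ] ≡ [ m ] * [ n ]
      []-* m n = []-cong (trans (%-distribˡ-* m n p)
        (cong (ℕ._% p) (sym (cong₂ ℕ._*_ (toℕ-[] m) (toℕ-[] n)))))

      [p]≡0 : [ p ] ≡ 0#
      [p]≡0 = []-cong (trans (n%n≡0 p) (sym (m*n%n≡0 0 p)))

      []≡0⇒∣ : ∀ {n} → [ n ] ≡ 0# → p ∣ n
      []≡0⇒∣ {n} e = m%n≡0⇒n∣m n p (trans (sym (toℕ-[] n)) (trans (cong toℕ e) (trans (toℕ-[] 0) (m*n%n≡0 0 p))))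

      []-small : ∀ {n} → n ℕ.< p → toℕ [ n ] ≡ n
      []-small n<p = trans (toℕ-[] _) (m<n⇒m%n≡m n<p)

    private
      -- The map `[_]` from ℕ to F is onto and respects sums and products, so each ring law of F is
      -- the image of the same law in ℕ.
      via : ∀ {P : F → Set} → (∀ n → P [ n ]) → ∀ x → P x
      via {P} f x = subst P ([]-toℕ x) (f (toℕ x))

      via₂ : ∀ {P : F → F → Set} → (∀ m n → P [ m ] [ n ]) → ∀ x y → P x y
      via₂ {P} f = via {λ x → ∀ y → P x y} λ m → via (f m)

      via₃ : ∀ {P : F → F → F → Set} → (∀ k m n → P [ k ] [ m ] [ n ]) → ∀ x y z → P x y z
      via₃ {P} f = via {λ x → ∀ y z → P x y z} λ k → via₂ (f k)

      via≡ : ∀ {m n} → m ≡ n → [ m ] ≡ [ n ]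
      via≡ = cong [_]

    +-comm : ∀ x y → x + y ≡ y + x
    +-comm = via₂ λ m n → trans (sym ([]-+ m n)) (trans (via≡ (ℕ.+-comm m n)) ([]-+ n m))

    *-comm : ∀ x y → x * y ≡ y * x
    *-comm = via₂ λ m n → trans (sym ([]-* m n)) (trans (via≡ (ℕ.*-comm m n)) ([]-* n m))

    +-assoc : ∀ x y z → (x + y) + z ≡ x + (y + z)
    +-assoc = via₃ λ k m n → trans (cong (_+ [ n ]) (sym ([]-+ k m))) (trans (sym ([]-+ _ n)) (trans (via≡ (ℕ.+-assoc k m n))
      (trans ([]-+ k _) (cong ([ k ] +_) ([]-+ m n)))))

    *-assoc : ∀ x y z → (x * y) * z ≡ x * (y * z)
    *-assoc = via₃ λ k m n → trans (cong (_* [ n ]) (sym ([]-* k m))) (trans (sym ([]-* _ n)) (trans (via≡ (ℕ.*-assoc k m n))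
      (trans ([]-* k _) (cong ([ k ] *_) ([]-* m n)))))

    *-distribʳ : ∀ x y z → (y + z) * x ≡ y * x + z * x
    *-distribʳ = via₃ λ k m n → trans (cong (_* [ k ]) (sym ([]-+ m n))) (trans (sym ([]-* _ k)) (trans (via≡ (ℕ.*-distribʳ-+ k m n))
      (trans ([]-+ (m ℕ.* k) (n ℕ.* k)) (cong₂ _+_ ([]-* m k) ([]-* n k)))))

    +-identityˡ : ∀ x → 0# + x ≡ x
    +-identityˡ = via λ n → sym ([]-+ 0 n)

    *-identityˡ : ∀ x → 1# * x ≡ x
    *-identityˡ = via λ n → trans (sym ([]-* 1 n)) (via≡ (ℕ.*-identityˡ n))

    -‿inverseʳ : ∀ x → x + - x ≡ 0#
    -‿inverseʳ x = trans (cong₂ _+_ (sym ([]-toℕ x)) (neg-def x)) (trans (sym ([]-+ (toℕ x) _))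
      (trans (via≡ (ℕ.m+[n∸m]≡n (ℕ.<⇒≤ (toℕ<n x)))) [p]≡0))

    opaque
      -- Bézout for the coprime numbers p and `toℕ x`. Over ℕ the identity has two forms, according
      -- to the side that carries the 1; they give the inverse `[ b ]` or `- [ b ]`.
      *-inverse : ∀ x → x ≢ 0# → ∃ λ y → x * y ≡ 1#
      *-inverse x x≢0 = go (coprime-Bézout (prime⇒coprime pr {{ℕ.≢-nonZero x≢0′}} (toℕ<n x)))
        where
        x≢0′ : toℕ x ≢ 0
        x≢0′ e = x≢0 (trans (sym ([]-toℕ x)) (cong [_] e))
        absorb : ∀ k → [ k ℕ.* p ] ≡ 0#
        absorb k = trans ([]-* k p) (trans (cong ([ k ] *_) [p]≡0)
          (trans (sym ([]-* k 0)) (via≡ (ℕ.*-zeroʳ k))))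
        turn : ∀ b → [ b ℕ.* toℕ x ] ≡ x * [ b ]
        turn b = trans ([]-* b _) (trans (cong ([ b ] *_) ([]-toℕ x)) (*-comm _ _))
        go : Bézout.Identity 1 p (toℕ x) → ∃ λ y → x * y ≡ 1#
        go (Bézout.-+ a b eq) = [ b ] , trans (sym (turn b)) (trans (via≡ (sym eq)) (trans ([]-+ 1 (a ℕ.* p))
            (trans (cong (1# +_) (absorb a)) (trans (+-comm _ _) (+-identityˡ _)))))
        go (Bézout.+- a b eq) = - [ b ] , neg-case
          where
          1+xb≡0 : 1# + x * [ b ] ≡ 0#
          1+xb≡0 = trans (cong (1# +_) (sym (turn b))) (trans (sym ([]-+ 1 _)) (trans (via≡ eq) (absorb a)))
          zeroʳ : x * 0# ≡ 0#
          zeroʳ = trans (cong (_* 0#) (sym ([]-toℕ x))) (trans (sym ([]-* (toℕ x) 0)) (via≡ (ℕ.*-zeroʳ (toℕ x))))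
          xb+x-b≡0 : x * [ b ] + x * - [ b ] ≡ 0#
          xb+x-b≡0 = trans (cong₂ _+_ (*-comm _ _) (*-comm _ _)) (trans (sym (*-distribʳ x [ b ] (- [ b ])))
            (trans (cong (_* x) (-‿inverseʳ [ b ])) (trans (*-comm _ _) zeroʳ)))
          neg-case : x * - [ b ] ≡ 1#
          neg-case = trans (sym (+-identityˡ _)) (trans (cong (_+ x * - [ b ]) (sym 1+xb≡0)) (trans (+-assoc _ _ _)
            (trans (cong (1# +_) xb+x-b≡0) (trans (+-comm _ _) (+-identityˡ _)))))

    commutativeRing : CommutativeRing _ _
    commutativeRing = record
      { Carrier = F ; _≈_ = _≡_ ; _+_ = _+_ ; _*_ = _*_ ; -_ = neg ; 0# = 0# ; 1# = 1#
      ; isCommutativeRing = record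
        { isRing = record
          { +-isAbelianGroup = record
            { isGroup = record
              { isMonoid = record
                { isSemigroup = record
                  { isMagma = record { isEquivalence = isEquivalence ; ∙-cong = cong₂ _+_ }
                  ; assoc = +-assoc }
                ; identity = +-identityˡ , λ x → trans (+-comm x 0#) (+-identityˡ x) }
              ; inverse = (λ x → trans (+-comm (- x) x) (-‿inverseʳ x)) , -‿inverseʳ
              ; ⁻¹-cong = cong neg }
            ; comm = +-comm }
          ; *-cong = cong₂ _*_
          ; *-assoc = *-assoc
          ; *-identity = *-identityˡ , λ x → trans (*-comm x 1#) (*-identityˡ x)
          ; distrib = (λ x y z → trans (*-comm x (y + z)) (trans (*-distribʳ x y z) (cong₂ _+_ (*-comm y x) (*-comm z x))))
                    , *-distribʳ
          }
        ; *-comm = *-comm } }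

    open CommutativeRing commutativeRing public
      using (+-identityʳ; *-identityʳ; -‿inverseˡ; zeroˡ; zeroʳ; distribˡ; distribʳ; +-commutativeMonoid; *-commutativeMonoid)

    open IntegerSolver commutativeRing public using (solve; num; _:=_; _:+_; _:*_; _:-_; :-_)

    _≟_ : (x y : F) → Dec (x ≡ y)
    _≟_ = Fin._≟_

    1≢0 : 1# ≢ 0#
    1≢0 e = ℕ.<⇒≱ (ℕ.nonTrivial⇒n>1 p {{prime⇒nonTrivial pr}}) (∣⇒≤ ([]≡0⇒∣ e))

    []≢0 : ∀ {n} → 0 ℕ.< n → n ℕ.< p → [ n ] ≢ 0#
    []≢0 0<n n<p e = ℕ.<⇒≱ n<p (∣⇒≤ {{ℕ.>-nonZero 0<n}} ([]≡0⇒∣ e))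

    [suc] : ∀ n → [ suc n ] ≡ 1# + [ n ]
    [suc] n = []-+ 1 n

    opaque
      -- Made total with value 0 at 0, so that quotients can be written down before the denominator
      -- is known to be nonzero.
      _⁻¹ : F → F
      x ⁻¹ with x ≟ 0#
      ... | yes _   = 0#
      ... | no x≢0 = proj₁ (*-inverse x x≢0)

      inverseʳ : ∀ {x} → x ≢ 0# → x * x ⁻¹ ≡ 1#
      inverseʳ {x} x≢0 with x ≟ 0#
      ... | yes e   = contradiction e x≢0
      ... | no x≢0′ = proj₂ (*-inverse x x≢0′)

    inverseˡ : ∀ {x} → x ≢ 0# → x ⁻¹ * x ≡ 1#
    inverseˡ x≢0 = trans (*-comm _ _) (inverseʳ x≢0)

    *-cancelˡ : ∀ {x y z} → x ≢ 0# → x * y ≡ x * z → y ≡ z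
    *-cancelˡ {x} {y} {z} x≢0 e = begin
      y              ≡⟨ undo y ⟩
      x ⁻¹ * (x * y) ≡⟨ cong (x ⁻¹ *_) e ⟩
      x ⁻¹ * (x * z) ≡⟨ undo z ⟨
      z              ∎
      where
      open ≡-Reasoning
      undo : ∀ w → w ≡ x ⁻¹ * (x * w)
      undo w = trans (sym (*-identityˡ w)) (trans (cong (_* w) (sym (inverseˡ x≢0))) (*-assoc _ _ _))

    *-zero : ∀ {x y} → x * y ≡ 0# → x ≡ 0# ⊎ y ≡ 0#
    *-zero {x} {y} e with x ≟ 0#
    ... | yes x≡0 = inj₁ x≡0
    ... | no x≢0 = inj₂ (*-cancelˡ x≢0 (trans e (sym (zeroʳ x))))

    *-nonzero : ∀ {x y} → x ≢ 0# → y ≢ 0# → x * y ≢ 0#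
    *-nonzero x≢0 y≢0 e = Sum.[ x≢0 , y≢0 ] (*-zero e)

    ⁻¹-nonzero : ∀ {x} → x ≢ 0# → x ⁻¹ ≢ 0#
    ⁻¹-nonzero {x} x≢0 e = 1≢0 (trans (sym (inverseʳ x≢0)) (trans (cong (x *_) e) (zeroʳ x)))

    -0≡0 : - 0# ≡ 0#
    -0≡0 = trans (sym (+-identityˡ _)) (-‿inverseʳ 0#)

    x-y≡0⇒x≡y : ∀ {x y} → x - y ≡ 0# → x ≡ y
    x-y≡0⇒x≡y {x} {y} e = trans ((solve 2 (λ x y → x := (x :- y) :+ y) refl) x y) (trans (cong (_+ y) e) (+-identityˡ y))

    neg-nonzero : ∀ {x} → x ≢ 0# → - x ≢ 0#
    neg-nonzero {x} x≢0 e = x≢0 (trans ((solve 1 (λ x → x := :- :- x) refl) x) (trans (cong neg e) -0≡0))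

    infixr 10 _^_
    _^_ : F → ℕ → F
    x ^ zero  = 1#
    x ^ suc n = x * x ^ n

    ^-+ : ∀ x m n → x ^ (m ℕ.+ n) ≡ x ^ m * x ^ n
    ^-+ x zero n = sym (*-identityˡ _)
    ^-+ x (suc m) n = trans (cong (x *_) (^-+ x m n)) (sym (*-assoc x _ _))

    1^ : ∀ n → 1# ^ n ≡ 1#
    1^ zero = refl
    1^ (suc n) = trans (*-identityˡ _) (1^ n)

    ^-* : ∀ x m n → x ^ (m ℕ.* n) ≡ (x ^ n) ^ m
    ^-* x zero n = refl
    ^-* x (suc m) n = trans (^-+ x n (m ℕ.* n)) (cong (x ^ n *_) (^-* x m n))

    *-^ : ∀ x y n → (x * y) ^ n ≡ x ^ n * y ^ n
    *-^ x y zero = sym (*-identityˡ _)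
    *-^ x y (suc n) = trans (cong (x * y *_) (*-^ x y n))
      ((solve 4 (λ x y a b → x :* y :* (a :* b) := x :* a :* (y :* b)) refl) x y (x ^ n) (y ^ n))

    ^-nonzero : ∀ {x} n → x ≢ 0# → x ^ n ≢ 0#
    ^-nonzero zero x≢0 = 1≢0
    ^-nonzero (suc n) x≢0 = *-nonzero x≢0 (^-nonzero n x≢0)

-- Cardinalities of predicates.

module Sizes where

  open import Data.Nat as ℕ using (ℕ; zero; suc; _+_; _*_; _^_; _≤_; _<_; s≤s; z≤n)
  import Data.Nat.Properties as ℕ
  open import Data.Bool using (Bool; true; T)
  open import Data.Bool.Properties using (T-≡)
  open import Data.Fin as Fin using (Fin; splitAt; join; combine; remQuot)
  open import Data.Fin.Properties as Fin using (injective⇒≤)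
  open import Data.List using (List; []; _∷_; length; lookup; filterᵇ; allFin)
  open import Data.List.Relation.Unary.Any using (index)
  open import Data.List.Membership.Propositional.Properties using (∈-lookup; ∈-filter⁻; ∈-filter⁺; ∈-allFin)
  open import Data.List.Relation.Unary.Any.Properties using (lookup-index)
  open import Data.List.Relation.Unary.All as All using ()
  open import Data.List.Relation.Unary.AllPairs using (_∷_)
  open import Data.List.Relation.Unary.Unique.Propositional using (Unique)
  open import Data.List.Relation.Unary.Unique.Propositional.Properties using (filter⁺; allFin⁺)
  open import Data.Fin.Permutation as Perm using (Permutation′; permutation; _⟨$⟩ʳ_; _⟨$⟩ˡ_)
  open import Data.Product using (∃; _×_; _,_; proj₁; proj₂; uncurry)
  open import Data.Sum as Sum using (_⊎_; inj₁; inj₂)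
  open import Data.Unit using (⊤; tt)
  open import Data.Empty using (⊥; ⊥-elim)
  open import Function using (_∘_; id; Equivalence)
  open import Relation.Nullary using (Dec; yes; no; contradiction)
  open import Relation.Nullary.Decidable using (isYes; toWitness; fromWitness; T?)
  open import Relation.Binary.PropositionalEquality hiding ([_])

  private variable
    A B : Set
    P : A → Set
    Q : B → Set
    a b c n : ℕ

  -- Only the element counts: two proofs of `P x` receive the same position because `enum` is
  -- injective. So `P` may be proof-relevant, as a relation that hides a middle vertex is.
  record Size {A : Set} (P : A → Set) (k : ℕ) : Set where
    field
      enum       : Fin k → A
      injective  : ∀ {i j} → enum i ≡ enum j → i ≡ j
      sound      : ∀ i → P (enum i)
      position   : ∀ {x} → P x → Fin k
      enum-position : ∀ {x} (px : P x) → enum (position px) ≡ x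
  open Size public

  size-≤ : Size P a → Size Q b → (f : A → B) → (∀ {x} → P x → Q (f x)) →
    (∀ {x y} → P x → P y → f x ≡ f y → x ≡ y) → a ≤ b
  size-≤ S T f fPQ finj = injective⇒≤ {f = λ i → position T (fPQ (sound S i))} λ {i} {j} e →
    injective S (finj (sound S i) (sound S j)
      (trans (sym (enum-position T _)) (trans (cong (enum T) e) (enum-position T _))))

  size-≡ : ∀ {P Q : A → Set} → Size P a → Size Q b → (∀ {x} → P x → Q x) → (∀ {x} → Q x → P x) → a ≡ b
  size-≡ S T f g = ℕ.≤-antisym (size-≤ S T id f λ _ _ e → e) (size-≤ T S id g λ _ _ e → e)

  size-map : Size P a → (f : A → B) (g : ∀ {y} → Q y → A) → (∀ {x} → P x → Q (f x)) → (∀ {y} (q : Q y) → P (g q)) →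
    (∀ {x y} → P x → P y → f x ≡ f y → x ≡ y) → (∀ {y} (q : Q y) → f (g q) ≡ y) → Size Q a
  size-map S f g fPQ gQP finj fg = record
    { enum = f ∘ enum S
    ; injective = λ {i} {j} e → injective S (finj (sound S i) (sound S j) e)
    ; sound = fPQ ∘ sound S
    ; position = λ q → position S (gQP q)
    ; enum-position = λ q → trans (cong f (enum-position S (gQP q))) (fg q) }

  size-cong : ∀ {P Q : A → Set} → Size P a → (∀ {x} → P x → Q x) → (∀ {x} → Q x → P x) → Size Q a
  size-cong S f g = size-map S id (λ {y} _ → y) f g (λ _ _ e → e) (λ _ → refl)

  size-Fin : ∀ n → Size {Fin n} (λ _ → ⊤) n
  size-Fin n = record { enum = id ; injective = id ; sound = λ _ → tt ; position = λ {x} _ → x ; enum-position = λ _ → refl }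

  size-singleton : (x : A) → Size (_≡ x) 1
  size-singleton x = record
    { enum = λ _ → x ; injective = λ { {Fin.zero} {Fin.zero} _ → refl } ; sound = λ _ → refl
    ; position = λ _ → Fin.zero ; enum-position = sym }

  lookup-injective : {xs : List A} → Unique xs → ∀ i j → lookup xs i ≡ lookup xs j → i ≡ j
  lookup-injective (_ ∷ _) Fin.zero Fin.zero _ = refl
  lookup-injective (x∉ ∷ _) Fin.zero (Fin.suc j) e = contradiction e (All.lookup x∉ (∈-lookup j))
  lookup-injective (x∉ ∷ _) (Fin.suc i) Fin.zero e = contradiction (sym e) (All.lookup x∉ (∈-lookup i))
  lookup-injective (_ ∷ u) (Fin.suc i) (Fin.suc j) e = cong Fin.suc (lookup-injective u i j e)

  -- The link with `valency`, which is the length of such a filtered list.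
  size-filter : (f : Fin n → Bool) → Size (λ x → f x ≡ true) (length (filterᵇ f (allFin n)))
  size-filter {n} f = record
    { enum = lookup xs
    ; injective = lookup-injective (filter⁺ (T? ∘ f) (allFin⁺ n)) _ _
    ; sound = λ i → Equivalence.to T-≡ (proj₂ (∈-filter⁻ (T? ∘ f) {xs = allFin n} (∈-lookup i)))
    ; position = λ e → index (member e)
    ; enum-position = λ e → sym (lookup-index (member e)) }
    where
    xs = filterᵇ f (allFin n)
    member : ∀ {x} → f x ≡ true → _
    member {x} e = ∈-filter⁺ (T? ∘ f) (∈-allFin x) (Equivalence.from T-≡ e)

  size-dec : {P : Fin n → Set} → (∀ x → Dec (P x)) → ∃ (Size P)
  size-dec P? = _ , size-cong (size-filter (isYes ∘ P?))
    (λ {x} e → toWitness (Equivalence.from T-≡ e))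
    (λ {x} px → Equivalence.to T-≡ (fromWitness px))

  size-⊎ : Size P a → Size Q b → Size Sum.[ P , Q ] (a + b)
  size-⊎ {P = P} {a = a} {Q = Q} {b = b} S T = record
    { enum = item ∘ splitAt a
    ; injective = λ {i} {j} e → trans (sym (Fin.join-splitAt a b i))
        (trans (cong (join a b) (item-injective (splitAt a i) (splitAt a j) e)) (Fin.join-splitAt a b j))
    ; sound = item-sound ∘ splitAt a
    ; position = λ {x} → place x
    ; enum-position = λ {x} → item-place x }
    where
    item : Fin a ⊎ Fin b → _
    item = Sum.map (enum S) (enum T)
    item-injective : ∀ i j → item i ≡ item j → i ≡ j
    item-injective (inj₁ i) (inj₁ j) e = cong inj₁ (injective S (inj₁-inj e))
      where
      inj₁-inj : ∀ {A B : Set} {x y : A} → inj₁ {B = B} x ≡ inj₁ y → x ≡ y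
      inj₁-inj refl = refl
    item-injective (inj₂ i) (inj₂ j) e = cong inj₂ (injective T (inj₂-inj e))
      where
      inj₂-inj : ∀ {A B : Set} {x y : B} → inj₂ {A = A} x ≡ inj₂ y → x ≡ y
      inj₂-inj refl = refl
    item-sound : ∀ i → Sum.[ P , Q ] (item i)
    item-sound (inj₁ i) = sound S i
    item-sound (inj₂ i) = sound T i
    place : ∀ x → Sum.[ P , Q ] x → Fin (a + b)
    place (inj₁ x) px = position S px Fin.↑ˡ b
    place (inj₂ x) qx = a Fin.↑ʳ position T qx
    item-place : ∀ x (h : Sum.[ P , Q ] x) → item (splitAt a (place x h)) ≡ x
    item-place (inj₁ x) px = trans (cong item (Fin.splitAt-↑ˡ a (position S px) b)) (cong inj₁ (enum-position S px))
    item-place (inj₂ x) qx = trans (cong item (Fin.splitAt-↑ʳ a b (position T qx))) (cong inj₂ (enum-position T qx))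

  size-Σ : {P : A → Set} {R : A → B → Set} → Size P a → (∀ x → P x → Size (R x) b) →
    Size (λ (x , y) → P x × R x y) (a * b)
  size-Σ {a = a} {b = b} {P = P} {R} S T = record
    { enum = item ∘ remQuot b
    ; injective = λ {i} {j} e → trans (sym (Fin.combine-remQuot {a} b i))
        (trans (cong (uncurry combine) (item-injective (remQuot b i) (remQuot b j) e)) (Fin.combine-remQuot {a} b j))
    ; sound = λ k → sound S _ , sound (T _ (sound S _)) _
    ; position = λ { (px , rxy) → combine (position S px) (second px rxy) }
    ; enum-position = λ { {x , y} (px , rxy) → trans (cong item (Fin.remQuot-combine (position S px) (second px rxy)))
        (cong₂ _,_ (enum-position S px) (enum-position (T _ (sound S (position S px))) (transport px rxy))) } }
    where
    item : Fin a × Fin b → _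
    item (i , j) = enum S i , enum (T _ (sound S i)) j
    item-injective : ∀ i j → item i ≡ item j → i ≡ j
    item-injective (i , j) (k , l) e with refl ← injective S (cong proj₁ e) =
      cong (i ,_) (injective (T _ (sound S i)) (cong proj₂ e))
    transport : ∀ {x y} (px : P x) → R x y → R (enum S (position S px)) y
    transport {y = y} px = subst (λ x → R x y) (sym (enum-position S px))
    second : ∀ {x y} → P x → R x y → Fin b
    second px rxy = position (T _ (sound S (position S px))) (transport px rxy)

  -- Tagging each element with the covering set chosen for it gives an injection into the disjoint
  -- sum, even where `Q` and `R` overlap.
  size-cover : {P Q R : A → Set} → Size P a → Size Q b → Size R c → (∀ {x} → P x → Q x ⊎ R x) → a ≤ b + c
  size-cover {a = a} {P = P} {Q} {R} S T U f = injective⇒≤ {f = place} λ {i} {j} e →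
    injective S (trans (sym (untag-tag (cases i))) (trans (cong untag (trans (sym (enum-place i))
      (trans (cong (enum (size-⊎ T U)) e) (enum-place j)))) (untag-tag (cases j))))
    where
    tag : ∀ {x} → Q x ⊎ R x → _ ⊎ _
    tag {x} (inj₁ _) = inj₁ x
    tag {x} (inj₂ _) = inj₂ x
    tagged : ∀ {x} (h : Q x ⊎ R x) → Sum.[ Q , R ] (tag h)
    tagged (inj₁ q) = q
    tagged (inj₂ r) = r
    untag : ∀ {A : Set} → A ⊎ A → A
    untag = Sum.[ id , id ]
    untag-tag : ∀ {x} (h : Q x ⊎ R x) → untag (tag h) ≡ x
    untag-tag (inj₁ _) = refl
    untag-tag (inj₂ _) = refl
    cases : ∀ i → Q (enum S i) ⊎ R (enum S i)
    cases i = f (sound S i)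
    place : ∀ i → Fin _
    place i = position (size-⊎ T U) {tag (cases i)} (tagged (cases i))
    enum-place : ∀ i → enum (size-⊎ T U) (place i) ≡ tag (cases i)
    enum-place i = enum-position (size-⊎ T U) {tag (cases i)} (tagged (cases i))

  size-disjoint : {P Q R : A → Set} → Size P a → Size Q b → Size R c → (∀ {x} → Q x → P x) → (∀ {x} → R x → P x) →
    (∀ {x} → Q x → R x → ⊥) → b + c ≤ a
  size-disjoint {P = P} {Q} {R} S T U f g disjoint = size-≤ (size-⊎ T U) S Sum.[ id , id ]
    (λ { {inj₁ _} → f ; {inj₂ _} → g }) (λ {x} {y} → inj x y)
    where
    inj : ∀ x y → Sum.[ Q , R ] x → Sum.[ Q , R ] y → Sum.[ id , id ] x ≡ Sum.[ id , id ] y → x ≡ y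
    inj (inj₁ _) (inj₁ _) _ _ refl = refl
    inj (inj₁ _) (inj₂ _) q r refl = ⊥-elim (disjoint q r)
    inj (inj₂ _) (inj₁ _) r q refl = ⊥-elim (disjoint q r)
    inj (inj₂ _) (inj₂ _) _ _ refl = refl

  size-split : {P Q R : A → Set} → Size P a → Size Q b → Size R c → (∀ {x} → P x → Q x ⊎ R x) →
    (∀ {x} → Q x → P x) → (∀ {x} → R x → P x) → (∀ {x} → Q x → R x → ⊥) → a ≡ b + c
  size-split S T U cover f g disjoint = ℕ.≤-antisym (size-cover S T U cover) (size-disjoint S T U f g disjoint)

  size>0 : ∀ {x : A} → Size P a → P x → 0 < a
  size>0 {a = zero} S px with () ← position S px
  size>0 {a = suc _} S px = s≤s z≤n

  -- An element of `Q` outside `P` would give `Q` more than `a` elements. This is the tool that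
  -- turns an inclusion of equally large vertex sets into an equality.
  size-full : {P Q : A → Set} → Size P a → Size Q b → b ≤ a → (∀ {x} → P x → Q x) → ∀ {x} → Dec (P x) → Q x → P x
  size-full S T b≤a f (yes px) _ = px
  size-full {a = a} {b = b} {P = P} S T b≤a f {x} (no ¬px) qx = contradiction
    (ℕ.≤-trans (size-disjoint T S (size-singleton x) f (λ { refl → qx }) (λ { px refl → ¬px px })) b≤a)
    (ℕ.<⇒≱ (ℕ.≤-reflexive (ℕ.+-comm 1 a)))

  size-lists : ∀ N m → Size {List (Fin N)} (λ xs → length xs ≡ m) (N ^ m)
  size-lists N zero = size-cong (size-singleton []) (λ { refl → refl }) (λ { {[]} refl → refl })
  size-lists N (suc m) = size-map (size-Σ (size-Fin N) (λ _ _ → size-lists N m)) (uncurry _∷_)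
    (λ {xs} → split xs) (λ { (_ , e) → cong suc e }) (λ {xs} → split-sound xs)
    (λ { _ _ refl → refl }) (λ {xs} → join-split xs)
    where
    split : ∀ xs → length xs ≡ suc m → Fin N × List (Fin N)
    split (x ∷ xs) _ = x , xs
    split-sound : ∀ xs (e : length xs ≡ suc m) → ⊤ × length (proj₂ (split xs e)) ≡ m
    split-sound (x ∷ xs) e = tt , ℕ.suc-injective e
    join-split : ∀ xs (e : length xs ≡ suc m) → uncurry _∷_ (split xs e) ≡ xs
    join-split (x ∷ xs) e = refl

  size-sub : {P Q : A → Set} → Size P a → (∀ {x} → P x → Dec (Q x)) → ∃ (Size (λ x → P x × Q x))
  size-sub {P = P} {Q} S Q? = _ , size-map (proj₂ (size-dec (λ i → Q? (sound S i)))) (enum S)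
    (λ (px , _) → position S px) (λ {i} q → sound S i , q)
    (λ (px , qx) → subst Q (sym (enum-position S px)) qx) (λ _ _ → injective S) (λ (px , _) → enum-position S px)

  size-permute : Size P n → Permutation′ n → Size P n
  size-permute S π = record
    { enum = λ i → enum S (π ⟨$⟩ʳ i)
    ; injective = λ e → trans (sym (Perm.inverseˡ π)) (trans (cong (π ⟨$⟩ˡ_) (injective S e)) (Perm.inverseˡ π))
    ; sound = λ i → sound S (π ⟨$⟩ʳ i)
    ; position = λ px → π ⟨$⟩ˡ position S px
    ; enum-position = λ px → trans (cong (enum S) (Perm.inverseʳ π)) (enum-position S px) }

  -- The image has n elements, so by `size-full` it is everything; this supplies the inverse.
  injective-permutation : (f : Fin n → Fin n) → (∀ {i j} → f i ≡ f j → i ≡ j) → ∃ λ (π : Permutation′ n) → ∀ i → π ⟨$⟩ʳ i ≡ f i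
  injective-permutation {n} f inj = permutation f (proj₁ ∘ preimage) (λ i → sym (proj₂ (preimage i)))
    (λ i → inj (sym (proj₂ (preimage (f i))))) , λ _ → refl
    where
    image : Size (λ i → ∃ λ j → i ≡ f j) n
    image = size-map (size-Fin n) f (λ (j , _) → j) (λ {j} _ → j , refl) (λ _ → tt) (λ _ _ → inj) (λ (_ , e) → sym e)
    preimage : ∀ i → ∃ λ j → i ≡ f j
    preimage i = size-full image (size-Fin n) ℕ.≤-refl (λ _ → tt) (Fin.any? λ j → i Fin.≟ f j) tt

-- Orbits of maps of prime period.

module Orbits where

  open Sizes
  open import Data.Nat as ℕ using (ℕ; zero; suc; _+_; _*_; _∸_; _≤_; _<_; z≤n; NonZero)
  import Data.Nat.Properties as ℕ
  open import Data.Nat.DivMod using (_%_; _/_; m≡m%n+[m/n]*n; m%n<n)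
  open import Data.Nat.Divisibility using (_∣_; divides)
  open import Data.Nat.Primality using (Prime; prime⇒nonZero)
  open import Data.Nat.Coprimality using (prime⇒coprime; coprime-Bézout)
  open import Data.Nat.GCD using (module Bézout)
  open import Data.Fin as Fin using (Fin; toℕ; fromℕ<)
  open import Data.Fin.Properties as Fin using (toℕ<n; toℕ-fromℕ<; toℕ-injective; all?)
  open import Data.Product using (∃; _×_; _,_; proj₁; proj₂)
  open import Data.Unit using (⊤; tt)
  open import Data.Sum using (inj₁; inj₂; [_,_]′)
  open import Relation.Nullary using (contradiction)
  open import Relation.Binary.Definitions using (tri<; tri≈; tri>)
  open import Relation.Binary.PropositionalEquality hiding ([_])

  private variable
    A : Set

  iterate : (A → A) → ℕ → A → A
  iterate f zero x = x
  iterate f (suc n) x = f (iterate f n x)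

  module _ (f : A → A) where
    iterate-+ : ∀ m n x → iterate f (m + n) x ≡ iterate f m (iterate f n x)
    iterate-+ zero n x = refl
    iterate-+ (suc m) n x = cong f (iterate-+ m n x)

    iterate-sucʳ : ∀ n x → iterate f (suc n) x ≡ iterate f n (f x)
    iterate-sucʳ n x = trans (cong (λ k → iterate f k x) (ℕ.+-comm 1 n)) (iterate-+ n 1 x)

    iterate-* : ∀ m k {x} → iterate f m x ≡ x → iterate f (k * m) x ≡ x
    iterate-* m zero e = refl
    iterate-* m (suc k) {x} e = trans (iterate-+ m (k * m) x) (trans (cong (iterate f m) (iterate-* m k e)) e)

    iterate-% : ∀ q .{{_ : NonZero q}} {x} → iterate f q x ≡ x → ∀ n → iterate f n x ≡ iterate f (n % q) x
    iterate-% q {x} e n = trans (cong (λ k → iterate f k x) (m≡m%n+[m/n]*n n q))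
      (trans (iterate-+ (n % q) _ x) (cong (iterate f (n % q)) (iterate-* q (n / q) e)))

    module _ {q} (q-prime : Prime q) where
      -- Bézout combines the coprime periods q and d into the period 1.
      prime-period : ∀ {d x} → iterate f q x ≡ x → 0 < d → d < q → iterate f d x ≡ x → f x ≡ x
      prime-period {d} {x} eq 0<d d<q ed = go (coprime-Bézout (prime⇒coprime q-prime {{ℕ.>-nonZero 0<d}} d<q))
        where
        close : ∀ {a b} a′ b′ → iterate f a x ≡ x → iterate f b x ≡ x → 1 + b′ * b ≡ a′ * a → f x ≡ x
        close {a} {b} a′ b′ ea eb e = trans (sym (cong f (iterate-* b b′ eb)))
          (trans (cong (λ k → iterate f k x) e) (iterate-* a a′ ea))
        go : Bézout.Identity 1 q d → f x ≡ x
        go (Bézout.+- a b e) = close {q} {d} a b eq ed e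
        go (Bézout.-+ a b e) = close {d} {q} b a ed eq e

      -- There is no inverse of `f` with which to cancel the first i steps; instead q - i further
      -- steps close the cycle.
      iterate-return : ∀ {x} → iterate f q x ≡ x → ∀ i j → i ≤ q → i < j → j < q → iterate f i x ≡ iterate f j x → f x ≡ x
      iterate-return {x} eq i j i≤q i<j j<q e = prime-period {j ∸ i} eq (ℕ.m<n⇒0<n∸m i<j) (ℕ.≤-<-trans (ℕ.m∸n≤m j i) j<q)
        (begin
          iterate f (j ∸ i) x                         ≡⟨ cong (iterate f (j ∸ i)) eq ⟨
          iterate f (j ∸ i) (iterate f q x)           ≡⟨ iterate-+ (j ∸ i) q x ⟨
          iterate f (j ∸ i + q) x                     ≡⟨ cong (λ k → iterate f k x) arith ⟩
          iterate f (q ∸ i + j) x                     ≡⟨ iterate-+ (q ∸ i) j x ⟩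
          iterate f (q ∸ i) (iterate f j x)           ≡⟨ cong (iterate f (q ∸ i)) e ⟨
          iterate f (q ∸ i) (iterate f i x)           ≡⟨ iterate-+ (q ∸ i) i x ⟨
          iterate f (q ∸ i + i) x                     ≡⟨ cong (λ k → iterate f k x) (ℕ.m∸n+n≡m i≤q) ⟩
          iterate f q x                               ≡⟨ eq ⟩
          x                                           ∎)
        where
        open ≡-Reasoning
        arith : j ∸ i + q ≡ q ∸ i + j
        arith = ℕ.+-cancelʳ-≡ i _ _ (begin
          j ∸ i + q + i     ≡⟨ ℕ.+-assoc (j ∸ i) q i ⟩
          j ∸ i + (q + i)   ≡⟨ cong (j ∸ i +_) (ℕ.+-comm q i) ⟩
          j ∸ i + (i + q)   ≡⟨ ℕ.+-assoc (j ∸ i) i q ⟨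
          j ∸ i + i + q     ≡⟨ cong (_+ q) (ℕ.m∸n+n≡m (ℕ.<⇒≤ i<j)) ⟩
          j + q             ≡⟨ ℕ.+-comm j q ⟩
          q + j             ≡⟨ cong (_+ j) (ℕ.m∸n+n≡m i≤q) ⟨
          q ∸ i + i + j     ≡⟨ ℕ.+-assoc (q ∸ i) i j ⟩
          q ∸ i + (i + j)   ≡⟨ cong (q ∸ i +_) (ℕ.+-comm i j) ⟩
          q ∸ i + (j + i)   ≡⟨ ℕ.+-assoc (q ∸ i) j i ⟨
          q ∸ i + j + i     ∎)

      iterate-injective : ∀ {x} → iterate f q x ≡ x → f x ≢ x →
        ∀ {i j} → i < q → j < q → iterate f i x ≡ iterate f j x → i ≡ j
      iterate-injective eq fx≢x {i} {j} i<q j<q e with ℕ.<-cmp i j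
      ... | tri< i<j _ _ = contradiction (iterate-return eq i j (ℕ.<⇒≤ i<q) i<j j<q e) fx≢x
      ... | tri≈ _ i≡j _ = i≡j
      ... | tri> _ _ j<i = contradiction (iterate-return eq j i (ℕ.<⇒≤ j<q) j<i i<q (sym e)) fx≢x

  argmin : (f : ℕ → ℕ) (n : ℕ) → ∃ λ i → i ≤ n × (∀ j → j ≤ n → f i ≤ f j)
  argmin f zero = 0 , z≤n , λ { zero _ → ℕ.≤-refl }
  argmin f (suc n) with argmin f n
  ... | i , i≤n , min with ℕ.≤-total (f i) (f (suc n))
  ...   | inj₁ le = i , ℕ.m≤n⇒m≤1+n i≤n , λ j j≤ → [ (λ j<  → min j (ℕ.s≤s⁻¹ j<)) , (λ { refl → le }) ]′ (ℕ.m≤n⇒m<n∨m≡n j≤)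
  ...   | inj₂ ge = suc n , ℕ.≤-refl , λ j j≤ → [ (λ j< → ℕ.≤-trans ge (min j (ℕ.s≤s⁻¹ j<))) , (λ { refl → ℕ.≤-refl }) ]′ (ℕ.m≤n⇒m<n∨m≡n j≤)

  -- Every orbit has a unique member of least index, and the orbit is parametrised by the q iterates of that member.
  orbits-Fin : ∀ {M q} → Prime q → (σ : Fin M → Fin M) → (∀ x → iterate σ q x ≡ x) → (∀ x → σ x ≢ x) → q ∣ M
  orbits-Fin {M} {q} q-prime σ period free = divides k (size-≡ (size-Fin M) all-Size (λ _ → tt) (λ _ → tt))
    where
    instance
      q≢0 : NonZero q
      q≢0 = prime⇒nonZero q-prime
    Least : Fin M → Set
    Least r = ∀ (l : Fin q) → toℕ r ≤ toℕ (iterate σ (toℕ l) r)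
    leasts = size-dec {P = Least} (λ r → all? (λ l → toℕ r ℕ.≤? toℕ (iterate σ (toℕ l) r)))
    k = proj₁ leasts
    least-all : ∀ {r} → Least r → ∀ n → toℕ r ≤ toℕ (iterate σ n r)
    least-all {r} L n = subst (toℕ r ≤_) (cong toℕ (trans (cong (λ l → iterate σ l r) (toℕ-fromℕ< (m%n<n n q))) (sym (iterate-% σ q (period r) n))))
      (L (fromℕ< (m%n<n n q)))
    reverse : ∀ {x y} i → i ≤ q → iterate σ i x ≡ y → iterate σ (q ∸ i) y ≡ x
    reverse {x} i i≤q refl = trans (sym (iterate-+ σ (q ∸ i) i x)) (trans (cong (λ l → iterate σ l x) (ℕ.m∸n+n≡m i≤q)) (period x))
    find : ∀ x → ∃ λ i → i ≤ q × (∀ j → j ≤ q → toℕ (iterate σ i x) ≤ toℕ (iterate σ j x))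
    find x = argmin (λ i → toℕ (iterate σ i x)) q
    root : Fin M → Fin M
    root x = iterate σ (proj₁ (find x)) x
    root-least : ∀ x → Least (root x)
    root-least x l = subst (toℕ (root x) ≤_)
      (cong toℕ (trans (sym (iterate-% σ q (period x) (toℕ l + proj₁ (find x)))) (iterate-+ σ (toℕ l) (proj₁ (find x)) x)))
      (proj₂ (proj₂ (find x)) ((toℕ l + proj₁ (find x)) % q) (ℕ.<⇒≤ (m%n<n _ q)))
    offset : Fin M → Fin q
    offset x = fromℕ< (m%n<n (q ∸ proj₁ (find x)) q)
    from-root : ∀ x → iterate σ (toℕ (offset x)) (root x) ≡ x
    from-root x = trans (cong (λ l → iterate σ l (root x)) (toℕ-fromℕ< (m%n<n (q ∸ proj₁ (find x)) q)))
      (trans (sym (iterate-% σ q (period (root x)) _)) (reverse (proj₁ (find x)) (proj₁ (proj₂ (find x))) refl))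
    same-root : ∀ {r s} → Least r → Least s → (i j : Fin q) → iterate σ (toℕ i) r ≡ iterate σ (toℕ j) s → r ≡ s
    same-root {r} {s} R S i j e = toℕ-injective (ℕ.≤-antisym (below R S i j e) (below S R j i (sym e)))
      where
      below : ∀ {r s} → Least r → Least s → (i j : Fin q) → iterate σ (toℕ i) r ≡ iterate σ (toℕ j) s → toℕ r ≤ toℕ s
      below {r} {s} R S i j e = subst (toℕ r ≤_)
        (cong toℕ (trans (iterate-+ σ (q ∸ toℕ j) (toℕ i) r) (reverse (toℕ j) (ℕ.<⇒≤ (toℕ<n j)) (sym e))))
        (least-all R (q ∸ toℕ j + toℕ i))
    all-Size : Size {Fin M} (λ _ → ⊤) (k * q)
    all-Size = size-map (size-Σ (proj₂ leasts) (λ _ _ → size-Fin q)) (λ (r , i) → iterate σ (toℕ i) r)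
      (λ {x} _ → root x , offset x) (λ _ → tt) (λ {x} _ → root-least x , tt)
      (λ { {r , i} {s , j} (R , _) (S , _) e → pair-≡ (same-root R S i j e) e })
      (λ {x} _ → from-root x)
      where
      pair-≡ : ∀ {r s} {i j : Fin q} → r ≡ s → iterate σ (toℕ i) r ≡ iterate σ (toℕ j) s → (r , i) ≡ (s , j)
      pair-≡ {r} {i = i} {j} refl e = cong (r ,_) (toℕ-injective
        (iterate-injective σ q-prime (period r) (free r) (toℕ<n i) (toℕ<n j) e))

  -- Carries `orbits-Fin` over to a predicate along its enumeration. With q = 2 it becomes the
  -- parity argument for an involution without fixed points.
  free-orbits : ∀ {P : A → Set} {M q} → Prime q → Size P M → (ρ : A → A) → (∀ {x} → P x → P (ρ x)) →
    (∀ {x} → P x → iterate ρ q x ≡ x) → (∀ {x} → P x → ρ x ≢ x) → q ∣ M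
  free-orbits {q = q} q-prime S ρ preserve period free = orbits-Fin q-prime σ
    (λ i → injective S (trans (enum-iterate q i) (period (sound S i))))
    (λ i e → free (sound S i) (trans (sym (enum-position S _)) (cong (enum S) e)))
    where
    σ : _ → _
    σ i = position S (preserve (sound S i))
    enum-iterate : ∀ n i → enum S (iterate σ n i) ≡ iterate ρ n (enum S i)
    enum-iterate zero i = refl
    enum-iterate (suc n) i = trans (enum-position S _) (cong ρ (enum-iterate n i))

-- Cauchy's theorem and automorphisms of prime order.

module Cauchy where

  open Sizes
  open Orbits
  open import Data.Nat as ℕ using (ℕ; zero; suc; _+_; _*_; _^_)
  import Data.Nat.Properties as ℕ
  open import Data.Nat.Divisibility using (_∣_; ∣m+n∣m⇒∣n; ∣-trans; m∣m*n; ∣1⇒≡1; divides)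
  open import Data.Nat.Primality using (Prime; ¬prime[0]; ¬prime[1])
  open import Data.Bool using (Bool)
  import Data.Bool.Properties as Bool
  open import Data.Fin as Fin using (Fin; zero; suc; combine; finToFun; funToFin)
  open import Data.Fin.Properties as Fin using (all?; funToFin-finToFin; finToFun-funToFin)
  open import Data.Fin.Permutation as Perm using (Permutation′; permutation; _⟨$⟩ʳ_; _⟨$⟩ˡ_; _∘ₚ_; flip)
  open import Data.List using (List; []; _∷_; _++_; _∷ʳ_; length; replicate; foldr)
  open import Data.List.Properties using (≡-dec; ++-assoc; ++-identityʳ; length-++; length-replicate; ∷-injective)
  open import Data.Product using (Σ; ∃; _×_; _,_; proj₁; proj₂)
  open import Data.Unit using (⊤; tt)
  open import Data.Sum using (inj₁; inj₂)
  open import Function using (_∘_)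
  open import Algebra.Structures using (IsGroup)
  open import Relation.Nullary using (¬_; Dec; yes; no; contradiction)
  open import Relation.Nullary.Decidable using (_×-dec_; ¬?)
  open import Relation.Binary.PropositionalEquality hiding ([_])

  private variable
    A : Set

  rotate : List A → List A
  rotate [] = []
  rotate (x ∷ xs) = xs ∷ʳ x

  rotate-++ : (xs ys : List A) → iterate rotate (length xs) (xs ++ ys) ≡ ys ++ xs
  rotate-++ [] ys = sym (++-identityʳ ys)
  rotate-++ (x ∷ xs) ys = begin
    iterate rotate (suc (length xs)) (x ∷ xs ++ ys) ≡⟨ iterate-sucʳ rotate (length xs) _ ⟩
    iterate rotate (length xs) ((xs ++ ys) ∷ʳ x)    ≡⟨ cong (iterate rotate (length xs)) (++-assoc xs ys _) ⟩
    iterate rotate (length xs) (xs ++ (ys ∷ʳ x))    ≡⟨ rotate-++ xs (ys ∷ʳ x) ⟩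
    (ys ∷ʳ x) ++ xs                                 ≡⟨ ++-assoc ys _ xs ⟩
    ys ++ x ∷ xs                                    ∎
    where open ≡-Reasoning

  length-rotate : (xs : List A) → length (rotate xs) ≡ length xs
  length-rotate [] = refl
  length-rotate (x ∷ xs) = trans (length-++ xs) (ℕ.+-comm (length xs) 1)

  rotate-fixed : ∀ (x : A) xs → rotate (x ∷ xs) ≡ x ∷ xs → x ∷ xs ≡ replicate (suc (length xs)) x
  rotate-fixed x [] e = refl
  rotate-fixed x (y ∷ ys) e with refl ← proj₁ (∷-injective e) = cong (x ∷_) (rotate-fixed x ys (proj₂ (∷-injective e)))

  -- McKay's argument: rotation acts on the q-tuples of product ε.
  module McKay {N q : ℕ} (q-prime : Prime q) (q∣N : q ∣ N)
    {_∙_ : Fin N → Fin N → Fin N} {ε : Fin N} {_⁻¹ : Fin N → Fin N} (isGroup : IsGroup _≡_ _∙_ ε _⁻¹) where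

    open IsGroup isGroup using (assoc; identityˡ; identityʳ; inverseˡ; inverseʳ)

    product : List (Fin N) → Fin N
    product = foldr _∙_ ε

    product-++ : ∀ xs ys → product (xs ++ ys) ≡ product xs ∙ product ys
    product-++ [] ys = sym (identityˡ _)
    product-++ (x ∷ xs) ys = trans (cong (x ∙_) (product-++ xs ys)) (sym (assoc x _ _))

    inverse-unique : ∀ x y → x ∙ y ≡ ε → x ≡ y ⁻¹
    inverse-unique x y e = trans (sym (identityʳ x)) (trans (cong (x ∙_) (sym (inverseʳ y)))
      (trans (sym (assoc x y (y ⁻¹))) (trans (cong (_∙ (y ⁻¹)) e) (identityˡ _))))

    inverse-comm : ∀ x y → x ∙ y ≡ ε → y ∙ x ≡ ε
    inverse-comm x y e = trans (cong (y ∙_) (inverse-unique x y e)) (inverseʳ y)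

    Cycle : ℕ → List (Fin N) → Set
    Cycle m xs = length xs ≡ m × product xs ≡ ε

    -- All entries but the first are free, and the first must be the inverse of their product.
    size-cycles : ∀ m → Size (Cycle (suc m)) (N ^ m)
    size-cycles m = size-map (size-lists N m) (λ ys → (product ys ⁻¹) ∷ ys) (λ {xs} → rest xs)
      (λ {ys} e → cong suc e , inverseˡ (product ys)) (λ {xs} → rest-length xs)
      (λ _ _ e → proj₂ (∷-injective e)) (λ {xs} → complete xs)
      where
      rest : ∀ xs → Cycle (suc m) xs → List (Fin N)
      rest (x ∷ xs) _ = xs
      rest-length : ∀ xs c → length (rest xs c) ≡ m
      rest-length (x ∷ xs) (e , _) = ℕ.suc-injective e
      complete : ∀ xs c → (product (rest xs c) ⁻¹) ∷ rest xs c ≡ xs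
      complete (x ∷ xs) (_ , e) = cong (_∷ xs) (sym (inverse-unique x (product xs) e))

    rotate-cycle : ∀ {m xs} → Cycle m xs → Cycle m (rotate xs)
    rotate-cycle {xs = []} c = c
    rotate-cycle {xs = x ∷ xs} (l , e) = trans (length-rotate (x ∷ xs)) l ,
      trans (product-++ xs (x ∷ [])) (trans (cong (product xs ∙_) (identityʳ x)) (inverse-comm x _ e))

    rotate-period : ∀ {m} (xs : List (Fin N)) → length xs ≡ m → iterate rotate m xs ≡ xs
    rotate-period xs refl = trans (cong (iterate rotate (length xs)) (sym (++-identityʳ xs))) (rotate-++ xs [])

    product-replicate-ε : ∀ m → product (replicate m ε) ≡ ε
    product-replicate-ε zero = refl
    product-replicate-ε (suc m) = trans (identityˡ _) (product-replicate-ε m)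

    rotate-replicate : ∀ m (x : Fin N) → rotate (replicate m x) ≡ replicate m x
    rotate-replicate zero x = refl
    rotate-replicate (suc m) x = go m
      where
      go : ∀ m → replicate m x ∷ʳ x ≡ x ∷ replicate m x
      go zero = refl
      go (suc m) = cong (x ∷_) (go m)

    Order-q : Fin N → Set
    Order-q g = g ≢ ε × product (replicate q g) ≡ ε

    rotate-injective : ∀ {m} {xs ys : List (Fin N)} → length xs ≡ suc m → length ys ≡ suc m → rotate xs ≡ rotate ys → xs ≡ ys
    rotate-injective {m} {xs} {ys} lx ly e = trans (sym (rotate-period xs lx)) (trans (iterate-sucʳ rotate m xs)
      (trans (cong (iterate rotate m) e) (trans (sym (iterate-sucʳ rotate m ys)) (rotate-period ys ly))))

    order-q? : ∀ g → Dec (Order-q g)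
    order-q? g = ¬? (g Fin.≟ ε) ×-dec (product (replicate q g) Fin.≟ ε)

    fixed-cycle : ∀ xs → Cycle q xs → xs ≢ replicate q ε → rotate xs ≡ xs → ∃ Order-q
    fixed-cycle [] (l , _) xs≢ _ = contradiction (subst Prime (sym l) q-prime) ¬prime[0]
    fixed-cycle (x ∷ xs) (refl , e) xs≢ fixed = x , (λ { refl → xs≢ constant }) , trans (cong product (sym constant)) e
      where
      constant : x ∷ xs ≡ replicate q x
      constant = rotate-fixed x xs fixed

    -- Rotation fixes exactly the constant tuples. If the tuple of ε were the only fixed one, the
    -- other tuples would fall into free orbits of length q, and their number is one less than a
    -- power of `N`; then q would divide 1.
    cauchy : ∃ Order-q
    cauchy with Fin.any? order-q?
    ... | yes found = found
    ... | no none = contradiction q-prime (go q refl)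
      where
      -- Exposes q - 1 as a successor: the number `N ^ (q - 1)` of tuples is a multiple of q only
      -- because its exponent is positive.
      go : ∀ q′ → q′ ≡ q → ¬ Prime q
      go zero refl = ¬prime[0]
      go (suc zero) refl = ¬prime[1]
      go (suc (suc m)) refl _ = contradiction q-prime (subst (λ k → ¬ Prime k) (sym (∣1⇒≡1 q∣1)) ¬prime[1])
        where
        trivial = replicate q ε
        others = size-sub {Q = _≢ trivial} (size-cycles (suc m)) λ {xs} _ → ¬? (≡-dec Fin._≟_ xs trivial)
        q∣others : q ∣ proj₁ others
        q∣others = free-orbits q-prime (proj₂ others) rotate
          (λ {xs} (c , xs≢) → rotate-cycle {xs = xs} c , λ e → xs≢ (rotate-injective (proj₁ c) (length-replicate q)
            (trans e (sym (rotate-replicate q ε)))))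
          (λ {xs} (c , _) → rotate-period xs (proj₁ c))
          (λ {xs} (c , xs≢) fixed → none (fixed-cycle xs c xs≢ fixed))
        count : N ^ suc m ≡ proj₁ others + 1
        count = size-split (size-cycles (suc m)) (proj₂ others) (size-singleton trivial)
          (λ {xs} c → split xs c (≡-dec Fin._≟_ xs trivial)) proj₁
          (λ { refl → length-replicate q , product-replicate-ε q })
          (λ (_ , xs≢) → xs≢)
          where
          split : ∀ xs → Cycle q xs → Dec (xs ≡ trivial) → _
          split xs c (yes e) = inj₂ e
          split xs c (no ne) = inj₁ (c , ne)
        q∣1 : q ∣ 1
        q∣1 = ∣m+n∣m⇒∣n (subst (q ∣_) count (∣-trans q∣N (m∣m*n (N ^ m)))) q∣others

  funToFin-cong : ∀ {m n} (f g : Fin m → Fin n) → f ≗ g → funToFin f ≡ funToFin g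
  funToFin-cong {zero} f g e = refl
  funToFin-cong {suc m} f g e = cong₂ combine (e zero) (funToFin-cong (f ∘ suc) (g ∘ suc) (e ∘ suc))

  finToFun-injective : ∀ {m n} (c d : Fin (n ℕ.^ m)) → finToFun {n} {m} c ≗ finToFun d → c ≡ d
  finToFun-injective {m} {n} c d e = trans (sym (funToFin-finToFin {m} {n} c))
    (trans (funToFin-cong (finToFun {n} {m} c) (finToFun d) e) (funToFin-finToFin {m} {n} d))

  module _ {q : ℕ} (L : Fin q → Fin q → Bool) where

    Automorphism : Permutation′ q → Set
    Automorphism π = ∀ x y → L (π ⟨$⟩ʳ x) (π ⟨$⟩ʳ y) ≡ L x y

    private
      -- An automorphism is coded by numbers for its two directions. This makes the automorphisms a
      -- finite set with decidable equality, so that the group can live on `Fin N`.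
      Code : Set
      Code = Fin (q ^ q) × Fin (q ^ q)

      app : Fin (q ^ q) → Fin q → Fin q
      app = finToFun {q} {q}

      Valid : Code → Set
      Valid (c , d) = (∀ x → app c (app d x) ≡ x) × (∀ x → app d (app c x) ≡ x) × (∀ x y → L (app c x) (app c y) ≡ L x y)

      codes = size-sub {Q = Valid} (size-Σ {R = λ _ _ → ⊤} (size-Fin (q ^ q)) (λ _ _ → size-Fin (q ^ q))) λ {(c , d)} _ →
        all? (λ x → app c (app d x) Fin.≟ x) ×-dec all? (λ x → app d (app c x) Fin.≟ x) ×-dec
        all? (λ x → all? (λ y → L (app c x) (app c y) Bool.≟ L x y))

      N : ℕ
      N = proj₁ codes

      S : Size _ N
      S = proj₂ codes

      valid : ∀ i → Valid (enum S i)
      valid i = proj₂ (sound S i)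

      opaque
        perm : Fin N → Permutation′ q
        perm i = permutation (app (proj₁ (enum S i))) (app (proj₂ (enum S i))) (proj₁ (valid i)) (proj₁ (proj₂ (valid i)))

        perm-automorphism : ∀ i → Automorphism (perm i)
        perm-automorphism i = proj₂ (proj₂ (valid i))

        perm-injective : ∀ {i j} → (∀ x → perm i ⟨$⟩ʳ x ≡ perm j ⟨$⟩ʳ x) → i ≡ j
        perm-injective {i} {j} e = injective S (cong₂ _,_ (finToFun-injective {q} {q} _ _ e) (finToFun-injective {q} {q} _ _ λ x →
          trans (cong (app (proj₂ (enum S i))) (sym (trans (e _) (proj₁ (valid j) x)))) (proj₁ (proj₂ (valid i)) _)))

        code : ∀ π → Automorphism π → Σ Code λ c → (⊤ × ⊤) × Valid c
        code π aut = (funToFin to , funToFin from) , (tt , tt) ,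
          (λ x → trans (eq-to _) (trans (cong to (eq-from x)) (Perm.inverseʳ π))) ,
          (λ x → trans (eq-from _) (trans (cong from (eq-to x)) (Perm.inverseˡ π))) ,
          λ x y → trans (cong₂ L (eq-to x) (eq-to y)) (aut x y)
          where
          to from : Fin q → Fin q
          to = π ⟨$⟩ʳ_
          from = π ⟨$⟩ˡ_
          eq-to : app (funToFin to) ≗ to
          eq-to = finToFun-funToFin to
          eq-from : app (funToFin from) ≗ from
          eq-from = finToFun-funToFin from

        index : ∀ π → Automorphism π → Fin N
        index π aut = position S (proj₂ (code π aut))

        perm-index : ∀ π aut x → perm (index π aut) ⟨$⟩ʳ x ≡ π ⟨$⟩ʳ x
        perm-index π aut x = trans (cong (λ c → app (proj₁ c) x) (enum-position S (proj₂ (code π aut))))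
          (finToFun-funToFin (π ⟨$⟩ʳ_) x)

      ∘-automorphism : ∀ {π ρ} → Automorphism π → Automorphism ρ → Automorphism (π ∘ₚ ρ)
      ∘-automorphism a b x y = trans (b _ _) (a x y)

      flip-automorphism : ∀ {π} → Automorphism π → Automorphism (flip π)
      flip-automorphism {π} a x y = trans (sym (a _ _)) (cong₂ L (Perm.inverseʳ π) (Perm.inverseʳ π))

      _∙_ : Fin N → Fin N → Fin N
      i ∙ j = index (perm j ∘ₚ perm i) (∘-automorphism {perm j} {perm i} (perm-automorphism j) (perm-automorphism i))

      ε : Fin N
      ε = index Perm.id (λ _ _ → refl)

      _⁻¹ : Fin N → Fin N
      i ⁻¹ = index (flip (perm i)) (flip-automorphism {perm i} (perm-automorphism i))

      act : Fin N → Fin q → Fin q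
      act i x = perm i ⟨$⟩ʳ x

      act-∙ : ∀ i j x → act (i ∙ j) x ≡ act i (act j x)
      act-∙ i j x = perm-index _ _ x

      act-ε : ∀ x → act ε x ≡ x
      act-ε x = perm-index _ _ x

      act-⁻¹ : ∀ i x → act (i ⁻¹) x ≡ perm i ⟨$⟩ˡ x
      act-⁻¹ i x = perm-index _ _ x

      isGroup : IsGroup _≡_ _∙_ ε _⁻¹
      isGroup = record
        { isMonoid = record
          { isSemigroup = record
            { isMagma = record { isEquivalence = isEquivalence ; ∙-cong = cong₂ _∙_ }
            ; assoc = λ i j k → perm-injective λ x → trans (act-∙ (i ∙ j) k x) (trans (act-∙ i j (act k x))
                (sym (trans (act-∙ i (j ∙ k) x) (cong (act i) (act-∙ j k x))))) }
          ; identity = (λ i → perm-injective λ x → trans (act-∙ ε i x) (act-ε _))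
                     , (λ i → perm-injective λ x → trans (act-∙ i ε x) (cong (act i) (act-ε x))) }
        ; inverse = (λ i → perm-injective λ x → trans (act-∙ (i ⁻¹) i x) (trans (act-⁻¹ i _) (trans (Perm.inverseˡ (perm i)) (sym (act-ε x)))))
                  , (λ i → perm-injective λ x → trans (act-∙ i (i ⁻¹) x) (trans (cong (act i) (act-⁻¹ i x)) (trans (Perm.inverseʳ (perm i)) (sym (act-ε x)))))
        ; ⁻¹-cong = cong _⁻¹ }

    module _ (q-prime : Prime q) (transitive : ∀ x y → ∃ λ π → Automorphism π × π ⟨$⟩ʳ x ≡ y) where

      private
        mover : Fin q → Fin q → Fin N
        mover x y = index (proj₁ (transitive x y)) (proj₁ (proj₂ (transitive x y)))

        act-mover : ∀ x y → act (mover x y) x ≡ y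
        act-mover x y = trans (perm-index _ _ x) (proj₂ (proj₂ (transitive x y)))

        -- Orbit and stabiliser: every automorphism is uniquely `g y ∙ i` with `i` fixing `x₀`.
        q∣N : Fin q → q ∣ N
        q∣N x₀ = divides (proj₁ stabiliser) (trans (size-≡ (size-Fin N) decomposition (λ _ → tt) (λ _ → tt)) (ℕ.*-comm q _))
          where
          stabiliser = size-dec {P = λ i → act i x₀ ≡ x₀} (λ i → act i x₀ Fin.≟ x₀)
          open IsGroup isGroup using (assoc; identityˡ; inverseˡ; inverseʳ)
          cancel : ∀ g i → (g ⁻¹) ∙ (g ∙ i) ≡ i
          cancel g i = trans (sym (assoc _ _ _)) (trans (cong (_∙ i) (inverseˡ g)) (identityˡ i))
          cancel′ : ∀ g i → g ∙ ((g ⁻¹) ∙ i) ≡ i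
          cancel′ g i = trans (sym (assoc _ _ _)) (trans (cong (_∙ i) (inverseʳ g)) (identityˡ i))
          g : Fin q → Fin N
          g y = mover x₀ y
          image : ∀ {y i} → act i x₀ ≡ x₀ → act (g y ∙ i) x₀ ≡ y
          image {y} {i} e = trans (act-∙ (g y) i x₀) (trans (cong (act (g y)) e) (act-mover x₀ y))
          decomposition : Size {Fin N} (λ _ → ⊤) (q * proj₁ stabiliser)
          decomposition = size-map (size-Σ (size-Fin q) (λ _ _ → proj₂ stabiliser)) (λ (y , i) → g y ∙ i)
            (λ {i} _ → act i x₀ , (g (act i x₀) ⁻¹) ∙ i) (λ _ → tt)
            (λ {i} _ → tt , trans (act-∙ _ i x₀) (trans (act-⁻¹ (g (act i x₀)) _)
              (trans (cong (perm (g (act i x₀)) ⟨$⟩ˡ_) (sym (act-mover x₀ (act i x₀)))) (Perm.inverseˡ (perm (g (act i x₀)))))))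
            (λ { {y , i} {z , j} (_ , si) (_ , sj) e → pair y i z j (trans (sym (image si)) (trans (cong (λ k → act k x₀) e) (image sj))) e })
            (λ {i} _ → cancel′ (g (act i x₀)) i)
            where
            pair : ∀ y i z j → y ≡ z → g y ∙ i ≡ g z ∙ j → (y , i) ≡ (z , j)
            pair y i .y j refl e = cong (y ,_) (trans (sym (cancel (g y) i)) (trans (cong ((g y ⁻¹) ∙_) e) (cancel (g y) j)))

      automorphism-of-prime-order : Fin q → ∃ λ π → Automorphism π × (∀ x → iterate (π ⟨$⟩ʳ_) q x ≡ x) × ∃ λ x → π ⟨$⟩ʳ x ≢ x
      automorphism-of-prime-order x₀ = perm g , perm-automorphism g , period , moved
        where
        module M = McKay q-prime (q∣N x₀) isGroup
        g = proj₁ M.cauchy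
        act-product : ∀ m x → act (M.product (replicate m g)) x ≡ iterate (act g) m x
        act-product zero x = act-ε x
        act-product (suc m) x = trans (act-∙ g _ x) (cong (act g) (act-product m x))
        period : ∀ x → iterate (act g) q x ≡ x
        period x = trans (sym (act-product q x)) (trans (cong (λ i → act i x) (proj₂ (proj₂ M.cauchy))) (act-ε x))
        moved : ∃ λ x → act g x ≢ x
        moved = Fin.¬∀⟶∃¬ q _ (λ x → act g x Fin.≟ x) λ fixed → proj₁ (proj₂ M.cauchy) (perm-injective λ x → trans (fixed x) (sym (act-ε x)))

-- Finite differences and polynomial functions over F.

module Differences where

  open Field
  open import Data.Nat as ℕ using (ℕ; zero; suc; _≤_; _<_; z≤n; s≤s)
  import Data.Nat.Properties as ℕ
  open import Data.Nat.Primality using (Prime)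
  open import Data.Fin as Fin using (Fin; toℕ; fromℕ<)
  open import Data.Fin.Properties as Fin using (toℕ<n; toℕ-fromℕ<)
  open import Data.List using (List; []; _∷_; map)
  open import Data.Product using (∃; _×_; _,_; proj₁; proj₂)
  open import Data.Sum using (_⊎_; inj₁; inj₂)
  open import Function using (_∘_; id)
  open import Relation.Nullary using (yes; no; contradiction)
  open import Relation.Binary.PropositionalEquality hiding ([_])

  module FiniteDifferences (p : ℕ) (pr : Prime p) where
    open PrimeField p pr
    open import Algebra.Properties.CommutativeMonoid.Sum +-commutativeMonoid using (sum; sum-cong-≗; ∑-distrib-+; sum-permute) public

    Fun : Set
    Fun = F → F

    Δ : Fun → Fun
    Δ f x = f (x + 1#) - f x

    Δ^ : ℕ → Fun → Fun
    Δ^ zero f = f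
    Δ^ (suc n) f = Δ^ n (Δ f)

    Δ-cong : ∀ {f g} → f ≗ g → Δ f ≗ Δ g
    Δ-cong e x = cong₂ _-_ (e _) (e x)

    Δ^-cong : ∀ n {f g} → f ≗ g → Δ^ n f ≗ Δ^ n g
    Δ^-cong zero e = e
    Δ^-cong (suc n) e = Δ^-cong n (Δ-cong e)

    Δ^-sucˡ : ∀ n f → Δ^ (suc n) f ≗ Δ (Δ^ n f)
    Δ^-sucˡ zero f x = refl
    Δ^-sucˡ (suc n) f = Δ^-sucˡ n (Δ f)

    Zero : Fun → Set
    Zero f = ∀ x → f x ≡ 0#

    Δ-zero : ∀ {f} → Zero f → Zero (Δ f)
    Δ-zero z x = trans (cong₂ _-_ (z _) (z x)) (-‿inverseʳ 0#)

    Δ^-zero : ∀ n {f} → Zero f → Zero (Δ^ n f)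
    Δ^-zero zero z = z
    Δ^-zero (suc n) z = Δ^-zero n (Δ-zero z)

    -- For n ≤ p these are the polynomial functions of degree less than n.
    Kills : ℕ → Fun → Set
    Kills n f = Zero (Δ^ n f)

    Kills-≤ : ∀ {m n f} → m ≤ n → Kills m f → Kills n f
    Kills-≤ {n = n} z≤n k = Δ^-zero n k
    Kills-≤ (s≤s m≤n) k = Kills-≤ m≤n k

    Kills-+ : ∀ n {f g} → Kills n f → Kills n g → Kills n (λ x → f x + g x)
    Kills-+ zero a b x = trans (cong₂ _+_ (a x) (b x)) (+-identityˡ _)
    Kills-+ (suc n) {f} {g} a b x = trans
      (Δ^-cong n (λ y → (solve 4 (λ a b c d → a :+ b :- (c :+ d) := a :- c :+ (b :- d)) refl) (f (y + 1#)) (g (y + 1#)) (f y) (g y)) x)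
      (Kills-+ n a b x)

    -- Lead d c f: f is a polynomial function of degree at most d with c as coefficient of x^d.
    Lead : ℕ → F → Fun → Set
    Lead zero c f = ∀ x → f x ≡ c
    Lead (suc d) c f = Lead d ([ suc d ] * c) (Δ f)

    Lead-cong : ∀ d {c f g} → f ≗ g → Lead d c f → Lead d c g
    Lead-cong zero e l x = trans (sym (e x)) (l x)
    Lead-cong (suc d) e l = Lead-cong d (Δ-cong e) l

    Lead-coefficient : ∀ d {c c′ f} → c ≡ c′ → Lead d c f → Lead d c′ f
    Lead-coefficient d {f = f} e = subst (λ c → Lead d c f) e

    Lead-+ : ∀ d {a b f g} → Lead d a f → Lead d b g → Lead d (a + b) (λ x → f x + g x)
    Lead-+ zero l m x = cong₂ _+_ (l x) (m x)
    Lead-+ (suc d) {a} {b} {f} {g} l m = Lead-cong d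
      (λ y → (solve 4 (λ a b c d → a :- c :+ (b :- d) := a :+ b :- (c :+ d)) refl) (f (y + 1#)) (g (y + 1#)) (f y) (g y))
      (Lead-coefficient d (sym (distribˡ _ _ _)) (Lead-+ d l m))

    Lead-raise : ∀ d {c f} → Lead d c f → Lead (suc d) 0# f
    Lead-raise zero l x = trans (cong₂ _-_ (l _) (l x)) (trans (-‿inverseʳ _) (sym (zeroʳ _)))
    Lead-raise (suc d) l = Lead-coefficient (suc d) (sym (zeroʳ _)) (Lead-raise d l)

    Lead-constant : ∀ d c → 0 < d → Lead d 0# (λ _ → c)
    Lead-constant (suc zero) c _ = Lead-raise 0 λ _ → refl
    Lead-constant (suc (suc d)) c _ = Lead-raise (suc d) (Lead-constant (suc d) c (s≤s z≤n))

    Lead-shift : ∀ d {c f} → Lead d c f → Lead d c (λ x → f (x + 1#))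
    Lead-shift zero l x = l _
    Lead-shift (suc d) l = Lead-shift d l

    Lead-scale : ∀ d a {b g} → Lead d b g → Lead d (a * b) (λ x → a * g x)
    Lead-scale zero a l x = cong (a *_) (l x)
    Lead-scale (suc d) a {b} {g} l = Lead-cong d
      (λ y → (solve 3 (λ a u v → a :* (u :- v) := a :* u :- a :* v) refl) a (g (y + 1#)) (g y))
      (Lead-coefficient d ((solve 3 (λ a b n → a :* (n :* b) := n :* (a :* b)) refl) a b [ suc d ]) (Lead-scale d a l))

    Lead-* : ∀ d e {a b f g} → Lead d a f → Lead e b g → Lead (d ℕ.+ e) (a * b) (λ x → f x * g x)
    Lead-* zero e {a} {g = g} l m = Lead-cong e (λ x → cong (_* g x) (sym (l x))) (Lead-scale e a m)
    Lead-* (suc d) zero {a} {b} {f} l m = Lead-cong (suc d ℕ.+ 0)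
      (λ x → trans (*-comm b (f x)) (cong (f x *_) (sym (m x))))
      (subst (λ k → Lead k (a * b) (λ x → b * f x)) (sym (ℕ.+-identityʳ (suc d)))
        (Lead-coefficient (suc d) (*-comm b a) (Lead-scale (suc d) b l)))
    Lead-* (suc d) (suc e) {a} {b} {f} {g} l m = Lead-cong (d ℕ.+ suc e)
      (λ x → (solve 4 (λ f f′ g g′ → (f′ :- f) :* g′ :+ f :* (g′ :- g) := f′ :* g′ :- f :* g) refl) (f x) (f (x + 1#)) (g x) (g (x + 1#)))
      (Lead-coefficient (d ℕ.+ suc e) coefficient
        (Lead-+ (d ℕ.+ suc e) (Lead-* d (suc e) l (Lead-shift (suc e) m))
          (subst (λ k → Lead k (a * ([ suc e ] * b)) (λ x → f x * Δ g x)) (sym (ℕ.+-suc d e)) (Lead-* (suc d) e l m))))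
      where
      coefficient : [ suc d ] * a * b + a * ([ suc e ] * b) ≡ [ suc (d ℕ.+ suc e) ] * (a * b)
      coefficient = trans ((solve 4 (λ a b m n → m :* a :* b :+ a :* (n :* b) := (m :+ n) :* (a :* b)) refl) a b [ suc d ] [ suc e ])
        (cong (_* (a * b)) (sym ([]-+ (suc d) (suc e))))

    Lead-id : Lead 1 1# id
    Lead-id x = (solve 1 (λ x → x :+ (num 1) :- x := (num 1) :* (num 1)) refl) x

    Lead-^ : ∀ n {d c f} → Lead d c f → Lead (n ℕ.* d) (c ^ n) (λ x → f x ^ n)
    Lead-^ zero l x = refl
    Lead-^ (suc n) {d} l = Lead-* d (n ℕ.* d) l (Lead-^ n l)

    Lead-power : ∀ n → Lead n 1# (_^ n)
    Lead-power n = subst (λ k → Lead k 1# (_^ n)) (ℕ.*-identityʳ n)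
      (Lead-coefficient (n ℕ.* 1) (1^ n) (Lead-^ n Lead-id))

    Lead⇒Kills : ∀ d {c f} → Lead d c f → Kills (suc d) f
    Lead⇒Kills zero l x = trans (cong₂ _-_ (l _) (l x)) (-‿inverseʳ _)
    Lead⇒Kills (suc d) l = Lead⇒Kills d l

    -- Each difference multiplies the leading coefficient by the current degree, and degrees below p
    -- are invertible in F.
    Lead-Kills : ∀ {m d c f} → Lead d c f → Kills m f → m ≤ d → d < p → c ≡ 0#
    Lead-Kills {zero} {zero} l k _ _ = trans (sym (l 0#)) (k 0#)
    Lead-Kills {zero} {suc d} l k _ d<p with *-zero (Lead-Kills {0} {d} l (Δ-zero k) z≤n (ℕ.<-trans (ℕ.n<1+n d) d<p))
    ... | inj₁ e = contradiction e ([]≢0 (s≤s z≤n) d<p)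
    ... | inj₂ e = e
    Lead-Kills {suc m} {suc d} l k (s≤s m≤d) d<p with *-zero (Lead-Kills {m} {d} l k m≤d (ℕ.<-trans (ℕ.n<1+n d) d<p))
    ... | inj₁ e = contradiction e ([]≢0 (s≤s z≤n) d<p)
    ... | inj₂ e = e

    Δ-zero⇒constant : ∀ {f} → Zero (Δ f) → ∀ x → f x ≡ f 0#
    Δ-zero⇒constant {f} z x = trans (cong f (sym ([]-toℕ x))) (go (toℕ x))
      where
      go : ∀ k → f [ k ] ≡ f 0#
      go zero = refl
      go (suc k) = trans (cong f (trans ([suc] k) (+-comm 1# [ k ]))) (trans (x-y≡0⇒x≡y (z [ k ])) (go k))

    -- Integration recovers degree and coefficient: the leading coefficient of the difference is
    -- divided by `suc d`, and a function whose difference vanishes is constant.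
    leading : ∀ m {f} → m ≤ p → Kills m f → Zero f ⊎ (∃ λ d → ∃ λ c → d < m × c ≢ 0# × Lead d c f)
    leading zero _ k = inj₁ k
    leading (suc m) {f} m<p k with leading m (ℕ.<⇒≤ m<p) k
    ... | inj₂ (d , c , d<m , c≢0 , l) = inj₂ (suc d , c * [ suc d ] ⁻¹ , s≤s d<m , *-nonzero c≢0 (⁻¹-nonzero n≢0) ,
        Lead-coefficient d (sym (trans ((solve 3 (λ n c i → n :* (c :* i) := (n :* i) :* c) refl) [ suc d ] c ([ suc d ] ⁻¹))
          (trans (cong (_* c) (inverseʳ n≢0)) (*-identityˡ c)))) l)
      where
      n≢0 : [ suc d ] ≢ 0#
      n≢0 = []≢0 (s≤s z≤n) (ℕ.≤-<-trans d<m m<p)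
    ... | inj₁ z with f 0# ≟ 0#
    ...   | yes e = inj₁ λ x → trans (Δ-zero⇒constant z x) e
    ...   | no ne = inj₂ (0 , f 0# , s≤s z≤n , ne , Δ-zero⇒constant z)

    roots : ∀ {n} → (Fin n → F) → Fun
    roots {zero} e x = 1#
    roots {suc n} e x = (x - e Fin.zero) * roots (e ∘ Fin.suc) x

    Lead-linear : ∀ a → Lead 1 1# (λ x → x - a)
    Lead-linear a x = (solve 2 (λ x a → x :+ (num 1) :- a :- (x :- a) := (num 1) :* (num 1)) refl) x a

    Lead-roots : ∀ {n} (e : Fin n → F) → Lead n 1# (roots e)
    Lead-roots {zero} e x = refl
    Lead-roots {suc n} e = Lead-coefficient (suc n) (*-identityˡ _) (Lead-* 1 n (Lead-linear (e Fin.zero)) (Lead-roots (e ∘ Fin.suc)))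

    roots-zero : ∀ {n} (e : Fin n → F) i → roots e (e i) ≡ 0#
    roots-zero e Fin.zero = trans (cong (_* roots (e ∘ Fin.suc) (e Fin.zero)) (-‿inverseʳ _)) (zeroˡ _)
    roots-zero e (Fin.suc i) = trans (cong ((e (Fin.suc i) - e Fin.zero) *_) (roots-zero (e ∘ Fin.suc) i)) (zeroʳ _)

    roots-nonzero : ∀ {n} (e : Fin n → F) x → (∀ i → x ≢ e i) → roots e x ≢ 0#
    roots-nonzero {zero} e x ne = 1≢0
    roots-nonzero {suc n} e x ne = *-nonzero (ne Fin.zero ∘ x-y≡0⇒x≡y) (roots-nonzero (e ∘ Fin.suc) x (ne ∘ Fin.suc))

    sum-zero : ∀ {n} (f : Fin n → F) → (∀ i → f i ≡ 0#) → sum f ≡ 0#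
    sum-zero {zero} f z = refl
    sum-zero {suc n} f z = trans (cong₂ _+_ (z Fin.zero) (sum-zero (f ∘ Fin.suc) (z ∘ Fin.suc))) (+-identityˡ _)

    sum-single : ∀ {n} (f : Fin n → F) i → (∀ j → j ≢ i → f j ≡ 0#) → sum f ≡ f i
    sum-single f Fin.zero z = trans (cong (f Fin.zero +_) (sum-zero (f ∘ Fin.suc) λ j → z (Fin.suc j) λ ())) (+-identityʳ _)
    sum-single f (Fin.suc i) z = trans (cong₂ _+_ (z Fin.zero λ ())
      (sum-single (f ∘ Fin.suc) i λ j ne → z (Fin.suc j) (ne ∘ Fin.suc-injective))) (+-identityˡ _)

    Kills-sum : ∀ {n} m (f : Fin n → Fun) → (∀ i → Kills m (f i)) → Kills m (λ x → sum (λ i → f i x))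
    Kills-sum {zero} m f k = Δ^-zero m λ _ → refl
    Kills-sum {suc n} m f k = Kills-+ m (k Fin.zero) (Kills-sum m (f ∘ Fin.suc) (k ∘ Fin.suc))

    Kills-cong : ∀ m {f g} → f ≗ g → Kills m f → Kills m g
    Kills-cong m e k x = trans (sym (Δ^-cong m e x)) (k x)

    p≡1+[p-1] : suc (p ℕ.∸ 1) ≡ p
    p≡1+[p-1] = ℕ.suc-pred p

    -- Lagrange interpolation.
    Kills-p : ∀ f → Kills p f
    Kills-p f = Kills-cong p {λ x → sum (λ a → term a x)} (λ x → trans (sum-single _ x (λ a a≢x → other a x a≢x)) (self x))
      (Kills-sum p term λ a → subst (λ k → Kills k (term a)) p≡1+[p-1]
        (Lead⇒Kills (p ℕ.∸ 1) (Lead-scale (p ℕ.∸ 1) _ (Lead-roots (others a)))))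
      where
      -- The points a + 1, ..., a + (p - 1), that is, all of F except a.
      others : F → Fin (p ℕ.∸ 1) → F
      others a i = a + [ suc (toℕ i) ]
      bound : ∀ (i : Fin (p ℕ.∸ 1)) → suc (toℕ i) < p
      bound i = subst (suc (toℕ i) <_) p≡1+[p-1] (s≤s (toℕ<n i))
      others-≢ : ∀ a i → a ≢ others a i
      others-≢ a i e = []≢0 (s≤s z≤n) (bound i)
        (trans ((solve 2 (λ a s → s := a :+ s :- a) refl) a [ suc (toℕ i) ]) (trans (cong (_- a) (sym e)) (-‿inverseʳ a)))
      term : F → Fun
      term a x = f a * roots (others a) a ⁻¹ * roots (others a) x
      self : ∀ x → term x x ≡ f x
      self x = trans (*-assoc (f x) _ _) (trans (cong (f x *_) (inverseˡ (roots-nonzero (others x) x (others-≢ x)))) (*-identityʳ _))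
      other : ∀ a x → a ≢ x → term a x ≡ 0#
      other a x a≢x = trans (cong (f a * roots (others a) a ⁻¹ *_) (find (toℕ (x - a)) refl)) (zeroʳ _)
        where
        find : ∀ k → k ≡ toℕ (x - a) → roots (others a) x ≡ 0#
        find zero e = contradiction (sym (x-y≡0⇒x≡y (trans (sym ([]-toℕ _)) (cong [_] (sym e))))) a≢x
        find (suc k) e = trans (cong (roots (others a)) x≡) (roots-zero (others a) i)
          where
          k<p-1 : k < p ℕ.∸ 1
          k<p-1 = ℕ.s≤s⁻¹ (subst (suc k <_) (sym p≡1+[p-1]) (subst (_< p) (sym e) (toℕ<n (x - a))))
          i = fromℕ< k<p-1
          x≡ : x ≡ others a i
          x≡ = trans ((solve 2 (λ x a → x := a :+ (x :- a)) refl) x a) (cong (a +_) (trans (sym ([]-toℕ _)) (cong [_] (trans (sym e) (cong suc (sym (toℕ-fromℕ< k<p-1)))))))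

    -- The list c₀, c₁, c₂, ... stands for the operator c₀ + c₁ Δ + c₂ Δ² + ....
    op : List F → Fun → Fun
    op [] h x = 0#
    op (c ∷ cs) h x = c * h x + op cs (Δ h) x

    op-zero : ∀ cs {h} → Zero h → Zero (op cs h)
    op-zero [] z x = refl
    op-zero (c ∷ cs) z x = trans (cong₂ _+_ (trans (cong (c *_) (z x)) (zeroʳ c)) (op-zero cs (Δ-zero z) x)) (+-identityˡ _)

    op-Δ : ∀ cs h → Δ (op cs h) ≗ op cs (Δ h)
    op-Δ [] h x = -‿inverseʳ 0#
    op-Δ (c ∷ cs) h x = trans
      ((solve 5 (λ c u v s t → c :* u :+ s :- (c :* v :+ t) := c :* (u :- v) :+ (s :- t)) refl) c (h (x + 1#)) (h x) (op cs (Δ h) (x + 1#)) (op cs (Δ h) x))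
      (cong (c * Δ h x +_) (op-Δ cs (Δ h) x))

    op-Δ^ : ∀ n cs h → Δ^ n (op cs h) ≗ op cs (Δ^ n h)
    op-Δ^ zero cs h x = refl
    op-Δ^ (suc n) cs h x = trans (Δ^-cong n (op-Δ cs h) x) (op-Δ^ n cs (Δ h) x)

    -- Δ is nilpotent by `Kills-p`, so a nonzero constant term makes the operator invertible.
    -- Concretely, once Δ^(j+1) h vanishes the operator acts on Δ^j h as multiplication by B, and j
    -- can be lowered.
    op-injective : ∀ {B cs h} → B ≢ 0# → Zero (op (B ∷ cs) h) → Zero h
    op-injective {B} {cs} {h} B≢0 z = down p (Kills-p h)
      where
      down : ∀ j → Kills j h → Zero h
      down zero k = k
      down (suc j) k = down j λ x → *-cancelˡ B≢0 (begin
        B * Δ^ j h x                            ≡⟨ +-identityʳ _ ⟨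
        B * Δ^ j h x + 0#                       ≡⟨ cong (B * Δ^ j h x +_) (op-zero cs (λ y → trans (sym (Δ^-sucˡ j h y)) (k y)) x) ⟨
        op (B ∷ cs) (Δ^ j h) x                  ≡⟨ op-Δ^ j (B ∷ cs) h x ⟨
        Δ^ j (op (B ∷ cs) h) x                  ≡⟨ Δ^-zero j z x ⟩
        0#                                      ≡⟨ zeroʳ B ⟨
        B * 0#                                  ∎)
        where open ≡-Reasoning

    -- Splits off the highest power of Δ that divides the operator; what remains is a unit by
    -- `op-injective`.
    op-order : ∀ cs → (∀ h → Zero (op cs h)) ⊎ (∃ λ m → ∃ λ B → ∃ λ ds → B ≢ 0# × (∀ h → op cs h ≗ op (B ∷ ds) (Δ^ m h)))
    op-order [] = inj₁ λ _ _ → refl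
    op-order (c ∷ cs) with c ≟ 0#
    ... | no c≢0 = inj₂ (0 , c , cs , c≢0 , λ _ _ → refl)
    ... | yes refl with op-order cs
    ...   | inj₁ z = inj₁ λ h x → trans (cong₂ _+_ (zeroˡ _) (z (Δ h) x)) (+-identityˡ _)
    ...   | inj₂ (m , B , ds , B≢0 , e) = inj₂ (suc m , B , ds , B≢0 ,
        λ h x → trans (cong (_+ op cs (Δ h) x) (zeroˡ _)) (trans (+-identityˡ _) (e (Δ h) x)))

    IsOp : (Fun → Fun) → Set
    IsOp T = ∃ λ cs → ∀ h x → T h x ≡ op cs h x

    infixl 6 _⊞_
    _⊞_ : List F → List F → List F
    [] ⊞ ds = ds
    (c ∷ cs) ⊞ [] = c ∷ cs
    (c ∷ cs) ⊞ (d ∷ ds) = (c + d) ∷ (cs ⊞ ds)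

    op-⊞ : ∀ cs ds h x → op cs h x + op ds h x ≡ op (cs ⊞ ds) h x
    op-⊞ [] ds h x = +-identityˡ _
    op-⊞ (c ∷ cs) [] h x = +-identityʳ _
    op-⊞ (c ∷ cs) (d ∷ ds) h x = trans
      ((solve 5 (λ c d u s t → c :* u :+ s :+ (d :* u :+ t) := (c :+ d) :* u :+ (s :+ t)) refl) c d (h x) (op cs (Δ h) x) (op ds (Δ h) x))
      (cong ((c + d) * h x +_) (op-⊞ cs ds (Δ h) x))

    op-scale : ∀ a cs h x → a * op cs h x ≡ op (map (a *_) cs) h x
    op-scale a [] h x = zeroʳ a
    op-scale a (c ∷ cs) h x = trans ((solve 4 (λ a c u s → a :* (c :* u :+ s) := a :* c :* u :+ a :* s) refl) a c (h x) (op cs (Δ h) x))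
      (cong (a * c * h x +_) (op-scale a cs (Δ h) x))

    IsOp-+ : ∀ {S T} → IsOp S → IsOp T → IsOp (λ h x → S h x + T h x)
    IsOp-+ (cs , s) (ds , t) = cs ⊞ ds , λ h x → trans (cong₂ _+_ (s h x) (t h x)) (op-⊞ cs ds h x)

    IsOp-scale : ∀ {T} a → IsOp T → IsOp (λ h x → a * T h x)
    IsOp-scale a (cs , t) = map (a *_) cs , λ h x → trans (cong (a *_) (t h x)) (op-scale a cs h x)

    IsOp-sum : ∀ {n} (T : Fin n → Fun → Fun) → (∀ i → IsOp (T i)) → IsOp (λ h x → sum (λ i → T i h x))
    IsOp-sum {zero} T _ = [] , λ _ _ → refl
    IsOp-sum {suc n} T t = IsOp-+ {T Fin.zero} (t Fin.zero) (IsOp-sum (T ∘ Fin.suc) (t ∘ Fin.suc))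

    -- Translation by 1 is 1 + Δ, and translation by u is its u-th power.
    IsOp-shift : ∀ u → IsOp (λ h x → h (x + u))
    IsOp-shift u = subst (λ u → IsOp (λ h x → h (x + u))) ([]-toℕ u) (go (toℕ u))
      where
      next : ∀ {T} → IsOp T → IsOp (λ h x → T h (x + 1#))
      next {T} (cs , t) = cs ⊞ (0# ∷ cs) , λ h x → begin
        T h (x + 1#)                                ≡⟨ t h (x + 1#) ⟩
        op cs h (x + 1#)                            ≡⟨ (solve 2 (λ u v → u := v :+ ((num 0) :+ (u :- v))) refl) (op cs h (x + 1#)) (op cs h x) ⟩
        op cs h x + (0# + Δ (op cs h) x)            ≡⟨ cong (op cs h x +_) (cong₂ _+_ (sym (zeroˡ (h x))) (op-Δ cs h x)) ⟩
        op cs h x + op (0# ∷ cs) h x                ≡⟨ op-⊞ cs (0# ∷ cs) h x ⟩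
        op (cs ⊞ (0# ∷ cs)) h x                     ∎
        where open ≡-Reasoning
      go : ∀ k → IsOp (λ h x → h (x + [ k ]))
      go zero = 1# ∷ [] , λ h x → trans (cong h (+-identityʳ x)) (trans (sym (*-identityˡ _)) (sym (+-identityʳ _)))
      go (suc k) = proj₁ step , λ h x → trans (cong h (trans (cong (x +_) ([suc] k)) (sym (+-assoc x 1# [ k ])))) (proj₂ step h x)
        where
        step : IsOp (λ h x → h (x + 1# + [ k ]))
        step = next (go k)

    IsOp-id : IsOp (λ h x → h x)
    IsOp-id = 1# ∷ [] , λ h x → trans (sym (*-identityˡ _)) (sym (+-identityʳ _))

    -- Otherwise y (y^m - 1) would vanish on all of F with leading coefficient 1 and degree m + 1
    -- below p.
    exponent-bound : ∀ m → 0 < m → (∀ y → y ≢ 0# → y ^ m ≡ 1#) → p ≤ suc m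
    exponent-bound m 0<m e = ℕ.≮⇒≥ λ m+1<p → 1≢0 (trans (trans (sym (+-identityʳ 1#)) (sym (*-identityˡ _)))
      (Lead-Kills {0} {suc m} (Lead-* 1 m Lead-id (Lead-+ m (Lead-power m) (Lead-constant m (- 1#) 0<m))) vanish z≤n m+1<p))
      where
      vanish : Zero (λ y → y * (y ^ m - 1#))
      vanish y with y ≟ 0#
      ... | yes refl = zeroˡ _
      ... | no y≢0 = trans (cong (y *_) (trans (cong (_- 1#) (e y y≢0)) (-‿inverseʳ 1#))) (zeroʳ y)

-- Automorphisms of Cayley graphs of F are affine.

module Affine where

  open Field
  open Sizes
  open Differences
  open import Data.Nat as ℕ using (ℕ; zero; suc; _≤_; _<_; z≤n; s≤s)
  import Data.Nat.Properties as ℕ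
  open import Data.Nat.DivMod using (m≡m%n+[m/n]*n; m%n<n; m/n<m; m/n*n≤m; _/_)
  open import Data.Nat.Primality using (Prime)
  open import Data.Bool using (Bool; true; false; if_then_else_)
  open import Data.Fin as Fin using (Fin; fromℕ<)
  open import Data.Fin.Permutation as Perm using (Permutation′; permutation; _⟨$⟩ʳ_)
  open import Data.List using (_∷_)
  open import Data.Product using (∃; _×_; _,_; proj₁; proj₂)
  open import Data.Sum using (_⊎_; inj₁; inj₂; [_,_]′)
  open import Function using (_∘_; id)
  open import Relation.Nullary using (contradiction)
  open import Relation.Binary.PropositionalEquality hiding ([_])

  module AffineAutomorphisms (p : ℕ) (pr : Prime p) where
    open PrimeField p pr
    open FiniteDifferences p pr

    translation : F → Permutation′ p
    translation a = permutation (_+ a) (_- a) (λ x → (solve 2 (λ x a → x :- a :+ a := x) refl) x a) (λ x → (solve 2 (λ x a → x :+ a :- a := x) refl) x a)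

    -- T sums h (x + u) - h x over u ∈ U. It commutes with automorphisms π and equals (B + Δ …) Δ^m with m ≤ |U|,
    -- so ∘ π preserves the functions of degree less than m; degrees of powers then force π to have degree 1.
    module _ (U : F → Bool) (U0 : U 0# ≡ false) {k : ℕ} (S : Size (λ x → U x ≡ true) k) (k>0 : 0 < k) (2k<p : k ℕ.+ k < p) where

      weight : F → F
      weight u = if U u then 1# else 0#

      T : Fun → Fun
      T h x = sum λ u → weight u * (h (x + u) - h x)

      T-op : IsOp T
      T-op = IsOp-sum (λ u h x → weight u * (h (x + u) - h x)) λ u → IsOp-scale {λ h x → h (x + u) - h x} (weight u) (difference u)
        where
        difference : ∀ u → IsOp (λ h x → h (x + u) - h x)
        difference u = proj₁ both , λ h x → trans ((solve 2 (λ a b → a :- b := a :+ (:- (num 1)) :* b) refl) (h (x + u)) (h x)) (proj₂ both h x)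
          where
          both : IsOp (λ h x → h (x + u) + (- 1#) * h x)
          both = IsOp-+ {λ h x → h (x + u)} (IsOp-shift u) (IsOp-scale {λ h x → h x} (- 1#) IsOp-id)

      T-cong : ∀ {h k} → h ≗ k → T h ≗ T k
      T-cong e x = sum-cong-≗ λ u → cong (weight u *_) (cong₂ _-_ (e _) (e x))

      private
        u₀ : F
        u₀ = enum S (fromℕ< k>0)

      -- P is the product of x and of all x - u′ with u′ in U other than one chosen u. It vanishes
      -- at 0 and on U except at u, so a single term of the sum survives. A polynomial of degree k
      -- outside the kernel of T bounds the order of T by k.
      witness : ∃ λ P → Lead k 1# P × T P 0# ≢ 0#
      witness = go S refl
        where
        go : ∀ {k′} (S : Size (λ x → U x ≡ true) k′) → k′ ≡ k → ∃ λ P → Lead k 1# P × T P 0# ≢ 0#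
        go {zero} S refl = contradiction k>0 λ ()
        go {suc k′} S refl = P , Lead-P , λ e → P-u≢0 (trans (sym (*-identityˡ (P u)))
          (trans (cong (λ b → weight-of b * P u) (sym Uu)) (trans (sym value) e)))
          where
          weight-of : Bool → F
          weight-of b = if b then 1# else 0#
          P : Fun
          P x = x * roots (enum S ∘ Fin.suc) x
          u : F
          u = enum S Fin.zero
          Uu : U u ≡ true
          Uu = sound S Fin.zero
          Lead-P : Lead (suc k′) 1# P
          Lead-P = Lead-coefficient (suc k′) (*-identityˡ 1#) (Lead-* 1 k′ Lead-id (Lead-roots (enum S ∘ Fin.suc)))
          u≢0 : u ≢ 0#
          u≢0 e = contradiction (trans (sym U0) (trans (cong U (sym e)) Uu)) λ ()
          P-u≢0 : P u ≢ 0#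
          P-u≢0 = *-nonzero u≢0 (roots-nonzero _ u λ i e → contradiction (injective S {Fin.zero} {Fin.suc i} e) λ ())
          simplify : ∀ v → weight v * (P (0# + v) - P 0#) ≡ weight v * P v
          simplify v = cong (weight v *_) (trans (cong₂ (λ a b → P a - b) (+-identityˡ v) (zeroˡ _)) (trans (cong (P v +_) -0≡0) (+-identityʳ _)))
          elsewhere : ∀ v → v ≢ u → weight v * P v ≡ 0#
          elsewhere v v≢u with U v in Uv
          ... | false = zeroˡ _
          ... | true with position S Uv | enum-position S Uv
          ...   | Fin.zero | e = contradiction (sym e) v≢u
          ...   | Fin.suc i | e = trans (*-identityˡ _) (trans (cong (v *_) (trans (cong (roots (enum S ∘ Fin.suc)) (sym e)) (roots-zero _ i))) (zeroʳ v))
          value : T P 0# ≡ weight u * P u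
          value = trans (sum-cong-≗ simplify) (sum-single (λ v → weight v * P v) u elsewhere)

      -- The order m is positive because T kills constants, and at most k because Δ^m must not kill
      -- the witness.
      order : ∃ λ m → ∃ λ B → ∃ λ ds → B ≢ 0# × m ≤ k × 0 < m × (∀ h → T h ≗ op (B ∷ ds) (Δ^ m h))
      order = [ (λ z → contradiction (trans (proj₂ T-op (proj₁ witness) 0#) (z (proj₁ witness) 0#)) (proj₂ (proj₂ witness)))
              , (λ (m , B , ds , B≢0 , e) → nonzero m B ds B≢0 λ h x → trans (proj₂ T-op h x) (e h x)) ]′ (op-order (proj₁ T-op))
        where
        m>0 : ∀ m {B ds} → B ≢ 0# → (∀ h → T h ≗ op (B ∷ ds) (Δ^ m h)) → 0 < m
        m>0 (suc m) _ _ = s≤s z≤n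
        m>0 zero {B} {ds} B≢0 T≗ = contradiction (op-injective {B} {ds} B≢0 (λ x → trans (sym (T≗ (λ _ → 1#) x))
          (sum-zero _ λ u → trans (cong (weight u *_) (-‿inverseʳ 1#)) (zeroʳ _))) 0#) 1≢0

        nonzero : ∀ m B ds → B ≢ 0# → (∀ h → T h ≗ op (B ∷ ds) (Δ^ m h)) → _
        nonzero m B ds B≢0 T≗ = m , B , ds , B≢0 , m≤k , m>0 m {B} {ds} B≢0 T≗ , T≗
          where
          m≤k : m ≤ k
          m≤k = ℕ.≮⇒≥ λ k<m → proj₂ (proj₂ witness) (trans (T≗ _ 0#)
            (op-zero (B ∷ ds) (Kills-≤ k<m (Lead⇒Kills k (proj₁ (proj₂ witness)))) 0#))

      module _ (π : Permutation′ p) (aut : ∀ x y → U ((π ⟨$⟩ʳ y) - (π ⟨$⟩ʳ x)) ≡ U (y - x)) where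
        private
          f : Fun
          f = π ⟨$⟩ʳ_

        f-injective : ∀ {x y} → f x ≡ f y → x ≡ y
        f-injective {x} {y} e = trans (sym (Perm.inverseˡ π)) (trans (cong (π Perm.⟨$⟩ˡ_) e) (Perm.inverseˡ π))

        T-centred : ∀ h x → T h x ≡ sum λ y → weight (y - x) * (h y - h x)
        T-centred h x = sym (trans (sum-permute (λ y → weight (y - x) * (h y - h x)) (translation x))
          (sum-cong-≗ λ u → cong₂ (λ a b → weight a * (h b - h x)) ((solve 2 (λ u x → u :+ x :- x := u) refl) u x) (+-comm u x)))

        -- Centred at x, T sums over the points y with y - x in U; an automorphism permutes these
        -- sets, so the sum can be reindexed by π.
        T-∘ : ∀ h x → T (h ∘ f) x ≡ T h (f x)
        T-∘ h x = begin
          T (h ∘ f) x                                          ≡⟨ T-centred (h ∘ f) x ⟩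
          (sum λ y → weight (y - x) * (h (f y) - h (f x)))     ≡⟨ (sum-cong-≗ λ y → cong (λ b → (if b then 1# else 0#) * (h (f y) - h (f x))) (sym (aut x y))) ⟩
          (sum λ y → weight (f y - f x) * (h (f y) - h (f x))) ≡⟨ sum-permute (λ z → weight (z - f x) * (h z - h (f x))) π ⟨
          (sum λ z → weight (z - f x) * (h z - h (f x)))       ≡⟨ T-centred h (f x) ⟨
          T h (f x)                                            ∎
          where open ≡-Reasoning

        private
          m = proj₁ order
          B = proj₁ (proj₂ order)
          ds = proj₁ (proj₂ (proj₂ order))
          B≢0 = proj₁ (proj₂ (proj₂ (proj₂ order)))
          m≤k = proj₁ (proj₂ (proj₂ (proj₂ (proj₂ order))))
          m>0 = proj₁ (proj₂ (proj₂ (proj₂ (proj₂ (proj₂ order)))))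
          T≗ = proj₂ (proj₂ (proj₂ (proj₂ (proj₂ (proj₂ order)))))

        kernel : ∀ h → Zero (T h) → Kills m h
        kernel h z = op-injective {B} {ds} B≢0 λ x → trans (sym (T≗ h x)) (z x)

        cokernel : ∀ h → Kills m h → Zero (T h)
        cokernel h k x = trans (T≗ h x) (op-zero (B ∷ ds) k x)

        Kills-∘ : ∀ h → Kills m h → Kills m (h ∘ f)
        Kills-∘ h k = kernel (h ∘ f) λ x → trans (T-∘ h x) (cokernel h k (f x))

        Kills-2⇒affine : Kills 2 f → ∀ x → f x ≡ (f 1# - f 0#) * x + f 0#
        Kills-2⇒affine k₂ x = trans ((solve 3 (λ u v s → u := u :- s :* v :+ s :* v) refl) (f x) x slope)
          (trans (cong (_+ slope * x) (trans (Δ-zero⇒constant {λ y → f y - slope * y} flat x) ((solve 2 (λ c s → c :- s :* (num 0) := c) refl) (f 0#) slope)))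
            (+-comm _ _))
          where
          slope : F
          slope = f 1# - f 0#
          step : ∀ y → Δ f y ≡ slope
          step y = trans (Δ-zero⇒constant k₂ y) (cong (λ a → f a - f 0#) (+-identityˡ 1#))
          flat : Zero (Δ (λ y → f y - slope * y))
          flat y = trans ((solve 4 (λ u v s y → u :- s :* (y :+ (num 1)) :- (v :- s :* y) := (u :- v) :- s) refl) (f (y + 1#)) (f y) slope y)
            (trans (cong (_- slope) (step y)) (-‿inverseʳ slope))

        Kills-f : Kills 2 f
        Kills-f = go m refl
          where
          id₂ : Kills 2 id
          id₂ = Lead⇒Kills 1 Lead-id
          go : ∀ m′ → m ≡ m′ → Kills 2 f
          go zero e = contradiction (subst (0 <_) e m>0) λ ()
          -- For m = 1 the invariant functions are the constants, which says nothing about f. But T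
          -- applied twice is a unit times Δ², so it kills `id`, and by `T-∘` it also kills
          -- `id ∘ f`.
          go (suc zero) e = kernel′ (Δ f) λ x → trans (sym (op-Δ (B ∷ ds) (Δ f) x)) (Δ-T-f x)
            where
            T≗Δ : ∀ h → T h ≗ op (B ∷ ds) (Δ h)
            T≗Δ h x = trans (T≗ h x) (cong (λ j → op (B ∷ ds) (Δ^ j h) x) e)
            kernel′ : ∀ h → Zero (op (B ∷ ds) (Δ h)) → Kills 1 h
            kernel′ h z = op-injective {B} {ds} B≢0 z
            TT-id : Zero (T (T id))
            TT-id x = trans (T≗Δ (T id) x) (op-zero (B ∷ ds) (λ y → trans (Δ-cong (T≗Δ id) y)
              (trans (op-Δ (B ∷ ds) (Δ id) y) (op-zero (B ∷ ds) id₂ y))) x)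
            TT-f : Zero (T (T f))
            TT-f x = trans (T-cong (T-∘ id) x) (trans (T-∘ (T id) x) (TT-id (f x)))
            Δ-T-f : Zero (Δ (op (B ∷ ds) (Δ f)))
            Δ-T-f x = trans (Δ-cong (λ y → sym (T≗Δ f y)) x) (kernel′ (T f) (λ y → trans (sym (T≗Δ (T f) y)) (TT-f y)) x)
          go (suc (suc m₂)) e = by-degree (leading m (ℕ.≤-trans m≤k (ℕ.<⇒≤ k<p)) Kills-m)
            where
            k<p : k < p
            k<p = ℕ.≤-<-trans (ℕ.m≤m+n k k) 2k<p
            2≤m : 2 ≤ m
            2≤m = subst (2 ≤_) (sym e) (s≤s (s≤s z≤n))
            Kills-m : Kills m f
            Kills-m = Kills-∘ id (Kills-≤ 2≤m id₂)
            by-degree : Zero f ⊎ (∃ λ d → ∃ λ c → d < m × c ≢ 0# × Lead d c f) → Kills 2 f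
            by-degree (inj₁ z) = contradiction (f-injective (trans (z 1#) (sym (z 0#)))) 1≢0
            by-degree (inj₂ (zero , c , _ , _ , l)) = contradiction (f-injective (trans (l 1#) (sym (l 0#)))) 1≢0
            by-degree (inj₂ (suc zero , c , _ , _ , l)) = Lead⇒Kills 1 l
            by-degree (inj₂ (d@(suc (suc d′)) , c , d<m , c≢0 , l)) = contradiction
              (Lead-Kills (Lead-^ w {d} {c} {f} l) (Kills-∘ (_^ w) (Kills-≤ w<m (Lead⇒Kills w (Lead-power w)))) m≤wd wd<p)
              (^-nonzero w c≢0)
              where
              -- The least w with w d ≥ m. Since d ≥ 2, it is below m, so the w-th power of f is
              -- killed by Δ^m; but that power has degree w d < 2 m ≤ 2 k < p and nonzero leading
              -- coefficient.
              w = suc (suc m₂ / d)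
              w<m : w < m
              w<m = subst (w <_) (sym e) (s≤s (m/n<m (suc m₂) d (s≤s (s≤s z≤n))))
              m≤wd : m ≤ w ℕ.* d
              m≤wd = subst (_≤ w ℕ.* d) (sym e) (ℕ.≤-trans (s≤s (ℕ.≤-reflexive (m≡m%n+[m/n]*n (suc m₂) d)))
                (ℕ.+-monoˡ-≤ (suc m₂ / d ℕ.* d) (m%n<n (suc m₂) d)))
              wd<p : w ℕ.* d < p
              wd<p = ℕ.≤-<-trans (ℕ.+-mono-≤ (ℕ.≤-trans (ℕ.<⇒≤ d<m) m≤k) (ℕ.≤-trans (m/n*n≤m (suc m₂) d)
                (ℕ.≤-trans (ℕ.n≤1+n _) (subst (_≤ k) e m≤k)))) 2k<p

        affine : ∀ x → f x ≡ (f 1# - f 0#) * x + f 0#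
        affine = Kills-2⇒affine Kills-f

-- Primitive roots modulo p.

module Cyclic where

  open Field
  open Differences
  open import Data.Nat as ℕ using (ℕ; zero; suc; _≤_; _<_; z≤n; s≤s; NonZero; _!)
  import Data.Nat.Properties as ℕ
  open import Data.Nat.DivMod using (m≡m%n+[m/n]*n; m%n<n; _/_; _%_)
  open import Data.Nat.Divisibility
  open import Data.Nat.Induction using (<-rec)
  open import Data.Nat.Primality using (Prime; prime⇒irreducible; prime⇒nonZero; prime⇒nonTrivial)
  open import Data.Nat.Primality.Factorisation using (factorise; PrimeFactorisation)
  open import Data.Nat.Coprimality using (Coprime; coprime-divisor) renaming (sym to coprime-sym)
  open import Data.List using (_∷_; [])
  open import Data.Nat.ListAction using (product)
  open import Data.List.Relation.Unary.All using ([]; _∷_)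
  open import Data.Fin as Fin using (Fin; toℕ; fromℕ<)
  open import Data.Fin.Properties as Fin using (toℕ<n; toℕ-fromℕ<; all?; any?; pigeonhole; injective⇒≤; ¬∀⟶∃¬)
  open import Data.Product using (∃; _×_; _,_; proj₁; proj₂)
  open import Data.Sum using (inj₁; inj₂; [_,_]′)
  open import Relation.Nullary using (¬_; Dec; yes; no; contradiction)
  open import Relation.Nullary.Decidable using (_→-dec_; ¬?)
  open import Relation.Binary.PropositionalEquality hiding ([_])

  coprime-* : ∀ {m n o} → Coprime m n → Coprime m o → Coprime m (n ℕ.* o)
  coprime-* mn mo (i∣m , i∣no) = mo (i∣m , coprime-divisor (λ (j∣i , j∣n) → mn (∣-trans j∣i i∣m , j∣n)) i∣no)

  coprime-^ : ∀ {m n} k → Coprime m n → Coprime m (n ℕ.^ k)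
  coprime-^ zero c (_ , i∣1) = ∣1⇒≡1 i∣1
  coprime-^ (suc k) c = coprime-* c (coprime-^ k c)

  ∤⇒coprime : ∀ {q r} → Prime q → ¬ q ∣ r → Coprime r q
  ∤⇒coprime q-prime q∤r (i∣r , i∣q) with prime⇒irreducible q-prime i∣q
  ... | inj₁ e = e
  ... | inj₂ refl = contradiction i∣r q∤r

  prime-divisor : ∀ d → 1 < d → ∃ λ q → Prime q × q ∣ d
  prime-divisor d 1<d = go (factorise d {{ℕ.>-nonZero (ℕ.<-trans (s≤s z≤n) 1<d)}})
    where
    go : PrimeFactorisation d → _
    go record { factors = [] ; isFactorisation = e } = contradiction e (ℕ.>⇒≢ 1<d)
    go record { factors = q ∷ qs ; isFactorisation = e ; factorsPrime = q-prime ∷ _ } = q , q-prime , subst (q ∣_) (sym e) (m∣m*n (product qs))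

  prime-part : ∀ {q} → Prime q → ∀ d → 0 < d → ∃ λ e → ∃ λ r → d ≡ q ℕ.^ e ℕ.* r × ¬ q ∣ r
  prime-part {q} q-prime = <-rec _ λ d rec d>0 → go d rec d>0 (q ∣? d)
    where
    instance
      q≢0 : NonZero q
      q≢0 = prime⇒nonZero q-prime
    1<q : 1 < q
    1<q = ℕ.nonTrivial⇒n>1 q {{prime⇒nonTrivial q-prime}}
    go : ∀ d → (∀ {k} → k < d → 0 < k → ∃ λ e → ∃ λ r → k ≡ q ℕ.^ e ℕ.* r × ¬ q ∣ r) → 0 < d → Dec (q ∣ d) →
      ∃ λ e → ∃ λ r → d ≡ q ℕ.^ e ℕ.* r × ¬ q ∣ r
    go d rec d>0 (no q∤d) = 0 , d , sym (ℕ.+-identityʳ d) , q∤d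
    go d rec d>0 (yes (divides zero refl)) = contradiction d>0 λ ()
    go d rec d>0 (yes (divides k@(suc k′) refl)) with rec {k} (ℕ.m<m*n k q 1<q) (s≤s z≤n)
    ... | e , r , k≡ , q∤r = suc e , r , trans (ℕ.*-comm k q) (trans (cong (q ℕ.*_) k≡) (sym (ℕ.*-assoc q (q ℕ.^ e) r))) , q∤r

  least : ∀ {P : ℕ → Set} → (∀ n → Dec (P n)) → ∀ n → P n → ∃ λ m → P m × (∀ k → k < m → ¬ P k)
  least {P} P? = <-rec _ λ n rec pn → go n rec pn (any? (λ (i : Fin n) → P? (toℕ i)))
    where
    go : ∀ n → (∀ {k} → k < n → P k → ∃ λ m → P m × (∀ k → k < m → ¬ P k)) → P n → Dec (∃ λ (i : Fin n) → P (toℕ i)) →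
      ∃ λ m → P m × (∀ k → k < m → ¬ P k)
    go n rec pn (yes (i , pi)) = rec (toℕ<n i) pi
    go n rec pn (no none) = n , pn , λ k k<n pk → none (fromℕ< k<n , subst P (sym (toℕ-fromℕ< k<n)) pk)

  module CyclicUnits (p : ℕ) (pr : Prime p) where
    open PrimeField p pr
    open FiniteDifferences p pr using (exponent-bound)

    Ord : F → ℕ → Set
    Ord x d = x ^ d ≡ 1# × (∀ k → x ^ k ≡ 1# → d ∣ k)

    power-reduce : ∀ x q d r → x ^ d ≡ 1# → x ^ (r ℕ.+ q ℕ.* d) ≡ x ^ r
    power-reduce x q d r e = trans (^-+ x r (q ℕ.* d)) (trans (cong (x ^ r *_) (trans (^-* x q d) (trans (cong (_^ q) e) (1^ q)))) (*-identityʳ _))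

    power-∣ : ∀ {x d k} → d ∣ k → x ^ d ≡ 1# → x ^ k ≡ 1#
    power-∣ {x} {d} (divides q refl) e = power-reduce x q d 0 e

    -- Division with remainder by the least positive member. It serves both for the order of one
    -- element and for the exponent of the whole group of units.
    generator-exponent : ∀ {P : ℕ → Set} → (∀ n → Dec (P n)) → (∀ q d r → P d → P (r ℕ.+ q ℕ.* d) → P r) → ∀ n → 0 < n → P n →
      ∃ λ d → 0 < d × P d × (∀ k → P k → d ∣ k)
    generator-exponent {P} P? reduce n n>0 pn = go (least (λ k → P? (suc k)) (ℕ.pred n) (subst P (sym (ℕ.suc-pred n {{ℕ.>-nonZero n>0}})) pn))
      where
      go : ∃ (λ d → P (suc d) × (∀ k → k < d → ¬ P (suc k))) → ∃ λ d → 0 < d × P d × (∀ k → P k → d ∣ k)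
      go (d , pd , minimal) = suc d , s≤s z≤n , pd , λ k pk → exact k
        (reduce (k / suc d) (suc d) (k % suc d) pd (subst P (m≡m%n+[m/n]*n k (suc d)) pk)) (k % suc d) refl
        where
        exact : ∀ k → P (k % suc d) → ∀ r → r ≡ k % suc d → suc d ∣ k
        exact k pr zero e = m%n≡0⇒n∣m k (suc d) (sym e)
        exact k pr (suc r) e = contradiction (subst P (sym e) pr) (minimal r (ℕ.s≤s⁻¹ (subst (_< suc d) (sym e) (m%n<n k (suc d)))))

    power-returns : ∀ x → x ≢ 0# → ∃ λ k → 0 < k × k ≤ p × x ^ k ≡ 1#
    power-returns x x≢0 with pigeonhole (ℕ.n<1+n p) (λ i → x ^ toℕ i)
    ... | i , j , i<j , e = toℕ j ℕ.∸ toℕ i , ℕ.m<n⇒0<n∸m i<j , ℕ.≤-trans (ℕ.m∸n≤m (toℕ j) (toℕ i)) (ℕ.s≤s⁻¹ (toℕ<n j)) ,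
      sym (*-cancelˡ (^-nonzero (toℕ i) x≢0) (trans (*-identityʳ _) (trans e (trans (cong (x ^_) (sym (ℕ.m+[n∸m]≡n (ℕ.<⇒≤ i<j)))) (^-+ x (toℕ i) _)))))

    order-of : ∀ x → x ≢ 0# → ∃ λ d → 0 < d × Ord x d
    order-of x x≢0 with power-returns x x≢0
    ... | k , k>0 , _ , e = generator-exponent (λ n → x ^ n ≟ 1#) (λ q d r pd pr → trans (sym (power-reduce x q d r pd)) pr) k k>0 e

    Universal : ℕ → Set
    Universal k = ∀ y → y ≢ 0# → y ^ k ≡ 1#

    universal? : ∀ k → Dec (Universal k)
    universal? k = all? λ y → ¬? (y ≟ 0#) →-dec (y ^ k ≟ 1#)

    universal-! : Universal (p !)
    universal-! y y≢0 with power-returns y y≢0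
    ... | suc k , _ , k<p , e = power-∣ {y} (∣-trans (m∣m*n {suc k} (k !)) (m≤n⇒m!∣n! k<p)) e

    opaque
      -- The search for the exponent of the group can start from `p !`, as every unit has some
      -- period at most p.
      universal : ∃ λ m → 0 < m × Universal m × (∀ k → Universal k → m ∣ k)
      universal = generator-exponent universal? (λ q d r pd pr y y≢0 → trans (sym (power-reduce y q d r (pd y y≢0))) (pr y y≢0))
        (p !) (ℕ.n≢0⇒n>0 (ℕ.≢-nonZero⁻¹ (p !) {{ℕ._!≢0 p}})) universal-!

    private
      m = proj₁ universal
      m>0 = proj₁ (proj₂ universal)
      m-universal = proj₁ (proj₂ (proj₂ universal))
      m-least = proj₂ (proj₂ (proj₂ universal))

    -- Raising `(x * y) ^ k` to the power b removes y, so a divides b k and hence k; likewise with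
    -- the roles exchanged, and a and b are coprime.
    Ord-* : ∀ {x y a b} → Coprime a b → Ord x a → Ord y b → Ord (x * y) (a ℕ.* b)
    Ord-* {x} {y} {a} {b} c (xa , x-least) (yb , y-least) =
      trans (*-^ x y (a ℕ.* b)) (trans (cong₂ _*_ (power-∣ {x} {a} (m∣m*n b) xa) (power-∣ {y} {b} (n∣m*n a) yb)) (*-identityˡ _)) ,
      λ k e → combine k
        (coprime-divisor c (x-least (b ℕ.* k) (trans (sym (*-identityʳ _)) (trans (cong (x ^ (b ℕ.* k) *_) (sym (power-∣ {y} {b} (m∣m*n k) yb)))
          (trans (sym (*-^ x y (b ℕ.* k))) (power-∣ {x * y} {k} (n∣m*n b) e))))))
        (coprime-divisor (coprime-sym c) (y-least (a ℕ.* k) (trans (sym (*-identityˡ _)) (trans (cong (_* y ^ (a ℕ.* k)) (sym (power-∣ {x} {a} (m∣m*n k) xa)))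
          (trans (sym (*-^ x y (a ℕ.* k))) (power-∣ {x * y} {k} (n∣m*n a) e))))))
      where
      combine : ∀ k → a ∣ k → b ∣ k → a ℕ.* b ∣ k
      combine k (divides q refl) b∣k = subst (a ℕ.* b ∣_) (ℕ.*-comm a q)
        (*-monoʳ-∣ a (coprime-divisor (coprime-sym c) (subst (b ∣_) (ℕ.*-comm q a) b∣k)))

    -- Write q^(e+1) as c times the order. A factor q of c would already give x^(q^e) = 1, and a
    -- divisor of q^(e+1) prime to q is 1.
    Ord-prime-power : ∀ {q x} e → Prime q → x ≢ 0# → x ^ (q ℕ.^ suc e) ≡ 1# → x ^ (q ℕ.^ e) ≢ 1# → Ord x (q ℕ.^ suc e)
    Ord-prime-power {q} {x} e q-prime x≢0 one not-one = from-order (order-of x x≢0)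
      where
      exact : ∀ {d} c → Ord x d → q ℕ.^ suc e ≡ c ℕ.* d → Dec (q ∣ c) → Ord x (q ℕ.^ suc e)
      exact {d} .(c′ ℕ.* q) (xd , _) eq (yes (divides c′ refl)) = contradiction (power-∣ {x} (divides c′ (ℕ.*-cancelˡ-≡ _ _ q {{prime⇒nonZero q-prime}}
        (trans eq (trans (cong (ℕ._* d) (ℕ.*-comm c′ q)) (ℕ.*-assoc q c′ d))))) xd) not-one
      exact {d} c x-ord eq (no q∤c) = subst (Ord x) (trans (sym (ℕ.+-identityʳ d)) (trans (cong (ℕ._* d) (sym c≡1)) (sym eq))) x-ord
        where
        c≡1 : c ≡ 1
        c≡1 = coprime-^ (suc e) (∤⇒coprime q-prime q∤c) (∣-refl , subst (c ∣_) (sym eq) (m∣m*n d))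
      from-order : (∃ λ d → 0 < d × Ord x d) → Ord x (q ℕ.^ suc e)
      from-order (d , _ , x-ord) = from-divides (proj₂ x-ord (q ℕ.^ suc e) one)
        where
        from-divides : d ∣ q ℕ.^ suc e → Ord x (q ℕ.^ suc e)
        from-divides (divides c eq) = exact c x-ord eq (q ∣? c)

    -- Split d into a prime power q^(e+1) and a cofactor r prime to q. As m / q is not a universal
    -- exponent, some y has y^(m/q) ≠ 1, and a suitable power of y has order q^(e+1). Induction
    -- serves r, and the product has order d.
    element-of-order : ∀ d → 0 < d → d ∣ m → ∃ λ x → x ≢ 0# × Ord x d
    element-of-order = <-rec _ λ d rec → go d rec
      where
      go : ∀ d → (∀ {k} → k < d → 0 < k → k ∣ m → ∃ λ x → x ≢ 0# × Ord x k) → 0 < d → d ∣ m → ∃ λ x → x ≢ 0# × Ord x d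
      go (suc zero) _ _ _ = 1# , 1≢0 , *-identityˡ _ , λ k _ → 1∣ k
      go d@(suc (suc _)) rec d>0 d∣m with prime-divisor d (s≤s (s≤s z≤n))
      ... | q , q-prime , q∣d with prime-part q-prime d d>0
      ...   | zero , r , d≡ , q∤r = contradiction (subst (q ∣_) (trans d≡ (ℕ.+-identityʳ r)) q∣d) q∤r
      ...   | suc e , zero , d≡ , q∤r = contradiction (q ∣0) q∤r
      ...   | suc e , r@(suc _) , d≡ , q∤r = build d∣m
        where
        instance
          q≢0 : NonZero q
          q≢0 = prime⇒nonZero q-prime
        Q : ℕ
        Q = q ℕ.^ suc e
        1<q : 1 < q
        1<q = ℕ.nonTrivial⇒n>1 q {{prime⇒nonTrivial q-prime}}
        1<Q : 1 < Q
        1<Q = ℕ.<-≤-trans 1<q (ℕ.m≤m*n q (q ℕ.^ e) {{ℕ.m^n≢0 q e}})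
        r<d : r < d
        r<d = subst (r <_) (sym d≡) (subst (r <_) (ℕ.*-comm r Q) (ℕ.m<m*n r Q 1<Q))
        build : d ∣ m → ∃ λ x → x ≢ 0# × Ord x d
        build (divides s m≡) = z * proj₁ other , *-nonzero z≢0 (proj₁ (proj₂ other)) , subst (Ord _) (sym d≡)
          (Ord-* (coprime-sym (coprime-^ (suc e) (∤⇒coprime q-prime q∤r)))
            (Ord-prime-power e q-prime z≢0
              (trans (sym (^-* y Q (s ℕ.* r))) (trans (cong (y ^_) (sym m≡′)) (m-universal y y≢0)))
              (λ e → y-bad (trans (^-* y (q ℕ.^ e′) (s ℕ.* r)) e)))
            (proj₂ (proj₂ other)))
          where
          e′ = e
          other = rec r<d (s≤s z≤n) (∣-trans (subst (r ∣_) (sym d≡) (n∣m*n Q)) d∣m)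
          m≡′ : m ≡ Q ℕ.* (s ℕ.* r)
          m≡′ = trans m≡ (trans (cong (s ℕ.*_) d≡) (trans (sym (ℕ.*-assoc s Q r)) (trans (cong (ℕ._* r) (ℕ.*-comm s Q)) (ℕ.*-assoc Q s r))))
          -- This is m / q.
          k : ℕ
          k = q ℕ.^ e ℕ.* (s ℕ.* r)
          k<m : k < m
          k<m = subst (k <_) (trans (ℕ.*-comm k q) (trans (sym (ℕ.*-assoc q (q ℕ.^ e) _)) (sym m≡′))) (ℕ.m<m*n k q {{k≢0 k refl}} 1<q)
            where
            k≢0 : ∀ k′ → k′ ≡ k → NonZero k′
            k≢0 zero e = contradiction (trans m≡′ (trans (ℕ.*-assoc q (q ℕ.^ e′) _) (trans (cong (q ℕ.*_) (sym e)) (ℕ.*-zeroʳ q)))) (ℕ.>⇒≢ m>0)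
            k≢0 (suc _) _ = _
          bad : ¬ Universal k
          bad u = ℕ.<⇒≱ k<m (∣⇒≤ {{ℕ.>-nonZero (k>0 k refl)}} (m-least k u))
            where
            k>0 : ∀ k′ → k′ ≡ k → 0 < k′
            k>0 zero e = contradiction (trans m≡′ (trans (ℕ.*-assoc q (q ℕ.^ e′) _) (trans (cong (q ℕ.*_) (sym e)) (ℕ.*-zeroʳ q)))) (ℕ.>⇒≢ m>0)
            k>0 (suc _) _ = s≤s z≤n
          bad-y : ∃ λ y → ¬ (y ≢ 0# → y ^ k ≡ 1#)
          bad-y = ¬∀⟶∃¬ p _ (λ y → ¬? (y ≟ 0#) →-dec (y ^ k ≟ 1#)) bad
          y = proj₁ bad-y
          y≢0 : y ≢ 0#
          y≢0 e = proj₂ bad-y λ ne → contradiction e ne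
          y-bad : y ^ k ≢ 1#
          y-bad e = proj₂ bad-y λ _ → e
          z : F
          z = y ^ (s ℕ.* r)
          z≢0 : z ≢ 0#
          z≢0 = ^-nonzero (s ℕ.* r) y≢0

    opaque
      primitive-root : ∃ λ t → t ≢ 0# × Ord t m
      primitive-root = element-of-order m m>0 ∣-refl

    t : F
    t = proj₁ primitive-root

    t≢0 : t ≢ 0#
    t≢0 = proj₁ (proj₂ primitive-root)

    private
      t-ord = proj₂ (proj₂ primitive-root)

      t^-injective : ∀ {i j} → i < m → j < m → t ^ i ≡ t ^ j → i ≡ j
      t^-injective {i} {j} i<m j<m e = [ (λ le → go le j<m e) , (λ le → sym (go le i<m (sym e))) ]′ (ℕ.≤-total i j)
        where
        go : ∀ {i j} → i ≤ j → j < m → t ^ i ≡ t ^ j → i ≡ j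
        go {i} {j} i≤j j<m e with j ℕ.∸ i in d
        ... | zero = ℕ.≤-antisym i≤j (ℕ.m∸n≡0⇒m≤n d)
        ... | suc k = contradiction (∣⇒≤ (proj₂ t-ord (suc k) (sym (*-cancelˡ (^-nonzero i t≢0) (trans (*-identityʳ _)
                (trans e (trans (cong (t ^_) (trans (sym (ℕ.m+[n∸m]≡n i≤j)) (cong (i ℕ.+_) d))) (^-+ t i (suc k)))))))))
              (ℕ.<⇒≱ (ℕ.≤-<-trans (subst (_≤ j) d (ℕ.m∸n≤m j i)) j<m))

      powers : ∀ {n} → (Fin n → F) → Fin (n ℕ.+ m) → F
      powers {n} f i = [ f , (λ j → t ^ toℕ j) ]′ (Fin.splitAt n i)

      powers-injective : ∀ {n} (f : Fin n → F) → (∀ {i j} → f i ≡ f j → i ≡ j) → (∀ i (j : Fin m) → f i ≢ t ^ toℕ j) →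
        ∀ {i j} → powers f i ≡ powers f j → i ≡ j
      powers-injective {n} f inj apart {i} {j} e = trans (sym (Fin.join-splitAt n m i))
        (trans (cong (Fin.join n m) (go (Fin.splitAt n i) (Fin.splitAt n j) e)) (Fin.join-splitAt n m j))
        where
        go : ∀ a b → [ f , (λ j → t ^ toℕ j) ]′ a ≡ [ f , (λ j → t ^ toℕ j) ]′ b → a ≡ b
        go (inj₁ a) (inj₁ b) e = cong inj₁ (inj e)
        go (inj₁ a) (inj₂ b) e = contradiction e (apart a b)
        go (inj₂ a) (inj₁ b) e = contradiction (sym e) (apart b a)
        go (inj₂ a) (inj₂ b) e = cong inj₂ (Fin.toℕ-injective (t^-injective (toℕ<n a) (toℕ<n b) e))

    -- Zero and the m powers of t are distinct, which gives one inequality; `exponent-bound` gives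
    -- the other.
    m≡p-1 : suc m ≡ p
    m≡p-1 = ℕ.≤-antisym (injective⇒≤ (powers-injective {1} (λ _ → 0#) (λ { {Fin.zero} {Fin.zero} _ → refl })
      (λ _ j e → ^-nonzero (toℕ j) t≢0 (sym e)))) (exponent-bound m m>0 m-universal)

    t-order : Ord t (p ℕ.∸ 1)
    t-order = subst (Ord t) (cong ℕ.pred m≡p-1) t-ord

    -- A unit that is no power of t would make p + 1 elements of F, together with 0 and the p - 1
    -- powers.
    log : ∀ x → x ≢ 0# → ∃ λ k → x ≡ t ^ k
    log x x≢0 with any? (λ (i : Fin m) → x ≟ t ^ toℕ i)
    ... | yes (i , e) = toℕ i , e
    ... | no none = contradiction (injective⇒≤ (powers-injective {2} f f-injective apart)) (ℕ.<⇒≱ (s≤s (ℕ.≤-reflexive (sym m≡p-1))))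
      where
      f : Fin 2 → F
      f Fin.zero = 0#
      f (Fin.suc _) = x
      f-injective : ∀ {i j} → f i ≡ f j → i ≡ j
      f-injective {Fin.zero} {Fin.zero} _ = refl
      f-injective {Fin.zero} {Fin.suc _} e = contradiction (sym e) x≢0
      f-injective {Fin.suc _} {Fin.zero} e = contradiction e x≢0
      f-injective {Fin.suc Fin.zero} {Fin.suc Fin.zero} _ = refl
      apart : ∀ i (j : Fin m) → f i ≢ t ^ toℕ j
      apart Fin.zero j e = ^-nonzero (toℕ j) t≢0 (sym e)
      apart (Fin.suc _) j e = none (j , e)

-- Squares and nonsquares of F.

module Squares where

  open Field
  open Cyclic
  open import Data.Nat as ℕ using (ℕ; zero; suc; s≤s; z≤n)
  import Data.Nat.Properties as ℕ
  open import Data.Nat.Divisibility using (_∣_; divides; ∣⇒≤)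
  open import Data.Nat.Primality using (Prime)
  open import Data.Fin.Properties using (any?)
  open import Data.Product using (∃; _×_; _,_; proj₁; proj₂)
  open import Data.Sum using (_⊎_; inj₁; inj₂; [_,_]′; map)
  open import Function using (_∘_)
  open import Relation.Nullary using (¬_; Dec; yes; no; contradiction)
  open import Relation.Nullary.Decidable using (_×-dec_; ¬?; does; dec-true; dec-false)
  open import Data.Bool using (Bool; true; false; not)
  open import Relation.Binary.PropositionalEquality hiding ([_])

  parity : ∀ n → ∃ λ m → n ≡ m ℕ.+ m ⊎ n ≡ suc (m ℕ.+ m)
  parity zero = 0 , inj₁ refl
  parity (suc n) with parity n
  ... | m , inj₁ e = m , inj₂ (cong suc e)
  ... | m , inj₂ e = suc m , inj₁ (cong suc (trans e (sym (ℕ.+-suc m m))))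

  even≢odd : ∀ m n → m ℕ.+ m ≢ suc (n ℕ.+ n)
  even≢odd (suc m) zero e = contradiction (trans (sym (ℕ.+-suc m m)) (ℕ.suc-injective e)) λ ()
  even≢odd (suc m) (suc n) e = even≢odd m n (ℕ.suc-injective (ℕ.suc-injective
    (trans (cong suc (sym (ℕ.+-suc m m))) (trans e (cong (suc ∘ suc) (ℕ.+-suc n n))))))

  -- The multiplication of the group of order two with unit `true`; with it `isSq` is a homomorphism
  -- on the units of F.
  eqb : Bool → Bool → Bool
  eqb true b = b
  eqb false b = not b

  eqb-true : ∀ b → eqb b true ≡ b
  eqb-true true = refl
  eqb-true false = refl

  eqb-refl : ∀ b → eqb b b ≡ true
  eqb-refl true = refl
  eqb-refl false = refl

  module SquareBasics (p : ℕ) (pr : Prime p) where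
    open PrimeField p pr

    Sq : F → Set
    Sq x = ∃ λ q → q ≢ 0# × x ≡ q * q

    sq? : ∀ x → Dec (Sq x)
    sq? x = any? λ q → ¬? (q ≟ 0#) ×-dec (x ≟ q * q)

    Sq⇒≢0 : ∀ {x} → Sq x → x ≢ 0#
    Sq⇒≢0 (q , q≢0 , refl) = *-nonzero q≢0 q≢0

    Sq-square : ∀ {q} → q ≢ 0# → Sq (q * q)
    Sq-square q≢0 = _ , q≢0 , refl

    Sq-1 : Sq 1#
    Sq-1 = 1# , 1≢0 , sym (*-identityˡ 1#)

    Sq-* : ∀ {x y} → Sq x → Sq y → Sq (x * y)
    Sq-* (q , q≢0 , refl) (r , r≢0 , refl) = q * r , *-nonzero q≢0 r≢0 , (solve 2 (λ q r → q :* q :* (r :* r) := q :* r :* (q :* r)) refl) q r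

    Sq-divˡ : ∀ {x y} → Sq x → Sq (x * y) → Sq y
    Sq-divˡ {y = y} (q , q≢0 , refl) (r , r≢0 , e) = r * q ⁻¹ , *-nonzero r≢0 (⁻¹-nonzero q≢0) ,
      trans (trans ((solve 1 (λ y → y := (num 1) :* (num 1) :* y) refl) y) (cong (λ o → o * o * y) (sym (inverseʳ q≢0))))
      (trans ((solve 3 (λ q i y → q :* i :* (q :* i) :* y := q :* q :* y :* (i :* i)) refl) q (q ⁻¹) y)
      (trans (cong (_* (q ⁻¹ * q ⁻¹)) e) ((solve 2 (λ r i → r :* r :* (i :* i) := r :* i :* (r :* i)) refl) r (q ⁻¹))))

    Sq-divʳ : ∀ {x y} → Sq y → Sq (x * y) → Sq x
    Sq-divʳ {x} {y} s s′ = Sq-divˡ s (subst Sq (*-comm x y) s′)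

    Sq-⁻¹ : ∀ {x} → Sq x → Sq (x ⁻¹)
    Sq-⁻¹ {x} s = Sq-divˡ s (subst Sq (sym (inverseʳ (Sq⇒≢0 s))) Sq-1)

    opaque
      isSq : F → Bool
      isSq d = does (sq? d)

      isSq-true : ∀ {d} → isSq d ≡ true → Sq d
      isSq-true {d} e with sq? d
      ... | yes s = s

      isSq-false : ∀ {d} → isSq d ≡ false → ¬ Sq d
      isSq-false {d} e with sq? d
      ... | no n = n

      Sq⇒isSq : ∀ {d} → Sq d → isSq d ≡ true
      Sq⇒isSq {d} = dec-true (sq? d)

      ¬Sq⇒isSq : ∀ {d} → ¬ Sq d → isSq d ≡ false
      ¬Sq⇒isSq {d} = dec-false (sq? d)

  module SquareClasses (p : ℕ) (pr : Prime p) (h : ℕ) (p-odd : p ≡ suc (h ℕ.+ h)) where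
    open PrimeField p pr
    open CyclicUnits p pr public using (t; t≢0; t-order; log)
    open SquareBasics p pr public

    p-1≡2h : p ℕ.∸ 1 ≡ h ℕ.+ h
    p-1≡2h = cong ℕ.pred p-odd

    t-period : t ^ (h ℕ.+ h) ≡ 1#
    t-period = subst (λ k → t ^ k ≡ 1#) p-1≡2h (proj₁ t-order)

    t-period-∣ : ∀ k → t ^ k ≡ 1# → h ℕ.+ h ∣ k
    t-period-∣ k e = subst (_∣ k) p-1≡2h (proj₂ t-order k e)

    h>0 : 0 ℕ.< h
    h>0 = positive h p-odd
      where
      positive : ∀ h → p ≡ suc (h ℕ.+ h) → 0 ℕ.< h
      positive zero e = contradiction (trans (cong [_] (sym e)) [p]≡0) 1≢0
      positive (suc _) _ = s≤s z≤n

    2≢0 : 1# + 1# ≢ 0#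
    2≢0 e = []≢0 {2} (s≤s z≤n) (subst (2 ℕ.<_) (sym p-odd) (s≤s (ℕ.+-mono-≤ h>0 h>0))) (trans ([]-+ 1 1) e)

    x²≡1 : ∀ {x} → x * x ≡ 1# → x ≡ 1# ⊎ x ≡ - 1#
    x²≡1 {x} e = map x-y≡0⇒x≡y (λ z → trans ((solve 1 (λ x → x := x :+ (num 1) :- (num 1)) refl) x) (trans (cong (_- 1#) z) (+-identityˡ _)))
      (*-zero (trans ((solve 1 (λ x → (x :- (num 1)) :* (x :+ (num 1)) := x :* x :- (num 1)) refl) x) (trans (cong (_- 1#) e) (-‿inverseʳ 1#))))

    t^-double : ∀ j → t ^ (j ℕ.+ j) ≡ t ^ j * t ^ j
    t^-double j = ^-+ t j j

    -- If t = t^(2j), then t has an odd period, while every period is a multiple of 2 h. With h = i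
    -- + 1, the exponent `suc (i ℕ.+ i)` is 2 h - 1 and stands for -1.
    t-nonsquare : ¬ Sq t
    t-nonsquare (q , q≢0 , e) = go h h>0 t-period t-period-∣ (log q q≢0)
      where
      go : ∀ h → 0 ℕ.< h → t ^ (h ℕ.+ h) ≡ 1# → (∀ k → t ^ k ≡ 1# → h ℕ.+ h ∣ k) → ¬ ∃ λ j → q ≡ t ^ j
      go (suc i) _ period period-∣ (j , refl) = odd (period-∣ (j ℕ.+ j ℕ.+ suc (i ℕ.+ i)) (begin
        t ^ (j ℕ.+ j ℕ.+ suc (i ℕ.+ i))       ≡⟨ ^-+ t (j ℕ.+ j) _ ⟩
        t ^ (j ℕ.+ j) * t ^ suc (i ℕ.+ i)     ≡⟨ cong (_* t ^ suc (i ℕ.+ i)) (trans (t^-double j) (sym e)) ⟩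
        t ^ suc (suc (i ℕ.+ i))               ≡⟨ cong (λ k → t ^ suc k) (ℕ.+-suc i i) ⟨
        t ^ (suc i ℕ.+ suc i)                 ≡⟨ period ⟩
        1#                                    ∎))
        where
        open ≡-Reasoning
        odd : ¬ suc i ℕ.+ suc i ∣ j ℕ.+ j ℕ.+ suc (i ℕ.+ i)
        odd (divides c eq) = even≢odd (c ℕ.* suc i) (j ℕ.+ i) (begin
          c ℕ.* suc i ℕ.+ c ℕ.* suc i           ≡⟨ ℕ.*-distribˡ-+ c (suc i) (suc i) ⟨
          c ℕ.* (suc i ℕ.+ suc i)               ≡⟨ eq ⟨
          j ℕ.+ j ℕ.+ suc (i ℕ.+ i)             ≡⟨ ℕ.+-suc (j ℕ.+ j) (i ℕ.+ i) ⟩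
          suc (j ℕ.+ j ℕ.+ (i ℕ.+ i))           ≡⟨ cong suc (+-interchange j j i i) ⟩
          suc (j ℕ.+ i ℕ.+ (j ℕ.+ i))           ∎)
          where open import Algebra.Properties.CommutativeSemigroup ℕ.+-commutativeSemigroup renaming (interchange to +-interchange)

    nonsquare-form : ∀ {x} → x ≢ 0# → ¬ Sq x → ∃ λ r → r ≢ 0# × x ≡ t * (r * r)
    nonsquare-form {x} x≢0 ns = go (log x x≢0)
      where
      go : (∃ λ k → x ≡ t ^ k) → _
      go (k , e) with parity k
      ... | j , inj₁ refl = contradiction (t ^ j , ^-nonzero j t≢0 , trans e (t^-double j)) ns
      ... | j , inj₂ refl = t ^ j , ^-nonzero j t≢0 , trans e (cong (t *_) (t^-double j))

    nonsquare-* : ∀ {x y} → x ≢ 0# → y ≢ 0# → ¬ Sq x → ¬ Sq y → Sq (x * y)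
    nonsquare-* x≢0 y≢0 nx ny = go (nonsquare-form x≢0 nx) (nonsquare-form y≢0 ny)
      where
      go : ∀ {x y} → (∃ λ r → r ≢ 0# × x ≡ t * (r * r)) → (∃ λ r → r ≢ 0# × y ≡ t * (r * r)) → Sq (x * y)
      go (r , r≢0 , refl) (s , s≢0 , refl) = t * r * s , *-nonzero (*-nonzero t≢0 r≢0) s≢0 ,
        (solve 3 (λ t r s → t :* (r :* r) :* (t :* (s :* s)) := t :* r :* s :* (t :* r :* s)) refl) t r s

    square-*-nonsquare : ∀ {x y} → Sq x → ¬ Sq y → ¬ Sq (x * y)
    square-*-nonsquare sx ny = ny ∘ Sq-divˡ sx

    nonsquare-*-square : ∀ {x y} → ¬ Sq x → Sq y → ¬ Sq (x * y)
    nonsquare-*-square nx sy = nx ∘ Sq-divʳ sy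

    nonsquare-⁻¹ : ∀ {x} → x ≢ 0# → ¬ Sq x → ¬ Sq (x ⁻¹)
    nonsquare-⁻¹ {x} x≢0 nx s = nx (Sq-divʳ s (subst Sq (sym (inverseʳ x≢0)) Sq-1))

    -- Its square is 1, and h is too small to be a period of t.
    t^h≡-1 : t ^ h ≡ - 1#
    t^h≡-1 = [ (λ e → contradiction (ℕ.+-cancelˡ-≤ h _ _ (subst (h ℕ.+ h ℕ.≤_) (sym (ℕ.+-identityʳ h))
        (∣⇒≤ {{ℕ.>-nonZero h>0}} (t-period-∣ h e)))) (ℕ.<⇒≱ h>0)) , (λ e → e) ]′
      (x²≡1 (trans (sym (t^-double h)) t-period))

    -- The half-way power t^h = -1 has the square root t^(h/2) as soon as h is even; this is how p ≡
    -- 1 (mod 4) is used.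
    Sq-neg-1 : ∀ j → h ≡ j ℕ.+ j → Sq (- 1#)
    Sq-neg-1 j refl = t ^ j , ^-nonzero j t≢0 , trans (sym t^h≡-1) (t^-double j)

    isSq-* : ∀ {x y} → x ≢ 0# → y ≢ 0# → isSq (x * y) ≡ eqb (isSq x) (isSq y)
    isSq-* {x} {y} x≢0 y≢0 = go (sq? x) (sq? y)
      where
      go : Dec (Sq x) → Dec (Sq y) → isSq (x * y) ≡ eqb (isSq x) (isSq y)
      go (yes sx) (yes sy) = trans (Sq⇒isSq (Sq-* sx sy)) (sym (cong₂ eqb (Sq⇒isSq sx) (Sq⇒isSq sy)))
      go (yes sx) (no ny) = trans (¬Sq⇒isSq (square-*-nonsquare sx ny)) (sym (cong₂ eqb (Sq⇒isSq sx) (¬Sq⇒isSq ny)))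
      go (no nx) (yes sy) = trans (¬Sq⇒isSq (nonsquare-*-square nx sy)) (sym (cong₂ eqb (¬Sq⇒isSq nx) (Sq⇒isSq sy)))
      go (no nx) (no ny) = trans (Sq⇒isSq (nonsquare-* x≢0 y≢0 nx ny)) (sym (cong₂ eqb (¬Sq⇒isSq nx) (¬Sq⇒isSq ny)))

    isSq-0 : isSq 0# ≡ false
    isSq-0 = ¬Sq⇒isSq λ s → Sq⇒≢0 s refl

    isSq-Sq-* : ∀ {a} → Sq a → ∀ x → isSq (a * x) ≡ isSq x
    isSq-Sq-* {a} sa x = go (x ≟ 0#)
      where
      go : Dec (x ≡ 0#) → isSq (a * x) ≡ isSq x
      go (yes refl) = cong isSq (zeroʳ a)
      go (no x≢0) = trans (isSq-* (Sq⇒≢0 sa) x≢0) (cong (λ b → eqb b (isSq x)) (Sq⇒isSq sa))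

    isSq-neg : Sq (- 1#) → ∀ x → isSq x ≡ isSq (- x)
    isSq-neg s x = trans (sym (isSq-Sq-* s x)) (cong isSq ((solve 1 (λ x → (:- (num 1)) :* x := :- x) refl) x))

    isSq-square-* : ∀ {q x} → q ≢ 0# → x ≢ 0# → isSq (q * q * x) ≡ isSq x
    isSq-square-* {x = x} q≢0 _ = isSq-Sq-* (Sq-square q≢0) x

    same-class : ∀ {x y} → x ≢ 0# → y ≢ 0# → isSq x ≡ isSq y → ∃ λ q → q ≢ 0# × y ≡ q * q * x
    same-class {x} {y} x≢0 y≢0 e = go (isSq-true (trans (isSq-* y≢0 x≢0) (trans (cong (λ b → eqb b (isSq x)) (sym e)) (eqb-refl (isSq x)))))
      where
      go : Sq (y * x) → ∃ λ q → q ≢ 0# × y ≡ q * q * x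
      go (q , q≢0 , eq) = q * x ⁻¹ , *-nonzero q≢0 (⁻¹-nonzero x≢0) , (begin
        y                                  ≡⟨ *-identityʳ y ⟨
        y * 1#                             ≡⟨ cong (y *_) (inverseʳ x≢0) ⟨
        y * (x * x ⁻¹)                     ≡⟨ *-assoc y x _ ⟨
        y * x * x ⁻¹                       ≡⟨ cong (_* x ⁻¹) eq ⟩
        q * q * x ⁻¹                       ≡⟨ *-identityʳ _ ⟨
        q * q * x ⁻¹ * 1#                  ≡⟨ cong (q * q * x ⁻¹ *_) (inverseˡ x≢0) ⟨
        q * q * x ⁻¹ * (x ⁻¹ * x)          ≡⟨ (solve 3 (λ q i x → q :* q :* i :* (i :* x) := q :* i :* (q :* i) :* x) refl) q (x ⁻¹) x ⟩
        q * x ⁻¹ * (q * x ⁻¹) * x          ∎)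
        where open ≡-Reasoning

-- From common multipliers of the nonneighbours to the Paley graph.

module LocalAlgebra where

  open Field
  open Sizes
  open Squares
  open import Data.Nat as ℕ using (ℕ; zero; suc; _<_; _≤_; s≤s)
  import Data.Nat.Properties as ℕ
  open import Data.Nat.Primality using (Prime)
  open import Data.Bool using (Bool; true; false; not)
  import Data.Bool.Properties as Bool
  open import Data.Fin as Fin using (Fin; toℕ)
  open import Data.Product using (∃; _×_; _,_; proj₁; proj₂)
  open import Data.Sum using (_⊎_; inj₁; inj₂)
  open import Data.Unit using (tt)
  open import Data.Empty using (⊥)
  open import Relation.Nullary using (¬_; Dec; yes; no; contradiction)
  open import Relation.Nullary.Decidable using (_×-dec_; ¬?)
  open import Relation.Binary.PropositionalEquality hiding ([_])

  module NonNeighbours (p : ℕ) (pr : Prime p) (N : Fin p → Bool) where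
    open PrimeField p pr

    S : F → Set
    S d = d ≢ 0# × N d ≡ false

    s? : ∀ d → Dec (S d)
    s? d = ¬? (d ≟ 0#) ×-dec (N d Bool.≟ false)

    module _ (N0 : N 0# ≡ false) {r₀} (Nr₀ : N r₀ ≡ true) where

      -- Every element of F is a multiple of d, so N would be constant, yet it differs at 0 and r₀.
      aperiodic : ∀ {d} → d ≢ 0# → ¬ (∀ x → N (x + d) ≡ N x)
      aperiodic {d} d≢0 periodic = contradiction (trans (sym (multiple (toℕ c))) (trans (cong N hit) Nr₀)) λ ()
        where
        c = r₀ * d ⁻¹
        multiple : ∀ k → N ([ k ] * d) ≡ false
        multiple zero = trans (cong N (zeroˡ d)) N0
        multiple (suc k) = trans (cong N (trans (cong (_* d) ([suc] k)) ((solve 2 (λ k d → ((num 1) :+ k) :* d := k :* d :+ d) refl) [ k ] d)))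
          (trans (periodic ([ k ] * d)) (multiple k))
        hit : [ toℕ c ] * d ≡ r₀
        hit = trans (cong (_* d) ([]-toℕ c)) (trans (*-assoc r₀ _ d) (trans (cong (r₀ *_) (inverseˡ d≢0)) (*-identityʳ r₀)))

      N⇒≢0 : ∀ {x} → N x ≡ true → x ≢ 0#
      N⇒≢0 e refl = contradiction (trans (sym N0) e) λ ()

      module _ {k} (size-S : Size S k) where

        neighbours = size-dec {P = λ x → N x ≡ true} (λ x → N x Bool.≟ true)

        class-sizes : p ≡ 1 ℕ.+ (proj₁ neighbours ℕ.+ k)
        class-sizes = trans (size-split (size-Fin p) (size-singleton 0#) (proj₂ nonzero) (λ {x} _ → zero? x) (λ _ → tt) (λ _ → tt) (λ { refl ne → ne refl }))
          (cong suc (size-split (proj₂ nonzero) (proj₂ neighbours) size-S (λ {x} → classify x) N⇒≢0 proj₁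
            (λ e (_ , e′) → contradiction (trans (sym e) e′) λ ())))
          where
          nonzero = size-dec {P = _≢ 0#} (λ x → ¬? (x ≟ 0#))
          zero? : ∀ x → x ≡ 0# ⊎ x ≢ 0#
          zero? x with x ≟ 0#
          ... | yes e = inj₁ e
          ... | no ne = inj₂ ne
          classify : ∀ x → x ≢ 0# → N x ≡ true ⊎ S x
          classify x x≢0 with N x in e
          ... | true = inj₁ refl
          ... | false = inj₂ (x≢0 , refl)

        module _ {s₀} (Ss₀ : S s₀) (mult : ∀ {s s′} → S s → S s′ → ∀ d → N (s′ * d) ≡ N (s * d)) where
          private
            divide : ∀ {s} → S s → ∀ x → s * (x * s ⁻¹) ≡ x
            divide (s≢0 , _) x = trans ((solve 3 (λ s i x → s :* (x :* i) := (s :* i) :* x) refl) _ _ x) (trans (cong (_* x) (inverseʳ s≢0)) (*-identityˡ x))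

            cancel : ∀ {a} → a ≢ 0# → ∀ x → a * (a ⁻¹ * x) ≡ x
            cancel a≢0 x = trans (sym (*-assoc _ _ x)) (trans (cong (_* x) (inverseʳ a≢0)) (*-identityˡ x))

            cancel′ : ∀ {a} → a ≢ 0# → ∀ x → a ⁻¹ * (a * x) ≡ x
            cancel′ a≢0 x = trans (sym (*-assoc _ _ x)) (trans (cong (_* x) (inverseˡ a≢0)) (*-identityˡ x))

            scaled : ∀ {a} → a ≢ 0# → Size (λ y → S (a ⁻¹ * y)) k
            scaled {a} a≢0 = size-map size-S (a *_) (λ {y} _ → a ⁻¹ * y) (subst S (sym (cancel′ a≢0 _))) (λ s → s)
              (λ _ _ → *-cancelˡ a≢0) (λ {y} _ → cancel a≢0 y)

            quotient : F → F
            quotient x = x * s₀ ⁻¹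

            quotient≢0 : ∀ {x} → N x ≡ true → quotient x ≢ 0#
            quotient≢0 e = *-nonzero (N⇒≢0 e) (⁻¹-nonzero (proj₁ Ss₀))

            -- Multiplication by x / s₀ takes s₀ to x and therefore all of S into the neighbours,
            -- which are thus a union of cosets like S.
            quotient-S : ∀ {x s} → N x ≡ true → S s → N (quotient x * s) ≡ true
            quotient-S {x} {s} e Ss = trans (cong N (*-comm (quotient x) s))
              (trans (mult Ss₀ Ss (quotient x)) (trans (cong N (divide Ss₀ x)) e))

            quotient⇒N : ∀ {x y} → N x ≡ true → S (quotient x ⁻¹ * y) → N y ≡ true
            quotient⇒N {x} {y} e Ss = trans (cong N (sym (cancel (quotient≢0 e) y))) (quotient-S e Ss)

            ρ : F
            ρ = quotient r₀

            ρ≢0 : ρ ≢ 0#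
            ρ≢0 = quotient≢0 Nr₀

          k≤N : k ≤ proj₁ neighbours
          k≤N = size-≤ (scaled ρ≢0) (proj₂ neighbours) (λ x → x) (quotient⇒N Nr₀) (λ _ _ e → e)

          2k<p : k ℕ.+ k < p
          2k<p = subst (k ℕ.+ k <_) (sym class-sizes) (s≤s (ℕ.+-monoˡ-≤ k k≤N))

          module _ (p<3k : p < k ℕ.+ k ℕ.+ k) where

            -- A neighbour x outside ρS lies in another coset of neighbours, disjoint from ρS. The
            -- two cosets together with S and 0 would need more than 3 k elements.
            N⇒ρS : ∀ {x} → N x ≡ true → S (ρ ⁻¹ * x)
            N⇒ρS {x} Nx with s? (ρ ⁻¹ * x)
            ... | yes s = s
            ... | no ns = contradiction
              (subst (k ℕ.+ k ℕ.+ k <_) (sym class-sizes) (s≤s (ℕ.+-monoˡ-≤ k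
                (size-disjoint (proj₂ neighbours) (scaled (quotient≢0 Nx)) (scaled ρ≢0) (quotient⇒N Nx) (quotient⇒N Nr₀) disjoint))))
              (ℕ.<-asym p<3k)
              where
              disjoint : ∀ {y} → S (quotient x ⁻¹ * y) → S (ρ ⁻¹ * y) → ⊥
              disjoint {y} Ss Ss′ = ns (*-nonzero (⁻¹-nonzero ρ≢0) (N⇒≢0 Nx) , trans (cong N move)
                (trans (mult Ss Ss′ _) (trans (cong N (divide Ss s₀)) (proj₂ Ss₀))))
                where
                s = quotient x ⁻¹ * y
                move : ρ ⁻¹ * x ≡ ρ ⁻¹ * y * (s₀ * s ⁻¹)
                move = begin
                  ρ ⁻¹ * x                                    ≡⟨ cong (ρ ⁻¹ *_) (divide Ss₀ x) ⟨
                  ρ ⁻¹ * (s₀ * quotient x)                    ≡⟨ cong (λ o → ρ ⁻¹ * (s₀ * o)) (*-identityʳ _) ⟨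
                  ρ ⁻¹ * (s₀ * (quotient x * 1#))             ≡⟨ cong (λ o → ρ ⁻¹ * (s₀ * (quotient x * o))) (inverseʳ (proj₁ Ss)) ⟨
                  ρ ⁻¹ * (s₀ * (quotient x * (s * s ⁻¹)))     ≡⟨ (solve 5 (λ a b c d e → a :* (b :* (c :* (d :* e))) := a :* (c :* d) :* (b :* e)) refl) (ρ ⁻¹) s₀ (quotient x) s (s ⁻¹) ⟩
                  ρ ⁻¹ * (quotient x * s) * (s₀ * s ⁻¹)       ≡⟨ cong (λ o → ρ ⁻¹ * o * (s₀ * s ⁻¹)) (cancel (quotient≢0 Nx) y) ⟩
                  ρ ⁻¹ * y * (s₀ * s ⁻¹)                      ∎
                  where open ≡-Reasoning

            half : p ≡ suc (k ℕ.+ k)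
            half = trans class-sizes (cong (λ m → suc (m ℕ.+ k)) (ℕ.≤-antisym
              (size-≤ (proj₂ neighbours) (scaled ρ≢0) (λ x → x) N⇒ρS (λ _ _ e → e)) k≤N))

            -- The nonzero elements are the disjoint union of S and ρS. One direction is
            -- `quotient-S`, the other `N⇒ρS`.
            ρ-flips : ∀ {x} → x ≢ 0# → N (ρ * x) ≡ not (N x)
            ρ-flips {x} x≢0 with N x in e | N (ρ * x) in e′
            ... | true | false = refl
            ... | false | true = refl
            ... | true | true = contradiction (trans (sym e) (trans (cong N (sym (cancel′ ρ≢0 x))) (proj₂ (N⇒ρS e′)))) λ ()
            ... | false | false = contradiction (trans (sym (quotient-S Nr₀ (x≢0 , e))) e′) λ ()

            ρ²-preserves : ∀ {x} → x ≢ 0# → N (ρ * (ρ * x)) ≡ N x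
            ρ²-preserves x≢0 = trans (ρ-flips (*-nonzero ρ≢0 x≢0)) (trans (cong not (ρ-flips x≢0)) (Bool.not-involutive _))

            private
              square-S : ∀ {q d} → S q → N (q * (q * d)) ≡ N (s₀ * (s₀ * d))
              square-S {q} {d} Sq = trans (mult Ss₀ Sq (q * d)) (trans (cong N ((solve 3 (λ s q d → s :* (q :* d) := q :* (s :* d)) refl) s₀ q d)) (mult Ss₀ Sq (s₀ * d)))

              square : ∀ {q d} → q ≢ 0# → d ≢ 0# → N (q * (q * d)) ≡ N (s₀ * (s₀ * d))
              square {q} {d} q≢0 d≢0 with N q in e
              ... | false = square-S (q≢0 , e)
              ... | true = trans (cong N (trans (cong (λ q → q * (q * d)) (sym (cancel ρ≢0 q)))
                  ((solve 3 (λ r s d → r :* s :* (r :* s :* d) := r :* (r :* (s :* (s :* d)))) refl) ρ s d)))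
                  (trans (ρ²-preserves (*-nonzero (proj₁ Ss) (*-nonzero (proj₁ Ss) d≢0))) (square-S Ss))
                where
                s = ρ ⁻¹ * q
                Ss : S s
                Ss = N⇒ρS e

            -- Whether q lies in S or in ρS, multiplication by q² has the same effect on N as
            -- multiplication by s₀², and for q = 1 there is no effect.
            square-preserves : ∀ {q d} → q ≢ 0# → d ≢ 0# → N (q * (q * d)) ≡ N d
            square-preserves {q} {d} q≢0 d≢0 = trans (square q≢0 d≢0) (trans (sym (square 1≢0 d≢0))
              (cong N (trans (*-identityˡ _) (*-identityˡ d))))

            open SquareClasses p pr k half

            Sq⇒N : ∀ {d} → Sq d → N (r₀ * d) ≡ true
            Sq⇒N (q , q≢0 , refl) = trans (cong N ((solve 2 (λ r q → r :* (q :* q) := q :* (q :* r)) refl) r₀ q)) (trans (square-preserves q≢0 (N⇒≢0 Nr₀)) Nr₀)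

            -- If r₀ d is a neighbour for one nonsquare d, then so is r₀ x for every nonsquare x, as
            -- two nonsquares differ by a square. The squares give the rest of F*, and s₀ could not
            -- exist.
            N⇒Sq : ∀ {d} → N (r₀ * d) ≡ true → Sq d
            N⇒Sq {d} e with sq? d
            ... | yes s = s
            ... | no ns = contradiction (trans (sym (everything (s₀ * r₀ ⁻¹) (*-nonzero (proj₁ Ss₀) (⁻¹-nonzero r₀≢0))))
                (trans (cong N (trans (cong (r₀ *_) (*-comm _ _)) (cancel r₀≢0 s₀))) (proj₂ Ss₀))) λ ()
              where
              r₀≢0 = N⇒≢0 Nr₀
              d≢0 : d ≢ 0#
              d≢0 refl = contradiction (trans (sym N0) (trans (cong N (sym (zeroʳ r₀))) e)) λ ()
              everything : ∀ x → x ≢ 0# → N (r₀ * x) ≡ true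
              everything x x≢0 with sq? x
              ... | yes s = Sq⇒N s
              ... | no nx = go (nonsquare-form d≢0 ns) (nonsquare-form x≢0 nx)
                where
                strip : ∀ {y r} → r ≢ 0# → y ≡ t * (r * r) → N (r₀ * y) ≡ N (r₀ * t)
                strip {r = r} r≢0 refl = trans (cong N ((solve 3 (λ a t r → a :* (t :* (r :* r)) := r :* (r :* (a :* t))) refl) r₀ t r))
                  (square-preserves r≢0 (*-nonzero r₀≢0 t≢0))
                go : (∃ λ r → r ≢ 0# × d ≡ t * (r * r)) → (∃ λ r → r ≢ 0# × x ≡ t * (r * r)) → N (r₀ * x) ≡ true
                go (r , r≢0 , d≡) (r′ , r′≢0 , x≡) = trans (strip r′≢0 x≡) (trans (sym (strip r≢0 d≡)) e)

-- The local graph as a Cayley graph of F.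

module Local where

  open import Defs hiding (module Mat; sym)
  open Field
  open Sizes
  open Orbits
  open Cauchy
  open Affine
  open LocalAlgebra
  open import Data.Nat as ℕ using (ℕ; zero; suc; _<_; _≤_; s≤s)
  import Data.Nat.Properties as ℕ
  open import Data.Nat.Primality using (Prime)
  open import Data.Bool using (Bool; true; false; not)
  import Data.Bool.Properties as Bool
  open import Data.Fin as Fin using (Fin; toℕ)
  open import Data.Fin.Properties as Fin using (toℕ<n)
  open import Data.Fin.Permutation as Perm using (Permutation′; _⟨$⟩ʳ_; _⟨$⟩ˡ_; flip)
  open import Data.Product using (∃; _×_; _,_; proj₁; proj₂)
  open import Data.Sum using (_⊎_; inj₁; inj₂; [_,_]′)
  open import Relation.Nullary using (¬_; yes; no; contradiction)
  open import Relation.Binary.PropositionalEquality hiding ([_])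

  true-iff : ∀ {b b′} → (b ≡ true → b′ ≡ true) → (b′ ≡ true → b ≡ true) → b ≡ b′
  true-iff {true} f g = sym (f refl)
  true-iff {false} {true} f g = g refl
  true-iff {false} {false} f g = refl

  module GraphBasics {n} (Γ : Graph n) where
    Adj : Fin n → Fin n → Set
    Adj u v = adj Γ u v ≡ true

    Adj-sym : ∀ {u v} → Adj u v → Adj v u
    Adj-sym {u} {v} a = trans (Graph.sym Γ v u) a

    Adj⇒≢ : ∀ {u v} → Adj u v → u ≢ v
    Adj⇒≢ {u} a refl = contradiction (trans (sym (irrefl Γ u)) a) λ ()

    ¬Adj⇒false : ∀ {u v} → ¬ Adj u v → adj Γ u v ≡ false
    ¬Adj⇒false = Bool.¬-not

    flip-aut : ∀ {σ} → IsAut Γ σ → IsAut Γ (flip σ)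
    flip-aut {σ} a u v = trans (sym (a _ _)) (cong₂ (adj Γ) (Perm.inverseʳ σ) (Perm.inverseʳ σ))

    perm-injective : (σ : Permutation′ n) → ∀ {u v} → σ ⟨$⟩ʳ u ≡ σ ⟨$⟩ʳ v → u ≡ v
    perm-injective σ e = trans (sym (Perm.inverseˡ σ)) (trans (cong (σ ⟨$⟩ˡ_) e) (Perm.inverseˡ σ))

    -- Induction along the walk: a step to a vertex adjacent to w starts at w itself, closes a
    -- triangle, or begins a 2-geodesic.
    geodesic-exists : ∀ {u w} → Reach Γ u w → u ≡ w ⊎ Adj u w ⊎ (∃ λ x → ∃ λ y → ∃ λ z → Is2Geodesic Γ x y z)
    geodesic-exists here = inj₁ refl
    geodesic-exists (step {u} {v} {w} a r) with geodesic-exists r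
    ... | inj₁ refl = inj₂ (inj₁ a)
    ... | inj₂ (inj₂ g) = inj₂ (inj₂ g)
    ... | inj₂ (inj₁ b) with u Fin.≟ w | adj Γ u w in e
    ...   | yes u≡w | _ = inj₁ u≡w
    ...   | no _ | true = inj₂ (inj₁ refl)
    ...   | no u≢w | false = inj₂ (inj₂ (u , v , w , (a , b , u≢w) , e))

    noncomplete-geodesic : Connected Γ → NonComplete Γ → ∃ λ x → ∃ λ y → ∃ λ z → Is2Geodesic Γ x y z
    noncomplete-geodesic conn (u , v , u≢v , e) with geodesic-exists (conn u v)
    ... | inj₁ u≡v = contradiction u≡v u≢v
    ... | inj₂ (inj₁ a) = contradiction (trans (sym e) a) λ ()
    ... | inj₂ (inj₂ g) = g

  module LocalGraphs {n} (Γ : Graph n) (p : ℕ) (pr : Prime p) (regular : Regular Γ p) (arc-transitive : ArcTransitive Γ) where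
    open GraphBasics Γ public
    open PrimeField p pr

    Neighbourhood : Fin n → Set
    Neighbourhood v = Size (Adj v) p

    neighbourhood : ∀ v → Neighbourhood v
    neighbourhood v = subst (Size (Adj v)) (regular v) (size-filter (adj Γ v))

    module _ {v} (S : Neighbourhood v) where
      restrict-to : ∀ {σ} → IsAut Γ σ → σ ⟨$⟩ʳ v ≡ v → F → F
      restrict-to {σ} a e x = position S {σ ⟨$⟩ʳ enum S x} (trans (cong (λ w → adj Γ w _) (sym e)) (trans (a v _) (sound S x)))

      enum-restrict-to : ∀ {σ} (a : IsAut Γ σ) e x → enum S (restrict-to {σ} a e x) ≡ σ ⟨$⟩ʳ enum S x
      enum-restrict-to a e x = enum-position S _

      restrict : ∀ {σ} → IsAut Γ σ → σ ⟨$⟩ʳ v ≡ v → ∃ λ (π : Permutation′ p) → ∀ x → enum S (π ⟨$⟩ʳ x) ≡ σ ⟨$⟩ʳ enum S x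
      restrict {σ} a e = proj₁ π , λ x → trans (cong (enum S) (proj₂ π x)) (enum-restrict-to {σ} a e x)
        where
        π = injective-permutation (restrict-to {σ} a e) λ {i} {j} q → injective S (perm-injective σ
          (trans (sym (enum-restrict-to {σ} a e i)) (trans (cong (enum S) q) (enum-restrict-to {σ} a e j))))

    -- The connection function N is a parameter because one N serves every vertex: labellings are
    -- carried along by automorphisms.
    record Labelling (N : F → Bool) (v : Fin n) : Set where
      field
        nbrs : Neighbourhood v
        difference : ∀ x y → adj Γ (enum nbrs x) (enum nbrs y) ≡ N (y - x)
      ν : F → Fin n
      ν = enum nbrs
    open Labelling public

    relabel : ∀ {N N′ v} (π : Permutation′ p) → (∀ x y → N ((π ⟨$⟩ʳ y) - (π ⟨$⟩ʳ x)) ≡ N′ (y - x)) → Labelling N v → Labelling N′ v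
    relabel π e ℓ = record { nbrs = size-permute (nbrs ℓ) π ; difference = λ x y → trans (difference ℓ _ _) (e x y) }

    transport : ∀ {N v σ} → IsAut Γ σ → Labelling N v → Labelling N (σ ⟨$⟩ʳ v)
    transport {v = v} {σ} a ℓ = record
      { nbrs = size-map (nbrs ℓ) (σ ⟨$⟩ʳ_) (λ {y} _ → σ ⟨$⟩ˡ y) (λ {x} b → trans (a _ _) b)
          (λ {y} b → trans (sym (a v _)) (trans (cong (adj Γ _) (Perm.inverseʳ σ)) b)) (λ _ _ → perm-injective σ) (λ _ → Perm.inverseʳ σ)
      ; difference = λ x y → trans (a _ _) (difference ℓ x y) }

    -- Translations of F preserve differences, so any chosen neighbour may be given the label 0.
    based : ∀ {N v u} → Labelling N v → Adj v u → ∃ λ (ℓ : Labelling N v) → ν ℓ 0# ≡ u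
    based {N} {v} {u} ℓ b = relabel (translation c) (λ x y → cong N ((solve 3 (λ x y c → y :+ c :- (x :+ c) := y :- x) refl) x y c)) ℓ ,
      trans (cong (ν ℓ) (+-identityˡ c)) (enum-position (nbrs ℓ) b)
      where
      open AffineAutomorphisms p pr using (translation)
      c = position (nbrs ℓ) b

    vertex-transitive : ∀ u v → ∃ λ σ → IsAut Γ σ × σ ⟨$⟩ʳ u ≡ v
    vertex-transitive u v with arc-transitive u _ v _ (sound (neighbourhood u) 0#) (sound (neighbourhood v) 0#)
    ... | σ , a , e , _ = σ , a , e

    -- An automorphism of order p of the local graph makes it a Cayley graph of the additive group of F.
    module _ (v : Fin n) where
      private
        S = neighbourhood v

        L : F → F → Bool
        L x y = adj Γ (enum S x) (enum S y)

        L-transitive : ∀ x y → ∃ λ π → Automorphism L π × π ⟨$⟩ʳ x ≡ y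
        L-transitive x y with arc-transitive v _ v _ (sound S x) (sound S y)
        ... | σ , a , ev , ex = proj₁ (restrict S {σ} a ev) ,
          (λ i j → trans (cong₂ (adj Γ) (proj₂ (restrict S {σ} a ev) i) (proj₂ (restrict S {σ} a ev) j)) (a _ _)) ,
          injective S (trans (proj₂ (restrict S {σ} a ev) x) ex)

        opaque
          rotation : ∃ λ π → Automorphism L π × (∀ x → iterate (π ⟨$⟩ʳ_) p x ≡ x) × ∃ λ x → π ⟨$⟩ʳ x ≢ x
          rotation = automorphism-of-prime-order L pr L-transitive 0#

        f : F → F
        f = proj₁ rotation ⟨$⟩ʳ_
        f-aut = proj₁ (proj₂ rotation)
        f-period = proj₁ (proj₂ (proj₂ rotation))
        x₁ = proj₁ (proj₂ (proj₂ (proj₂ rotation)))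

        orbit : F → F
        orbit y = iterate f (toℕ y) x₁

        orbit-+ : ∀ x d → orbit (x + d) ≡ iterate f (toℕ x) (orbit d)
        orbit-+ x d = trans (cong (λ k → iterate f k x₁) (trans (cong toℕ (+-def x d)) (toℕ-[] _)))
          (trans (sym (iterate-% f p (f-period x₁) (toℕ x ℕ.+ toℕ d))) (iterate-+ f (toℕ x) (toℕ d) x₁))

        orbit-0 : orbit 0# ≡ x₁
        orbit-0 = cong (λ k → iterate f k x₁) ([]-small (ℕ.>-nonZero⁻¹ p))

        iterate-aut : ∀ k x y → L (iterate f k x) (iterate f k y) ≡ L x y
        iterate-aut zero x y = refl
        iterate-aut (suc k) x y = trans (f-aut _ _) (iterate-aut k x y)

        -- The point x₁ is moved and p is prime, so its p iterates are distinct and exhaust the p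
        -- neighbours.
        orbit-permutation = injective-permutation orbit λ {i} {j} e → Fin.toℕ-injective
          (iterate-injective f pr (f-period x₁) (proj₂ (proj₂ (proj₂ (proj₂ rotation)))) (toℕ<n i) (toℕ<n j) e)

      cayley : ∃ λ N → Labelling N v
      cayley = (λ d → L x₁ (orbit d)) , record
        { nbrs = size-permute S (proj₁ orbit-permutation)
        ; difference = λ x y → begin
            L (proj₁ orbit-permutation ⟨$⟩ʳ x) (proj₁ orbit-permutation ⟨$⟩ʳ y) ≡⟨ cong₂ L (proj₂ orbit-permutation x) (proj₂ orbit-permutation y) ⟩
            L (orbit x) (orbit y)                               ≡⟨ cong₂ (λ a b → L (orbit a) (orbit b)) (sym (+-identityʳ x)) ((solve 2 (λ x y → y := x :+ (y :- x)) refl) x y) ⟩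
            L (orbit (x + 0#)) (orbit (x + (y - x)))            ≡⟨ cong₂ L (orbit-+ x 0#) (orbit-+ x (y - x)) ⟩
            L (iterate f (toℕ x) (orbit 0#)) (iterate f (toℕ x) (orbit (y - x))) ≡⟨ iterate-aut (toℕ x) _ _ ⟩
            L (orbit 0#) (orbit (y - x))                        ≡⟨ cong (λ a → L a (orbit (y - x))) orbit-0 ⟩
            L x₁ (orbit (y - x))                                ∎ }
        where open ≡-Reasoning

  module CayleyStructure {n} (Γ : Graph n) (p : ℕ) (pr : Prime p) (regular : Regular Γ p) (2gt : TwoGeodesicTransitive Γ)
    (some-geodesic : ∃ λ x → ∃ λ y → ∃ λ z → Is2Geodesic Γ x y z)
    (some-triangle : ∃ λ x → ∃ λ y → ∃ λ z → adj Γ x y ≡ true × adj Γ x z ≡ true × adj Γ y z ≡ true) where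
    open LocalGraphs Γ p pr regular (proj₁ 2gt)
    open PrimeField p pr
    open AffineAutomorphisms p pr

    private
      v₀ : Fin n
      v₀ = proj₁ some-triangle

    opaque
      N : F → Bool
      N = proj₁ (cayley v₀)

      labelling₀ : Labelling N v₀
      labelling₀ = proj₂ (cayley v₀)

      labelling : ∀ v → Labelling N v
      labelling v = go (vertex-transitive v₀ v)
        where
        go : ∀ {v} → (∃ λ σ → IsAut Γ σ × σ ⟨$⟩ʳ v₀ ≡ v) → Labelling N v
        go (σ , a , refl) = transport {σ = σ} a labelling₀

    labelling-at : ∀ {u v} → Adj v u → ∃ λ (ℓ : Labelling N v) → ν ℓ 0# ≡ u
    labelling-at {u} {v} = based (labelling v)

    open NonNeighbours p pr N public

    N0 : N 0# ≡ false
    N0 = trans (cong N (sym (-‿inverseʳ 0#))) (trans (sym (difference labelling₀ 0# 0#)) (irrefl Γ _))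

    N-neg : ∀ d → N (- d) ≡ N d
    N-neg d = trans (cong N ((solve 2 (λ d z → (:- d) := z :- (z :+ d)) refl) d 0#)) (trans (sym (difference labelling₀ _ _))
      (trans (Graph.sym Γ _ _) (trans (difference labelling₀ _ _) (cong N ((solve 2 (λ d z → z :+ d :- z := d) refl) d 0#)))))

    N-from : ∀ {v} (ℓ : Labelling N v) d → adj Γ (ν ℓ 0#) (ν ℓ d) ≡ N d
    N-from ℓ d = trans (difference ℓ 0# d) (cong N ((solve 1 (λ d → d :- (num 0) := d) refl) d))

    geodesic⇒S : ∀ {u v w} → Is2Geodesic Γ u v w → ∃ λ (ℓ : Labelling N v) → ∃ λ s → S s × ν ℓ 0# ≡ u × ν ℓ s ≡ w
    geodesic⇒S {u} {v} {w} ((a , b , u≢w) , e) = from (labelling-at (Adj-sym a))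
      where
      from : (∃ λ (ℓ : Labelling N v) → ν ℓ 0# ≡ u) → _
      from (ℓ , refl) = ℓ , s , ((λ s≡0 → u≢w (trans (cong (ν ℓ) (sym s≡0)) (enum-position (nbrs ℓ) b))) ,
          trans (sym (N-from ℓ s)) (trans (cong (adj Γ _) (enum-position (nbrs ℓ) b)) e)) , refl , enum-position (nbrs ℓ) b
        where
        s = position (nbrs ℓ) b

    S⇒geodesic : ∀ {v} (ℓ : Labelling N v) {s} → S s → Is2Geodesic Γ (ν ℓ 0#) v (ν ℓ s)
    S⇒geodesic ℓ {s} (s≢0 , e) = (Adj-sym (sound (nbrs ℓ) 0#) , sound (nbrs ℓ) s , λ q → s≢0 (sym (injective (nbrs ℓ) q))) ,
      trans (N-from ℓ s) e

    opaque
      some-S : ∃ S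
      some-S = go (geodesic⇒S (proj₂ (proj₂ (proj₂ some-geodesic))))
        where
        go : ∀ {u v w} → (∃ λ (ℓ : Labelling N v) → ∃ λ s → S s × ν ℓ 0# ≡ u × ν ℓ s ≡ w) → ∃ S
        go (_ , s , Ss , _) = s , Ss

    opaque
      some-N : ∃ λ r → N r ≡ true
      some-N = from-triangle some-triangle
        where
        go : ∀ {x y z} → adj Γ x z ≡ true → adj Γ y z ≡ true → (∃ λ (ℓ : Labelling N x) → ν ℓ 0# ≡ y) → ∃ λ r → N r ≡ true
        go xz yz (ℓ , refl) = position (nbrs ℓ) xz , trans (sym (N-from ℓ _)) (trans (cong (adj Γ _) (enum-position (nbrs ℓ) xz)) yz)
        from-triangle : (∃ λ x → ∃ λ y → ∃ λ z → adj Γ x y ≡ true × adj Γ x z ≡ true × adj Γ y z ≡ true) → ∃ λ r → N r ≡ true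
        from-triangle (x , y , z , xy , xz , yz) = go xz yz (labelling-at xy)

    opaque
      size-S : ∃ (Size S)
      size-S = size-dec {P = S} s?
    k = proj₁ size-S

    private
      size-N = neighbours N0 (proj₂ some-N) (proj₂ size-S)
      sizes = class-sizes N0 (proj₂ some-N) (proj₂ size-S)

      inS : F → Bool
      inS d with d ≟ 0#
      ... | yes _ = false
      ... | no _ = not (N d)

      inS⇒S : ∀ {d} → inS d ≡ true → S d
      inS⇒S {d} e with d ≟ 0#
      ... | no ne = ne , Bool.not-injective e

      S⇒inS : ∀ {d} → S d → inS d ≡ true
      S⇒inS {d} (ne , e) with d ≟ 0#
      ... | yes z = contradiction z ne
      ... | no _ = cong not e

      inS0 : inS 0# ≡ false
      inS0 with 0# ≟ 0#
      ... | yes _ = refl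
      ... | no ne = contradiction refl ne

    -- The neighbours and the nonneighbours of 0 number p - 1 together, so the smaller of the two
    -- sets meets the size bound of `affine`. An automorphism preserves both.
    automorphisms-affine : (π : Permutation′ p) → (∀ x y → N ((π ⟨$⟩ʳ y) - (π ⟨$⟩ʳ x)) ≡ N (y - x)) →
      ∀ x → π ⟨$⟩ʳ x ≡ ((π ⟨$⟩ʳ 1#) - (π ⟨$⟩ʳ 0#)) * x + (π ⟨$⟩ʳ 0#)
    automorphisms-affine π aut = [ (λ le → affine N N0 (proj₂ size-N) (size>0 (proj₂ size-N) (proj₂ some-N)) (small (ℕ.+-monoʳ-≤ _ le)) π aut)
      , (λ le → affine inS inS0 (size-cong (proj₂ size-S) S⇒inS inS⇒S) (size>0 (proj₂ size-S) (proj₂ some-S)) (small (ℕ.+-monoˡ-≤ _ le)) π inS-aut) ]′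
      (ℕ.≤-total (proj₁ size-N) k)
      where
      small : ∀ {m} → m ≤ proj₁ size-N ℕ.+ k → m < p
      small le = subst (_ <_) (sym sizes) (s≤s le)
      apart : ∀ {x y} → y - x ≢ 0# → (π ⟨$⟩ʳ y) - (π ⟨$⟩ʳ x) ≢ 0#
      apart {x} ne z = ne (trans (cong (_- x) (trans (sym (Perm.inverseˡ π)) (trans (cong (π ⟨$⟩ˡ_) (x-y≡0⇒x≡y z)) (Perm.inverseˡ π)))) (-‿inverseʳ x))
      inS-aut : ∀ x y → inS ((π ⟨$⟩ʳ y) - (π ⟨$⟩ʳ x)) ≡ inS (y - x)
      inS-aut x y with y - x ≟ 0# | (π ⟨$⟩ʳ y) - (π ⟨$⟩ʳ x) ≟ 0#
      ... | yes _ | yes _ = refl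
      ... | no _ | no _ = cong not (aut x y)
      ... | no ne | yes z = contradiction z (apart ne)
      ... | yes z | no ne = contradiction (trans (cong (λ a → (π ⟨$⟩ʳ a) - (π ⟨$⟩ʳ x)) (x-y≡0⇒x≡y z)) (-‿inverseʳ _)) ne

    -- Both s and s′ extend label 0 and v₀ to a 2-geodesic. An automorphism fixing v₀ and label 0
    -- and taking s to s′ is affine on labels without constant term, hence it is multiplication by
    -- s′ / s.
    multipliers : ∀ {s s′} → S s → S s′ → ∀ d → N (s′ * d) ≡ N (s * d)
    multipliers {s} {s′} Ss Ss′ d = go (proj₂ 2gt _ _ _ _ _ _ (S⇒geodesic ℓ Ss) (S⇒geodesic ℓ Ss′))
      where
      ℓ = labelling v₀
      go : (∃ λ σ → IsAut Γ σ × σ ⟨$⟩ʳ ν ℓ 0# ≡ ν ℓ 0# × σ ⟨$⟩ʳ v₀ ≡ v₀ × σ ⟨$⟩ʳ ν ℓ s ≡ ν ℓ s′) → N (s′ * d) ≡ N (s * d)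
      go (σ , a , e₀ , ev , es) = trans (cong N (trans (cong (_* d) s′≡) (*-assoc m s d))) (scale (s * d))
        where
        π = proj₁ (restrict (nbrs ℓ) {σ} a ev)
        π-spec = proj₂ (restrict (nbrs ℓ) {σ} a ev)
        aut : ∀ x y → N ((π ⟨$⟩ʳ y) - (π ⟨$⟩ʳ x)) ≡ N (y - x)
        aut x y = trans (sym (difference ℓ _ _)) (trans (cong₂ (adj Γ) (π-spec x) (π-spec y)) (trans (a _ _) (difference ℓ x y)))
        m = (π ⟨$⟩ʳ 1#) - (π ⟨$⟩ʳ 0#)
        π0 : π ⟨$⟩ʳ 0# ≡ 0#
        π0 = injective (nbrs ℓ) (trans (π-spec 0#) e₀)
        linear : ∀ x → π ⟨$⟩ʳ x ≡ m * x
        linear x = trans (automorphisms-affine π aut x) (trans (cong (m * x +_) π0) (+-identityʳ _))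
        s′≡ : s′ ≡ m * s
        s′≡ = trans (injective (nbrs ℓ) (trans (sym es) (sym (π-spec s)))) (linear s)
        scale : ∀ x → N (m * x) ≡ N x
        scale x = trans (cong N (trans (sym (linear x)) (trans ((solve 1 (λ a → a := a :- (num 0)) refl) _) (cong (λ z → (π ⟨$⟩ʳ x) - z) (sym π0)))))
          (trans (aut 0# x) (cong N ((solve 1 (λ x → x :- (num 0) := x) refl) x)))

-- Counting common neighbours and second neighbourhoods.

module Counting where

  open import Defs hiding (module Mat; sym)
  open Field
  open Sizes
  open Squares
  open Local
  open import Data.Nat as ℕ using (ℕ; zero; suc; _<_; _≤_; z≤n)
  import Data.Nat.Properties as ℕ
  open import Data.Nat.Divisibility using (_∣_; divides; ∣⇒≤)
  open import Data.Nat.Primality using (Prime; euclidsLemma)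
  open import Data.Bool using (Bool; true; false)
  import Data.Bool.Properties as Bool
  open import Data.Fin as Fin using (Fin)
  open import Data.Fin.Properties as Fin using (any?)
  open import Data.Fin.Permutation as Perm using (Permutation′; permutation; _⟨$⟩ʳ_; _⟨$⟩ˡ_)
  open import Data.Product using (∃; _×_; _,_; proj₁; proj₂; swap)
  open import Data.Sum using (_⊎_; inj₁; inj₂; [_,_]′)
  open import Relation.Nullary using (¬_; Dec; yes; no; contradiction)
  open import Relation.Nullary.Decidable using (_×-dec_; _⊎-dec_; ¬?)
  open import Relation.Binary.PropositionalEquality hiding ([_])

  module PaleyCount (p : ℕ) (pr : Prime p) (h : ℕ) (p-odd : p ≡ suc (h ℕ.+ h)) where
    open PrimeField p pr
    open SquareClasses p pr h p-odd

    -- For nonsquare d the involution x ↦ d²/x of the squares exchanges the x with x - d square and those with x - d nonsquare.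
    paley-common : ∀ {d a m} → Sq (- 1#) → d ≢ 0# → ¬ Sq d → Size Sq m → Size (λ x → Sq x × Sq (x - d)) a → m ≡ a ℕ.+ a
    paley-common {d} {a} {m} -1∈Sq d≢0 nd size-Sq size-A = trans
      (size-split size-Sq size-A (proj₂ size-B) (λ {x} s → classify s (sq? (x - d))) proj₁ proj₁ (λ (_ , s) (_ , n) → n s))
      (cong (a ℕ.+_) (sym A≡B))
      where
      size-B = size-dec {P = λ x → Sq x × ¬ Sq (x - d)} (λ x → sq? x ×-dec ¬? (sq? (x - d)))
      classify : ∀ {x} → Sq x → Dec (Sq (x - d)) → (Sq x × Sq (x - d)) ⊎ (Sq x × ¬ Sq (x - d))
      classify s (yes s′) = inj₁ (s , s′)
      classify s (no n) = inj₂ (s , n)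
      f : F → F
      f x = d * d * x ⁻¹
      f-Sq : ∀ {x} → Sq x → Sq (f x)
      f-Sq s = Sq-* (Sq-square d≢0) (Sq-⁻¹ s)
      f-shift : ∀ {x} → Sq x → f x - d ≡ d * (- 1# * x ⁻¹ * (x - d))
      f-shift {x} s = trans (cong (λ o → f x - o) (trans (sym (*-identityʳ d)) (cong (d *_) (sym (inverseʳ (Sq⇒≢0 s))))))
        ((solve 3 (λ d x i → d :* d :* i :- d :* (x :* i) := d :* ((:- (num 1)) :* i :* (x :- d))) refl) d x (x ⁻¹))
      factor : ∀ {x} → Sq x → Sq (- 1# * x ⁻¹)
      factor s = Sq-* -1∈Sq (Sq-⁻¹ s)
      f-injective : ∀ {x y} → Sq x → Sq y → f x ≡ f y → x ≡ y
      f-injective {x} {y} sx sy e = begin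
        x                    ≡⟨ *-identityʳ x ⟨
        x * 1#               ≡⟨ cong (x *_) (inverseʳ (Sq⇒≢0 sy)) ⟨
        x * (y * y ⁻¹)       ≡⟨ cong (λ i → x * (y * i)) (*-cancelˡ (*-nonzero d≢0 d≢0) e) ⟨
        x * (y * x ⁻¹)       ≡⟨ (solve 3 (λ x y i → x :* (y :* i) := y :* (x :* i)) refl) x y (x ⁻¹) ⟩
        y * (x * x ⁻¹)       ≡⟨ cong (y *_) (inverseʳ (Sq⇒≢0 sx)) ⟩
        y * 1#               ≡⟨ *-identityʳ y ⟩
        y                    ∎
        where open ≡-Reasoning
      x≢d : ∀ {x} → Sq x → x - d ≢ 0#
      x≢d s z = nd (subst Sq (x-y≡0⇒x≡y z) s)
      A≡B : a ≡ proj₁ size-B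
      A≡B = ℕ.≤-antisym
        (size-≤ size-A (proj₂ size-B) f (λ (s , s′) → f-Sq s , λ z → nonsquare-*-square nd (Sq-* (factor s) s′) (subst Sq (f-shift s) z))
          (λ (s , _) (s′ , _) → f-injective s s′))
        (size-≤ (proj₂ size-B) size-A f (λ (s , n) → f-Sq s , subst Sq (sym (f-shift s))
            (nonsquare-* d≢0 (*-nonzero (Sq⇒≢0 (factor s)) (x≢d s)) nd (square-*-nonsquare (factor s) n)))
          (λ (s , _) (s′ , _) → f-injective s s′))

  module PaleyLabelling {n} (Γ : Graph n) (p : ℕ) (pr : Prime p) (regular : Regular Γ p) (2gt : TwoGeodesicTransitive Γ)
    (some-geodesic : ∃ λ x → ∃ λ y → ∃ λ z → Is2Geodesic Γ x y z)
    (some-triangle : ∃ λ x → ∃ λ y → ∃ λ z → adj Γ x y ≡ true × adj Γ x z ≡ true × adj Γ y z ≡ true) where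
    open LocalGraphs Γ p pr regular (proj₁ 2gt) public
    open PrimeField p pr
    private module Cayley = CayleyStructure Γ p pr regular 2gt some-geodesic some-triangle
    open Cayley using (N; N0; N-neg; N-from; S; s?; k; size-S; some-S; some-N; geodesic⇒S; S⇒geodesic; labelling; labelling-at; multipliers; aperiodic)

    Common : Fin n → Fin n → Fin n → Set
    Common u w x = Adj u x × Adj w x

    Beyond : Fin n → Fin n → Fin n → Set
    Beyond u v w = Adj v w × u ≢ w × adj Γ u w ≡ false

    -- Distance exactly two. For an edge u v, `Beyond u v` is the part of the neighbourhood of v
    -- that is at distance two from u.
    Far : Fin n → Fin n → Set
    Far u w = ∃ λ v → Is2Geodesic Γ u v w

    far? : ∀ u w → Dec (Far u w)
    far? u w = any? λ v → ((adj Γ u v Bool.≟ true) ×-dec (adj Γ v w Bool.≟ true) ×-dec ¬? (u Fin.≟ w)) ×-dec (adj Γ u w Bool.≟ false)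

    private
      u₀ v₀ w₀ : Fin n
      u₀ = proj₁ some-geodesic
      v₀ = proj₁ (proj₂ some-geodesic)
      w₀ = proj₁ (proj₂ (proj₂ some-geodesic))
      g₀ : Is2Geodesic Γ u₀ v₀ w₀
      g₀ = proj₂ (proj₂ (proj₂ some-geodesic))

      opaque
        common₀ : ∃ (Size (Common u₀ w₀))
        common₀ = size-dec {P = Common u₀ w₀} (λ x → (adj Γ u₀ x Bool.≟ true) ×-dec (adj Γ w₀ x Bool.≟ true))
      c = proj₁ common₀

      -- Counted for one 2-geodesic and carried to the others by transitivity.
      size-common : ∀ {u v w} → Is2Geodesic Γ u v w → Size (Common u w) c
      size-common {u} {v} {w} g = go (proj₂ 2gt _ _ _ _ _ _ g₀ g)
        where
        go : (∃ λ σ → IsAut Γ σ × σ ⟨$⟩ʳ u₀ ≡ u × σ ⟨$⟩ʳ v₀ ≡ v × σ ⟨$⟩ʳ w₀ ≡ w) → Size (Common u w) c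
        go (σ , a , refl , _ , refl) = size-map (proj₂ common₀) (σ ⟨$⟩ʳ_) (λ {y} _ → σ ⟨$⟩ˡ y)
          (λ (b , b′) → trans (a _ _) b , trans (a _ _) b′) (λ (b , b′) → back b , back b′) (λ _ _ → perm-injective σ) (λ _ → Perm.inverseʳ σ)
          where
          back : ∀ {x y} → adj Γ (σ ⟨$⟩ʳ x) y ≡ true → adj Γ x (σ ⟨$⟩ˡ y) ≡ true
          back b = trans (sym (a _ _)) (trans (cong (adj Γ _) (Perm.inverseʳ σ)) b)

      size-beyond : ∀ {u v} → Adj u v → Size (Beyond u v) k
      size-beyond {u} {v} a = from (labelling-at (Adj-sym a))
        where
        from : (∃ λ (ℓ : Labelling N v) → ν ℓ 0# ≡ u) → Size (Beyond u v) k
        from (ℓ , refl) = size-map (proj₂ size-S) (ν ℓ) (λ (b , _) → position (nbrs ℓ) b)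
          (λ {s} Ss → let ((_ , b , ne) , e) = S⇒geodesic ℓ Ss in b , ne , e)
          (λ (b , ne , e) → (λ z → ne (trans (cong (ν ℓ) (sym z)) (enum-position (nbrs ℓ) b))) ,
            trans (sym (N-from ℓ _)) (trans (cong (adj Γ _) (enum-position (nbrs ℓ) b)) e))
          (λ _ _ → injective (nbrs ℓ)) (λ (b , _) → enum-position (nbrs ℓ) b)

      opaque
        size-far : ∀ u → ∃ (Size (Far u))
        size-far u = size-dec {P = Far u} (far? u)

      -- Edges between the first and the second neighbourhood of u, counted from either side.
      double-count : ∀ u → p ℕ.* k ≡ proj₁ (size-far u) ℕ.* c
      double-count u = size-≡ (size-Σ (neighbourhood u) (λ _ → size-beyond))
        (size-map (size-Σ (proj₂ (size-far u)) (λ _ (_ , g) → size-common g)) swap (λ {y} _ → swap y)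
          (λ ((_ , ((_ , _ , ne) , e)) , b , b′) → b , Adj-sym b′ , ne , e)
          (λ (b , b′ , ne , e) → (_ , (b , b′ , ne) , e) , b , Adj-sym b′)
          (λ { _ _ refl → refl }) (λ _ → refl))
        (λ x → x) (λ x → x)

      module _ {d} (Sd : S d) where
        Both : F → Set
        Both x = N x ≡ true × N (x - d) ≡ true

        opaque
          size-both : ∃ (Size Both)
          size-both = size-dec {P = Both} (λ x → (N x Bool.≟ true) ×-dec (N (x - d) Bool.≟ true))

        -- A label that is not adjacent to both labels 0 and d lies in S or in S + d. This includes
        -- d itself, and also 0, because S is closed under negation.
        p≤both+2k : p ≤ proj₁ size-both ℕ.+ (k ℕ.+ k)
        p≤both+2k = ℕ.≤-trans (size-cover (size-Fin p) (proj₂ size-both) (proj₂ size-rest) (λ {x} _ → classify x))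
          (ℕ.+-monoʳ-≤ (proj₁ size-both) (size-cover (proj₂ size-rest) (proj₂ size-S) shifted (λ r → r)))
          where
          size-rest = size-dec {P = λ x → S x ⊎ S (x - d)} (λ x → s? x ⊎-dec s? (x - d))
          shifted : Size (λ x → S (x - d)) k
          shifted = size-map (proj₂ size-S) (_+ d) (λ {y} _ → y - d) (λ {x} → subst S ((solve 2 (λ x d → x := x :+ d :- d) refl) x d)) (λ s → s)
            (λ {x} {y} _ _ e → trans ((solve 2 (λ x d → x := x :+ d :- d) refl) x d) (trans (cong (_- d) e) ((solve 2 (λ x d → x :+ d :- d := x) refl) y d)))
            (λ {y} _ → (solve 2 (λ y d → y :- d :+ d := y) refl) y d)
          first : ∀ {x} → N x ≡ false → Dec (x ≡ 0#) → S x ⊎ S (x - d)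
          first e (no ne) = inj₁ (ne , e)
          first e (yes refl) = inj₂ (subst S (sym (+-identityˡ _)) (neg-nonzero (proj₁ Sd) , trans (N-neg d) (proj₂ Sd)))
          second : ∀ {x} → N (x - d) ≡ false → Dec (x - d ≡ 0#) → S x ⊎ S (x - d)
          second e (no ne) = inj₂ (ne , e)
          second e (yes z) = inj₁ (subst S (sym (x-y≡0⇒x≡y z)) Sd)
          classify : ∀ x → Both x ⊎ (S x ⊎ S (x - d))
          classify x = go _ _ refl refl
            where
            go : ∀ b b′ → N x ≡ b → N (x - d) ≡ b′ → Both x ⊎ (S x ⊎ S (x - d))
            go true true e e′ = inj₁ (e , e′)
            go false _ e _ = inj₂ (first e (x ≟ 0#))
            go true false _ e′ = inj₂ (second e′ (x - d ≟ 0#))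

        both<c : proj₁ size-both < c
        both<c = size-disjoint (size-common (S⇒geodesic ℓ Sd)) (size-singleton v₀)
          (size-map {Q = λ y → ∃ λ x → Both x × y ≡ ν ℓ x} (proj₂ size-both) (ν ℓ) (λ (x , _) → x) (λ b → _ , b , refl) (λ (_ , b , _) → b) (λ _ _ → injective (nbrs ℓ)) (λ (_ , _ , e) → sym e))
          (λ { refl → Adj-sym (sound (nbrs ℓ) 0#) , Adj-sym (sound (nbrs ℓ) d) })
          (λ { (x , (b , b′) , refl) → trans (N-from ℓ x) b , trans (difference ℓ d x) b′ })
          (λ { refl (x , _ , e) → Adj⇒≢ (sound (nbrs ℓ) x) e })
          where
          ℓ : Labelling N v₀
          ℓ = labelling v₀

      c>0 : 0 < c
      c>0 = ℕ.≤-<-trans z≤n (both<c (proj₂ some-S))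

      c≤p : c ≤ p
      c≤p = size-≤ (size-common g₀) (neighbourhood u₀) (λ x → x) proj₁ (λ _ _ e → e)

      -- With c = p two nonadjacent neighbours of v₀ would have the same neighbourhood, and the
      -- difference of their labels would be a period of N.
      c≢p : c ≢ p
      c≢p c≡p = aperiodic N0 (proj₂ some-N) (proj₁ Sd) λ x → trans (sym (agree (x + d)))
        (cong N ((solve 2 (λ x d → x :+ d :- d := x) refl) x d))
        where
        d = proj₁ some-S
        Sd = proj₂ some-S
        ℓ = labelling v₀
        g = S⇒geodesic ℓ Sd
        common? : ∀ x → Dec (Common (ν ℓ 0#) (ν ℓ d) x)
        common? x = (adj Γ (ν ℓ 0#) x Bool.≟ true) ×-dec (adj Γ (ν ℓ d) x Bool.≟ true)
        first : ∀ {x} → Adj (ν ℓ 0#) x → Common (ν ℓ 0#) (ν ℓ d) x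
        first {x} = size-full (size-common g) (neighbourhood (ν ℓ 0#)) (ℕ.≤-reflexive (sym c≡p)) proj₁ (common? x)
        second : ∀ {x} → Adj (ν ℓ d) x → Common (ν ℓ 0#) (ν ℓ d) x
        second {x} = size-full (size-common g) (neighbourhood (ν ℓ d)) (ℕ.≤-reflexive (sym c≡p)) proj₂ (common? x)
        same : ∀ x → adj Γ (ν ℓ d) x ≡ adj Γ (ν ℓ 0#) x
        same x = true-iff (λ e → proj₁ (second e)) (λ e → proj₂ (first e))
        agree : ∀ x → N (x - d) ≡ N x
        agree x = trans (sym (difference ℓ d x)) (trans (same (ν ℓ x)) (N-from ℓ x))

      far-sizes-agree : ∀ u v → proj₁ (size-far u) ≡ proj₁ (size-far v)
      far-sizes-agree u v = ℕ.*-cancelʳ-≡ (proj₁ (size-far u)) (proj₁ (size-far v)) c {{ℕ.>-nonZero c>0}}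
        (trans (sym (double-count u)) (double-count v))

      k-multiple : ∀ m → proj₁ (size-far u₀) ≡ m ℕ.* p → k ≡ m ℕ.* c
      k-multiple m e = ℕ.*-cancelˡ-≡ k (m ℕ.* c) p (trans (double-count u₀) (trans (cong (ℕ._* c) (trans e (ℕ.*-comm m p))) (ℕ.*-assoc p m c)))

      p∣far : p ∣ proj₁ (size-far u₀) → ∃ λ m → k ≡ m ℕ.* c × (∀ u → proj₁ (size-far u) ≡ m ℕ.* p)
      p∣far (divides m e) = m , k-multiple m e , λ u → trans (far-sizes-agree u u₀) e

      p∤c : ¬ p ∣ c
      p∤c p∣c = ℕ.<⇒≱ (ℕ.≤∧≢⇒< c≤p c≢p) (∣⇒≤ {{ℕ.>-nonZero c>0}} p∣c)

      opaque
        -- p divides the product of c and the size of the second neighbourhood, but not c, as 0 < c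
        -- < p. So the second neighbourhood has m p elements, and cancelling p leaves k = m c.
        c∣k : ∃ λ m → k ≡ m ℕ.* c × (∀ u → proj₁ (size-far u) ≡ m ℕ.* p)
        c∣k = [ p∣far , (λ p∣c → contradiction p∣c p∤c) ]′
          (euclidsLemma (proj₁ (size-far u₀)) c pr (divides k (trans (sym (double-count u₀)) (ℕ.*-comm p k))))

      m₀ = proj₁ c∣k

      k>0 : 0 < k
      k>0 = size>0 (proj₂ size-S) (proj₂ some-S)

      c≤k : c ≤ k
      c≤k = go m₀ (proj₁ (proj₂ c∣k))
        where
        go : ∀ m → k ≡ m ℕ.* c → c ≤ k
        go zero e = contradiction e (ℕ.>⇒≢ k>0)
        go (suc m) e = subst (c ≤_) (sym e) (ℕ.m≤m+n c _)

      p<3k : p < k ℕ.+ k ℕ.+ k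
      p<3k = subst (p <_) (sym (ℕ.+-assoc k k k)) (ℕ.≤-<-trans (p≤both+2k (proj₂ some-S))
        (ℕ.+-monoˡ-< (k ℕ.+ k) (ℕ.<-≤-trans (both<c (proj₂ some-S)) c≤k)))

      r₀ = proj₁ some-N
      Nr₀ = proj₂ some-N
      r₀≢0 = Cayley.N⇒≢0 N0 Nr₀ Nr₀

    h : ℕ
    h = k

    opaque
      p-odd : p ≡ suc (h ℕ.+ h)
      p-odd = Cayley.half N0 Nr₀ (proj₂ size-S) (proj₂ some-S) multipliers p<3k

    open SquareClasses p pr h p-odd public

    private opaque
      N-Sq : ∀ {d} → N (r₀ * d) ≡ true → Sq d
      N-Sq = Cayley.N⇒Sq N0 Nr₀ (proj₂ size-S) (proj₂ some-S) multipliers p<3k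

      Sq-N : ∀ {d} → Sq d → N (r₀ * d) ≡ true
      Sq-N = Cayley.Sq⇒N N0 Nr₀ (proj₂ size-S) (proj₂ some-S) multipliers p<3k

    private
      N-isSq : ∀ d → N (r₀ * d) ≡ isSq d
      N-isSq d with N (r₀ * d) in e
      ... | true = sym (Sq⇒isSq (N-Sq e))
      ... | false = sym (¬Sq⇒isSq λ s → contradiction (trans (sym e) (Sq-N s)) λ ())

      scaling : Permutation′ p
      scaling = permutation (r₀ *_) (r₀ ⁻¹ *_) (λ x → trans (sym (*-assoc _ _ x)) (trans (cong (_* x) (inverseʳ r₀≢0)) (*-identityˡ x)))
        (λ x → trans (sym (*-assoc _ _ x)) (trans (cong (_* x) (inverseˡ r₀≢0)) (*-identityˡ x)))

    -- The neighbours of label 0 are the labels r₀ times a square; rescaling by r₀ makes them the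
    -- squares.
    paley : ∀ {u v} → Adj v u → ∃ λ (ℓ : Labelling isSq v) → ν ℓ 0# ≡ u
    paley {v = v} = based (relabel scaling (λ x y → trans (cong N ((solve 3 (λ r x y → r :* y :- r :* x := r :* (y :- x)) refl) r₀ x y)) (N-isSq (y - x))) (labelling v))

    -- Adjacency is symmetric, so the neighbours of label 0, and with them the squares, are closed
    -- under negation.
    -1∈Sq : Sq (- 1#)
    -1∈Sq = N-Sq (trans (cong N ((solve 1 (λ r → r :* (:- (num 1)) := :- (r :* (num 1))) refl) r₀)) (trans (N-neg _) (Sq-N Sq-1)))

    private
      size-Sq : Size Sq k
      size-Sq = size-map (subst (Size (λ x → N x ≡ true)) kN≡k (proj₂ kN)) (r₀ ⁻¹ *_) (λ {y} _ → r₀ * y)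
        (λ {x} e → N-Sq (trans (cong N (trans (sym (*-assoc _ _ x)) (trans (cong (_* x) (inverseʳ r₀≢0)) (*-identityˡ x)))) e)) Sq-N
        (λ _ _ → *-cancelˡ (⁻¹-nonzero r₀≢0)) (λ {y} _ → trans (sym (*-assoc _ _ y)) (trans (cong (_* y) (inverseˡ r₀≢0)) (*-identityˡ y)))
        where
        kN = Cayley.neighbours N0 Nr₀ (proj₂ size-S)
        kN≡k : proj₁ kN ≡ k
        kN≡k = ℕ.+-cancelʳ-≡ k _ _ (ℕ.suc-injective (trans (sym (Cayley.class-sizes N0 Nr₀ (proj₂ size-S))) p-odd))

      k≡2both : ∀ {d} (Sd : S d) → k ≡ proj₁ (size-both Sd) ℕ.+ proj₁ (size-both Sd)
      k≡2both {d} Sd = PaleyCount.paley-common p pr h p-odd -1∈Sq (*-nonzero (⁻¹-nonzero r₀≢0) (proj₁ Sd)) d-nonsquare size-Sq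
        (size-map (proj₂ (size-both Sd)) (r₀ ⁻¹ *_) (λ {y} _ → r₀ * y)
          (λ {x} (e , e′) → N-Sq (trans (cong N (undo x)) e) ,
            N-Sq (trans (cong N (trans ((solve 4 (λ r i x d → r :* (i :* x :- i :* d) := r :* (i :* (x :- d))) refl) r₀ (r₀ ⁻¹) x d) (undo (x - d)))) e′))
          (λ {y} (s , s′) → Sq-N s , trans (cong N (trans (cong (λ z → r₀ * y - z) (sym (undo d))) ((solve 3 (λ r y d → r :* y :- r :* d := r :* (y :- d)) refl) r₀ y (r₀ ⁻¹ * d)))) (Sq-N s′))
          (λ _ _ → *-cancelˡ (⁻¹-nonzero r₀≢0)) (λ {y} _ → trans (sym (*-assoc _ _ y)) (trans (cong (_* y) (inverseˡ r₀≢0)) (*-identityˡ y))))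
        where
        undo : ∀ x → r₀ * (r₀ ⁻¹ * x) ≡ x
        undo x = trans (sym (*-assoc _ _ x)) (trans (cong (_* x) (inverseʳ r₀≢0)) (*-identityˡ x))
        d-nonsquare : ¬ Sq (r₀ ⁻¹ * d)
        d-nonsquare s = contradiction (trans (sym (proj₂ Sd)) (trans (cong N (sym (undo d))) (Sq-N s))) λ ()

    -- Two nonadjacent vertices of the local graph have α common neighbours within it, and p = 4 α +
    -- 1.
    α : ℕ
    α = proj₁ (size-both (proj₂ some-S))

    h≡2α : h ≡ α ℕ.+ α
    h≡2α = k≡2both (proj₂ some-S)

    private
      -- By the Paley count k is twice the size of `Both`, hence less than 2 c, while k = m c with k
      -- positive.
      m₀≡1 : m₀ ≡ 1
      m₀≡1 = go m₀ (proj₁ (proj₂ c∣k))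
        where
        go : ∀ m → k ≡ m ℕ.* c → m ≡ 1
        go zero e = contradiction e (ℕ.>⇒≢ k>0)
        go (suc zero) e = refl
        go (suc (suc m)) e = contradiction (subst (c ℕ.+ c ≤_) (sym (trans e (sym (ℕ.+-assoc c c _)))) (ℕ.m≤m+n (c ℕ.+ c) _))
          (ℕ.<⇒≱ (subst (_< c ℕ.+ c) (sym h≡2α) (ℕ.+-mono-< (both<c (proj₂ some-S)) (both<c (proj₂ some-S)))))

    common-size : ∀ {u v w} → Is2Geodesic Γ u v w → Size (Common u w) h
    common-size {u} {w = w} g = subst (Size (Common u w)) (sym (trans (proj₁ (proj₂ c∣k)) (trans (cong (ℕ._* c) m₀≡1) (ℕ.+-identityʳ c)))) (size-common g)

    far-size : ∀ u → Size (Far u) p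
    far-size u = subst (Size (Far u)) (trans (proj₂ (proj₂ c∣k) u) (trans (cong (ℕ._* p) m₀≡1) (ℕ.+-identityʳ p))) (proj₂ (size-far u))

    beyond-size : ∀ {u v} → Adj u v → Size (Beyond u v) h
    beyond-size = size-beyond

-- Vectors modulo squares as a model of the graphs.

module VectorModels where

  open import Defs hiding (module Mat; sym)
  open Field
  open Squares
  open import Data.Nat using (ℕ)
  open import Data.Nat.Primality using (Prime)
  open import Data.Fin using (Fin)
  open import Data.Product using (∃; _×_; _,_; proj₁; proj₂)
  open import Relation.Binary.PropositionalEquality hiding ([_])

  module Vectors (p : ℕ) (pr : Prime p) where
    open PrimeField p pr
    open SquareBasics p pr

    Nonzero : F × F → Set
    Nonzero v = v ≢ (0# , 0#)

    det : F × F → F × F → F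
    det (x , y) (x′ , y′) = x * y′ - y * x′

    scale : F → F × F → F × F
    scale c (x , y) = c * x , c * y

    scale-nonzero : ∀ {c v} → c ≢ 0# → Nonzero v → Nonzero (scale c v)
    scale-nonzero {c} c≢0 nv e = nv (cong₂ _,_ (*-cancelˡ c≢0 (trans (cong proj₁ e) (sym (zeroʳ c)))) (*-cancelˡ c≢0 (trans (cong proj₂ e) (sym (zeroʳ c)))))

    -- The vertices are the nonzero vectors of F² modulo multiplication by nonzero squares.
    record VectorModel {n} (Γ : Graph n) (s : F) : Set where
      field
        ψ : F × F → Fin n
        onto : ∀ u → ∃ λ v → Nonzero v × ψ v ≡ u
        same : ∀ {v w} → Nonzero v → Nonzero w → ψ v ≡ ψ w → ∃ λ q → q ≢ 0# × w ≡ scale (q * q) v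
        scaled : ∀ {q v} → q ≢ 0# → Nonzero v → ψ (scale (q * q) v) ≡ ψ v
        adjacent : ∀ {v w} → Nonzero v → Nonzero w → adj Γ (ψ v) (ψ w) ≡ isSq (s * det v w)

-- Antipodes, and the identification with the vector model.

module Antipodal where

  open import Defs hiding (module Mat; sym)
  open Field
  open Sizes
  open Orbits
  open Squares
  open Counting
  open VectorModels
  open import Data.Nat as ℕ using (ℕ; zero; suc; _<_; _≤_; s≤s)
  import Data.Nat.Properties as ℕ
  open import Data.Nat.Divisibility using (_∣_; divides)
  open import Data.Nat.Primality using (Prime; euclidsLemma; prime?)
  open import Data.Bool using (Bool; true; false; not)
  import Data.Bool.Properties as Bool
  open import Data.Fin as Fin using (Fin; toℕ)
  open import Data.Fin.Properties as Fin using (any?)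
  open import Data.Fin.Permutation as Perm using (_⟨$⟩ʳ_; flip)
  open import Data.Product using (∃; _×_; _,_; proj₁; proj₂; swap)
  open import Data.Sum using (_⊎_; inj₁; inj₂; [_,_]′)
  open import Data.Unit using (tt)
  open import Relation.Nullary using (¬_; Dec; yes; no; contradiction)
  open import Relation.Nullary.Decidable using (_×-dec_; ¬?; toWitness)
  open import Relation.Binary.PropositionalEquality hiding ([_])

  module Antipodes {n} (Γ : Graph n) (p : ℕ) (pr : Prime p) (regular : Regular Γ p) (connected : Connected Γ) (2gt : TwoGeodesicTransitive Γ)
    (some-geodesic : ∃ λ x → ∃ λ y → ∃ λ z → Is2Geodesic Γ x y z)
    (some-triangle : ∃ λ x → ∃ λ y → ∃ λ z → adj Γ x y ≡ true × adj Γ x z ≡ true × adj Γ y z ≡ true) where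
    open PaleyLabelling Γ p pr regular 2gt some-geodesic some-triangle public
    open PrimeField p pr
    open Vectors p pr

    Far-sym : ∀ {u w} → Far u w → Far w u
    Far-sym (v , (a , b , ne) , e) = v , (Adj-sym b , Adj-sym a , λ z → ne (sym z)) , trans (Graph.sym Γ _ _) e

    Far⇒≢ : ∀ {u w} → Far u w → u ≢ w
    Far⇒≢ (_ , (_ , _ , ne) , _) = ne

    Far⇒¬Adj : ∀ {u w} → Far u w → ¬ Adj u w
    Far⇒¬Adj (_ , _ , e) a = contradiction (trans (sym e) a) λ ()

    Far-via : ∀ {u v w} → Adj u v → Adj v w → u ≢ w → ¬ Adj u w → Far u w
    Far-via a b ne na = _ , (a , b , ne) , ¬Adj⇒false na

    adj? : ∀ u v → Dec (Adj u v)
    adj? u v = adj Γ u v Bool.≟ true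

    -- When w is at distance two from u, this says that z is a neighbour of w at distance three from
    -- u.
    Third : Fin n → Fin n → Fin n → Set
    Third u w z = Adj w z × z ≢ u × ¬ Adj u z × ¬ Far u z

    third? : ∀ u w z → Dec (Third u w z)
    third? u w z = adj? w z ×-dec ¬? (z Fin.≟ u) ×-dec ¬? (adj? u z) ×-dec ¬? (far? u z)

    module _ {u w} (far : Far u w) where
      common? : ∀ x → Dec (Common u w x)
      common? x = adj? u x ×-dec adj? w x

      -- If a common neighbour of u and w were adjacent to z, then z would be at distance two from
      -- u.
      Common⇒Beyond : ∀ {z x} → Third u w z → Common u w x → Beyond z w x
      Common⇒Beyond {z} {x} (a , z≢u , nadj , nfar) (ux , wx) = wx , (λ { refl → nadj ux }) ,
        ¬Adj⇒false λ zx → nfar (Far-via ux (Adj-sym zx) (λ e → z≢u (sym e)) nadj)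

      -- Both sets have h elements, so the inclusion is an equality. Hence the nonneighbours of z
      -- around w are the same for every such z.
      Beyond⇒Common : ∀ {z x} → Third u w z → Beyond z w x → Common u w x
      Beyond⇒Common {z} {x} th = size-full (common-size (proj₂ far)) (beyond-size (Adj-sym (proj₁ th))) ℕ.≤-refl (Common⇒Beyond th) (common? x)

      -- Two such vertices would make the nonsquares invariant under a nonzero translation.
      Third-unique : ∀ {z z′} → Third u w z → Third u w z′ → z ≡ z′
      Third-unique {z} {z′} th th′ = from (paley (proj₁ th))
        where
        from : (∃ λ (ℓ : Labelling isSq w) → ν ℓ 0# ≡ z) → z ≡ z′
        from (ℓ , refl) = by (d ≟ 0#)
          where
          d = position (nbrs ℓ) (proj₁ th′)
          νd : ν ℓ d ≡ z′
          νd = enum-position (nbrs ℓ) (proj₁ th′)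
          Nonsquare : F → Set
          Nonsquare x = x ≢ 0# × ¬ Sq x
          beyond : ∀ {x} → Nonsquare x → Beyond (ν ℓ 0#) w (ν ℓ x)
          beyond {x} (x≢0 , nx) = sound (nbrs ℓ) x , (λ e → x≢0 (sym (injective (nbrs ℓ) e))) ,
            trans (difference ℓ 0# x) (¬Sq⇒isSq (λ s → nx (subst Sq ((solve 1 (λ x → x :- (num 0) := x) refl) x) s)))
          beyond⁻ : ∀ {x} → Beyond (ν ℓ d) w (ν ℓ x) → Nonsquare (x - d)
          beyond⁻ {x} (_ , ne , e) = (λ z → ne (cong (ν ℓ) (sym (x-y≡0⇒x≡y z)))) , isSq-false (trans (sym (difference ℓ d x)) e)
          shift : ∀ {x} → Nonsquare x → Nonsquare (x - d)
          shift ns = beyond⁻ (subst (λ z → Beyond z w _) (sym νd) (Common⇒Beyond th′ (Beyond⇒Common th (beyond ns))))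
          multiple : ∀ k → Nonsquare (t - [ k ] * d)
          multiple zero = subst Nonsquare ((solve 2 (λ t d → t := t :- (num 0) :* d) refl) t d) (t≢0 , t-nonsquare)
          multiple (suc k) = subst Nonsquare (trans ((solve 3 (λ t k d → t :- k :* d :- d := t :- ((num 1) :+ k) :* d) refl) t [ k ] d)
            (cong (λ c → t - c * d) (sym ([suc] k)))) (shift (multiple k))
          by : Dec (d ≡ 0#) → ν ℓ 0# ≡ z′
          by (yes d≡0) = trans (cong (ν ℓ) (sym d≡0)) νd
          by (no d≢0) = contradiction (trans (cong (λ c → t - c) hit) (-‿inverseʳ t)) (proj₁ (multiple (toℕ (t * d ⁻¹))))
            where
            hit : [ toℕ (t * d ⁻¹) ] * d ≡ t
            hit = trans (cong (_* d) ([]-toℕ _)) (trans (*-assoc t _ d) (trans (cong (t *_) (inverseˡ d≢0)) (*-identityʳ t)))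

    odd-nondivisible : ∀ {m} k → m ≡ suc (k ℕ.+ k) → ¬ 2 ∣ m
    odd-nondivisible k e (divides q e′) = even≢odd q k (trans (cong (q ℕ.+_) (sym (ℕ.+-identityʳ q))) (trans (ℕ.*-comm 2 q) (trans (sym e′) e)))

    classify : ∀ {u w} → Far u w → ∀ {x} → Adj w x → Common u w x ⊎ Far u x ⊎ Third u w x
    classify {u} {w} far {x} wx = go (adj? u x) (far? u x)
      where
      go : Dec (Adj u x) → Dec (Far u x) → Common u w x ⊎ Far u x ⊎ Third u w x
      go (yes ux) _ = inj₁ (ux , wx)
      go (no _) (yes f) = inj₂ (inj₁ f)
      go (no nux) (no nf) = inj₂ (inj₂ (wx , (λ { refl → Far⇒¬Adj far (Adj-sym wx) }) , nux , nf))

    -- Otherwise the graph induced on the p vertices at distance two from u would be regular of odd valency h + 1.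
    some-third : ∀ u → ∃ λ w → ∃ λ z → Far u w × Third u w z
    some-third u = go (any? λ w → any? λ z → far? u w ×-dec third? u w z)
      where
      go : Dec (∃ λ w → ∃ λ z → Far u w × Third u w z) → ∃ λ w → ∃ λ z → Far u w × Third u w z
      go (yes found) = found
      go (no none) = contradiction 2∣pairs
        [ odd-nondivisible h p-odd , odd-nondivisible α (cong suc h≡2α) ]′
        where
        Inner : Fin n → Fin n → Set
        Inner w z = Adj w z × Far u z
        size-inner : ∀ w → Far u w → Size (Inner w) (suc h)
        size-inner w far = subst (Size (Inner w)) (ℕ.+-cancelˡ-≡ h _ _ (trans (sym split) (trans p-odd (sym (ℕ.+-suc h h))))) (proj₂ inner)
          where
          inner = size-dec {P = Inner w} (λ z → adj? w z ×-dec far? u z)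
          split : p ≡ h ℕ.+ proj₁ inner
          split = size-split (neighbourhood w) (common-size (proj₂ far)) (proj₂ inner)
            (λ {x} wx → [ inj₁ , [ (λ f → inj₂ (wx , f)) , (λ th → contradiction (w , x , far , th) none) ]′ ]′ (classify far wx))
            proj₂ proj₁ (λ (ux , _) (_ , f) → Far⇒¬Adj f ux)
        -- Reversing an arc has no fixed point, so the number p (h + 1) of arcs among the vertices
        -- at distance two is even; but p is odd and h = 2 α.
        2∣pairs : 2 ∣ p ⊎ 2 ∣ suc h
        2∣pairs = euclidsLemma p (suc h) (toWitness {a? = prime? 2} tt) (free-orbits (toWitness {a? = prime? 2} tt)
          (size-Σ (far-size u) size-inner) swap (λ (f , a , f′) → f′ , Adj-sym a , f) (λ _ → refl)
          (λ { (_ , a , _) e → Adj⇒≢ a (sym (cong proj₁ e)) }))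

    Far-aut : ∀ {σ u w} → IsAut Γ σ → Far u w → Far (σ ⟨$⟩ʳ u) (σ ⟨$⟩ʳ w)
    Far-aut {σ} a (v , (b , c , ne) , e) = σ ⟨$⟩ʳ v , (trans (a _ _) b , trans (a _ _) c , λ z → ne (perm-injective σ z)) , trans (a _ _) e

    Far-aut⁻ : ∀ {σ u w} → IsAut Γ σ → Far (σ ⟨$⟩ʳ u) (σ ⟨$⟩ʳ w) → Far u w
    Far-aut⁻ {σ} a f = subst₂ Far (Perm.inverseˡ σ) (Perm.inverseˡ σ) (Far-aut {flip σ} (flip-aut {σ} a) f)

    -- The single instance from `some-third` is carried to every pair at distance two by an
    -- automorphism between 2-geodesics that start at u.
    third : ∀ {u w} → Far u w → ∃ λ z → Third u w z
    third {u} {w} (v , g) = go (some-third u)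
      where
      go : (∃ λ w → ∃ λ z → Far u w × Third u w z) → ∃ λ z → Third u w z
      go (w₁ , z₁ , (v₁ , g₁) , (a₁ , ne₁ , nadj₁ , nfar₁)) = move (proj₂ 2gt _ _ _ _ _ _ g₁ g)
        where
        move : (∃ λ σ → IsAut Γ σ × σ ⟨$⟩ʳ u ≡ u × σ ⟨$⟩ʳ v₁ ≡ v × σ ⟨$⟩ʳ w₁ ≡ w) → ∃ λ z → Third u w z
        move (σ , a , eu , _ , refl) = σ ⟨$⟩ʳ z₁ , trans (a _ _) a₁ , (λ e → ne₁ (perm-injective σ (trans e (sym eu)))) ,
          (λ b → nadj₁ (trans (sym (a _ _)) (subst (λ o → Adj o _) (sym eu) b))) ,
          (λ f → nfar₁ (Far-aut⁻ {σ} a (subst (λ o → Far o _) (sym eu) f)))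

    module _ {u z w} (far : Far u w) (th : Third u w z) where
      private
        Ball : Fin n → Set
        Ball y = Far u y × Adj z y

        joint = size-dec {P = λ y → Adj w y × Adj z y} (λ y → adj? w y ×-dec adj? z y)

        joint-size : Size (λ y → Adj w y × Adj z y) h
        joint-size = subst (Size _) (ℕ.+-cancelˡ-≡ h _ _ (ℕ.suc-injective (trans (sym (trans split₁ (cong suc split₂))) p-odd))) (proj₂ joint)
          where
          rest = size-dec {P = λ y → Adj w y × z ≢ y} (λ y → adj? w y ×-dec ¬? (z Fin.≟ y))
          eq? : ∀ {y} → Adj w y → Dec (z ≡ y) → y ≡ z ⊎ (Adj w y × z ≢ y)
          eq? a (yes e) = inj₁ (sym e)
          eq? a (no ne) = inj₂ (a , ne)
          split₁ : p ≡ 1 ℕ.+ proj₁ rest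
          split₁ = size-split (neighbourhood w) (size-singleton z) (proj₂ rest) (λ {y} a → eq? a (z Fin.≟ y)) (λ { refl → proj₁ th }) proj₁ (λ { refl (_ , ne) → ne refl })
          by : ∀ {y} → Adj w y × z ≢ y → Dec (Adj z y) → Beyond z w y ⊎ (Adj w y × Adj z y)
          by (a , ne) (yes b) = inj₂ (a , b)
          by (a , ne) (no nb) = inj₁ (a , ne , ¬Adj⇒false nb)
          split₂ : proj₁ rest ≡ h ℕ.+ proj₁ joint
          split₂ = size-split (proj₂ rest) (beyond-size (Adj-sym (proj₁ th))) (proj₂ joint) (λ {y} r → by r (adj? z y))
            (λ (a , ne , _) → a , ne) (λ (a , b) → a , Adj⇒≢ b) (λ (_ , _ , e) (_ , b) → contradiction (trans (sym e) b) λ ())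

        joint⇒Ball : ∀ {y} → Adj w y × Adj z y → Ball y
        joint⇒Ball {y} (wy , zy) = [ (λ c → contradiction (trans (sym (proj₂ (proj₂ (Common⇒Beyond far th c)))) zy) λ ()) ,
          [ (λ f → f , zy) , (λ th′ → contradiction (Third-unique far th th′) (Adj⇒≢ zy)) ]′ ]′ (classify far wy)

      -- Besides w there are the h common neighbours of w and z: such a vertex is not adjacent to u
      -- by `Common⇒Beyond`, and it is not at distance three, since z is the only such neighbour of
      -- w.
      ball-size : ∀ {m} → Size (λ y → Far u y × Adj z y) m → suc h ≤ m
      ball-size S = size-disjoint S (size-singleton w) joint-size (λ { refl → far , Adj-sym (proj₁ th) }) joint⇒Ball (λ { refl (a , _) → Adj⇒≢ a refl })

    Third-at : ∀ {u w z y} → Third u w z → Adj z y → Third u y z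
    Third-at (_ , rest) zy = Adj-sym zy , rest

    -- By `Third-unique` the neighbours of z and of z′ at distance two from u are disjoint if z ≠
    -- z′. Each set has at least h + 1 elements, against only p = 2 h + 1 vertices at distance two.
    Third-global : ∀ {u w w′ z z′} → Far u w → Far u w′ → Third u w z → Third u w′ z′ → z ≡ z′
    Third-global {u} {w} {w′} {z} {z′} f f′ th th′ = go (z Fin.≟ z′)
      where
      go : Dec (z ≡ z′) → z ≡ z′
      go (yes e) = e
      go (no ne) = contradiction (size-disjoint (far-size u) (proj₂ B) (proj₂ B′) proj₁ proj₁
          (λ {y} (fy , zy) (_ , z′y) → ne (Third-unique fy (Third-at th zy) (Third-at th′ z′y))))
        (ℕ.<⇒≱ (subst (_< proj₁ B ℕ.+ proj₁ B′) (sym p-odd)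
          (ℕ.<-≤-trans (s≤s (ℕ.≤-reflexive (sym (ℕ.+-suc h h)))) (ℕ.+-mono-≤ (ball-size f th (proj₂ B)) (ball-size f′ th′ (proj₂ B′))))))
        where
        B = size-dec {P = λ y → Far u y × Adj z y} (λ y → far? u y ×-dec adj? z y)
        B′ = size-dec {P = λ y → Far u y × Adj z′ y} (λ y → far? u y ×-dec adj? z′ y)

    record Opposite (u z : Fin n) : Set where
      field
        distinct : u ≢ z
        nonadjacent : ¬ Adj u z
        notfar : ¬ Far u z
        Far⇒Adj : ∀ {w} → Far u w → Adj z w
        Adj⇒Far : ∀ {w} → Adj z w → Far u w
        cover : ∀ x → x ≡ u ⊎ Adj u x ⊎ Far u x ⊎ x ≡ z
    open Opposite public

    opaque
      opposite : ∀ u → ∃ (Opposite u)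
      opposite u = go (third far₀)
        where
        w₀ : Fin n
        w₀ = enum (far-size u) 0#
        far₀ : Far u w₀
        far₀ = sound (far-size u) 0#
        go : (∃ λ z → Third u w₀ z) → ∃ (Opposite u)
        go (z , th) = z , record
          { distinct = λ e → proj₁ (proj₂ th) (sym e) ; nonadjacent = proj₁ (proj₂ (proj₂ th)) ; notfar = proj₂ (proj₂ (proj₂ th))
          ; Far⇒Adj = f⇒a
          ; Adj⇒Far = λ {w} → size-full (far-size u) (neighbourhood z) ℕ.≤-refl f⇒a (far? u w)
          ; cover = λ x → spread (connected u x) (inj₁ refl) }
          where
          f⇒a : ∀ {w} → Far u w → Adj z w
          f⇒a f = subst (λ z → Adj z _) (Third-global f far₀ (proj₂ (third f)) th) (Adj-sym (proj₁ (proj₂ (third f))))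
          Covered : Fin n → Set
          Covered x = x ≡ u ⊎ Adj u x ⊎ Far u x ⊎ x ≡ z
          -- The vertices listed in `Covered` are closed under adjacency, so connectedness makes
          -- them the whole graph.
          next : ∀ {x y} → Adj x y → Covered x → Covered y
          next b (inj₁ refl) = inj₂ (inj₁ b)
          next {x} {y} b (inj₂ (inj₁ a)) = by (y Fin.≟ u) (adj? u y)
            where
            by : Dec (y ≡ u) → Dec (Adj u y) → Covered y
            by (yes e) _ = inj₁ e
            by (no _) (yes c) = inj₂ (inj₁ c)
            by (no ne) (no nc) = inj₂ (inj₂ (inj₁ (Far-via a b (λ e → ne (sym e)) nc)))
          next b (inj₂ (inj₂ (inj₁ f))) = [ (λ c → inj₂ (inj₁ (proj₁ c))) , [ (λ f′ → inj₂ (inj₂ (inj₁ f′))) ,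
            (λ th′ → inj₂ (inj₂ (inj₂ (Third-global f far₀ th′ th)))) ]′ ]′ (classify f b)
          next b (inj₂ (inj₂ (inj₂ refl))) = inj₂ (inj₂ (inj₁ (size-full (far-size u) (neighbourhood z) ℕ.≤-refl f⇒a (far? u _) b)))
          spread : ∀ {x y} → Reach Γ x y → Covered x → Covered y
          spread here c = c
          spread (step b r) c = spread r (next b c)

    bar : Fin n → Fin n
    bar u = proj₁ (opposite u)

    bar-opposite : ∀ u → Opposite u (bar u)
    bar-opposite u = proj₂ (opposite u)

    bar-unique : ∀ {u z} → u ≢ z → ¬ Adj u z → ¬ Far u z → z ≡ bar u
    bar-unique {u} {z} ne na nf = [ (λ e → contradiction (sym e) ne) , [ (λ a → contradiction a na) , [ (λ f → contradiction f nf) , (λ e → e) ]′ ]′ ]′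
      (cover (bar-opposite u) z)

    bar-bar : ∀ u → bar (bar u) ≡ u
    bar-bar u = sym (bar-unique (λ e → distinct o (sym e)) (λ a → nonadjacent o (Adj-sym a)) (λ f → notfar o (Far-sym f)))
      where
      o = bar-opposite u

    bar-injective : ∀ {u v} → bar u ≡ bar v → u ≡ v
    bar-injective e = trans (sym (bar-bar _)) (trans (cong bar e) (bar-bar _))

    Far-bar : ∀ {u v} → Adj u v → Far u (bar v)
    Far-bar {u} {v} a = [ (λ e → contradiction (subst (Adj v) (sym e) (Adj-sym a)) (nonadjacent (bar-opposite v))) ,
      [ (λ b → contradiction (Adj-sym a) (Far⇒¬Adj (Adj⇒Far (bar-opposite v) (Adj-sym b)))) ,
      [ (λ f → f) , (λ e → contradiction (sym (bar-injective e)) (Adj⇒≢ a)) ]′ ]′ ]′ (cover (bar-opposite u) (bar v))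

    -- The neighbours of the antipode of v are exactly the vertices at distance two from v, and
    -- apart from v and its antipode nothing lies further away.
    bar-adj : ∀ {v w} → v ≢ w → w ≢ bar v → adj Γ (bar v) w ≡ not (adj Γ v w)
    bar-adj {v} {w} v≢w w≢v̄ = go (adj Γ v w) refl
      where
      go : ∀ b → adj Γ v w ≡ b → adj Γ (bar v) w ≡ not b
      go true e = ¬Adj⇒false λ a → Far⇒¬Adj (Adj⇒Far (bar-opposite v) a) e
      go false e = Far⇒Adj (bar-opposite v) ([ (λ z → contradiction (sym z) v≢w) ,
        [ (λ a → contradiction (trans (sym e) a) λ ()) , [ (λ f → f) , (λ z → contradiction z w≢v̄) ]′ ]′ ]′ (cover (bar-opposite v) w))

    bar-irreflexive : ∀ v → adj Γ (bar v) v ≡ false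
    bar-irreflexive v = ¬Adj⇒false λ a → nonadjacent (bar-opposite v) (Adj-sym a)

    v≢bar-v : ∀ v → v ≢ bar v
    v≢bar-v v = distinct (bar-opposite v)

    opaque
      -- The two vertices of an antipodal fibre, indexed so that the square class of a vector can
      -- select one of them.
      twist : Bool → Fin n → Fin n
      twist true v = v
      twist false v = bar v

      twist-true : ∀ v → v ≡ twist true v
      twist-true v = refl

      twist-false : ∀ v → bar v ≡ twist false v
      twist-false v = refl

      -- Each passage to an antipode negates adjacency between different fibres, and `eqb`
      -- multiplies these signs.
      twist-adj : ∀ a b {v w} → v ≢ w → w ≢ bar v → adj Γ (twist a v) (twist b w) ≡ eqb (eqb a b) (adj Γ v w)
      twist-adj true true _ _ = refl
      twist-adj false true v≢w w≢v̄ = bar-adj v≢w w≢v̄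
      twist-adj true false {v} {w} v≢w w≢v̄ = trans (Graph.sym Γ _ _) (trans (bar-adj (λ e → v≢w (sym e))
        (λ e → w≢v̄ (trans (sym (bar-bar w)) (cong bar (sym e))))) (cong not (Graph.sym Γ w v)))
      twist-adj false false {v} {w} v≢w w≢v̄ = trans (bar-adj (λ e → w≢v̄ (trans (sym (bar-bar w)) (cong bar (sym e)))) (λ e → v≢w (sym (bar-injective e))))
        (trans (cong not (twist-adj true false v≢w w≢v̄)) (Bool.not-involutive _))

      twist-irreflexive : ∀ a b v → adj Γ (twist a v) (twist b v) ≡ false
      twist-irreflexive true true v = irrefl Γ v
      twist-irreflexive false false v = irrefl Γ _
      twist-irreflexive false true v = bar-irreflexive v
      twist-irreflexive true false v = trans (Graph.sym Γ _ _) (bar-irreflexive v)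

      twist-injective : ∀ a b {v w} → w ≢ bar v → twist a v ≡ twist b w → v ≡ w × a ≡ b
      twist-injective true true _ e = e , refl
      twist-injective false false _ e = bar-injective e , refl
      twist-injective true false {w = w} ne e = contradiction (trans (sym (bar-bar w)) (cong bar (sym e))) ne
      twist-injective false true ne e = contradiction (sym e) ne

    private
      ∞ : Fin n
      ∞ = proj₁ some-geodesic

    opaque
      ℓ∞ : Labelling isSq ∞
      ℓ∞ = proj₁ (paley (proj₁ (proj₁ (proj₂ (proj₂ (proj₂ some-geodesic))))))

    private
      bar-ν : ∀ a → Far ∞ (bar (ν ℓ∞ a))
      bar-ν a = Far-bar (sound (nbrs ℓ∞) a)

      ν≢bar-ν : ∀ a b → ν ℓ∞ b ≢ bar (ν ℓ∞ a)
      ν≢bar-ν a b e = Far⇒¬Adj (bar-ν a) (subst (Adj ∞) e (sound (nbrs ℓ∞) b))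

      ν≢bar-∞ : ∀ a → ν ℓ∞ a ≢ bar ∞
      ν≢bar-∞ a e = nonadjacent (bar-opposite ∞) (subst (Adj ∞) e (sound (nbrs ℓ∞) a))

      ∞≢ν : ∀ a → ∞ ≢ ν ℓ∞ a
      ∞≢ν a = Adj⇒≢ (sound (nbrs ℓ∞) a)

      ∞≢bar-ν : ∀ a → ∞ ≢ bar (ν ℓ∞ a)
      ∞≢bar-ν a = Far⇒≢ (bar-ν a)

      place : (v : F × F) → Dec (proj₂ v ≡ 0#) → Fin n
      place (x , y) (yes _) = twist (isSq x) ∞
      place (x , y) (no _) = twist (isSq y) (ν ℓ∞ (x * y ⁻¹))

    -- The point x/y of the projective line names ∞ or a neighbour of ∞; the square class of the vector selects it or its antipode.
    point : F × F → Fin n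
    point v = place v (proj₂ v ≟ 0#)

    data View (v : F × F) : Set where
      infinite : proj₂ v ≡ 0# → proj₁ v ≢ 0# → point v ≡ twist (isSq (proj₁ v)) ∞ → View v
      finite : ∀ a → proj₂ v ≢ 0# → proj₁ v ≡ a * proj₂ v → point v ≡ twist (isSq (proj₂ v)) (ν ℓ∞ a) → View v

    view : ∀ v → Nonzero v → View v
    view v@(x , y) nz = go (y ≟ 0#) refl
      where
      go : ∀ d → point v ≡ place v d → View v
      go (yes y≡0) e = infinite y≡0 (λ x≡0 → nz (cong₂ _,_ x≡0 y≡0)) e
      go (no y≢0) e = finite (x * y ⁻¹) y≢0 (sym (trans (*-assoc x _ y) (trans (cong (x *_) (inverseˡ y≢0)) (*-identityʳ x)))) e

    -- For finite points with ratios a and a′ the determinant is - y y′ (a′ - a). The classes of y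
    -- and y′ are the two twists, the class of a′ - a is adjacency of the labels in the local graph,
    -- and the sign is a square.
    model-adjacent : ∀ {v w} → View v → View w → adj Γ (point v) (point w) ≡ isSq (det v w)
    model-adjacent {x , y} {x′ , y′} (infinite refl _ e) (infinite refl _ e′) = trans (cong₂ (adj Γ) e e′)
      (trans (twist-irreflexive _ _ ∞) (sym (trans (cong isSq ((solve 3 (λ x x′ z → x :* z :- z :* x′ := z :* (x :- x′)) refl) x x′ 0#)) (trans (cong isSq (zeroˡ _)) isSq-0))))
    model-adjacent {x , y} {x′ , y′} (infinite refl x≢0 e) (finite a y′≢0 _ e′) = trans (cong₂ (adj Γ) e e′) (trans (twist-adj _ _ (∞≢ν a) (ν≢bar-∞ a))
      (trans (trans (cong (eqb (eqb (isSq x) (isSq y′))) (sound (nbrs ℓ∞) a)) (eqb-true _))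
        (trans (sym (isSq-* x≢0 y′≢0)) (cong isSq ((solve 3 (λ x y x′ → x :* y := x :* y :- (num 0) :* x′) refl) x y′ x′)))))
    model-adjacent {x , y} {x′ , y′} (finite a y≢0 _ e) (infinite refl x′≢0 e′) = trans (cong₂ (adj Γ) e e′) (trans (twist-adj _ _ (λ z → ∞≢ν a (sym z)) (∞≢bar-ν a))
      (trans (trans (cong (eqb (eqb (isSq y) (isSq x′))) (Adj-sym (sound (nbrs ℓ∞) a))) (eqb-true _))
        (trans (sym (isSq-* y≢0 x′≢0)) (trans (isSq-neg -1∈Sq (y * x′)) (cong isSq ((solve 3 (λ x y x′ → :- (y :* x′) := x :* (num 0) :- y :* x′) refl) x y x′))))))
    model-adjacent {x , y} {x′ , y′} (finite a y≢0 refl e) (finite a′ y′≢0 refl e′) = trans (cong₂ (adj Γ) e e′) (go (a′ - a ≟ 0#))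
      where
      det-form : det (a * y , y) (a′ * y′ , y′) ≡ - (y * y′ * (a′ - a))
      det-form = (solve 4 (λ a y a′ y′ → a :* y :* y′ :- y :* (a′ :* y′) := :- (y :* y′ :* (a′ :- a))) refl) a y a′ y′
      go : Dec (a′ - a ≡ 0#) → adj Γ (twist (isSq y) (ν ℓ∞ a)) (twist (isSq y′) (ν ℓ∞ a′)) ≡ isSq (det (a * y , y) (a′ * y′ , y′))
      go (yes z) = trans (cong (λ b → adj Γ _ (twist (isSq y′) (ν ℓ∞ b))) (x-y≡0⇒x≡y z)) (trans (twist-irreflexive _ _ _)
        (sym (trans (cong isSq (trans det-form (trans (cong (λ d → - (y * y′ * d)) z) ((solve 1 (λ w → :- (w :* (num 0)) := (num 0)) refl) (y * y′))))) isSq-0)))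
      go (no nz) = trans (twist-adj _ _ (λ q → nz (trans (cong (_- a) (sym (injective (nbrs ℓ∞) q))) (-‿inverseʳ a))) (ν≢bar-ν a a′))
        (trans (cong₂ eqb (sym (isSq-* y≢0 y′≢0)) (difference ℓ∞ a a′)) (trans (sym (isSq-* (*-nonzero y≢0 y′≢0) nz))
          (trans (isSq-neg -1∈Sq _) (cong isSq (sym det-form)))))

    model-same : ∀ {v w} → View v → View w → point v ≡ point w → ∃ λ q → q ≢ 0# × w ≡ scale (q * q) v
    model-same {x , y} {x′ , y′} (infinite refl x≢0 e) (infinite refl x′≢0 e′) q = go (same-class x≢0 x′≢0 (proj₂ (twist-injective _ _ (v≢bar-v ∞) (trans (sym e) (trans q e′)))))
      where
      go : (∃ λ q → q ≢ 0# × x′ ≡ q * q * x) → _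
      go (q , q≢0 , eq) = q , q≢0 , cong₂ _,_ eq (sym (zeroʳ _))
    model-same (infinite _ _ e) (finite a _ _ e′) q = contradiction (proj₁ (twist-injective _ _ (ν≢bar-∞ a) (trans (sym e) (trans q e′)))) (∞≢ν a)
    model-same (finite a _ _ e) (infinite _ _ e′) q = contradiction (sym (proj₁ (twist-injective _ _ (∞≢bar-ν a) (trans (sym e) (trans q e′))))) (∞≢ν a)
    model-same {x , y} {x′ , y′} (finite a y≢0 refl e) (finite a′ y′≢0 refl e′) q = go (twist-injective _ _ (ν≢bar-ν a a′) (trans (sym e) (trans q e′)))
      where
      go : ν ℓ∞ a ≡ ν ℓ∞ a′ × isSq y ≡ isSq y′ → _
      go (eν , es) = by (injective (nbrs ℓ∞) eν) (same-class y≢0 y′≢0 es)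
        where
        by : a ≡ a′ → (∃ λ q → q ≢ 0# × y′ ≡ q * q * y) → ∃ λ q → q ≢ 0# × (a′ * y′ , y′) ≡ scale (q * q) (a * y , y)
        by refl (q , q≢0 , refl) = q , q≢0 , cong (_, q * q * y) ((solve 3 (λ a q y → a :* (q :* q :* y) := q :* q :* (a :* y)) refl) a q y)

    model-scale : ∀ {q v} → q ≢ 0# → View v → View (scale (q * q) v) → point (scale (q * q) v) ≡ point v
    model-scale {q} q≢0 (infinite _ x≢0 e) (infinite _ _ e′) = trans e′ (trans (cong (λ b → twist b ∞) (isSq-square-* q≢0 x≢0)) (sym e))
    model-scale {q} {x , y} q≢0 (infinite refl _ _) (finite _ ne _ _) = contradiction (zeroʳ _) ne
    model-scale q≢0 (finite _ y≢0 _ _) (infinite z _ _) = contradiction z (*-nonzero (*-nonzero q≢0 q≢0) y≢0)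
    model-scale {q} {x , y} q≢0 (finite a y≢0 refl e) (finite a′ _ eq e′) = trans e′ (trans (cong₂ (λ b c → twist b (ν ℓ∞ c)) (isSq-square-* q≢0 y≢0) a′≡a) (sym e))
      where
      a′≡a : a′ ≡ a
      a′≡a = *-cancelˡ (*-nonzero (*-nonzero q≢0 q≢0) y≢0) (trans (*-comm _ a′) (trans (sym eq) ((solve 3 (λ q a y → q :* (a :* y) := q :* y :* a) refl) (q * q) a y)))

    model-onto : ∀ w → ∃ λ v → Nonzero v × point v ≡ w
    model-onto w = [ (λ e → at-∞ 1# 1≢0 true (Sq⇒isSq Sq-1) (trans e (twist-true _))) , [ (λ a → at a) , [ (λ f → across f) , (λ e → at-∞ t t≢0 false (¬Sq⇒isSq t-nonsquare) (trans e (twist-false _))) ]′ ]′ ]′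
      (cover (bar-opposite ∞) w)
      where
      at-∞ : ∀ x → x ≢ 0# → ∀ b → isSq x ≡ b → w ≡ twist b ∞ → ∃ λ v → Nonzero v × point v ≡ w
      at-∞ x x≢0 b eb refl = (x , 0#) , nz , go (view (x , 0#) nz)
        where
        nz : Nonzero (x , 0#)
        nz z = x≢0 (cong proj₁ z)
        go : View (x , 0#) → point (x , 0#) ≡ twist b ∞
        go (infinite _ _ e) = trans e (cong (λ c → twist c ∞) eb)
        go (finite _ ne _ _) = contradiction refl ne
      at-ν : ∀ y → y ≢ 0# → ∀ b → isSq y ≡ b → ∀ a → w ≡ twist b (ν ℓ∞ a) → ∃ λ v → Nonzero v × point v ≡ w
      at-ν y y≢0 b eb a refl = (a * y , y) , nz , go (view (a * y , y) nz)
        where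
        nz : Nonzero (a * y , y)
        nz z = y≢0 (cong proj₂ z)
        go : View (a * y , y) → point (a * y , y) ≡ twist b (ν ℓ∞ a)
        go (infinite z _ _) = contradiction z y≢0
        go (finite a′ _ eq e) = trans e (cong₂ (λ c a → twist c (ν ℓ∞ a)) eb (*-cancelˡ y≢0 (trans (*-comm y a′) (trans (sym eq) (*-comm a y)))))
      at : Adj ∞ w → _
      at b = at-ν 1# 1≢0 true (Sq⇒isSq Sq-1) (position (nbrs ℓ∞) b) (trans (sym (enum-position (nbrs ℓ∞) b)) (twist-true _))
      across : Far ∞ w → _
      across f = at-ν t t≢0 false (¬Sq⇒isSq t-nonsquare) (position (nbrs ℓ∞) b) (trans (sym (bar-bar w)) (trans (cong bar (sym (enum-position (nbrs ℓ∞) b))) (twist-false _)))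
        where
        b : Adj ∞ (bar w)
        b = Adj-sym (Far⇒Adj (bar-opposite w) (Far-sym f))

    vector-model : VectorModel Γ 1#
    vector-model = record
      { ψ = point
      ; onto = model-onto
      ; same = λ nv nw → model-same (view _ nv) (view _ nw)
      ; scaled = λ {q} {v} q≢0 nv → model-scale q≢0 (view v nv) (view _ (scale-nonzero (*-nonzero q≢0 q≢0) nv))
      ; adjacent = λ {v} {w} nv nw → trans (model-adjacent (view v nv) (view w nw)) (cong isSq (sym (*-identityˡ (det v w)))) }

-- Linear automorphisms of the vector model.

module ModelTransitive where

  open import Defs hiding (module Mat; sym)
  open Field
  open Squares
  open VectorModels
  open import Data.Nat as ℕ using (ℕ; suc)
  open import Data.Nat.Primality using (Prime)
  open import Data.Bool using (true)
  open import Data.Fin using (Fin)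
  open import Data.Fin.Permutation using (Permutation′; permutation; _⟨$⟩ʳ_)
  open import Data.Product using (∃; _×_; _,_; proj₁; proj₂)
  open import Relation.Nullary using (¬_; contradiction)
  open import Relation.Binary.PropositionalEquality hiding ([_])

  module LinearMaps (p : ℕ) (pr : Prime p) where
    open PrimeField p pr
    open Vectors p pr

    comb : F → F → F × F → F × F → F × F
    comb a b (x , y) (x′ , y′) = a * x + b * x′ , a * y + b * y′

    det-combˡ : ∀ a b e f → det (comb a b e f) f ≡ a * det e f
    det-combˡ a b (x , y) (x′ , y′) = (solve 6 (λ a b x y x′ y′ → (a :* x :+ b :* x′) :* y′ :- (a :* y :+ b :* y′) :* x′ := a :* (x :* y′ :- y :* x′)) refl) a b x y x′ y′

    det-combʳ : ∀ a b e f → det e (comb a b e f) ≡ b * det e f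
    det-combʳ a b (x , y) (x′ , y′) = (solve 6 (λ a b x y x′ y′ → x :* (a :* y :+ b :* y′) :- y :* (a :* x :+ b :* x′) := b :* (x :* y′ :- y :* x′)) refl) a b x y x′ y′

    det-comb : ∀ a b c d e f → det (comb a b e f) (comb c d e f) ≡ (a * d - b * c) * det e f
    det-comb a b c d (x , y) (x′ , y′) = (solve 8 (λ a b c d x y x′ y′ → (a :* x :+ b :* x′) :* (c :* y :+ d :* y′) :- (a :* y :+ b :* y′) :* (c :* x :+ d :* x′) := (a :* d :- b :* c) :* (x :* y′ :- y :* x′)) refl) a b c d x y x′ y′

    det-scale : ∀ a b v w → det (scale a v) (scale b w) ≡ a * b * det v w
    det-scale a b (x , y) (x′ , y′) = (solve 6 (λ a b x y x′ y′ → a :* x :* (b :* y′) :- a :* y :* (b :* x′) := a :* b :* (x :* y′ :- y :* x′)) refl) a b x y x′ y′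

    comb-1-0 : ∀ e f → comb 1# 0# e f ≡ e
    comb-1-0 (x , y) (x′ , y′) = cong₂ _,_ ((solve 2 (λ x x′ → (num 1) :* x :+ (num 0) :* x′ := x) refl) x x′) ((solve 2 (λ x x′ → (num 1) :* x :+ (num 0) :* x′ := x) refl) y y′)

    comb-0-1 : ∀ e f → comb 0# 1# e f ≡ f
    comb-0-1 (x , y) (x′ , y′) = cong₂ _,_ ((solve 2 (λ x x′ → (num 0) :* x :+ (num 1) :* x′ := x′) refl) x x′) ((solve 2 (λ x x′ → (num 0) :* x :+ (num 1) :* x′ := x′) refl) y y′)

    comb-scale : ∀ c a b e f → comb (c * a) (c * b) e f ≡ scale c (comb a b e f)
    comb-scale c a b (x , y) (x′ , y′) = cong₂ _,_ ((solve 5 (λ c a b x x′ → c :* a :* x :+ c :* b :* x′ := c :* (a :* x :+ b :* x′)) refl) c a b x x′) ((solve 5 (λ c a b x x′ → c :* a :* x :+ c :* b :* x′ := c :* (a :* x :+ b :* x′)) refl) c a b y y′)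

    comb-scales : ∀ a b c d e f → comb a b (scale c e) (scale d f) ≡ comb (a * c) (b * d) e f
    comb-scales a b c d (x , y) (x′ , y′) = cong₂ _,_ ((solve 6 (λ a b c d x x′ → a :* (c :* x) :+ b :* (d :* x′) := a :* c :* x :+ b :* d :* x′) refl) a b c d x x′) ((solve 6 (λ a b c d x x′ → a :* (c :* x) :+ b :* (d :* x′) := a :* c :* x :+ b :* d :* x′) refl) a b c d y y′)

    det≢0⇒nonzeroˡ : ∀ {v w} → det v w ≢ 0# → Nonzero v
    det≢0⇒nonzeroˡ {w = x , y} d refl = d (trans (cong₂ _-_ (zeroˡ y) (zeroˡ x)) (-‿inverseʳ 0#))

    det≢0⇒nonzeroʳ : ∀ {v w} → det v w ≢ 0# → Nonzero w
    det≢0⇒nonzeroʳ {x , y} d refl = d (trans (cong₂ _-_ (zeroʳ x) (zeroʳ y)) (-‿inverseʳ 0#))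

    module Coordinates (e f : F × F) (D≢0 : det e f ≢ 0#) where
      i : F
      i = det e f ⁻¹

      fst snd : F × F → F
      fst v = det v f * i
      snd v = det e v * i

      cramer : ∀ v → comb (fst v) (snd v) e f ≡ v
      cramer (v₁ , v₂) = cong₂ _,_
        (trans ((solve 7 (λ x y x′ y′ v w i → (v :* y′ :- w :* x′) :* i :* x :+ (x :* w :- y :* v) :* i :* x′ := (x :* y′ :- y :* x′) :* i :* v) refl) _ _ _ _ v₁ v₂ i) (cancel v₁))
        (trans ((solve 7 (λ x y x′ y′ v w i → (v :* y′ :- w :* x′) :* i :* y :+ (x :* w :- y :* v) :* i :* y′ := (x :* y′ :- y :* x′) :* i :* w) refl) _ _ _ _ v₁ v₂ i) (cancel v₂))
        where
        cancel : ∀ c → det e f * i * c ≡ c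
        cancel c = trans (cong (_* c) (inverseʳ D≢0)) (*-identityˡ c)

      fst-comb : ∀ a b → fst (comb a b e f) ≡ a
      fst-comb a b = trans (cong (_* i) (det-combˡ a b e f)) (trans (*-assoc a _ _) (trans (cong (a *_) (inverseʳ D≢0)) (*-identityʳ a)))

      snd-comb : ∀ a b → snd (comb a b e f) ≡ b
      snd-comb a b = trans (cong (_* i) (det-combʳ a b e f)) (trans (*-assoc b _ _) (trans (cong (b *_) (inverseʳ D≢0)) (*-identityʳ b)))

    -- The linear map taking e to e′ and f to f′. Giving it by bases instead of a matrix lets it be
    -- read off from the vectors that represent two arcs.
    module Transfer (e f e′ f′ : F × F) (D≢0 : det e f ≢ 0#) (D′≢0 : det e′ f′ ≢ 0#) where
      private
        module C = Coordinates e f D≢0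
        module C′ = Coordinates e′ f′ D′≢0

      to from : F × F → F × F
      to v = comb (C.fst v) (C.snd v) e′ f′
      from v = comb (C′.fst v) (C′.snd v) e f

      to-comb : ∀ a b → to (comb a b e f) ≡ comb a b e′ f′
      to-comb a b = cong₂ (λ a b → comb a b e′ f′) (C.fst-comb a b) (C.snd-comb a b)

      from-to : ∀ v → from (to v) ≡ v
      from-to v = trans (cong₂ (λ a b → comb a b e f) (C′.fst-comb _ _) (C′.snd-comb _ _)) (C.cramer v)

      to-from : ∀ v → to (from v) ≡ v
      to-from v = trans (to-comb _ _) (C′.cramer v)

      to-scale : ∀ c v → to (scale c v) ≡ scale c (to v)
      to-scale c v = trans (cong to (trans (cong (scale c) (sym (C.cramer v))) (sym (comb-scale c _ _ e f))))
        (trans (to-comb _ _) (comb-scale c _ _ e′ f′))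

      to-det : ∀ v w → det (to v) (to w) ≡ det e′ f′ * det e f ⁻¹ * det v w
      to-det v w = begin
        det (to v) (to w)                                                    ≡⟨ det-comb _ _ _ _ e′ f′ ⟩
        m * det e′ f′                                                        ≡⟨ *-identityʳ _ ⟨
        m * det e′ f′ * 1#                                                   ≡⟨ cong (m * det e′ f′ *_) (inverseˡ D≢0) ⟨
        m * det e′ f′ * (det e f ⁻¹ * det e f)                               ≡⟨ (solve 4 (λ m d i c → m :* d :* (i :* c) := d :* i :* (m :* c)) refl) m (det e′ f′) (det e f ⁻¹) (det e f) ⟩
        det e′ f′ * det e f ⁻¹ * (m * det e f)                               ≡⟨ cong (det e′ f′ * det e f ⁻¹ *_) (det-comb _ _ _ _ e f) ⟨
        det e′ f′ * det e f ⁻¹ * det (comb (C.fst v) (C.snd v) e f) (comb (C.fst w) (C.snd w) e f)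
                                                                             ≡⟨ cong₂ (λ v w → det e′ f′ * det e f ⁻¹ * det v w) (C.cramer v) (C.cramer w) ⟩
        det e′ f′ * det e f ⁻¹ * det v w                                     ∎
        where
        open ≡-Reasoning
        m = C.fst v * C.snd w - C.snd v * C.fst w

      to-nonzero : ∀ {v} → Nonzero v → Nonzero (to v)
      to-nonzero {v} nv z = nv (trans (sym (from-to v)) (trans (cong from z) (comb-zero (C′.fst (0# , 0#)) (C′.snd (0# , 0#)) fst0 snd0)))
        where
        fst0 : C′.fst (0# , 0#) ≡ 0#
        fst0 = trans (cong (_* C′.i) (trans (cong₂ _-_ (zeroˡ _) (zeroˡ _)) (-‿inverseʳ 0#))) (zeroˡ _)
        snd0 : C′.snd (0# , 0#) ≡ 0#
        snd0 = trans (cong (_* C′.i) (trans (cong₂ _-_ (zeroʳ _) (zeroʳ _)) (-‿inverseʳ 0#))) (zeroˡ _)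
        comb-zero : ∀ a b → a ≡ 0# → b ≡ 0# → comb a b e f ≡ (0# , 0#)
        comb-zero _ _ refl refl = cong₂ _,_ (trans (cong₂ _+_ (zeroˡ _) (zeroˡ _)) (+-identityˡ _)) (trans (cong₂ _+_ (zeroˡ _) (zeroˡ _)) (+-identityˡ _))

  module ModelGraphs (p : ℕ) (pr : Prime p) (h : ℕ) (p-odd : p ≡ suc (h ℕ.+ h)) {n} (Γ : Graph n) {s : Fin p} where
    open PrimeField p pr
    open SquareClasses p pr h p-odd
    open Vectors p pr
    open LinearMaps p pr

    module _ (model : VectorModel Γ s) where
      open VectorModel model

      opaque
        lift : Fin n → F × F
        lift u = proj₁ (onto u)

        lift-nonzero : ∀ u → Nonzero (lift u)
        lift-nonzero u = proj₁ (proj₂ (onto u))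

        ψ-lift : ∀ u → ψ (lift u) ≡ u
        ψ-lift u = proj₂ (proj₂ (onto u))

      ψ-Sq : ∀ {c v} → Sq c → Nonzero v → ψ (scale c v) ≡ ψ v
      ψ-Sq (q , q≢0 , refl) nv = scaled q≢0 nv

      -- A linear map respects square multiples, hence descends to vertices, and a square
      -- determinant preserves the class of `det`.
      linear-automorphism : ∀ {e f e′ f′} (D≢0 : det e f ≢ 0#) (D′≢0 : det e′ f′ ≢ 0#) → Sq (det e′ f′ * det e f ⁻¹) →
        ∃ λ σ → IsAut Γ σ × (∀ a b → Nonzero (comb a b e f) → σ ⟨$⟩ʳ ψ (comb a b e f) ≡ ψ (comb a b e′ f′))
      linear-automorphism {e} {f} {e′} {f′} D≢0 D′≢0 κ = σ , σ-aut , λ a b nz → trans (descend T.to-scale T.to-nonzero nz) (cong ψ (T.to-comb a b))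
        where
        module T = Transfer e f e′ f′ D≢0 D′≢0
        module T⁻ = Transfer e′ f′ e f D′≢0 D≢0
        -- The chosen representative of a vertex differs from v by a square factor, which L passes
        -- on and ψ ignores.
        descend : ∀ {L : F × F → F × F} → (∀ c v → L (scale c v) ≡ scale c (L v)) → (∀ {v} → Nonzero v → Nonzero (L v)) →
          ∀ {v} → Nonzero v → ψ (L (lift (ψ v))) ≡ ψ (L v)
        descend {L} linear nonzero {v} nv = go (same (lift-nonzero (ψ v)) nv (ψ-lift (ψ v)))
          where
          go : (∃ λ q → q ≢ 0# × v ≡ scale (q * q) (lift (ψ v))) → ψ (L (lift (ψ v))) ≡ ψ (L v)
          go (q , q≢0 , e) = sym (trans (cong (λ v → ψ (L v)) e) (trans (cong ψ (linear _ _)) (scaled q≢0 (nonzero (lift-nonzero (ψ v))))))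
        σ : Permutation′ n
        σ = permutation (λ u → ψ (T.to (lift u))) (λ u → ψ (T.from (lift u)))
          (λ u → trans (descend T.to-scale T.to-nonzero (T⁻.to-nonzero (lift-nonzero u))) (trans (cong ψ (T.to-from _)) (ψ-lift u)))
          (λ u → trans (descend T⁻.to-scale T⁻.to-nonzero (T.to-nonzero (lift-nonzero u))) (trans (cong ψ (T.from-to _)) (ψ-lift u)))
        σ-aut : IsAut Γ σ
        σ-aut u v = trans (adjacent (T.to-nonzero (lift-nonzero u)) (T.to-nonzero (lift-nonzero v)))
          (trans (cong isSq (trans (cong (s *_) (T.to-det _ _)) ((solve 3 (λ s k d → s :* (k :* d) := k :* (s :* d)) refl) s _ (det (lift u) (lift v)))))
          (trans (isSq-Sq-* κ _) (trans (sym (adjacent (lift-nonzero u) (lift-nonzero v))) (cong₂ (adj Γ) (ψ-lift u) (ψ-lift v)))))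

      arc-det : ∀ {u v} → adj Γ u v ≡ true → Sq (s * det (lift u) (lift v))
      arc-det {u} {v} a = isSq-true (trans (sym (adjacent (lift-nonzero u) (lift-nonzero v))) (trans (cong₂ (adj Γ) (ψ-lift u) (ψ-lift v)) a))

      Sq-*⇒≢0 : ∀ {x y} → Sq (x * y) → y ≢ 0#
      Sq-*⇒≢0 sq refl = Sq⇒≢0 sq (zeroʳ _)

      -- The common factor s cancels from the quotient.
      Sq-quotient : ∀ {D D′} → Sq (s * D) → Sq (s * D′) → Sq (D′ * D ⁻¹)
      Sq-quotient {D} {D′} sD sD′ = Sq-divˡ sD (subst Sq (trans (sym (*-identityʳ _)) (trans (cong (s * D′ *_) (sym (inverseʳ (Sq-*⇒≢0 sD))))
        ((solve 4 (λ s d e i → s :* e :* (d :* i) := s :* d :* (e :* i)) refl) s D D′ (D ⁻¹)))) sD′)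

      -- A 2-geodesic is the image of e, f, a e + b f with a square and b nonsquare.
      record Frame (u v w : Fin n) : Set where
        field
          e f : F × F
          a b : F
          frame-det : Sq (s * det e f)
          a-square : Sq a
          b≢0 : b ≢ 0#
          b-nonsquare : ¬ Sq b
          ψe : ψ e ≡ u
          ψf : ψ f ≡ v
          ψg : ψ (comb a b e f) ≡ w

      module _ (-1∈Sq : Sq (- 1#)) where
        frame : ∀ {u v w} → Is2Geodesic Γ u v w → Frame u v w
        frame {u} {v} {w} ((uv , vw , u≢w) , nuw) = record
          { e = e ; f = f ; a = a ; b = b ; frame-det = arc-det uv ; a-square = a-square ; b≢0 = b≢0 ; b-nonsquare = b-nonsquare
          ; ψe = ψ-lift u ; ψf = ψ-lift v ; ψg = trans (cong ψ (C.cramer g)) (ψ-lift w) }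
          where
          e = lift u
          f = lift v
          g = lift w
          D≢0 : det e f ≢ 0#
          D≢0 = Sq-*⇒≢0 (arc-det uv)
          module C = Coordinates e f D≢0
          a = C.fst g
          b = C.snd g
          -- For g = a e + b f one has det f g = - a det e f. Both v w and u v are arcs, and -1 is a
          -- square.
          a-square : Sq a
          a-square = Sq-divˡ -1∈Sq (Sq-divˡ (arc-det uv) (subst Sq (begin
            s * det f g                            ≡⟨ cong (λ g → s * det f g) (C.cramer g) ⟨
            s * det f (comb a b e f)               ≡⟨ cong (s *_) (flip f (comb a b e f)) ⟩
            s * - det (comb a b e f) f             ≡⟨ cong (λ d → s * - d) (det-combˡ a b e f) ⟩
            s * - (a * det e f)                    ≡⟨ (solve 3 (λ s a d → s :* (:- (a :* d)) := s :* d :* ((:- (num 1)) :* a)) refl) s a (det e f) ⟩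
            s * det e f * (- 1# * a)               ∎) (arc-det vw)))
            where
            open ≡-Reasoning
            flip : ∀ v w → det v w ≡ - det w v
            flip (x , y) (x′ , y′) = (solve 4 (λ x y x′ y′ → x :* y′ :- y :* x′ := :- (x′ :* y :- y′ :* x)) refl) x y x′ y′
          -- With b = 0 the vector of w would be a square multiple of e, so w = u. If b were a
          -- square, then u and w would be adjacent.
          b≢0 : b ≢ 0#
          b≢0 b≡0 = u≢w (sym (trans (sym (ψ-lift w)) (trans (cong ψ (trans (sym (C.cramer g)) collapse)) (trans (ψ-Sq a-square (lift-nonzero u)) (ψ-lift u)))))
            where
            collapse : comb a b e f ≡ scale a e
            collapse = trans (cong (λ b → comb a b e f) b≡0) (cong₂ _,_ (drop-zero a (proj₁ e) (proj₁ f)) (drop-zero a (proj₂ e) (proj₂ f)))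
              where
              drop-zero : ∀ a x y → a * x + 0# * y ≡ a * x
              drop-zero a x y = trans (cong (a * x +_) (zeroˡ y)) (+-identityʳ _)
          b-nonsquare : ¬ Sq b
          b-nonsquare sb = contradiction (trans (sym nuw) (trans (sym (cong₂ (adj Γ) (ψ-lift u) (ψ-lift w))) (trans (adjacent (lift-nonzero u) (lift-nonzero w))
            (Sq⇒isSq (subst Sq (trans ((solve 3 (λ s d b → s :* d :* b := s :* (b :* d)) refl) s (det e f) b) (trans (cong (s *_) (sym (det-combʳ a b e f))) (cong (λ g → s * det e g) (C.cramer g))))
              (Sq-* (arc-det uv) sb)))))) λ ()

        2-geodesic-transitive : TwoGeodesicTransitive Γ
        2-geodesic-transitive = arcs , λ u v w u′ v′ w′ g g′ → geodesics (frame g) (frame g′)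
          where
          arcs : ArcTransitive Γ
          arcs u v u′ v′ a a′ = go (linear-automorphism (Sq-*⇒≢0 (arc-det a)) (Sq-*⇒≢0 (arc-det a′)) (Sq-quotient (arc-det a) (arc-det a′)))
            where
            go : (∃ λ σ → IsAut Γ σ × (∀ a b → Nonzero (comb a b (lift u) (lift v)) → σ ⟨$⟩ʳ ψ (comb a b (lift u) (lift v)) ≡ ψ (comb a b (lift u′) (lift v′)))) → _
            go (σ , aut , act) = σ , aut , image 1# 0# {u} {u′} (comb-1-0 (lift u) (lift v)) (comb-1-0 (lift u′) (lift v′)) , image 0# 1# {v} {v′} (comb-0-1 (lift u) (lift v)) (comb-0-1 (lift u′) (lift v′))
              where
              image : ∀ a b {x x′} → comb a b (lift u) (lift v) ≡ lift x → comb a b (lift u′) (lift v′) ≡ lift x′ → σ ⟨$⟩ʳ x ≡ x′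
              image a b {x} {x′} e e′ = trans (cong (σ ⟨$⟩ʳ_) (sym (trans (cong ψ e) (ψ-lift x)))) (trans (act a b (subst Nonzero (sym e) (lift-nonzero x))) (trans (cong ψ e′) (ψ-lift x′)))
          geodesics : ∀ {u v w u′ v′ w′} → Frame u v w → Frame u′ v′ w′ →
            ∃ λ σ → IsAut Γ σ × σ ⟨$⟩ʳ u ≡ u′ × σ ⟨$⟩ʳ v ≡ v′ × σ ⟨$⟩ʳ w ≡ w′
          geodesics {u} {v} {w} {u′} {v′} {w′} R R′ = go (linear-automorphism D≢0 (subst (_≢ 0#) (sym (det-scale c d R′.e R′.f)) (*-nonzero (Sq⇒≢0 (Sq-* c-Sq d-Sq)) D′≢0))
              (subst Sq (sym (trans (cong (_* det R.e R.f ⁻¹) (det-scale c d R′.e R′.f)) (*-assoc (c * d) _ _))) (Sq-* (Sq-* c-Sq d-Sq) (Sq-quotient R.frame-det R′.frame-det))))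
            where
            module R = Frame R
            module R′ = Frame R′
            D≢0 : det R.e R.f ≢ 0#
            D≢0 = Sq-*⇒≢0 R.frame-det
            D′≢0 : det R′.e R′.f ≢ 0#
            D′≢0 = Sq-*⇒≢0 R′.frame-det
            -- Scaling e′ by a′ / a and f′ by b′ / b makes the coefficients of the third vectors
            -- agree. Both factors are squares, the second as a quotient of two nonsquares, so the
            -- vertices stay the same.
            c = R′.a * R.a ⁻¹
            d = R′.b * R.b ⁻¹
            c-Sq : Sq c
            c-Sq = Sq-* R′.a-square (Sq-⁻¹ R.a-square)
            d-Sq : Sq d
            d-Sq = nonsquare-* R′.b≢0 (⁻¹-nonzero R.b≢0) R′.b-nonsquare (nonsquare-⁻¹ R.b≢0 R.b-nonsquare)
            ac : R.a * c ≡ R′.a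
            ac = trans ((solve 3 (λ a a′ i → a :* (a′ :* i) := a′ :* (a :* i)) refl) R.a R′.a (R.a ⁻¹)) (trans (cong (R′.a *_) (inverseʳ (Sq⇒≢0 R.a-square))) (*-identityʳ _))
            bd : R.b * d ≡ R′.b
            bd = trans ((solve 3 (λ a a′ i → a :* (a′ :* i) := a′ :* (a :* i)) refl) R.b R′.b (R.b ⁻¹)) (trans (cong (R′.b *_) (inverseʳ R.b≢0)) (*-identityʳ _))
            go : (∃ λ σ → IsAut Γ σ × (∀ a b → Nonzero (comb a b R.e R.f) → σ ⟨$⟩ʳ ψ (comb a b R.e R.f) ≡ ψ (comb a b (scale c R′.e) (scale d R′.f)))) → _
            go (σ , aut , act) = σ , aut ,
              image 1# 0# {R.e} {u} {u′} (comb-1-0 R.e R.f) (det≢0⇒nonzeroˡ {R.e} {R.f} D≢0) R.ψe (trans (cong ψ (comb-1-0 (scale c R′.e) (scale d R′.f))) (trans (ψ-Sq {c} {R′.e} c-Sq (det≢0⇒nonzeroˡ {R′.e} {R′.f} D′≢0)) R′.ψe)) ,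
              image 0# 1# {R.f} {v} {v′} (comb-0-1 R.e R.f) (det≢0⇒nonzeroʳ {R.e} {R.f} D≢0) R.ψf (trans (cong ψ (comb-0-1 (scale c R′.e) (scale d R′.f))) (trans (ψ-Sq {d} {R′.f} d-Sq (det≢0⇒nonzeroʳ {R′.e} {R′.f} D′≢0)) R′.ψf)) ,
              image R.a R.b {comb R.a R.b R.e R.f} {w} {w′} refl g-nonzero R.ψg (trans (cong ψ (trans (comb-scales R.a R.b c d R′.e R′.f) (cong₂ (λ a b → comb a b R′.e R′.f) ac bd))) R′.ψg)
              where
              g-nonzero : Nonzero (comb R.a R.b R.e R.f)
              g-nonzero = det≢0⇒nonzeroˡ (subst (_≢ 0#) (sym (det-combˡ R.a R.b R.e R.f)) (*-nonzero (Sq⇒≢0 R.a-square) D≢0))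
              image : ∀ a b {v x x′} → comb a b R.e R.f ≡ v → Nonzero v → ψ v ≡ x → ψ (comb a b (scale c R′.e) (scale d R′.f)) ≡ x′ → σ ⟨$⟩ʳ x ≡ x′
              image a b refl nv refl e′ = trans (act a b nv) e′

-- The icosahedron as the vector model for p = 5.

module Icosahedron where

  open import Defs hiding (module Mat; sym)
  open Field
  open Squares
  open VectorModels
  open import Data.Nat using (ℕ)
  open import Data.Nat.Primality using (Prime)
  import Data.Bool.Properties as Bool
  open import Data.Fin as Fin using (Fin; #_)
  open import Data.Fin.Properties as Fin using (all?; any?)
  open import Data.Product using (∃; _×_; _,_; proj₁; proj₂)
  open import Data.Product.Properties using (≡-dec)
  open import Data.Vec using (Vec; []; _∷_; lookup)
  open import Function.Bundles using (Inverse; mk↔ₛ′)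
  open import Relation.Nullary using (Dec)
  open import Relation.Nullary.Decidable using (_×-dec_; _→-dec_; ¬?; from-yes)
  open import Relation.Binary.PropositionalEquality hiding ([_])

  module ModelIsomorphisms (p : ℕ) (pr : Prime p) where
    open PrimeField p pr
    open SquareBasics p pr
    open Vectors p pr
    open VectorModel

    -- A vertex is lifted to a vector through one model and read through the other; the result is
    -- independent of the lift because both models identify the same vectors.
    models-isomorphic : ∀ {n m s} {Γ : Graph n} {Δ : Graph m} → VectorModel Γ s → VectorModel Δ s → Isomorphic Γ Δ
    models-isomorphic {n} {m} {s} {Γ} {Δ} M N = mk↔ₛ′ (transfer M N) (transfer N M) (transfer-inverse N M) (transfer-inverse M N) , λ u v →
      trans (adjacent N (nonzero M u) (nonzero M v)) (trans (sym (adjacent M (nonzero M u) (nonzero M v))) (cong₂ (adj Γ) (ψ-lift M u) (ψ-lift M v)))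
      where
      lift : ∀ {n} {Γ : Graph n} → VectorModel Γ s → Fin n → F × F
      lift M u = proj₁ (onto M u)
      nonzero : ∀ {n} {Γ : Graph n} (M : VectorModel Γ s) u → Nonzero (lift M u)
      nonzero M u = proj₁ (proj₂ (onto M u))
      ψ-lift : ∀ {n} {Γ : Graph n} (M : VectorModel Γ s) u → ψ M (lift M u) ≡ u
      ψ-lift M u = proj₂ (proj₂ (onto M u))
      transfer : ∀ {n m} {Γ : Graph n} {Δ : Graph m} → VectorModel Γ s → VectorModel Δ s → Fin n → Fin m
      transfer M N u = ψ N (lift M u)
      transfer-inverse : ∀ {n m} {Γ : Graph n} {Δ : Graph m} (M : VectorModel Γ s) (N : VectorModel Δ s) u → transfer N M (transfer M N u) ≡ u
      transfer-inverse M N u = go (same N (nonzero N w) (nonzero M u) (ψ-lift N w))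
        where
        w = transfer M N u
        go : (∃ λ q → q ≢ 0# × lift M u ≡ scale (q * q) (lift N w)) → ψ M (lift N w) ≡ u
        go (q , q≢0 , e) = trans (sym (scaled M q≢0 (nonzero N w))) (trans (cong (ψ M) (sym e)) (ψ-lift M u))

    transport-model : ∀ {n m s} {Γ : Graph n} {Δ : Graph m} → Isomorphic Γ Δ → VectorModel Δ s → VectorModel Γ s
    transport-model {Γ = Γ} {Δ} (f , f-adj) M = record
      { ψ = λ v → from (ψ M v)
      ; onto = λ u → let (v , nv , e) = onto M (to u) in v , nv , trans (cong from e) (inverseʳ′ u)
      ; same = λ nv nw e → same M nv nw (trans (sym (inverseˡ′ _)) (trans (cong to e) (inverseˡ′ _)))
      ; scaled = λ q≢0 nv → cong from (scaled M q≢0 nv)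
      ; adjacent = λ nv nw → trans (trans (sym (f-adj _ _)) (cong₂ (adj Δ) (inverseˡ′ _) (inverseˡ′ _))) (adjacent M nv nw) }
      where
      open Inverse f using (to; from)
      inverseˡ′ : ∀ v → to (from v) ≡ v
      inverseˡ′ v = Inverse.inverseˡ f refl
      inverseʳ′ : ∀ u → from (to u) ≡ u
      inverseʳ′ u = Inverse.inverseʳ f refl

  module IcosahedronModel (pr : Prime 5) where
    open PrimeField 5 pr
    open SquareClasses 5 pr 2 refl
    open Vectors 5 pr

    -- Row x and column y hold the vertex of the vector (x, y). The nonzero squares modulo 5 are 1
    -- and -1, so opposite vectors share an entry. The entry at (0, 0) is a dummy.
    table : Vec (Vec (Fin 12) 5) 5
    table = (# 0 ∷ # 0 ∷ # 11 ∷ # 11 ∷ # 0 ∷ [])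
          ∷ (# 1 ∷ # 2 ∷ # 3 ∷ # 4 ∷ # 5 ∷ [])
          ∷ (# 9 ∷ # 7 ∷ # 10 ∷ # 8 ∷ # 6 ∷ [])
          ∷ (# 9 ∷ # 6 ∷ # 8 ∷ # 10 ∷ # 7 ∷ [])
          ∷ (# 1 ∷ # 5 ∷ # 4 ∷ # 3 ∷ # 2 ∷ []) ∷ []

    representatives : Vec (F × F) 12
    representatives = (# 0 , # 1) ∷ (# 1 , # 0) ∷ (# 1 , # 1) ∷ (# 1 , # 2) ∷ (# 1 , # 3) ∷ (# 1 , # 4)
      ∷ (# 2 , # 4) ∷ (# 2 , # 1) ∷ (# 2 , # 3) ∷ (# 2 , # 0) ∷ (# 2 , # 2) ∷ (# 0 , # 2) ∷ []

    vertex : F × F → Fin 12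
    vertex (x , y) = lookup (lookup table x) y

    vector : Fin 12 → F × F
    vector = lookup representatives

    private
      _≟ᵛ_ : (v w : F × F) → Dec (v ≡ w)
      _≟ᵛ_ = ≡-dec _≟_ _≟_

    -- Unfolding the field operations and `isSq` lets these finite checks evaluate.
    opaque
      unfolding _+_ isSq

      vertex-vector : ∀ u → Nonzero (vector u) × vertex (vector u) ≡ u
      vertex-vector = from-yes (all? λ u → ¬? (vector u ≟ᵛ (0# , 0#)) ×-dec (vertex (vector u) Fin.≟ u))

      canonical : ∀ x y → Nonzero (x , y) → ∃ λ q → q ≢ 0# × (x , y) ≡ scale (q * q) (vector (vertex (x , y)))
      canonical = from-yes (all? λ x → all? λ y → ¬? ((x , y) ≟ᵛ (0# , 0#)) →-dec
        any? λ q → ¬? (q ≟ 0#) ×-dec ((x , y) ≟ᵛ scale (q * q) (vector (vertex (x , y)))))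

      vertex-scaled : ∀ q x y → q ≢ 0# → vertex (scale (q * q) (x , y)) ≡ vertex (x , y)
      vertex-scaled = from-yes (all? λ q → all? λ x → all? λ y → ¬? (q ≟ 0#) →-dec (vertex (scale (q * q) (x , y)) Fin.≟ vertex (x , y)))

      vector-adjacent : ∀ u v → adj icosahedron u v ≡ isSq (det (vector u) (vector v))
      vector-adjacent = from-yes (all? λ u → all? λ v → adj icosahedron u v Bool.≟ isSq (det (vector u) (vector v)))

    icosahedron-model : VectorModel icosahedron 1#
    icosahedron-model = record
      { ψ = vertex
      ; onto = λ u → vector u , vertex-vector u
      ; same = λ {v} {w} nv nw e → go v w e (canonical (proj₁ v) (proj₂ v) nv) (canonical (proj₁ w) (proj₂ w) nw)
      ; scaled = λ {q} {v} q≢0 _ → vertex-scaled q (proj₁ v) (proj₂ v) q≢0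
      ; adjacent = λ {v} {w} nv nw → trans (vector-adjacent (vertex v) (vertex w)) (adjacent′ v w (canonical (proj₁ v) (proj₂ v) nv) (canonical (proj₁ w) (proj₂ w) nw)) }
      where
      Canonical : F × F → Set
      Canonical v = ∃ λ q → q ≢ 0# × v ≡ scale (q * q) (vector (vertex v))
      go : ∀ v w → vertex v ≡ vertex w → Canonical v → Canonical w → ∃ λ q → q ≢ 0# × w ≡ scale (q * q) v
      go v w e (q , q≢0 , ev) (r , r≢0 , ew) = r * q ⁻¹ , *-nonzero r≢0 (⁻¹-nonzero q≢0) , trans ew
        (trans (cong (λ u → scale (r * r) (vector u)) (sym e)) (trans (cong₂ _,_ (rescale (proj₁ g)) (rescale (proj₂ g))) (cong (scale (r * q ⁻¹ * (r * q ⁻¹))) (sym ev))))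
        where
        g = vector (vertex v)
        rescale : ∀ x → r * r * x ≡ r * q ⁻¹ * (r * q ⁻¹) * (q * q * x)
        rescale x = trans (trans ((solve 2 (λ r x → r :* r :* x := r :* r :* ((num 1) :* (num 1)) :* x) refl) r x) (cong (λ o → r * r * (o * o) * x) (sym (inverseʳ q≢0))))
          ((solve 4 (λ r q i x → r :* r :* (q :* i :* (q :* i)) :* x := r :* i :* (r :* i) :* (q :* q :* x)) refl) r q (q ⁻¹) x)
      adjacent′ : ∀ v w → Canonical v → Canonical w → isSq (det (vector (vertex v)) (vector (vertex w))) ≡ isSq (1# * det v w)
      adjacent′ v w (q , q≢0 , ev) (r , r≢0 , ew) = sym (trans (cong isSq (trans (*-identityˡ _) (trans (cong₂ det ev ew) (bilinear (vector (vertex v)) (vector (vertex w))))))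
        (isSq-Sq-* (Sq-* (Sq-square q≢0) (Sq-square r≢0)) (det (vector (vertex v)) (vector (vertex w)))))
        where
        bilinear : ∀ v w → det (scale (q * q) v) (scale (r * r) w) ≡ q * q * (r * r) * det v w
        bilinear (x , y) (x′ , y′) = (solve 6 (λ c d x y x′ y′ → c :* x :* (d :* y′) :- c :* y :* (d :* x′) := c :* d :* (x :* y′ :- y :* x′)) refl) (q * q) (r * r) x y x′ y′

-- The action of SL(2,p) on row vectors.

module Matrices where

  open import Defs using (module Mat)
  open Field
  open VectorModels
  open ModelTransitive
  open import Data.Nat as ℕ using (ℕ; zero; suc)
  import Data.Nat.Properties as ℕ
  open import Data.Nat.DivMod using (_mod_)
  open import Data.Nat.Primality using (Prime)
  open import Data.Fin using (toℕ)
  open import Data.Product using (∃; _×_; _,_; proj₁; proj₂)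
  open import Data.Sum using (_⊎_; inj₁; inj₂)
  open import Relation.Nullary using (Dec; yes; no; contradiction)
  open import Relation.Binary.PropositionalEquality hiding ([_])

  module RowAction (p : ℕ) (pr : Prime p) where
    open PrimeField p pr
    open Vectors p pr
    open LinearMaps p pr
    open Mat p public using (M; mat; _·_; one; Det1; inv; _≈_) renaming (_^_ to _^ᴹ_; -ₘ_ to -ᴹ_)

    infixl 6 _∙_

    mat-cong : ∀ {a b c d a′ b′ c′ d′} → a ≡ a′ → b ≡ b′ → c ≡ c′ → d ≡ d′ → mat a b c d ≡ mat a′ b′ c′ d′
    mat-cong refl refl refl refl = refl

    opaque
      bracket : ∀ a b c d → (toℕ a ℕ.* toℕ b ℕ.+ toℕ c ℕ.* toℕ d) mod p ≡ a * b + c * d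
      bracket a b c d = trans (sym ([]-def _)) (trans ([]-+ (toℕ a ℕ.* toℕ b) _) (cong₂ _+_ (sym (*-def a b)) (sym (*-def c d))))

      ·-def : ∀ a b c d a′ b′ c′ d′ → mat a b c d · mat a′ b′ c′ d′ ≡ mat (a * a′ + b * c′) (a * b′ + b * d′) (c * a′ + d * c′) (c * b′ + d * d′)
      ·-def a b c d a′ b′ c′ d′ = mat-cong (bracket a a′ b c′) (bracket a b′ b d′) (bracket c a′ d c′) (bracket c b′ d d′)

      neg≡ : ∀ x → Mat.neg p x ≡ - x
      neg≡ x = trans (sym ([]-def _)) (sym (neg-def x))

      one-def : one ≡ mat 1# 0# 0# 1#
      one-def = mat-cong (sym ([]-def 1)) (sym ([]-def 0)) (sym ([]-def 0)) (sym ([]-def 1))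

      inv-def : ∀ a b c d → inv (mat a b c d) ≡ mat d (- b) (- c) a
      inv-def a b c d = mat-cong refl (neg≡ b) (neg≡ c) refl

      neg-mat : ∀ a b c d → -ᴹ mat a b c d ≡ mat (- a) (- b) (- c) (- d)
      neg-mat a b c d = mat-cong (neg≡ a) (neg≡ b) (neg≡ c) (neg≡ d)

      Det1⇒ : ∀ a b c d → Det1 (mat a b c d) → a * d - b * c ≡ 1#
      Det1⇒ a b c d e = trans (cong (_- b * c) (trans (*-def a d) (trans ([]-def _) (trans e (trans (sym ([]-def _)) (trans ([]-+ (toℕ b ℕ.* toℕ c) 1) (cong (_+ 1#) (sym (*-def b c))))))))) ((solve 1 (λ x → x :+ (num 1) :- x := (num 1)) refl) (b * c))

      ⇒Det1 : ∀ a b c d → a * d - b * c ≡ 1# → Det1 (mat a b c d)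
      ⇒Det1 a b c d e = trans (sym ([]-def _)) (trans (sym (*-def a d)) (trans (trans ((solve 2 (λ x y → x := y :+ (x :- y)) refl) (a * d) (b * c)) (cong (b * c +_) e))
        (sym (trans (sym ([]-def _)) (trans ([]-+ (toℕ b ℕ.* toℕ c) 1) (cong (_+ 1#) (sym (*-def b c))))))))

    opaque
      -- Rows are acted on from the right, so that a right coset Hx of the stabiliser of e up to
      -- squares is determined by the row `e ∙ x` up to squares.
      _∙_ : F × F → M → F × F
      (x , y) ∙ mat a b c d = x * a + y * c , x * b + y * d

      ∙-· : ∀ v X Y → v ∙ (X · Y) ≡ v ∙ X ∙ Y
      ∙-· v@(x , y) (mat a b c d) (mat a′ b′ c′ d′) = trans (cong (v ∙_) (·-def a b c d a′ b′ c′ d′)) (cong₂ _,_ (column a′ c′) (column b′ d′))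
        where
        column : ∀ u w → x * (a * u + b * w) + y * (c * u + d * w) ≡ (x * a + y * c) * u + (x * b + y * d) * w
        column u w = (solve 8 (λ x y a b c d u w → x :* (a :* u :+ b :* w) :+ y :* (c :* u :+ d :* w) := (x :* a :+ y :* c) :* u :+ (x :* b :+ y :* d) :* w) refl) x y a b c d u w

      ∙-one : ∀ v → v ∙ one ≡ v
      ∙-one v@(x , y) = trans (cong (v ∙_) one-def) (cong₂ _,_ ((solve 2 (λ x y → x :* (num 1) :+ y :* (num 0) := x) refl) x y) ((solve 2 (λ x y → x :* (num 0) :+ y :* (num 1) := y) refl) x y))

      ∙-neg : ∀ v X → v ∙ (-ᴹ X) ≡ scale (- 1#) (v ∙ X)
      ∙-neg v@(x , y) (mat a b c d) = trans (cong (v ∙_) (neg-mat a b c d)) (cong₂ _,_ (column a c) (column b d))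
        where
        column : ∀ u w → x * - u + y * - w ≡ - 1# * (x * u + y * w)
        column u w = (solve 4 (λ x y u w → x :* (:- u) :+ y :* (:- w) := (:- (num 1)) :* (x :* u :+ y :* w)) refl) x y u w

      ∙-comb : ∀ a b v w X → comb a b v w ∙ X ≡ comb a b (v ∙ X) (w ∙ X)
      ∙-comb a b (x , y) (x′ , y′) (mat k l m n) = cong₂ _,_ (column k m) (column l n)
        where
        column : ∀ u w → (a * x + b * x′) * u + (a * y + b * y′) * w ≡ a * (x * u + y * w) + b * (x′ * u + y′ * w)
        column u w = (solve 8 (λ a b x y x′ y′ u w → (a :* x :+ b :* x′) :* u :+ (a :* y :+ b :* y′) :* w := a :* (x :* u :+ y :* w) :+ b :* (x′ :* u :+ y′ :* w)) refl) a b x y x′ y′ u w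

      ∙-scale : ∀ c v X → scale c v ∙ X ≡ scale c (v ∙ X)
      ∙-scale c (x , y) (mat k l m n) = cong₂ _,_ ((solve 5 (λ c x y u w → c :* x :* u :+ c :* y :* w := c :* (x :* u :+ y :* w)) refl) c x y k m) ((solve 5 (λ c x y u w → c :* x :* u :+ c :* y :* w := c :* (x :* u :+ y :* w)) refl) c x y l n)

      det-∙ : ∀ v w X → Det1 X → det (v ∙ X) (w ∙ X) ≡ det v w
      det-∙ (x , y) (x′ , y′) (mat a b c d) D = trans
        ((solve 8 (λ x y x′ y′ a b c d → (x :* a :+ y :* c) :* (x′ :* b :+ y′ :* d) :- (x :* b :+ y :* d) :* (x′ :* a :+ y′ :* c) := (a :* d :- b :* c) :* (x :* y′ :- y :* x′)) refl) x y x′ y′ a b c d)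
        (trans (cong (_* (x * y′ - y * x′)) (Det1⇒ a b c d D)) (*-identityˡ _))

      ∙-inv : ∀ v X → Det1 X → v ∙ X ∙ inv X ≡ v
      ∙-inv (x , y) (mat a b c d) D = trans (cong (((x , y) ∙ mat a b c d) ∙_) (inv-def a b c d)) (cong₂ _,_
        (trans ((solve 6 (λ x y a b c d → (x :* a :+ y :* c) :* d :+ (x :* b :+ y :* d) :* (:- c) := (a :* d :- b :* c) :* x) refl) x y a b c d) (cancel x))
        (trans ((solve 6 (λ x y a b c d → (x :* a :+ y :* c) :* (:- b) :+ (x :* b :+ y :* d) :* a := (a :* d :- b :* c) :* y) refl) x y a b c d) (cancel y)))
        where
        cancel : ∀ z → (a * d - b * c) * z ≡ z
        cancel z = trans (cong (_* z) (Det1⇒ a b c d D)) (*-identityˡ z)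

      inv-∙ : ∀ v X → Det1 X → v ∙ inv X ∙ X ≡ v
      inv-∙ (x , y) (mat a b c d) D = trans (cong (λ Y → (x , y) ∙ Y ∙ mat a b c d) (inv-def a b c d)) (cong₂ _,_
        (trans ((solve 6 (λ x y a b c d → (x :* d :+ y :* (:- c)) :* a :+ (x :* (:- b) :+ y :* a) :* c := (a :* d :- b :* c) :* x) refl) x y a b c d) (cancel x))
        (trans ((solve 6 (λ x y a b c d → (x :* d :+ y :* (:- c)) :* b :+ (x :* (:- b) :+ y :* a) :* d := (a :* d :- b :* c) :* y) refl) x y a b c d) (cancel y)))
        where
        cancel : ∀ z → (a * d - b * c) * z ≡ z
        cancel z = trans (cong (_* z) (Det1⇒ a b c d D)) (*-identityˡ z)

      row₁ : ∀ a b c d → (1# , 0#) ∙ mat a b c d ≡ (a , b)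
      row₁ a b c d = cong₂ _,_ ((solve 2 (λ a c → (num 1) :* a :+ (num 0) :* c := a) refl) a c) ((solve 2 (λ a c → (num 1) :* a :+ (num 0) :* c := a) refl) b d)

      row₂ : ∀ a b c d → (0# , 1#) ∙ mat a b c d ≡ (c , d)
      row₂ a b c d = cong₂ _,_ ((solve 2 (λ a c → (num 0) :* a :+ (num 1) :* c := c) refl) a c) ((solve 2 (λ a c → (num 0) :* a :+ (num 1) :* c := c) refl) b d)

    e₁ e₂ : F × F
    e₁ = 1# , 0#
    e₂ = 0# , 1#

    rows-injective : ∀ {X Y} → e₁ ∙ X ≡ e₁ ∙ Y → e₂ ∙ X ≡ e₂ ∙ Y → X ≡ Y
    rows-injective {mat a b c d} {mat a′ b′ c′ d′} r₁ r₂ = mat-cong (cong proj₁ r₁′) (cong proj₂ r₁′) (cong proj₁ r₂′) (cong proj₂ r₂′)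
      where
      r₁′ : (a , b) ≡ (a′ , b′)
      r₁′ = trans (sym (row₁ a b c d)) (trans r₁ (row₁ a′ b′ c′ d′))
      r₂′ : (c , d) ≡ (c′ , d′)
      r₂′ = trans (sym (row₂ a b c d)) (trans r₂ (row₂ a′ b′ c′ d′))

    ∙-injective : ∀ {X Y} → (∀ v → v ∙ X ≡ v ∙ Y) → X ≡ Y
    ∙-injective e = rows-injective (e e₁) (e e₂)

    det-rows⇒Det1 : ∀ X → det (e₁ ∙ X) (e₂ ∙ X) ≡ 1# → Det1 X
    det-rows⇒Det1 (mat a b c d) e = ⇒Det1 a b c d (trans (sym (cong₂ det (row₁ a b c d) (row₂ a b c d))) e)

    det-e : det e₁ e₂ ≡ 1#
    det-e = trans (cong₂ _-_ (*-identityʳ 1#) (zeroˡ 0#)) (trans (cong (1# +_) -0≡0) (+-identityʳ 1#))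

    Det1-one : Det1 one
    Det1-one = det-rows⇒Det1 one (trans (cong₂ det (∙-one e₁) (∙-one e₂)) det-e)

    Det1-· : ∀ X Y → Det1 X → Det1 Y → Det1 (X · Y)
    Det1-· X Y DX DY = det-rows⇒Det1 (X · Y) (trans (cong₂ det (∙-· e₁ X Y) (∙-· e₂ X Y))
      (trans (det-∙ (e₁ ∙ X) (e₂ ∙ X) Y DY) (trans (det-∙ e₁ e₂ X DX) det-e)))

    Det1-neg : ∀ X → Det1 X → Det1 (-ᴹ X)
    Det1-neg X D = det-rows⇒Det1 (-ᴹ X) (trans (cong₂ det (∙-neg e₁ X) (∙-neg e₂ X)) (trans (det-scale (- 1#) (- 1#) (e₁ ∙ X) (e₂ ∙ X))
      (trans ((solve 1 (λ d → (:- (num 1)) :* (:- (num 1)) :* d := d) refl) (det (e₁ ∙ X) (e₂ ∙ X))) (trans (det-∙ e₁ e₂ X D) det-e))))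

    Det1-inv : ∀ X → Det1 X → Det1 (inv X)
    Det1-inv X D = det-rows⇒Det1 (inv X) (trans (sym (det-∙ (e₁ ∙ inv X) (e₂ ∙ inv X) X D)) (trans (cong₂ det (inv-∙ e₁ X D) (inv-∙ e₂ X D)) det-e))

    Det1-^ : ∀ X k → Det1 X → Det1 (X ^ᴹ k)
    Det1-^ X zero D = Det1-one
    Det1-^ X (suc k) D = Det1-· X (X ^ᴹ k) D (Det1-^ X k D)

    Det1-≈ : ∀ X Y → X ≈ Y → Det1 Y → Det1 X
    Det1-≈ X Y (inj₁ refl) D = D
    Det1-≈ X Y (inj₂ refl) D = Det1-neg Y D

    scale-scale : ∀ a b v → scale a (scale b v) ≡ scale (a * b) v
    scale-scale a b (x , y) = cong₂ _,_ (sym (*-assoc a b x)) (sym (*-assoc a b y))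

    scale-1 : ∀ v → scale 1# v ≡ v
    scale-1 (x , y) = cong₂ _,_ (*-identityˡ x) (*-identityˡ y)

    scale-injective : ∀ {a b v} → Nonzero v → scale a v ≡ scale b v → a ≡ b
    scale-injective {a} {b} {x , y} nv e = go (x ≟ 0#) (y ≟ 0#)
      where
      cancel : ∀ {z} → z ≢ 0# → a * z ≡ b * z → a ≡ b
      cancel z≢0 e = *-cancelˡ z≢0 (trans (*-comm _ a) (trans e (*-comm b _)))
      go : Dec (x ≡ 0#) → Dec (y ≡ 0#) → a ≡ b
      go (no x≢0) _ = cancel x≢0 (cong proj₁ e)
      go (yes _) (no y≢0) = cancel y≢0 (cong proj₂ e)
      go (yes x≡0) (yes y≡0) = contradiction (cong₂ _,_ x≡0 y≡0) nv

    ∙-nonzero : ∀ v X → Det1 X → Nonzero v → Nonzero (v ∙ X)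
    ∙-nonzero v X D nv e = nv (trans (sym (∙-inv v X D)) (trans (cong (_∙ inv X) (trans e (sym zero-scale)))
      (trans (∙-scale 0# v (inv X)) (cong₂ _,_ (zeroˡ _) (zeroˡ _)))))
      where
      zero-scale : scale 0# v ≡ (0# , 0#)
      zero-scale = cong₂ _,_ (zeroˡ _) (zeroˡ _)

    Sign : F → Set
    Sign ε = ε ≡ 1# ⊎ ε ≡ - 1#

    Sign-* : ∀ {ε η} → Sign ε → Sign η → Sign (ε * η)
    Sign-* (inj₁ refl) (inj₁ refl) = inj₁ (*-identityˡ 1#)
    Sign-* (inj₁ refl) (inj₂ refl) = inj₂ (*-identityˡ _)
    Sign-* (inj₂ refl) (inj₁ refl) = inj₂ (*-identityʳ _)
    Sign-* (inj₂ refl) (inj₂ refl) = inj₁ (trans ((solve 1 (λ x → (:- x) :* (:- x) := x :* x) refl) 1#) (*-identityˡ 1#))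

    Sign-square : ∀ {ε} → Sign ε → ε * ε ≡ 1#
    Sign-square (inj₁ refl) = *-identityˡ 1#
    Sign-square (inj₂ refl) = trans ((solve 1 (λ x → (:- x) :* (:- x) := x :* x) refl) 1#) (*-identityˡ 1#)

    -- The class of X in PSL(2,p) acts on rows up to sign.
    _≋_ : M → M → Set
    X ≋ Y = ∃ λ ε → Sign ε × (∀ v → v ∙ X ≡ scale ε (v ∙ Y))

    ≈⇒≋ : ∀ X Y → X ≈ Y → X ≋ Y
    ≈⇒≋ X Y (inj₁ refl) = 1# , inj₁ refl , λ v → sym (scale-1 _)
    ≈⇒≋ X Y (inj₂ refl) = - 1# , inj₂ refl , λ v → ∙-neg v Y

    ≋⇒≈ : ∀ X Y → X ≋ Y → X ≈ Y
    ≋⇒≈ X Y (_ , inj₁ refl , e) = inj₁ (∙-injective λ v → trans (e v) (scale-1 _))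
    ≋⇒≈ X Y (_ , inj₂ refl , e) = inj₂ (∙-injective λ v → trans (e v) (sym (∙-neg v Y)))

    ≋-·ˡ : ∀ X X′ Y → X ≋ X′ → (X · Y) ≋ (X′ · Y)
    ≋-·ˡ X X′ Y (ε , s , e) = ε , s , λ v → trans (∙-· v X Y) (trans (cong (_∙ Y) (e v)) (trans (∙-scale ε _ Y) (cong (scale ε) (sym (∙-· v X′ Y)))))

    ≋-trans : ∀ X Y Z → X ≋ Y → Y ≋ Z → X ≋ Z
    ≋-trans X Y Z (ε , s , e) (η , s′ , e′) = ε * η , Sign-* s s′ , λ v → trans (e v) (trans (cong (scale ε) (e′ v)) (scale-scale ε η _))

    ≋-sym : ∀ X Y → X ≋ Y → Y ≋ X
    ≋-sym X Y (ε , s , e) = ε , s , λ v → sym (trans (cong (scale ε) (e v)) (trans (scale-scale ε ε _) (trans (cong (λ c → scale c (v ∙ Y)) (Sign-square s)) (scale-1 _))))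

    eigen-^ : ∀ v X {r} k → v ∙ X ≡ scale r v → v ∙ (X ^ᴹ k) ≡ scale (r ^ k) v
    eigen-^ v X zero e = trans (∙-one v) (sym (scale-1 v))
    eigen-^ v X {r} (suc k) e = trans (∙-· v X (X ^ᴹ k)) (trans (cong (_∙ (X ^ᴹ k)) e) (trans (∙-scale r v (X ^ᴹ k))
      (trans (cong (scale r) (eigen-^ v X k e)) (scale-scale r (r ^ k) v))))

    eigen-inv : ∀ v X {r} → Det1 X → r ≢ 0# → v ∙ X ≡ scale r v → v ∙ inv X ≡ scale (r ⁻¹) v
    eigen-inv v X {r} D r≢0 e = begin
      v ∙ inv X                              ≡⟨ scale-1 _ ⟨
      scale 1# (v ∙ inv X)                   ≡⟨ cong (λ c → scale c (v ∙ inv X)) (inverseˡ r≢0) ⟨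
      scale (r ⁻¹ * r) (v ∙ inv X)           ≡⟨ scale-scale (r ⁻¹) r (v ∙ inv X) ⟨
      scale (r ⁻¹) (scale r (v ∙ inv X))     ≡⟨ cong (scale (r ⁻¹)) (∙-scale r v (inv X)) ⟨
      scale (r ⁻¹) (scale r v ∙ inv X)       ≡⟨ cong (λ w → scale (r ⁻¹) (w ∙ inv X)) e ⟨
      scale (r ⁻¹) (v ∙ X ∙ inv X)           ≡⟨ cong (scale (r ⁻¹)) (∙-inv v X D) ⟩
      scale (r ⁻¹) v                         ∎
      where open ≡-Reasoning

    ^ᴹ-+ : ∀ X m k v → v ∙ (X ^ᴹ (m ℕ.+ k)) ≡ v ∙ (X ^ᴹ m) ∙ (X ^ᴹ k)
    ^ᴹ-+ X zero k v = cong (_∙ (X ^ᴹ k)) (sym (∙-one v))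
    ^ᴹ-+ X (suc m) k v = trans (∙-· v X _) (trans (^ᴹ-+ X m k (v ∙ X)) (cong (_∙ (X ^ᴹ k)) (sym (∙-· v X (X ^ᴹ m)))))

    ^ᴹ-double : ∀ X m → X ^ᴹ (m ℕ.+ m) ≡ (X ^ᴹ 2) ^ᴹ m
    ^ᴹ-double X zero = refl
    ^ᴹ-double X (suc m) = ∙-injective λ v → begin
      v ∙ (X · (X ^ᴹ (m ℕ.+ suc m)))             ≡⟨ cong (λ k → v ∙ (X · (X ^ᴹ k))) (ℕ.+-suc m m) ⟩
      v ∙ (X · (X · (X ^ᴹ (m ℕ.+ m))))           ≡⟨ ∙-· v X _ ⟩
      v ∙ X ∙ (X · (X ^ᴹ (m ℕ.+ m)))             ≡⟨ ∙-· (v ∙ X) X _ ⟩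
      v ∙ X ∙ X ∙ (X ^ᴹ (m ℕ.+ m))               ≡⟨ cong₂ _∙_ (sym (square v)) (^ᴹ-double X m) ⟩
      v ∙ (X ^ᴹ 2) ∙ ((X ^ᴹ 2) ^ᴹ m)             ≡⟨ ∙-· v (X ^ᴹ 2) _ ⟨
      v ∙ ((X ^ᴹ 2) · ((X ^ᴹ 2) ^ᴹ m))           ∎
      where
      open ≡-Reasoning
      square : ∀ v → v ∙ (X ^ᴹ 2) ≡ v ∙ X ∙ X
      square v = trans (∙-· v X (X · one)) (trans (∙-· (v ∙ X) X one) (∙-one _))

    partner : F × F → F × F
    partner (x , y) with x ≟ 0#
    ... | no _  = 0# , x ⁻¹
    ... | yes _ = - (y ⁻¹) , 0#

    det-partner : ∀ v → Nonzero v → det v (partner v) ≡ 1#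
    det-partner (x , y) nv with x ≟ 0#
    ... | no x≢0 = trans (cong (λ z → x * x ⁻¹ - z) (zeroʳ y)) (trans (cong (λ z → x * x ⁻¹ + z) -0≡0) (trans (+-identityʳ _) (inverseʳ x≢0)))
    ... | yes refl = trans ((solve 3 (λ z y i → z :* z :- y :* (:- i) := z :* z :+ y :* i) refl) 0# y (y ⁻¹)) (trans (cong (_+ y * y ⁻¹) (zeroˡ 0#)) (trans (+-identityˡ _) (inverseʳ λ y≡0 → nv (cong (0# ,_) y≡0))))

    parallel : ∀ {e v} → Nonzero e → det e v ≡ 0# → ∃ λ r → v ≡ scale r e
    parallel {e} {v} ne z = C.fst v , trans (sym (C.cramer v)) (cong₂ _,_ (drop (proj₁ e) (proj₁ (partner e))) (drop (proj₂ e) (proj₂ (partner e))))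
      where
      D≢0 : det e (partner e) ≢ 0#
      D≢0 z = 1≢0 (trans (sym (det-partner e ne)) z)
      module C = Coordinates e (partner e) D≢0
      drop : ∀ x y → C.fst v * x + C.snd v * y ≡ C.fst v * x
      drop x y = trans (cong (λ d → C.fst v * x + d * C.i * y) z) (trans (cong (λ d → C.fst v * x + d * y) (zeroˡ C.i)) (trans (cong (C.fst v * x +_) (zeroˡ y)) (+-identityʳ _)))

    basis-injective : ∀ {X Y} e f → det e f ≢ 0# → e ∙ X ≡ e ∙ Y → f ∙ X ≡ f ∙ Y → X ≡ Y
    basis-injective {X} {Y} e f D≢0 ee ef = ∙-injective λ v → trans (cong (_∙ X) (sym (C.cramer v))) (trans (∙-comb _ _ e f X)
      (trans (cong₂ (comb (C.fst v) (C.snd v)) ee ef) (trans (sym (∙-comb _ _ e f Y)) (cong (_∙ Y) (C.cramer v)))))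
      where
      module C = Coordinates e f D≢0

    opaque
      unfolding _∙_

      -- The linear map between two bases of equal determinant has determinant 1, and its matrix has
      -- the images of e₁ and e₂ as rows.
      matrix-of : ∀ e f e′ f′ → det e f ≢ 0# → det e′ f′ ≡ det e f → ∃ λ X → Det1 X × e ∙ X ≡ e′ × f ∙ X ≡ f′
      matrix-of e f e′ f′ D≢0 D≡ = X , ⇒Det1 _ _ _ _ (trans (T.to-det e₁ e₂) (trans (cong₂ (λ a b → a * det e f ⁻¹ * b) D≡ det-e) (trans (*-identityʳ _) (inverseʳ D≢0)))) ,
        trans (acts e) (trans (cong T.to (sym (comb-1-0 e f))) (trans (T.to-comb 1# 0#) (comb-1-0 e′ f′))) ,
        trans (acts f) (trans (cong T.to (sym (comb-0-1 e f))) (trans (T.to-comb 0# 1#) (comb-0-1 e′ f′)))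
        where
        module T = Transfer e f e′ f′ D≢0 (subst (_≢ 0#) (sym D≡) D≢0)
        X : M
        X = mat (proj₁ (T.to e₁)) (proj₂ (T.to e₁)) (proj₁ (T.to e₂)) (proj₂ (T.to e₂))
        module C = Coordinates e f D≢0
        acts : ∀ v → v ∙ X ≡ T.to v
        acts v@(x , y) = trans (cong₂ _,_ refl refl) (sym (trans (cong T.to (expand v)) (linear x y)))
          where
          expand : ∀ v → v ≡ comb (proj₁ v) (proj₂ v) e₁ e₂
          expand (x , y) = cong₂ _,_ (sym (trans (cong₂ _+_ (*-identityʳ x) (zeroʳ y)) (+-identityʳ x))) (sym (trans (cong₂ _+_ (zeroʳ x) (*-identityʳ y)) (+-identityˡ y)))
          linear : ∀ x y → T.to (comb x y e₁ e₂) ≡ comb x y (T.to e₁) (T.to e₂)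
          linear x y = trans (cong T.to (trans (cong₂ (comb x y) (sym (C.cramer e₁)) (sym (C.cramer e₂))) (mix x y (C.fst e₁) (C.snd e₁) (C.fst e₂) (C.snd e₂) e f)))
            (trans (T.to-comb _ _) (sym (mix x y (C.fst e₁) (C.snd e₁) (C.fst e₂) (C.snd e₂) e′ f′)))
            where
            mix : ∀ x y a b c d e f → comb x y (comb a b e f) (comb c d e f) ≡ comb (x * a + y * c) (x * b + y * d) e f
            mix x y a b c d (u , u′) (w , w′) = cong₂ _,_ (coordinate u w) (coordinate u′ w′)
              where
              coordinate : ∀ u w → x * (a * u + b * w) + y * (c * u + d * w) ≡ (x * a + y * c) * u + (x * b + y * d) * w
              coordinate u w = (solve 8 (λ x y a b c d u w → x :* (a :* u :+ b :* w) :+ y :* (c :* u :+ d :* w) := (x :* a :+ y :* c) :* u :+ (x :* b :+ y :* d) :* w) refl) x y a b c d u w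

    ≋-· : ∀ X X′ Y Y′ → X ≋ X′ → Y ≋ Y′ → (X · Y) ≋ (X′ · Y′)
    ≋-· X X′ Y Y′ xx′ (η , s′ , e′) = ≋-trans (X · Y) (X′ · Y) (X′ · Y′) (≋-·ˡ X X′ Y xx′)
      (η , s′ , λ v → trans (∙-· v X′ Y) (trans (e′ (v ∙ X′)) (cong (scale η) (sym (∙-· v X′ Y′)))))

    ≋-refl : ∀ X → X ≋ X
    ≋-refl X = 1# , inj₁ refl , λ v → sym (scale-1 _)

    ≋-^ : ∀ X Y k → X ≋ Y → (X ^ᴹ k) ≋ (Y ^ᴹ k)
    ≋-^ X Y zero e = ≋-refl one
    ≋-^ X Y (suc k) e = ≋-· X Y (X ^ᴹ k) (Y ^ᴹ k) e (≋-^ X Y k e)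

    scale-cancel : ∀ {r} v w → r ≢ 0# → scale r v ≡ scale r w → v ≡ w
    scale-cancel v w r≢0 e = cong₂ _,_ (*-cancelˡ r≢0 (cong proj₁ e)) (*-cancelˡ r≢0 (cong proj₂ e))

    scale-comm : ∀ a b v → scale a (scale b v) ≡ scale b (scale a v)
    scale-comm a b v = trans (scale-scale a b v) (trans (cong (λ c → scale c v) (*-comm a b)) (sym (scale-scale b a v)))

    conjugate-· : ∀ v z y → v ∙ (z · (y · inv z)) ≡ v ∙ z ∙ y ∙ inv z
    conjugate-· v z y = trans (∙-· v z (y · inv z)) (∙-· (v ∙ z) y (inv z))

    conjugate-eigen : ∀ v z y {r} → Det1 z → v ∙ (z · (y · inv z)) ≡ scale r v → v ∙ z ∙ y ≡ scale r (v ∙ z)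
    conjugate-eigen v z y {r} D e = trans (sym (trans (cong (_∙ z) (conjugate-· v z y)) (inv-∙ (v ∙ z ∙ y) z D))) (trans (cong (_∙ z) e) (∙-scale r v z))

    eigen-conjugate : ∀ v z y {r} → Det1 z → v ∙ z ∙ y ≡ scale r (v ∙ z) → v ∙ (z · (y · inv z)) ≡ scale r v
    eigen-conjugate v z y {r} D e = trans (conjugate-· v z y) (trans (cong (_∙ inv z) e) (trans (∙-scale r (v ∙ z) (inv z)) (cong (scale r) (∙-inv v z D))))

    row-matrix : ∀ e v → Nonzero e → Nonzero v → ∃ λ X → Det1 X × e ∙ X ≡ v
    row-matrix e v ne nv = go (matrix-of e (partner e) v (partner v) (λ z → 1≢0 (trans (sym (det-partner e ne)) z)) (trans (det-partner v nv) (sym (det-partner e ne))))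
      where
      go : (∃ λ X → Det1 X × e ∙ X ≡ v × partner e ∙ X ≡ partner v) → ∃ λ X → Det1 X × e ∙ X ≡ v
      go (X , D , eX , _) = X , D , eX

-- Stabilisers of a line: ⟨a⟩, its normaliser, H and HgH.

module Borel where

  open import Defs using (module Mat)
  open Field
  open Squares
  open VectorModels
  open ModelTransitive
  open Matrices
  open import Data.Nat as ℕ using (ℕ; zero; suc)
  import Data.Nat.Properties as ℕ
  open import Data.Nat.Primality using (Prime)
  open import Data.Fin using (toℕ)
  open import Data.Product using (∃; _×_; _,_; proj₁)
  open import Data.Sum as Sum using (_⊎_; inj₁; inj₂; [_,_]′)
  open import Relation.Nullary using (¬_; contradiction)
  open import Relation.Binary.PropositionalEquality hiding ([_])

  module Subgroups (p : ℕ) (pr : Prime p) (h : ℕ) (p-odd : p ≡ suc (h ℕ.+ h)) (-1∈Sq : SquareBasics.Sq p pr (PrimeField.-_ p pr (PrimeField.1# p pr))) where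
    open PrimeField p pr
    open SquareClasses p pr h p-odd
    open Vectors p pr
    open LinearMaps p pr
    open RowAction p pr
    open Mat p using (InCyc; InNormalizer; InDouble)

    Sign⇒Sq : ∀ {ε} → Sign ε → Sq ε
    Sign⇒Sq (inj₁ refl) = Sq-1
    Sign⇒Sq (inj₂ refl) = -1∈Sq

    -- a generates, up to sign, the matrices y with e ∙ y = ± e, so its normaliser consists of the z for which e is an eigenvector.
    module Unipotent (a a′ : M) (a≋a′ : a ≋ a′) (e f : F × F) (D≢0 : det e f ≢ 0#) (ea : e ∙ a′ ≡ e) (fa : f ∙ a′ ≡ comb 1# 1# e f) where
      module C = Coordinates e f D≢0

      e-nonzero : Nonzero e
      e-nonzero = det≢0⇒nonzeroˡ {e} {f} D≢0

      eigenvalue≢0 : ∀ z {r} → Det1 z → e ∙ z ≡ scale r e → r ≢ 0#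
      eigenvalue≢0 z D ez refl = ∙-nonzero e z D e-nonzero (trans ez (cong₂ _,_ (zeroˡ _) (zeroˡ _)))

      e-power : ∀ k → e ∙ (a′ ^ᴹ k) ≡ e
      e-power zero = ∙-one e
      e-power (suc k) = trans (∙-· e a′ (a′ ^ᴹ k)) (trans (cong (_∙ (a′ ^ᴹ k)) ea) (e-power k))

      f-power : ∀ k → f ∙ (a′ ^ᴹ k) ≡ comb [ k ] 1# e f
      f-power zero = trans (∙-one f) (sym (comb-0-1 e f))
      f-power (suc k) = trans (∙-· f a′ (a′ ^ᴹ k)) (trans (cong (_∙ (a′ ^ᴹ k)) fa) (trans (∙-comb 1# 1# e f (a′ ^ᴹ k))
        (trans (cong₂ (comb 1# 1#) (e-power k) (f-power k)) (trans (add [ k ] e f) (cong (λ c → comb c 1# e f) (sym ([suc] k)))))))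
        where
        add : ∀ c e f → comb 1# 1# e (comb c 1# e f) ≡ comb (1# + c) 1# e f
        add c (x , y) (x′ , y′) = cong₂ _,_ ((solve 3 (λ c x x′ → (num 1) :* x :+ (num 1) :* (c :* x :+ (num 1) :* x′) := ((num 1) :+ c) :* x :+ (num 1) :* x′) refl) c x x′) ((solve 3 (λ c x x′ → (num 1) :* x :+ (num 1) :* (c :* x :+ (num 1) :* x′) := ((num 1) :+ c) :* x :+ (num 1) :* x′) refl) c y y′)

      e-a^ : ∀ k → ∃ λ ε → Sign ε × e ∙ (a ^ᴹ k) ≡ scale ε e
      e-a^ k = go (≋-^ a a′ k a≋a′)
        where
        go : (a ^ᴹ k) ≋ (a′ ^ᴹ k) → ∃ λ ε → Sign ε × e ∙ (a ^ᴹ k) ≡ scale ε e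
        go (ε , s , act) = ε , s , trans (act e) (cong (scale ε) (e-power k))

      -- Determinant 1 forces the f-coordinate of `f ∙ y` to be 1. Its e-coordinate is then the
      -- exponent, as the k-th power of a′ takes f to k e + f.
      fixes : ∀ y → Det1 y → e ∙ y ≡ e → y ≡ a′ ^ᴹ toℕ (C.fst (f ∙ y))
      fixes y D ey = basis-injective e f D≢0 (trans ey (sym (e-power k))) (trans (sym (C.cramer (f ∙ y)))
        (trans (cong₂ (λ c d → comb c d e f) (sym ([]-toℕ _)) snd≡1) (sym (f-power k))))
        where
        k = toℕ (C.fst (f ∙ y))
        snd≡1 : C.snd (f ∙ y) ≡ 1#
        snd≡1 = trans (cong (_* C.i) (trans (cong (λ w → det w (f ∙ y)) (sym ey)) (det-∙ e f y D))) (inverseʳ D≢0)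

      InCyc⇒ : ∀ y → InCyc a y → ∃ λ ε → Sign ε × e ∙ y ≡ scale ε e
      InCyc⇒ y (k , y≈) = go (≈⇒≋ y (a ^ᴹ k) y≈) (e-a^ k)
        where
        go : y ≋ (a ^ᴹ k) → (∃ λ ε → Sign ε × e ∙ (a ^ᴹ k) ≡ scale ε e) → ∃ λ ε → Sign ε × e ∙ y ≡ scale ε e
        go (η , s , act) (ε , s′ , ea) = η * ε , Sign-* s s′ , trans (act e) (trans (cong (scale η) ea) (scale-scale η ε e))

      ⇒InCyc : ∀ y {ε} → Det1 y → Sign ε → e ∙ y ≡ scale ε e → InCyc a y
      ⇒InCyc y D (inj₁ refl) ey = k , ≋⇒≈ y (a ^ᴹ k) (subst (_≋ (a ^ᴹ k)) (sym (fixes y D (trans ey (scale-1 e)))) (≋-sym (a ^ᴹ k) (a′ ^ᴹ k) (≋-^ a a′ k a≋a′)))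
        where
        k = toℕ (C.fst (f ∙ y))
      ⇒InCyc y D (inj₂ refl) ey = k , ≋⇒≈ y (a ^ᴹ k) (≋-trans y (-ᴹ y) (a ^ᴹ k)
          (- 1# , inj₂ refl , λ v → sym (trans (cong (scale (- 1#)) (∙-neg v y)) (double-neg (v ∙ y))))
          (subst (_≋ (a ^ᴹ k)) (sym (fixes (-ᴹ y) (Det1-neg y D) (trans (∙-neg e y) (trans (cong (scale (- 1#)) ey) (double-neg e)))))
            (≋-sym (a ^ᴹ k) (a′ ^ᴹ k) (≋-^ a a′ k a≋a′))))
        where
        k = toℕ (C.fst (f ∙ (-ᴹ y)))
        double-neg : ∀ v → scale (- 1#) (scale (- 1#) v) ≡ v
        double-neg v = trans (scale-scale _ _ v) (trans (cong (λ c → scale c v) (Sign-square (inj₂ refl))) (scale-1 v))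

      Det1-conj : ∀ z y → Det1 z → Det1 y → Det1 (z · (y · inv z))
      Det1-conj z y Dz Dy = Det1-· z (y · inv z) Dz (Det1-· y (inv z) Dy (Det1-inv z Dz))

      eigen⇒normalizer : ∀ z {r} → Det1 z → e ∙ z ≡ scale r e → InNormalizer (InCyc a) z
      eigen⇒normalizer z {r} Dz ez y Dy = (λ K → go (InCyc⇒ y K)) , λ K → back (InCyc⇒ _ K)
        where
        go : (∃ λ ε → Sign ε × e ∙ y ≡ scale ε e) → InCyc a (z · (y · inv z))
        go (ε , s , ey) = ⇒InCyc _ (Det1-conj z y Dz Dy) s (eigen-conjugate e z y Dz (trans (cong (_∙ y) ez) (trans (∙-scale r e y)
          (trans (cong (scale r) ey) (trans (scale-comm r ε e) (cong (scale ε) (sym ez)))))))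
        back : (∃ λ ε → Sign ε × e ∙ (z · (y · inv z)) ≡ scale ε e) → InCyc a y
        back (ε , s , ezy) = ⇒InCyc y Dy s (scale-cancel (e ∙ y) (scale ε e) (eigenvalue≢0 z Dz ez)
          (trans (sym (trans (cong (_∙ y) ez) (∙-scale r e y))) (trans (conjugate-eigen e z y Dz ezy) (trans (cong (scale ε) ez) (scale-comm ε r e)))))

      -- For the eigenvalue 1, a′ adds the f-coordinate of w to the e-coordinate, so the former
      -- vanishes. For -1, invariance of the determinant gives det e w = - det e w, and 2 is
      -- invertible.
      sign-eigen⇒parallel : ∀ w {ε} → Det1 a′ → Sign ε → w ∙ a′ ≡ scale ε w → det e w ≡ 0#
      sign-eigen⇒parallel w Da (inj₁ refl) wa = Sum.[ (λ z → z) , (λ z → contradiction z (⁻¹-nonzero D≢0)) ]′ (*-zero snd≡0)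
        where
        x = C.fst w
        y = C.snd w
        shifted : w ∙ a′ ≡ comb (x + y) y e f
        shifted = trans (cong (_∙ a′) (sym (C.cramer w))) (trans (∙-comb x y e f a′) (trans (cong₂ (comb x y) ea fa) (add x y e f)))
          where
          add : ∀ x y e f → comb x y e (comb 1# 1# e f) ≡ comb (x + y) y e f
          add x y (u , v) (u′ , v′) = cong₂ _,_ ((solve 4 (λ x y u u′ → x :* u :+ y :* ((num 1) :* u :+ (num 1) :* u′) := (x :+ y) :* u :+ y :* u′) refl) x y u u′) ((solve 4 (λ x y u u′ → x :* u :+ y :* ((num 1) :* u :+ (num 1) :* u′) := (x :+ y) :* u :+ y :* u′) refl) x y v v′)
        snd≡0 : y ≡ 0#
        snd≡0 = trans ((solve 2 (λ x y → y := x :+ y :- x) refl) x y) (trans (cong (_- x) (trans (sym (C.fst-comb (x + y) y)) (trans (cong C.fst (sym shifted)) (cong C.fst (trans wa (scale-1 w)))))) (-‿inverseʳ x))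
      sign-eigen⇒parallel w Da (inj₂ refl) wa = Sum.[ (λ z → contradiction z 2≢0) , (λ z → z) ]′ (*-zero (trans (cong ((1# + 1#) *_) refl)
        (trans ((solve 1 (λ d → ((num 1) :+ (num 1)) :* d := d :- (:- (num 1)) :* d) refl) (det e w)) (trans (cong (_- (- 1#) * det e w) flipped) (-‿inverseʳ _)))))
        where
        flipped : det e w ≡ - 1# * det e w
        flipped = trans (sym (det-∙ e w a′ Da)) (trans (cong₂ det ea wa) (trans (cong (λ v → det v (scale (- 1#) w)) (sym (scale-1 e)))
          (trans (det-scale 1# (- 1#) e w) (cong (_* det e w) (*-identityˡ _)))))

      -- The conjugate z a z⁻¹ lies in ⟨a⟩, hence sends e to ± e. Then `e ∙ z` is an eigenvector of
      -- a for a sign, and such eigenvectors lie on the line of e.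
      normalizer⇒eigen : ∀ z → Det1 a → Det1 a′ → Det1 z → InNormalizer (InCyc a) z → ∃ λ r → e ∙ z ≡ scale r e
      normalizer⇒eigen z Da Da′ Dz normal = go a≋a′ (InCyc⇒ _ (proj₁ (normal a Da) (1 , inj₁ (∙-injective λ v → sym (trans (∙-· v a one) (∙-one _))))))
        where
        go : a ≋ a′ → (∃ λ ε → Sign ε × e ∙ (z · (a · inv z)) ≡ scale ε e) → ∃ λ r → e ∙ z ≡ scale r e
        go (η , s , act) (ε , s′ , eza) = parallel {e} {e ∙ z} e-nonzero (sign-eigen⇒parallel (e ∙ z) Da′ (Sign-* s s′) (begin
          e ∙ z ∙ a′                          ≡⟨ scale-1 _ ⟨
          scale 1# (e ∙ z ∙ a′)               ≡⟨ cong (λ c → scale c (e ∙ z ∙ a′)) (Sign-square s) ⟨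
          scale (η * η) (e ∙ z ∙ a′)          ≡⟨ scale-scale η η _ ⟨
          scale η (scale η (e ∙ z ∙ a′))      ≡⟨ cong (scale η) (act (e ∙ z)) ⟨
          scale η (e ∙ z ∙ a)                 ≡⟨ cong (scale η) (conjugate-eigen e z a Dz eza) ⟩
          scale η (scale ε (e ∙ z))           ≡⟨ scale-scale η ε _ ⟩
          scale (η * ε) (e ∙ z)               ∎))
          where open ≡-Reasoning

      module _ (Da : Det1 a) (b : M) (Db : Det1 b) {d : F} (eb : e ∙ b ≡ scale d e) where

        H : M → Set
        H x = ∃ λ j → ∃ λ k → x ≈ ((a ^ᴹ j) · ((b ^ᴹ 2) ^ᴹ k))

        e-ab : ∀ y j k → y ≈ ((a ^ᴹ j) · (b ^ᴹ k)) → ∃ λ ε → Sign ε × e ∙ y ≡ scale (ε * d ^ k) e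
        e-ab y j k y≈ = go (≈⇒≋ y ((a ^ᴹ j) · (b ^ᴹ k)) y≈) (e-a^ j)
          where
          go : y ≋ ((a ^ᴹ j) · (b ^ᴹ k)) → (∃ λ ε → Sign ε × e ∙ (a ^ᴹ j) ≡ scale ε e) → ∃ λ ε → Sign ε × e ∙ y ≡ scale (ε * d ^ k) e
          go (η , s , act) (ε , s′ , ea) = η * ε , Sign-* s s′ , (begin
            e ∙ y                                         ≡⟨ act e ⟩
            scale η (e ∙ ((a ^ᴹ j) · (b ^ᴹ k)))           ≡⟨ cong (scale η) (∙-· e (a ^ᴹ j) (b ^ᴹ k)) ⟩
            scale η (e ∙ (a ^ᴹ j) ∙ (b ^ᴹ k))             ≡⟨ cong (λ w → scale η (w ∙ (b ^ᴹ k))) ea ⟩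
            scale η (scale ε e ∙ (b ^ᴹ k))                ≡⟨ cong (scale η) (∙-scale ε e (b ^ᴹ k)) ⟩
            scale η (scale ε (e ∙ (b ^ᴹ k)))              ≡⟨ scale-scale η ε _ ⟩
            scale (η * ε) (e ∙ (b ^ᴹ k))                  ≡⟨ cong (scale (η * ε)) (eigen-^ e b k eb) ⟩
            scale (η * ε) (scale (d ^ k) e)               ≡⟨ scale-scale (η * ε) (d ^ k) e ⟩
            scale (η * ε * d ^ k) e                       ∎)
            where open ≡-Reasoning

        Det1-ab : ∀ y j k → y ≈ ((a ^ᴹ j) · (b ^ᴹ k)) → Det1 y
        Det1-ab y j k y≈ = Det1-≈ y _ y≈ (Det1-· (a ^ᴹ j) (b ^ᴹ k) (Det1-^ a j Da) (Det1-^ b k Db))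

        private
          unpack : ∀ y j k → y ≈ ((a ^ᴹ j) · ((b ^ᴹ 2) ^ᴹ k)) → y ≈ ((a ^ᴹ j) · (b ^ᴹ (k ℕ.+ k)))
          unpack y j k = subst (λ c → y ≈ ((a ^ᴹ j) · c)) (sym (^ᴹ-double b k))

        H⇒Det1 : ∀ y → H y → Det1 y
        H⇒Det1 y (j , k , y≈) = Det1-ab y j (k ℕ.+ k) (unpack y j k y≈)

        d≢0 : d ≢ 0#
        d≢0 = eigenvalue≢0 b Db eb

        -- The eigenvalue is ± d^(2k), a square because -1 is one.
        H⇒eigen : ∀ y → H y → ∃ λ r → Sq r × e ∙ y ≡ scale r e
        H⇒eigen y (j , k , y≈) = go (e-ab y j (k ℕ.+ k) (unpack y j k y≈))
          where
          go : (∃ λ ε → Sign ε × e ∙ y ≡ scale (ε * d ^ (k ℕ.+ k)) e) → ∃ λ r → Sq r × e ∙ y ≡ scale r e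
          go (ε , s , ey) = _ , Sq-* (Sign⇒Sq s) (d ^ k , ^-nonzero k d≢0 , ^-+ d k k) , ey

        module _ (d-nonsquare : ¬ Sq d) (normal-form : ∀ x → Det1 x → InNormalizer (InCyc a) x → ∃ λ j → ∃ λ k → x ≈ ((a ^ᴹ j) · (b ^ᴹ k))) where

          -- The normal form a^j b^k has eigenvalue ± d^k on e. As d is a nonsquare and -1 a square,
          -- a square eigenvalue makes k even.
          eigen⇒H : ∀ y {r} → Det1 y → Sq r → e ∙ y ≡ scale r e → H y
          eigen⇒H y {r} Dy sr ey = go (normal-form y Dy (eigen⇒normalizer y Dy ey))
            where
            go : (∃ λ j → ∃ λ k → y ≈ ((a ^ᴹ j) · (b ^ᴹ k))) → H y
            go (j , k , y≈) = by (parity k)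
              where
              by : (∃ λ m → k ≡ m ℕ.+ m ⊎ k ≡ suc (m ℕ.+ m)) → H y
              by (m , inj₁ refl) = j , m , subst (λ c → y ≈ ((a ^ᴹ j) · c)) (^ᴹ-double b m) y≈
              by (m , inj₂ refl) = contradiction (Sq-divʳ {d} (d ^ m , ^-nonzero m d≢0 , ^-+ d m m) (odd (e-ab y j k y≈))) d-nonsquare
                where
                odd : (∃ λ ε → Sign ε × e ∙ y ≡ scale (ε * d ^ k) e) → Sq (d ^ suc (m ℕ.+ m))
                odd (ε , s , ey′) = Sq-divˡ (Sign⇒Sq s) (subst Sq (scale-injective {v = e} e-nonzero (trans (sym ey) ey′)) sr)

    module DoubleCoset (e : F × F) (e-nonzero : Nonzero e) (H : M → Set) (H⇒Det1 : ∀ y → H y → Det1 y)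
      (H⇒eigen : ∀ y → H y → ∃ λ r → Sq r × e ∙ y ≡ scale r e)
      (eigen⇒H : ∀ y {r} → Det1 y → Sq r → e ∙ y ≡ scale r e → H y)
      (g : M) (Dg : Det1 g) (D≢0 : det e (e ∙ g) ≢ 0#) where

      private
        D : F
        D = det e (e ∙ g)

      -- Elements of H scale e by squares and preserve determinants, so the class of `det e (e ∙ x)`
      -- is the same for all x in HgH; at g it is the class of D.
      double⇒ : ∀ x → InDouble H g x → Sq (D * det e (e ∙ x))
      double⇒ x (h₁ , h₂ , H₁ , H₂ , x≈) = go (H⇒eigen h₁ H₁) (H⇒eigen h₂ H₂) (≈⇒≋ x (h₁ · (g · h₂)) x≈)
        where
        go : (∃ λ r → Sq r × e ∙ h₁ ≡ scale r e) → (∃ λ r → Sq r × e ∙ h₂ ≡ scale r e) → x ≋ (h₁ · (g · h₂)) → Sq (D * det e (e ∙ x))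
        go (r₁ , s₁ , eh₁) (r₂ , s₂ , eh₂) (ε , s , act) = Sq-divˡ s₂ (subst Sq (sym (begin
          r₂ * (D * det e (e ∙ x))                      ≡⟨ (solve 3 (λ r D x → r :* (D :* x) := D :* (r :* (num 1) :* x)) refl) r₂ D (det e (e ∙ x)) ⟩
          D * (r₂ * 1# * det e (e ∙ x))                 ≡⟨ cong (D *_) (det-scale r₂ 1# e (e ∙ x)) ⟨
          D * det (scale r₂ e) (scale 1# (e ∙ x))       ≡⟨ cong₂ (λ v w → D * det v w) eh₂ (trans (sym ex) (sym (scale-1 _))) ⟨
          D * det (e ∙ h₂) (scale (ε * r₁) (e ∙ g ∙ h₂)) ≡⟨ cong (λ v → D * det v (scale (ε * r₁) (e ∙ g ∙ h₂))) (scale-1 _) ⟨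
          D * det (scale 1# (e ∙ h₂)) (scale (ε * r₁) (e ∙ g ∙ h₂)) ≡⟨ cong (D *_) (det-scale 1# (ε * r₁) (e ∙ h₂) (e ∙ g ∙ h₂)) ⟩
          D * (1# * (ε * r₁) * det (e ∙ h₂) (e ∙ g ∙ h₂)) ≡⟨ cong (λ d → D * (1# * (ε * r₁) * d)) (det-∙ e (e ∙ g) h₂ (H⇒Det1 h₂ H₂)) ⟩
          D * (1# * (ε * r₁) * D)                       ≡⟨ (solve 2 (λ D c → D :* ((num 1) :* c :* D) := c :* (D :* D)) refl) D (ε * r₁) ⟩
          ε * r₁ * (D * D)                              ∎)) (Sq-* (Sq-* (Sign⇒Sq s) s₁) (Sq-square D≢0)))
          where
          open ≡-Reasoning
          ex : e ∙ x ≡ scale (ε * r₁) (e ∙ g ∙ h₂)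
          ex = trans (act e) (trans (cong (scale ε) (trans (∙-· e h₁ (g · h₂)) (trans (cong (_∙ (g · h₂)) eh₁) (trans (∙-scale r₁ e (g · h₂)) (cong (scale r₁) (∙-· e g h₂))))))
            (scale-scale ε r₁ _))

      -- The factor h₂ is sought with e g h₂ = e x and with e h₂ a multiple of e. Determinant 1
      -- dictates the multiple κ = D / d, which is a square since D d is. Then h₁ = x h₂⁻¹ g⁻¹ fixes
      -- e.
      ⇒double : ∀ x → Det1 x → Sq (D * det e (e ∙ x)) → InDouble H g x
      ⇒double x Dx sq = go (matrix-of e (e ∙ g) (scale κ e) (e ∙ x) D≢0 (begin
        det (scale κ e) (e ∙ x)              ≡⟨ cong (det (scale κ e)) (scale-1 _) ⟨
        det (scale κ e) (scale 1# (e ∙ x))   ≡⟨ det-scale κ 1# e (e ∙ x) ⟩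
        D * d ⁻¹ * 1# * d                    ≡⟨ (solve 3 (λ D i d → D :* i :* (num 1) :* d := D :* (i :* d)) refl) D (d ⁻¹) d ⟩
        D * (d ⁻¹ * d)                       ≡⟨ cong (D *_) (inverseˡ d≢0) ⟩
        D * 1#                               ≡⟨ *-identityʳ D ⟩
        D                                    ∎))
        where
        open ≡-Reasoning
        d : F
        d = det e (e ∙ x)
        d≢0 : d ≢ 0#
        d≢0 z = Sq⇒≢0 sq (trans (cong (D *_) z) (zeroʳ D))
        κ : F
        κ = D * d ⁻¹
        κ-Sq : Sq κ
        κ-Sq = Sq-divʳ (Sq-square d≢0) (subst Sq (trans (trans (sym (*-identityʳ _)) (cong (D * d *_) (sym (inverseˡ d≢0)))) ((solve 3 (λ D d i → D :* d :* (i :* d) := D :* i :* (d :* d)) refl) D d (d ⁻¹))) sq)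
        go : (∃ λ h₂ → Det1 h₂ × e ∙ h₂ ≡ scale κ e × e ∙ g ∙ h₂ ≡ e ∙ x) → InDouble H g x
        go (h₂ , D₂ , eh₂ , egh₂) = h₁ , h₂ , eigen⇒H h₁ Det₁ Sq-1 (trans eh₁ (sym (scale-1 e))) , eigen⇒H h₂ D₂ κ-Sq eh₂ ,
          inj₁ (∙-injective λ v → sym (trans (∙-· v h₁ (g · h₂)) (trans (∙-· (v ∙ h₁) g h₂) (trans (cong (λ w → w ∙ g ∙ h₂) (act v))
            (trans (cong (_∙ h₂) (inv-∙ (v ∙ x ∙ inv h₂) g Dg)) (inv-∙ (v ∙ x) h₂ D₂))))))
          where
          h₁ : M
          h₁ = x · (inv h₂ · inv g)
          act : ∀ v → v ∙ h₁ ≡ v ∙ x ∙ inv h₂ ∙ inv g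
          act v = trans (∙-· v x (inv h₂ · inv g)) (∙-· (v ∙ x) (inv h₂) (inv g))
          Det₁ : Det1 h₁
          Det₁ = Det1-· x (inv h₂ · inv g) Dx (Det1-· (inv h₂) (inv g) (Det1-inv h₂ D₂) (Det1-inv g Dg))
          eh₁ : e ∙ h₁ ≡ e
          eh₁ = trans (act e) (trans (cong (λ w → w ∙ inv h₂ ∙ inv g) (sym egh₂)) (trans (cong (_∙ inv g) (∙-inv (e ∙ g) h₂ D₂)) (∙-inv e g Dg)))

      double-quotient⇒ : ∀ x y → Det1 x → InDouble H g (y · inv x) → Sq (D * det (e ∙ x) (e ∙ y))
      double-quotient⇒ x y Dx dd = subst (λ d → Sq (D * d)) (quotient-det x y Dx) (double⇒ (y · inv x) dd)
        where
        quotient-det : ∀ x y → Det1 x → det e (e ∙ (y · inv x)) ≡ det (e ∙ x) (e ∙ y)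
        quotient-det x y Dx = trans (sym (det-∙ e (e ∙ (y · inv x)) x Dx)) (cong (det (e ∙ x)) (trans (cong (_∙ x) (∙-· e y (inv x))) (inv-∙ (e ∙ y) x Dx)))

      ⇒double-quotient : ∀ x y → Det1 x → Det1 y → Sq (D * det (e ∙ x) (e ∙ y)) → InDouble H g (y · inv x)
      ⇒double-quotient x y Dx Dy sq = ⇒double (y · inv x) (Det1-· y (inv x) Dy (Det1-inv x Dx)) (subst (λ d → Sq (D * d)) (sym quotient-det) sq)
        where
        quotient-det : det e (e ∙ (y · inv x)) ≡ det (e ∙ x) (e ∙ y)
        quotient-det = trans (sym (det-∙ e (e ∙ (y · inv x)) x Dx)) (cong (det (e ∙ x)) (trans (cong (_∙ x) (∙-· e y (inv x))) (inv-∙ (e ∙ y) x Dx)))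

      H-quotient⇒ : ∀ x y → Det1 y → H (x · inv y) → ∃ λ r → Sq r × e ∙ x ≡ scale r (e ∙ y)
      H-quotient⇒ x y Dy Hxy = go (H⇒eigen (x · inv y) Hxy)
        where
        go : (∃ λ r → Sq r × e ∙ (x · inv y) ≡ scale r e) → ∃ λ r → Sq r × e ∙ x ≡ scale r (e ∙ y)
        go (r , s , exy) = r , s , trans (sym (inv-∙ (e ∙ x) y Dy)) (trans (cong (_∙ y) (trans (sym (∙-· e x (inv y))) exy)) (∙-scale r e y))

      ⇒H-quotient : ∀ x y {r} → Det1 x → Det1 y → Sq r → e ∙ x ≡ scale r (e ∙ y) → H (x · inv y)
      ⇒H-quotient x y {r} Dx Dy s ex = eigen⇒H (x · inv y) (Det1-· x (inv y) Dx (Det1-inv y Dy)) s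
        (trans (∙-· e x (inv y)) (trans (cong (_∙ inv y) ex) (trans (∙-scale r (e ∙ y) (inv y)) (cong (scale r) (∙-inv e y Dy)))))

-- From the coset data to the vector model.

module CosetToModel where

  open import Defs using (Graph; adj; module Mat)
  open Field
  open Differences
  open Squares
  open VectorModels
  open ModelTransitive
  open Matrices
  open Borel
  open import Data.Nat as ℕ using (ℕ; zero; suc; s≤s; z≤n)
  import Data.Nat.Properties as ℕ
  open import Data.Nat.DivMod using (m≡m%n+[m/n]*n)
  open import Data.Nat.Primality using (Prime; prime⇒nonTrivial)
  open import Data.Bool using (true; false)
  open import Data.Fin as Fin using (Fin; toℕ)
  open import Data.List using ([]; _∷_)
  open import Data.Product using (∃; _×_; _,_; proj₁; proj₂)
  open import Data.Product.Properties using (≡-dec)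
  open import Data.Sum using (_⊎_; inj₁; inj₂)
  open import Relation.Nullary using (¬_; Dec; yes; no; contradiction)
  open import Relation.Binary.PropositionalEquality hiding ([_])

  module CosetModel (p : ℕ) (pr : Prime p) (h : ℕ) (p-odd : p ≡ suc (h ℕ.+ h)) (-1∈Sq : SquareBasics.Sq p pr (PrimeField.-_ p pr (PrimeField.1# p pr))) where
    open PrimeField p pr
    open FiniteDifferences p pr using (Δ; op; op-injective; Zero)
    open SquareClasses p pr h p-odd
    open Vectors p pr
    open LinearMaps p pr
    open RowAction p pr
    open Subgroups p pr h p-odd -1∈Sq
    open Mat p using (InCyc; InNormalizer; InDouble; HasOrder; Gen; gen-one; gen-el; gen-inv; gen-mul; gen-≈; InCosetFamily; IsoCoset; G)

    trace : M → F
    trace (mat a b c d) = a + d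

    opaque
      unfolding _∙_

      cayley-hamilton : ∀ v X → Det1 X → v ∙ X ∙ X ≡ comb (trace X) (- 1#) (v ∙ X) v
      cayley-hamilton (x , y) (mat a b c d) D = cong₂ _,_
        (trans ((solve 6 (λ x y a b c d → (x :* a :+ y :* c) :* a :+ (x :* b :+ y :* d) :* c := (a :+ d) :* (x :* a :+ y :* c) :+ (:- (a :* d :- b :* c)) :* x) refl) x y a b c d)
          (cong (λ e → (a + d) * (x * a + y * c) + - e * x) (Det1⇒ a b c d D)))
        (trans ((solve 6 (λ x y a b c d → (x :* a :+ y :* c) :* b :+ (x :* b :+ y :* d) :* d := (a :+ d) :* (x :* b :+ y :* d) :+ (:- (a :* d :- b :* c)) :* y) refl) x y a b c d)
          (cong (λ e → (a + d) * (x * b + y * d) + - e * y) (Det1⇒ a b c d D)))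

    neg-^ : ∀ X k v → v ∙ ((-ᴹ X) ^ᴹ k) ≡ scale ((- 1#) ^ k) (v ∙ (X ^ᴹ k))
    neg-^ X zero v = sym (scale-1 _)
    neg-^ X (suc k) v = begin
      v ∙ ((-ᴹ X) · ((-ᴹ X) ^ᴹ k))                     ≡⟨ ∙-· v (-ᴹ X) _ ⟩
      v ∙ (-ᴹ X) ∙ ((-ᴹ X) ^ᴹ k)                       ≡⟨ neg-^ X k (v ∙ (-ᴹ X)) ⟩
      scale ((- 1#) ^ k) (v ∙ (-ᴹ X) ∙ (X ^ᴹ k))       ≡⟨ cong (λ w → scale ((- 1#) ^ k) (w ∙ (X ^ᴹ k))) (∙-neg v X) ⟩
      scale ((- 1#) ^ k) (scale (- 1#) (v ∙ X) ∙ (X ^ᴹ k)) ≡⟨ cong (scale ((- 1#) ^ k)) (∙-scale (- 1#) (v ∙ X) (X ^ᴹ k)) ⟩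
      scale ((- 1#) ^ k) (scale (- 1#) (v ∙ X ∙ (X ^ᴹ k))) ≡⟨ scale-comm _ _ _ ⟩
      scale (- 1#) (scale ((- 1#) ^ k) (v ∙ X ∙ (X ^ᴹ k))) ≡⟨ scale-scale _ _ _ ⟩
      scale ((- 1#) ^ suc k) (v ∙ X ∙ (X ^ᴹ k))        ≡⟨ cong (scale ((- 1#) ^ suc k)) (∙-· v X (X ^ᴹ k)) ⟨
      scale ((- 1#) ^ suc k) (v ∙ (X · (X ^ᴹ k)))      ∎
      where open ≡-Reasoning

    [-1]^p : (- 1#) ^ p ≡ - 1#
    [-1]^p = trans (cong ((- 1#) ^_) p-odd) (trans (cong (- 1# *_) (trans (^-+ (- 1#) h h) (trans (sym (*-^ (- 1#) (- 1#) h))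
      (trans (cong (_^ h) (Sign-square (inj₂ refl))) (1^ h))))) (*-identityʳ _))

    -- Order p in PSL(2,p) gives a^p = ± 1 as a matrix. As p is odd, passing from a to -a corrects a
    -- negative sign.
    normalised : ∀ a → (a ^ᴹ p) ≈ one → ∃ λ a′ → (a′ ≡ a ⊎ a′ ≡ -ᴹ a) × a′ ^ᴹ p ≡ one
    normalised a (inj₁ e) = a , inj₁ refl , e
    normalised a (inj₂ e) = -ᴹ a , inj₂ refl , ∙-injective λ v → trans (neg-^ a p v) (trans (cong₂ (λ c X → scale c (v ∙ X)) [-1]^p e)
      (trans (cong (scale (- 1#)) (∙-neg v one)) (trans (scale-scale _ _ _) (trans (cong (λ c → scale c (v ∙ one)) (Sign-square (inj₂ refl))) (scale-1 _)))))

    module _ (a : M) (Da : Det1 a) (a^p : a ^ᴹ p ≡ one) where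
      private
        row : ℕ → F
        row n = proj₁ (e₁ ∙ (a ^ᴹ n))

        multiple : ∀ k v → v ∙ (a ^ᴹ (k ℕ.* p)) ≡ v
        multiple zero v = ∙-one v
        multiple (suc k) v = trans (^ᴹ-+ a p (k ℕ.* p) v) (trans (cong (_∙ (a ^ᴹ (k ℕ.* p))) (trans (cong (v ∙_) a^p) (∙-one v))) (multiple k v))

        f : F → F
        f x = row (toℕ x)

        f-row : ∀ n → f [ n ] ≡ row n
        f-row n = trans (cong row (toℕ-[] n)) (sym (trans (cong row (m≡m%n+[m/n]*n n p)) (cong proj₁ (trans (^ᴹ-+ a (n ℕ.% p) _ e₁) (multiple (n ℕ./ p) _)))))

        recurrence : ∀ n → row (suc (suc n)) ≡ trace a * row (suc n) + - 1# * row n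
        recurrence n = cong proj₁ (begin
          e₁ ∙ (a · (a · (a ^ᴹ n)))                                  ≡⟨ trans (∙-· e₁ a _) (∙-· (e₁ ∙ a) a (a ^ᴹ n)) ⟩
          e₁ ∙ a ∙ a ∙ (a ^ᴹ n)                                      ≡⟨ cong (_∙ (a ^ᴹ n)) (cayley-hamilton e₁ a Da) ⟩
          comb (trace a) (- 1#) (e₁ ∙ a) e₁ ∙ (a ^ᴹ n)               ≡⟨ ∙-comb (trace a) (- 1#) (e₁ ∙ a) e₁ (a ^ᴹ n) ⟩
          comb (trace a) (- 1#) (e₁ ∙ a ∙ (a ^ᴹ n)) (e₁ ∙ (a ^ᴹ n))  ≡⟨ cong (λ w → comb (trace a) (- 1#) w (e₁ ∙ (a ^ᴹ n))) (∙-· e₁ a (a ^ᴹ n)) ⟨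
          comb (trace a) (- 1#) (e₁ ∙ (a · (a ^ᴹ n))) (e₁ ∙ (a ^ᴹ n)) ∎)
          where open ≡-Reasoning

      -- The entries of a^j are a function of j ∈ F killed by Δ² + (2 - τ) Δ + (2 - τ), which is injective unless τ = 2.
      trace≡2 : trace a ≡ 1# + 1#
      trace≡2 = decide (1# + 1# - trace a ≟ 0#)
        where
        B : F
        B = 1# + 1# - trace a
        step : ∀ n → [ n ] + 1# ≡ [ suc n ]
        step n = trans (+-comm [ n ] 1#) (sym ([suc] n))
        killed : ∀ n → op (B ∷ B ∷ 1# ∷ []) f [ n ] ≡ 0#
        killed n = begin
          B * f x + (B * Δ f x + (1# * Δ (Δ f) x + 0#))
            ≡⟨ (solve 4 (λ t u v w → ((num 1) :+ (num 1) :- t) :* u :+ (((num 1) :+ (num 1) :- t) :* (v :- u) :+ ((num 1) :* (w :- v :- (v :- u)) :+ (num 0))) := w :- (t :* v :+ (:- (num 1)) :* u)) refl) (trace a) (f x) (f (x + 1#)) (f (x + 1# + 1#)) ⟩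
          f (x + 1# + 1#) - (trace a * f (x + 1#) + - 1# * f x)
            ≡⟨ cong₂ (λ y z → f y - (trace a * f z + - 1# * f x)) (trans (cong (_+ 1#) (step n)) (step (suc n))) (step n) ⟩
          f [ suc (suc n) ] - (trace a * f [ suc n ] + - 1# * f x)
            ≡⟨ cong₂ _-_ (f-row (suc (suc n))) (cong₂ (λ u v → trace a * u + - 1# * v) (f-row (suc n)) (f-row n)) ⟩
          row (suc (suc n)) - (trace a * row (suc n) + - 1# * row n)
            ≡⟨ cong (_- (trace a * row (suc n) + - 1# * row n)) (recurrence n) ⟩
          trace a * row (suc n) + - 1# * row n - (trace a * row (suc n) + - 1# * row n)
            ≡⟨ -‿inverseʳ _ ⟩
          0# ∎
          where
          open ≡-Reasoning
          x = [ n ]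
        decide : Dec (B ≡ 0#) → trace a ≡ 1# + 1#
        decide (yes z) = sym (x-y≡0⇒x≡y z)
        -- Injectivity would make f vanish, but f 0 is the corner entry 1 of the identity matrix.
        decide (no B≢0) = contradiction (trans (sym (trans (f-row 0) (cong proj₁ (∙-one e₁)))) (op-injective {B} {B ∷ 1# ∷ []} B≢0
          (λ x → trans (cong (op (B ∷ B ∷ 1# ∷ []) f) (sym ([]-toℕ x))) (killed (toℕ x))) [ 0 ])) 1≢0

      -- With trace 2, Cayley-Hamilton reads (a - 1)² = 0. So if a moves f, the nonzero vector e = f
      -- a - f is fixed and cannot be parallel to f. One of e₁ and e₂ is moved because a is not the
      -- identity.
      unipotent-basis : a ≢ one → ∃ λ e → ∃ λ f → det e f ≢ 0# × e ∙ a ≡ e × f ∙ a ≡ comb 1# 1# e f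
      unipotent-basis a≢one = pick (moved? e₁) (moved? e₂)
        where
        moved? : ∀ v → Dec (v ∙ a ≡ v)
        moved? v = ≡-dec _≟_ _≟_ (v ∙ a) v
        build : ∀ f → f ∙ a ≢ f → ∃ λ e → ∃ λ f → det e f ≢ 0# × e ∙ a ≡ e × f ∙ a ≡ comb 1# 1# e f
        build f moved = e , f , independent , ea , fa
          where
          e : F × F
          e = comb 1# (- 1#) (f ∙ a) f
          restore : ∀ w v → w ≡ comb 1# 1# (comb 1# (- 1#) w v) v
          restore (x , y) (x′ , y′) = cong₂ _,_ ((solve 2 (λ x y → x := (num 1) :* ((num 1) :* x :+ (:- (num 1)) :* y) :+ (num 1) :* y) refl) x x′) ((solve 2 (λ x y → x := (num 1) :* ((num 1) :* x :+ (:- (num 1)) :* y) :+ (num 1) :* y) refl) y y′)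
          fa : f ∙ a ≡ comb 1# 1# e f
          fa = restore (f ∙ a) f
          shrink : ∀ w v → comb 1# (- 1#) (comb (1# + 1#) (- 1#) w v) w ≡ comb 1# (- 1#) w v
          shrink (x , y) (x′ , y′) = cong₂ _,_ ((solve 2 (λ x y → (num 1) :* (((num 1) :+ (num 1)) :* x :+ (:- (num 1)) :* y) :+ (:- (num 1)) :* x := (num 1) :* x :+ (:- (num 1)) :* y) refl) x x′) ((solve 2 (λ x y → (num 1) :* (((num 1) :+ (num 1)) :* x :+ (:- (num 1)) :* y) :+ (:- (num 1)) :* x := (num 1) :* x :+ (:- (num 1)) :* y) refl) y y′)
          ea : e ∙ a ≡ e
          ea = trans (∙-comb 1# (- 1#) (f ∙ a) f a) (trans (cong (λ w → comb 1# (- 1#) w (f ∙ a)) (trans (cayley-hamilton f a Da)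
            (cong (λ τ → comb τ (- 1#) (f ∙ a) f) trace≡2))) (shrink (f ∙ a) f))
          e-nonzero : Nonzero e
          e-nonzero z = moved (trans fa (trans (cong (λ e → comb 1# 1# e f) z) (absorb f)))
            where
            absorb : ∀ v → comb 1# 1# (0# , 0#) v ≡ v
            absorb (x , y) = cong₂ _,_ (trans (cong₂ _+_ (zeroʳ 1#) (*-identityˡ x)) (+-identityˡ x)) (trans (cong₂ _+_ (zeroʳ 1#) (*-identityˡ y)) (+-identityˡ y))
          independent : det e f ≢ 0#
          independent z = go (parallel {e} {f} e-nonzero z)
            where
            go : ¬ ∃ λ r → f ≡ scale r e
            go (r , fe) = moved (trans (cong (_∙ a) fe) (trans (∙-scale r e a) (trans (cong (scale r) ea) (sym fe))))
        pick : Dec (e₁ ∙ a ≡ e₁) → Dec (e₂ ∙ a ≡ e₂) → ∃ λ e → ∃ λ f → det e f ≢ 0# × e ∙ a ≡ e × f ∙ a ≡ comb 1# 1# e f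
        pick (no m) _ = build e₁ m
        pick (yes _) (no m) = build e₂ m
        pick (yes f₁) (yes f₂) = contradiction (rows-injective (trans f₁ (sym (∙-one e₁))) (trans f₂ (sym (∙-one e₂)))) a≢one

    Sq-^ : ∀ {d} k → Sq d → Sq (d ^ k)
    Sq-^ zero s = Sq-1
    Sq-^ (suc k) s = Sq-* s (Sq-^ k s)

    module Cosets {n} (Γ : Graph n) (a b c : M) (i : ℕ) (Da : Det1 a) (Db : Det1 b) (Dc : Det1 c) (a-order : HasOrder a p)
      (normal-form : ∀ x → Det1 x → (InNormalizer (InCyc a) x → ∃ λ j → ∃ λ k → x ≈ ((a ^ᴹ j) · (b ^ᴹ k)))
                                  × ((∃ λ j → ∃ λ k → x ≈ ((a ^ᴹ j) · (b ^ᴹ k))) → InNormalizer (InCyc a) x))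
      (generate : ∀ x → Det1 x → Gen (λ y → (∃ λ j → ∃ λ k → y ≈ ((a ^ᴹ j) · ((b ^ᴹ 2) ^ᴹ k))) ⊎ y ≡ c · ((b ^ᴹ 2) ^ᴹ i)) x)
      (isoCoset : IsoCoset Γ (λ x → ∃ λ j → ∃ λ k → x ≈ ((a ^ᴹ j) · ((b ^ᴹ 2) ^ᴹ k))) (c · ((b ^ᴹ 2) ^ᴹ i))) where

      private
        opaque
          normal-a : ∃ λ a′ → (a′ ≡ a ⊎ a′ ≡ -ᴹ a) × a′ ^ᴹ p ≡ one
          normal-a = normalised a (proj₁ (proj₂ a-order))

        a′ : M
        a′ = proj₁ normal-a

        opaque
          a≋a′ : a ≋ a′
          a≋a′ = go (proj₁ (proj₂ normal-a))
            where
            go : a′ ≡ a ⊎ a′ ≡ -ᴹ a → a ≋ a′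
            go (inj₁ e) = subst (a ≋_) (sym e) (≋-refl a)
            go (inj₂ e) = ≋-sym a′ a (- 1# , inj₂ refl , λ v → trans (cong (v ∙_) e) (∙-neg v a))

          Da′ : Det1 a′
          Da′ = Det1-≈ a′ a (proj₁ (proj₂ normal-a)) Da

          basis : ∃ λ e → ∃ λ f → det e f ≢ 0# × e ∙ a′ ≡ e × f ∙ a′ ≡ comb 1# 1# e f
          basis = unipotent-basis a′ Da′ (proj₂ (proj₂ normal-a)) λ a′≡one → proj₂ (proj₂ a-order) 1 (s≤s z≤n) (ℕ.nonTrivial⇒n>1 p {{prime⇒nonTrivial pr}})
            (≋⇒≈ (a ^ᴹ 1) one (≋-trans (a ^ᴹ 1) (a′ ^ᴹ 1) one (≋-^ a a′ 1 a≋a′) (subst (λ X → (X ^ᴹ 1) ≋ one) (sym a′≡one) (1# , inj₁ refl , λ v → trans (∙-· v one one) (trans (∙-one _) (sym (scale-1 _)))))))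

        e f : F × F
        e = proj₁ basis
        f = proj₁ (proj₂ basis)

        D₀ : det e f ≢ 0#
        D₀ = proj₁ (proj₂ (proj₂ basis))

        module U = Unipotent a a′ a≋a′ e f D₀ (proj₁ (proj₂ (proj₂ (proj₂ basis)))) (proj₂ (proj₂ (proj₂ (proj₂ basis))))

        opaque
          b-eigen : ∃ λ d → e ∙ b ≡ scale d e
          -- The exponents 0 and 1 exhibit b itself in normal form, so b normalises ⟨a⟩.
          b-eigen = U.normalizer⇒eigen b Da Da′ Db (proj₂ (normal-form b Db) (0 , 1 , inj₁ (∙-injective λ v → sym (trans (∙-· v one (b · one)) (trans (cong (_∙ (b · one)) (∙-one v)) (trans (∙-· v b one) (∙-one _)))))))

        d : F
        d = proj₁ b-eigen

        -- Every diagonal matrix normalises ⟨a⟩, so t = ± d^k for some k.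
        d-nonsquare : ¬ Sq d
        d-nonsquare sd = go (matrix-of e f (scale t e) (scale (t ⁻¹) f) D₀ (trans (det-scale t (t ⁻¹) e f) (trans (cong (_* det e f) (inverseʳ t≢0)) (*-identityˡ _))))
          where
          go : ¬ ∃ λ z → Det1 z × e ∙ z ≡ scale t e × f ∙ z ≡ scale (t ⁻¹) f
          go (z , Dz , ez , _) = by (proj₁ (normal-form z Dz) (U.eigen⇒normalizer z Dz ez))
            where
            by : ¬ ∃ λ j → ∃ λ k → z ≈ ((a ^ᴹ j) · (b ^ᴹ k))
            by (j , k , z≈) = use (U.e-ab Da b Db (proj₂ b-eigen) z j k z≈)
              where
              use : ¬ ∃ λ ε → Sign ε × e ∙ z ≡ scale (ε * d ^ k) e
              use (ε , s , ez′) = t-nonsquare (subst Sq (sym (scale-injective {v = e} U.e-nonzero (trans (sym ez) ez′))) (Sq-* (Sign⇒Sq s) (Sq-^ k sd)))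

        H : M → Set
        H = U.H Da b Db (proj₂ b-eigen)

        g : M
        g = c · ((b ^ᴹ 2) ^ᴹ i)

        Dg : Det1 g
        Dg = Det1-· c _ Dc (Det1-^ (b ^ᴹ 2) i (Det1-^ b 2 Db))

        Stable : M → Set
        Stable x = Det1 x × ∃ λ r → e ∙ x ≡ scale r e

        stable : (∃ λ r → e ∙ g ≡ scale r e) → ∀ {x} → Gen (λ y → H y ⊎ y ≡ g) x → Stable x
        stable sg gen-one = Det1-one , 1# , trans (∙-one e) (sym (scale-1 e))
        stable sg (gen-el {x} (inj₁ Hx)) = U.H⇒Det1 Da b Db (proj₂ b-eigen) x Hx , forget (U.H⇒eigen Da b Db (proj₂ b-eigen) x Hx)
          where
          forget : (∃ λ r → Sq r × e ∙ x ≡ scale r e) → ∃ λ r → e ∙ x ≡ scale r e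
          forget (r , _ , q) = r , q
        stable sg (gen-el (inj₂ refl)) = Dg , sg
        stable sg (gen-inv {x} G) = invert (stable sg G)
          where
          invert : Stable x → Stable (inv x)
          invert (D , r , ex) = Det1-inv x D , r ⁻¹ , eigen-inv e x D (U.eigenvalue≢0 x D ex) ex
        stable sg (gen-mul {x} {y} G₁ G₂) = times (stable sg G₁) (stable sg G₂)
          where
          times : Stable x → Stable y → Stable (x · y)
          times (Dx , r , ex) (Dy , s , ey) = Det1-· x y Dx Dy , r * s , trans (∙-· e x y) (trans (cong (_∙ y) ex) (trans (∙-scale r e y) (trans (cong (scale r) ey) (scale-scale r s e))))
        stable sg (gen-≈ {x} {y} G y≈x) = adjust (stable sg G) (≈⇒≋ y x y≈x)
          where
          adjust : Stable x → y ≋ x → Stable y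
          adjust (Dx , r , ex) (ε , s , act) = Det1-≈ y x y≈x Dx , ε * r , trans (act e) (trans (cong (scale ε) ex) (scale-scale ε r e))

        -- Otherwise all of G would fix the line of e.
        D≢0 : det e (e ∙ g) ≢ 0#
        D≢0 z = go (matrix-of e f f (scale (- 1#) e) D₀ (rotate e f))
          where
          rotate : ∀ v w → det w (scale (- 1#) v) ≡ det v w
          rotate (x , y) (x′ , y′) = (solve 4 (λ x y x′ y′ → x′ :* ((:- (num 1)) :* y) :- y′ :* ((:- (num 1)) :* x) := x :* y′ :- y :* x′) refl) x y x′ y′
          go : ¬ ∃ λ X → Det1 X × e ∙ X ≡ f × f ∙ X ≡ scale (- 1#) e
          go (X , DX , eX , _) = use (stable (parallel {e} {e ∙ g} U.e-nonzero z) (generate X DX))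
            where
            use : ¬ Stable X
            use (_ , r , eX′) = D₀ (trans (cong (det e) (trans (sym eX) eX′)) (self r e))
              where
              self : ∀ r v → det v (scale r v) ≡ 0#
              self r (x , y) = trans ((solve 3 (λ r x y → x :* (r :* y) :- y :* (r :* x) := r :* (x :* y) :- r :* (x :* y)) refl) r x y) (-‿inverseʳ _)

        module DC = DoubleCoset e U.e-nonzero H (U.H⇒Det1 Da b Db (proj₂ b-eigen)) (U.H⇒eigen Da b Db (proj₂ b-eigen))
          (U.eigen⇒H Da b Db (proj₂ b-eigen) d-nonsquare (λ x D → proj₁ (normal-form x D))) g Dg D≢0

        φ : G → Fin n
        φ = proj₁ isoCoset

        carrier : ∀ v → Nonzero v → ∃ λ X → Det1 X × e ∙ X ≡ v
        carrier v nv = row-matrix e v U.e-nonzero nv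

        -- The zero vector receives the dummy `one`, so that the parametrisation of the vertices is
        -- a total function of the vector.
        element : ∀ v → Dec (v ≡ (0# , 0#)) → ∃ λ X → Det1 X × (Nonzero v → e ∙ X ≡ v)
        element v (yes z) = one , Det1-one , λ nv → contradiction z nv
        element v (no nv) = proj₁ (carrier v nv) , proj₁ (proj₂ (carrier v nv)) , λ _ → proj₂ (proj₂ (carrier v nv))

        opaque
          rep : ∀ v → ∃ λ X → Det1 X × (Nonzero v → e ∙ X ≡ v)
          rep v = element v (≡-dec _≟_ _≟_ v (0# , 0#))

        at : F × F → G
        at v = proj₁ (rep v) , proj₁ (proj₂ (rep v))

        e-at : ∀ {v} → Nonzero v → e ∙ proj₁ (at v) ≡ v
        e-at {v} = proj₂ (proj₂ (rep v))

        φ-eq : ∀ x y {r} → Sq r → e ∙ proj₁ x ≡ scale r (e ∙ proj₁ y) → φ x ≡ φ y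
        φ-eq x y s q = proj₂ (proj₁ (proj₂ (proj₂ isoCoset)) x y) (DC.⇒H-quotient (proj₁ x) (proj₁ y) (proj₂ x) (proj₂ y) s q)

        φ-eq⁻ : ∀ x y → φ x ≡ φ y → ∃ λ r → Sq r × e ∙ proj₁ x ≡ scale r (e ∙ proj₁ y)
        φ-eq⁻ x y q = DC.H-quotient⇒ (proj₁ x) (proj₁ y) (proj₂ y) (proj₁ (proj₁ (proj₂ (proj₂ isoCoset)) x y) q)

      -- A vector v stands for the coset Hx with e x = v. The double coset condition compares det v
      -- w with the class of `det e (e ∙ g)`, which is therefore the scalar of the model.
      model : VectorModel Γ (det e (e ∙ g))
      model = record
        { ψ = λ v → φ (at v)
        ; onto = λ u → onto u (proj₁ (proj₂ isoCoset) u)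
        ; same = λ {v} {w} nv nw q → same v w nv nw (φ-eq⁻ (at w) (at v) (sym q))
        ; scaled = λ {q} {v} q≢0 nv → φ-eq (at (scale (q * q) v)) (at v) (Sq-square q≢0) (trans (e-at (scale-nonzero (*-nonzero q≢0 q≢0) nv)) (cong (scale (q * q)) (sym (e-at nv))))
        ; adjacent = λ {v} {w} nv nw → adjacent v w nv nw (proj₂ (proj₂ (proj₂ isoCoset)) (at v) (at w)) }
        where
        onto : ∀ u → (∃ λ x → φ x ≡ u) → ∃ λ v → Nonzero v × φ (at v) ≡ u
        onto u (x , refl) = e ∙ proj₁ x , nz , φ-eq (at (e ∙ proj₁ x)) x Sq-1 (trans (e-at nz) (sym (scale-1 _)))
          where
          nz : Nonzero (e ∙ proj₁ x)
          nz = ∙-nonzero e (proj₁ x) (proj₂ x) U.e-nonzero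
        same : ∀ v w → Nonzero v → Nonzero w → (∃ λ r → Sq r × e ∙ proj₁ (at w) ≡ scale r (e ∙ proj₁ (at v))) → ∃ λ q → q ≢ 0# × w ≡ scale (q * q) v
        same v w nv nw (_ , (q , q≢0 , refl) , eq) = q , q≢0 , trans (sym (e-at nw)) (trans eq (cong (scale (q * q)) (e-at nv)))
        adjacent : ∀ v w → Nonzero v → Nonzero w →
          (adj Γ (φ (at v)) (φ (at w)) ≡ true → InDouble H g (proj₁ (at w) · inv (proj₁ (at v)))) ×
          (InDouble H g (proj₁ (at w) · inv (proj₁ (at v))) → adj Γ (φ (at v)) (φ (at w)) ≡ true) →
          adj Γ (φ (at v)) (φ (at w)) ≡ isSq (det e (e ∙ g) * det v w)
        adjacent v w nv nw (to , from) = go _ refl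
          where
          rewrite-det : det (e ∙ proj₁ (at v)) (e ∙ proj₁ (at w)) ≡ det v w
          rewrite-det = cong₂ det (e-at nv) (e-at nw)
          forward : adj Γ (φ (at v)) (φ (at w)) ≡ true → Sq (det e (e ∙ g) * det v w)
          forward q = subst (λ z → Sq (det e (e ∙ g) * z)) rewrite-det (DC.double-quotient⇒ (proj₁ (at v)) (proj₁ (at w)) (proj₂ (at v)) (to q))
          backward : Sq (det e (e ∙ g) * det v w) → adj Γ (φ (at v)) (φ (at w)) ≡ true
          backward s = from (DC.⇒double-quotient (proj₁ (at v)) (proj₁ (at w)) (proj₂ (at v)) (proj₂ (at w)) (subst (λ z → Sq (det e (e ∙ g) * z)) (sym rewrite-det) s))
          go : ∀ β → adj Γ (φ (at v)) (φ (at w)) ≡ β → adj Γ (φ (at v)) (φ (at w)) ≡ isSq (det e (e ∙ g) * det v w)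
          go true q = trans q (sym (Sq⇒isSq (forward q)))
          go false q = trans q (sym (¬Sq⇒isSq λ s → contradiction (trans (sym q) (backward s)) λ ()))

    coset⇒model : ∀ {n} (Γ : Graph n) → InCosetFamily Γ → ∃ λ s → VectorModel Γ s
    coset⇒model Γ (a , b , c , i , Da , Db , Dc , a-order , _ , normal-form , _ , _ , _ , _ , generate , _ , iso) =
      _ , Cosets.model Γ a b c i Da Db Dc a-order normal-form generate iso

-- From the vector model to the coset data.

module ModelToCoset where

  open import Defs using (Graph; adj; Connected; Reach; here; step; module Mat)
  open Field
  open Squares
  open VectorModels
  open ModelTransitive
  open Matrices
  open Borel
  open import Data.Nat as ℕ using (ℕ; zero; suc; s≤s; z≤n)
  import Data.Nat.Properties as ℕ
  open import Data.Nat.DivMod using (m*n/n≡m)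
  open import Data.Nat.Divisibility using (∣⇒≤)
  open import Data.Nat.Primality using (Prime)
  open import Data.Bool using (true)
  open import Data.Fin using (Fin)
  open import Data.Product using (∃; _×_; _,_; proj₁; proj₂)
  open import Data.Sum using (_⊎_; inj₁; inj₂)
  open import Relation.Nullary using (¬_; Dec; yes; no; contradiction)
  open import Relation.Binary.PropositionalEquality hiding ([_])

  module CosetConstruction (p : ℕ) (pr : Prime p) (h : ℕ) (p-odd : p ≡ suc (h ℕ.+ h)) (-1∈Sq : SquareBasics.Sq p pr (PrimeField.-_ p pr (PrimeField.1# p pr)))
    (5<p : 5 ℕ.< p) where
    open PrimeField p pr
    open SquareClasses p pr h p-odd
    open Vectors p pr
    open LinearMaps p pr
    open RowAction p pr
    open Subgroups p pr h p-odd -1∈Sq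
    open Mat p using (InCyc; InNormalizer; InDouble; HasOrder; Gen; gen-one; gen-el; gen-inv; gen-mul; gen-≈; InCosetFamily; IsoCoset; G; CoreFree)

    opaque
      -- On rows, a is the transvection fixing e₂ and sending e₁ to e₁ + e₂, b is diagonal with the
      -- primitive root t as eigenvalue on e₂, and c is the Weyl element e₂ ↦ e₁ ↦ - e₂.
      a b c : M
      a = mat 1# 1# 0# 1#
      b = mat (t ⁻¹) 0# 0# t
      c = mat 0# (- 1#) 1# 0#

      Da : Det1 a
      Da = ⇒Det1 1# 1# 0# 1# (trans (cong₂ _-_ (*-identityˡ 1#) (zeroʳ 1#)) (trans (cong (1# +_) -0≡0) (+-identityʳ 1#)))

      Db : Det1 b
      Db = ⇒Det1 (t ⁻¹) 0# 0# t (trans (cong₂ _-_ (inverseˡ t≢0) (zeroʳ 0#)) (trans (cong (1# +_) -0≡0) (+-identityʳ 1#)))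

      Dc : Det1 c
      Dc = ⇒Det1 0# (- 1#) 1# 0# (trans (cong (_- (- 1#) * 1#) (zeroˡ 0#)) ((solve 1 (λ z → (num 0) :- (:- (num 1)) :* (num 1) := (num 1)) refl) 0#))

      e₂a : e₂ ∙ a ≡ e₂
      e₂a = row₂ 1# 1# 0# 1#

      e₁a : e₁ ∙ a ≡ comb 1# 1# e₂ e₁
      e₁a = trans (row₁ 1# 1# 0# 1#) (cong₂ _,_ ((solve 1 (λ x → x := (num 1) :* (num 0) :+ (num 1) :* x) refl) 1#) ((solve 1 (λ x → x := (num 1) :* x :+ (num 1) :* (num 0)) refl) 1#))

      e₂b : e₂ ∙ b ≡ scale t e₂
      e₂b = trans (row₂ (t ⁻¹) 0# 0# t) (cong₂ _,_ (sym (zeroʳ t)) (sym (*-identityʳ t)))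

      e₁b : e₁ ∙ b ≡ scale (t ⁻¹) e₁
      e₁b = trans (row₁ (t ⁻¹) 0# 0# t) (cong₂ _,_ (sym (*-identityʳ _)) (sym (zeroʳ _)))

      e₂c : e₂ ∙ c ≡ e₁
      e₂c = row₂ 0# (- 1#) 1# 0#

      e₁c : e₁ ∙ c ≡ scale (- 1#) e₂
      e₁c = trans (row₁ 0# (- 1#) 1# 0#) (cong₂ _,_ (sym (zeroʳ _)) (sym (*-identityʳ _)))

    det-e₂e₁ : det e₂ e₁ ≡ - 1#
    det-e₂e₁ = trans (cong₂ _-_ (zeroˡ 0#) (*-identityˡ 1#)) (+-identityˡ _)

    D₀ : det e₂ e₁ ≢ 0#
    D₀ z = neg-nonzero 1≢0 (trans (sym det-e₂e₁) z)

    module U = Unipotent a a (≋-refl a) e₂ e₁ D₀ e₂a e₁a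

    e₂-nonzero : Nonzero e₂
    e₂-nonzero = U.e-nonzero

    e₁-nonzero : Nonzero e₁
    e₁-nonzero z = 1≢0 (cong proj₁ z)

    ⁻¹-unique : ∀ {x y} → x ≢ 0# → x * y ≡ 1# → y ≡ x ⁻¹
    ⁻¹-unique x≢0 e = *-cancelˡ x≢0 (trans e (sym (inverseʳ x≢0)))

    t^-inverse : ∀ k → t ^ k * (t ⁻¹) ^ k ≡ 1#
    t^-inverse k = trans (sym (*-^ t (t ⁻¹) k)) (trans (cong (_^ k) (inverseʳ t≢0)) (1^ k))

    a-order : HasOrder a p
    a-order = ℕ.>-nonZero⁻¹ p , inj₁ (basis-injective e₂ e₁ D₀ (trans (U.e-power p) (sym (∙-one e₂)))
        (trans (U.f-power p) (trans (cong (λ k → comb k 1# e₂ e₁) [p]≡0) (trans (comb-0-1 e₂ e₁) (sym (∙-one e₁)))))) ,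
      λ k k>0 k<p e → go k k>0 k<p (≈⇒≋ (a ^ᴹ k) one e)
      where
      go : ∀ k → 0 ℕ.< k → k ℕ.< p → ¬ ((a ^ᴹ k) ≋ one)
      go k k>0 k<p (ε , _ , act) = []≢0 k>0 k<p (trans ((solve 2 (λ k z → k := k :* (num 1) :+ (num 1) :* (num 0)) refl) [ k ] 0#) (trans (cong proj₂ (trans (sym (U.f-power k)) (trans (act e₁) (cong (scale ε) (∙-one e₁))))) (zeroʳ ε)))

    half : (p ℕ.∸ 1) ℕ./ 2 ≡ h
    half = trans (cong (ℕ._/ 2) (trans p-1≡2h (trans (cong (h ℕ.+_) (sym (ℕ.+-identityʳ h))) (ℕ.*-comm 2 h)))) (m*n/n≡m h 2)

    -- The matrix b^h is -1, since t^h = -1, and so it is trivial in PSL(2,p). Conversely b^k = ± 1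
    -- gives t^(2k) = 1, and the period of t is 2 h.
    b-order : HasOrder b ((p ℕ.∸ 1) ℕ./ 2)
    b-order = subst (HasOrder b) (sym half) (h>0 , inj₂ (basis-injective e₂ e₁ D₀
        (trans (eigen-^ e₂ b h e₂b) (trans (cong (λ r → scale r e₂) t^h≡-1) (sym (neg-one e₂))))
        (trans (eigen-^ e₁ b h e₁b) (trans (cong (λ r → scale r e₁) [t⁻¹]^h) (sym (neg-one e₁))))) ,
      λ k k>0 k<h e → go k k>0 k<h (≈⇒≋ (b ^ᴹ k) one e))
      where
      neg-one : ∀ v → v ∙ (-ᴹ one) ≡ scale (- 1#) v
      neg-one v = trans (∙-neg v one) (cong (scale (- 1#)) (∙-one v))
      [t⁻¹]^h : (t ⁻¹) ^ h ≡ - 1#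
      [t⁻¹]^h = *-cancelˡ (neg-nonzero 1≢0) (trans (trans (cong (_* (t ⁻¹) ^ h) (sym t^h≡-1)) (t^-inverse h)) (sym (Sign-square (inj₂ refl))))
      go : ∀ k → 0 ℕ.< k → k ℕ.< h → ¬ ((b ^ᴹ k) ≋ one)
      go k k>0 k<h (ε , s , act) = ℕ.<⇒≱ (ℕ.+-mono-< k<h k<h) (∣⇒≤ {{ℕ.>-nonZero (ℕ.<-≤-trans k>0 (ℕ.m≤m+n k k))}} (t-period-∣ (k ℕ.+ k)
        (trans (^-+ t k k) (trans (cong₂ _*_ t^k t^k) (Sign-square s)))))
        where
        t^k : t ^ k ≡ ε
        t^k = scale-injective {v = e₂} e₂-nonzero (trans (sym (eigen-^ e₂ b k e₂b)) (trans (act e₂) (cong (scale ε) (∙-one e₂))))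

    -- The eigenvalue of x on e₂ is a power t^k. Dividing x by b^k leaves a matrix that fixes e₂,
    -- and such matrices are powers of a.
    normal-form : ∀ x → Det1 x → InNormalizer (InCyc a) x → ∃ λ j → ∃ λ k → x ≈ ((a ^ᴹ j) · (b ^ᴹ k))
    normal-form x Dx normal = go (U.normalizer⇒eigen x Da Da Dx normal)
      where
      go : (∃ λ r → e₂ ∙ x ≡ scale r e₂) → ∃ λ j → ∃ λ k → x ≈ ((a ^ᴹ j) · (b ^ᴹ k))
      go (r , ex) = by (log r r≢0)
        where
        r≢0 = U.eigenvalue≢0 x Dx ex
        by : (∃ λ k → r ≡ t ^ k) → ∃ λ j → ∃ λ k → x ≈ ((a ^ᴹ j) · (b ^ᴹ k))
        by (k , r≡) = proj₁ cyc , k , ≋⇒≈ x _ (subst (_≋ ((a ^ᴹ proj₁ cyc) · (b ^ᴹ k))) restore (≋-·ˡ y (a ^ᴹ proj₁ cyc) (b ^ᴹ k) (≈⇒≋ y _ (proj₂ cyc))))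
          where
          B = b ^ᴹ k
          DB : Det1 B
          DB = Det1-^ b k Db
          y : M
          y = x · inv B
          restore : y · B ≡ x
          restore = ∙-injective λ v → trans (∙-· v y B) (trans (cong (_∙ B) (∙-· v x (inv B))) (inv-∙ (v ∙ x) B DB))
          cyc : InCyc a y
          cyc = U.⇒InCyc y (Det1-· x (inv B) Dx (Det1-inv B DB)) (inj₁ refl) (trans (∙-· e₂ x (inv B)) (trans (cong (_∙ inv B) ex) (trans (∙-scale r e₂ (inv B))
            (trans (cong (scale r) (eigen-inv e₂ B DB (^-nonzero k t≢0) (eigen-^ e₂ b k e₂b))) (trans (scale-scale r _ e₂)
              (cong (λ z → scale z e₂) (trans (cong (_* (t ^ k) ⁻¹) r≡) (inverseʳ (^-nonzero k t≢0)))))))))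

    normal-form⁻ : ∀ x → Det1 x → (∃ λ j → ∃ λ k → x ≈ ((a ^ᴹ j) · (b ^ᴹ k))) → InNormalizer (InCyc a) x
    normal-form⁻ x Dx (j , k , x≈) = U.eigen⇒normalizer x Dx (proj₂ (proj₂ (U.e-ab Da b Db e₂b x j k x≈)))

    c-order : HasOrder c 2
    c-order = s≤s z≤n , inj₂ (basis-injective e₂ e₁ D₀
        (trans (square e₂) (trans (cong (_∙ c) e₂c) (trans e₁c (sym (neg-one e₂)))))
        (trans (square e₁) (trans (cong (_∙ c) e₁c) (trans (∙-scale (- 1#) e₂ c) (trans (cong (scale (- 1#)) e₂c) (sym (neg-one e₁))))))) ,
      λ { (suc zero) _ _ e → go (≈⇒≋ (c ^ᴹ 1) one e) ; (suc (suc k)) _ (s≤s (s≤s ())) }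
      where
      neg-one : ∀ v → v ∙ (-ᴹ one) ≡ scale (- 1#) v
      neg-one v = trans (∙-neg v one) (cong (scale (- 1#)) (∙-one v))
      square : ∀ v → v ∙ (c ^ᴹ 2) ≡ v ∙ c ∙ c
      square v = trans (∙-· v c (c · one)) (trans (∙-· (v ∙ c) c one) (∙-one _))
      go : ¬ ((c ^ᴹ 1) ≋ one)
      go (ε , _ , act) = 1≢0 (trans (cong proj₁ (trans (sym e₂c) (trans (sym (trans (∙-· e₂ c one) (∙-one _))) (trans (act e₂) (cong (scale ε) (∙-one e₂)))))) (zeroʳ ε))

    c-inverts-b : (c · (b · inv c)) ≈ inv b
    c-inverts-b = inj₁ (basis-injective e₂ e₁ D₀
      (trans (eigen-conjugate e₂ c b Dc (trans (cong (_∙ b) e₂c) (trans e₁b (cong (scale (t ⁻¹)) (sym e₂c))))) (sym (eigen-inv e₂ b Db t≢0 e₂b)))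
      (trans (eigen-conjugate e₁ c b Dc (trans (cong (_∙ b) e₁c) (trans (∙-scale (- 1#) e₂ b) (trans (cong (scale (- 1#)) e₂b) (trans (scale-comm (- 1#) t e₂) (cong (scale t) (sym e₁c)))))))
        (sym (trans (eigen-inv e₁ b Db (⁻¹-nonzero t≢0) e₁b) (cong (λ r → scale r e₁) (sym (⁻¹-unique (⁻¹-nonzero t≢0) (inverseˡ t≢0))))))))

    Line : F × F → F × F → M → Set
    Line v w x = ∃ λ u → v ∙ x ≡ scale u w

    Line-· : ∀ {v w z} x y → Line v w x → Line w z y → Line v z (x · y)
    Line-· {v} {w} {z} x y (u , e) (u′ , e′) = u * u′ , trans (∙-· v x y) (trans (cong (_∙ y) e) (trans (∙-scale u w y) (trans (cong (scale u) e′) (scale-scale u u′ z))))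

    Line-≋ : ∀ {v w} x y → x ≋ y → Line v w y → Line v w x
    Line-≋ {v} {w} x y (ε , _ , act) (u , e) = ε * u , trans (act v) (trans (cong (scale ε) e) (scale-scale ε u w))

    Line-conj : ∀ {v w r} x y → Det1 x → Line v w x → w ∙ y ≡ scale r w → v ∙ (x · (y · inv x)) ≡ scale r v
    Line-conj {v} {w} {r} x y Dx (u , e) wy = eigen-conjugate v x y Dx (trans (cong (_∙ y) e) (trans (∙-scale u w y) (trans (cong (scale u) wy) (trans (scale-comm u r w) (cong (scale r) (sym e))))))

    Line-conj⁻ : ∀ {v w r} x y → Det1 x → Nonzero v → Line v w x → v ∙ (x · (y · inv x)) ≡ scale r v → w ∙ y ≡ scale r w
    Line-conj⁻ {v} {w} {r} x y Dx nv (u , e) q = scale-cancel (w ∙ y) (scale r w) u≢0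
      (trans (sym (trans (cong (_∙ y) e) (∙-scale u w y))) (trans (conjugate-eigen v x y Dx q) (trans (cong (scale r) e) (scale-comm r u w))))
      where
      u≢0 : u ≢ 0#
      u≢0 refl = ∙-nonzero v x Dx nv (trans e (cong₂ _,_ (zeroˡ _) (zeroˡ _)))

    -- The monomial matrices: those that preserve or exchange the coordinate axes.
    Monomial : M → Set
    Monomial x = (Line e₂ e₂ x × Line e₁ e₁ x) ⊎ (Line e₂ e₁ x × Line e₁ e₂ x)

    Monomial-· : ∀ x y → Monomial x → Monomial y → Monomial (x · y)
    Monomial-· x y (inj₁ (l , m)) (inj₁ (l′ , m′)) = inj₁ (Line-· x y l l′ , Line-· x y m m′)
    Monomial-· x y (inj₁ (l , m)) (inj₂ (l′ , m′)) = inj₂ (Line-· x y l l′ , Line-· x y m m′)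
    Monomial-· x y (inj₂ (l , m)) (inj₁ (l′ , m′)) = inj₂ (Line-· x y l m′ , Line-· x y m l′)
    Monomial-· x y (inj₂ (l , m)) (inj₂ (l′ , m′)) = inj₁ (Line-· x y l m′ , Line-· x y m l′)

    Monomial-≋ : ∀ x y → x ≋ y → Monomial y → Monomial x
    Monomial-≋ x y e (inj₁ (l , m)) = inj₁ (Line-≋ x y e l , Line-≋ x y e m)
    Monomial-≋ x y e (inj₂ (l , m)) = inj₂ (Line-≋ x y e l , Line-≋ x y e m)

    Monomial-c^ : ∀ k → Monomial (c ^ᴹ k)
    Monomial-c^ zero = inj₁ ((1# , trans (∙-one e₂) (sym (scale-1 e₂))) , (1# , trans (∙-one e₁) (sym (scale-1 e₁))))
    Monomial-c^ (suc k) = Monomial-· c (c ^ᴹ k) (inj₂ ((1# , trans e₂c (sym (scale-1 e₁))) , (- 1# , e₁c))) (Monomial-c^ k)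

    -- The diagonal matrices of determinant 1 with square entries; in PSL(2,p) they form ⟨b²⟩.
    Split : M → Set
    Split y = ∃ λ r → ∃ λ s → Sq r × r * s ≡ 1# × e₂ ∙ y ≡ scale r e₂ × e₁ ∙ y ≡ scale s e₁

    InCyc-b²⇒Split : ∀ y → InCyc (b ^ᴹ 2) y → Split y
    InCyc-b²⇒Split y (k , y≈) = go (≈⇒≋ y (b ^ᴹ (k ℕ.+ k)) (subst (y ≈_) (sym (^ᴹ-double b k)) y≈))
      where
      go : y ≋ (b ^ᴹ (k ℕ.+ k)) → Split y
      go (ε , s , act) = ε * t ^ (k ℕ.+ k) , ε * (t ⁻¹) ^ (k ℕ.+ k) , Sq-* (Sign⇒Sq s) (t ^ k , ^-nonzero k t≢0 , ^-+ t k k) ,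
        trans ((solve 3 (λ e x y → e :* x :* (e :* y) := e :* e :* (x :* y)) refl) ε _ _) (trans (cong₂ _*_ (Sign-square s) (t^-inverse (k ℕ.+ k))) (*-identityˡ 1#)) ,
        trans (act e₂) (trans (cong (scale ε) (eigen-^ e₂ b (k ℕ.+ k) e₂b)) (scale-scale ε _ e₂)) ,
        trans (act e₁) (trans (cong (scale ε) (eigen-^ e₁ b (k ℕ.+ k) e₁b)) (scale-scale ε _ e₁))

    diagonal : ∀ y k {s} → t ^ k * s ≡ 1# → e₂ ∙ y ≡ scale (t ^ k) e₂ → e₁ ∙ y ≡ scale s e₁ → y ≡ b ^ᴹ k
    diagonal y k {s} ts ey₂ ey₁ = basis-injective e₂ e₁ D₀ (trans ey₂ (sym (eigen-^ e₂ b k e₂b)))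
      (trans ey₁ (trans (cong (λ r → scale r e₁) (*-cancelˡ (^-nonzero k t≢0) (trans ts (sym (t^-inverse k))))) (sym (eigen-^ e₁ b k e₁b))))

    Split⇒InCyc-b² : ∀ y → Split y → InCyc (b ^ᴹ 2) y
    Split⇒InCyc-b² y (_ , s , (q , q≢0 , refl) , rs , ey₂ , ey₁) = go (log q q≢0)
      where
      go : (∃ λ k → q ≡ t ^ k) → InCyc (b ^ᴹ 2) y
      go (k , refl) = k , inj₁ (trans (diagonal y (k ℕ.+ k) (trans (cong (_* s) (^-+ t k k)) rs) (trans ey₂ (cong (λ r → scale r e₂) (sym (^-+ t k k)))) ey₁) (^ᴹ-double b k))

    Monomial⇒normalizer : ∀ x → Det1 x → Monomial x → InNormalizer (InCyc (b ^ᴹ 2)) x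
    Monomial⇒normalizer x Dx m y Dy = (λ K → Split⇒InCyc-b² _ (forward m (InCyc-b²⇒Split y K))) , λ K → Split⇒InCyc-b² y (backward m (InCyc-b²⇒Split _ K))
      where
      Sq-inverse : ∀ {r s} → Sq r → r * s ≡ 1# → Sq s
      Sq-inverse sr rs = Sq-divˡ sr (subst Sq (sym rs) Sq-1)
      forward : Monomial x → Split y → Split (x · (y · inv x))
      forward (inj₁ (l , l′)) (r , s , sr , rs , ey₂ , ey₁) = r , s , sr , rs , Line-conj x y Dx l ey₂ , Line-conj x y Dx l′ ey₁
      forward (inj₂ (l , l′)) (r , s , sr , rs , ey₂ , ey₁) = s , r , Sq-inverse sr rs , trans (*-comm s r) rs , Line-conj x y Dx l ey₁ , Line-conj x y Dx l′ ey₂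
      backward : Monomial x → Split (x · (y · inv x)) → Split y
      backward (inj₁ (l , l′)) (r , s , sr , rs , q₂ , q₁) = r , s , sr , rs , Line-conj⁻ x y Dx e₂-nonzero l q₂ , Line-conj⁻ x y Dx e₁-nonzero l′ q₁
      backward (inj₂ (l , l′)) (r , s , sr , rs , q₂ , q₁) = s , r , Sq-inverse sr rs , trans (*-comm s r) rs , Line-conj⁻ x y Dx e₁-nonzero l′ q₁ , Line-conj⁻ x y Dx e₂-nonzero l q₂

    -- Here p > 5 enters: the period 2 h of t exceeds 4, so t² and t⁻² differ and b² has no
    -- eigenlines besides the axes.
    t⁴≢1 : t ^ 4 ≢ 1#
    t⁴≢1 e = ℕ.<⇒≱ (ℕ.s≤s⁻¹ (subst (5 ℕ.<_) p-odd 5<p)) (∣⇒≤ (t-period-∣ 4 e))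

    b²-eigen : ∀ v {r} → v ∙ (b ^ᴹ 2) ≡ scale r v → (∃ λ u → v ≡ scale u e₂) ⊎ (∃ λ u → v ≡ scale u e₁)
    b²-eigen v@(x , y) {r} e = go (x ≟ 0#) (y ≟ 0#)
      where
      v≡ : ∀ x y → (x , y) ≡ comb y x e₂ e₁
      v≡ x y = cong₂ _,_ ((solve 2 (λ x y → x := y :* (num 0) :+ x :* (num 1)) refl) x y) ((solve 2 (λ x y → y := y :* (num 1) :+ x :* (num 0)) refl) x y)
      collect : ∀ x y u w → comb y x (scale u e₂) (scale w e₁) ≡ (x * w , y * u)
      collect x y u w = cong₂ _,_ ((solve 4 (λ x y u w → y :* (u :* (num 0)) :+ x :* (w :* (num 1)) := x :* w) refl) x y u w) ((solve 4 (λ x y u w → y :* (u :* (num 1)) :+ x :* (w :* (num 0)) := y :* u) refl) x y u w)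
      image : (x * (t ⁻¹) ^ 2 , y * t ^ 2) ≡ scale r v
      image = trans (sym (trans (cong (_∙ (b ^ᴹ 2)) (v≡ x y)) (trans (∙-comb y x e₂ e₁ (b ^ᴹ 2)) (trans (cong₂ (comb y x) (eigen-^ e₂ b 2 e₂b) (eigen-^ e₁ b 2 e₁b)) (collect x y _ _))))) e
      go : Dec (x ≡ 0#) → Dec (y ≡ 0#) → (∃ λ u → v ≡ scale u e₂) ⊎ (∃ λ u → v ≡ scale u e₁)
      go (yes x≡0) _ = inj₁ (y , cong₂ _,_ (trans x≡0 (sym (zeroʳ y))) (sym (*-identityʳ y)))
      go (no _) (yes y≡0) = inj₂ (x , cong₂ _,_ (sym (*-identityʳ x)) (trans y≡0 (sym (zeroʳ x))))
      go (no x≢0) (no y≢0) = contradiction (trans (^-+ t 2 2) (trans (cong (t ^ 2 *_) (trans t²≡r (sym t⁻²≡r))) (t^-inverse 2))) t⁴≢1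
        where
        t²≡r : t ^ 2 ≡ r
        t²≡r = *-cancelˡ y≢0 (trans (cong proj₂ image) (*-comm r y))
        t⁻²≡r : (t ⁻¹) ^ 2 ≡ r
        t⁻²≡r = *-cancelˡ x≢0 (trans (cong proj₁ image) (*-comm r x))

    independent : ∀ x {u w} v → Det1 x → e₂ ∙ x ≡ scale u v → e₁ ∙ x ≢ scale w v
    independent x {u} {w} v Dx p₂ p₁ = D₀ (trans (sym (det-∙ e₂ e₁ x Dx)) (trans (cong₂ det p₂ p₁) (trans (det-scale u w v v) (trans (cong (u * w *_) (self v)) (zeroʳ _)))))
      where
      self : ∀ v → det v v ≡ 0#
      self (x , y) = trans (cong (λ z → x * y - z) (*-comm y x)) (-‿inverseʳ _)

    -- Conjugation by x takes b² to a diagonal matrix, so x sends e₂ and e₁ to eigenvectors of b²,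
    -- hence to axes, which are different because x is invertible.
    normalizer⇒Monomial : ∀ x → Det1 x → InNormalizer (InCyc (b ^ᴹ 2)) x → Monomial x
    normalizer⇒Monomial x Dx normal = go (InCyc-b²⇒Split _ (proj₁ (normal (b ^ᴹ 2) (Det1-^ b 2 Db)) (1 , inj₁ (∙-injective λ v → sym (trans (∙-· v (b ^ᴹ 2) one) (∙-one _))))))
      where
      go : Split (x · ((b ^ᴹ 2) · inv x)) → Monomial x
      go (r , s , _ , _ , q₂ , q₁) = by (b²-eigen (e₂ ∙ x) (conjugate-eigen e₂ x (b ^ᴹ 2) Dx q₂)) (b²-eigen (e₁ ∙ x) (conjugate-eigen e₁ x (b ^ᴹ 2) Dx q₁))
        where
        by : (∃ λ u → e₂ ∙ x ≡ scale u e₂) ⊎ (∃ λ u → e₂ ∙ x ≡ scale u e₁) → (∃ λ u → e₁ ∙ x ≡ scale u e₂) ⊎ (∃ λ u → e₁ ∙ x ≡ scale u e₁) → Monomial x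
        by (inj₁ l) (inj₂ m) = inj₁ (l , m)
        by (inj₂ l) (inj₁ m) = inj₂ (l , m)
        by (inj₁ (u , l)) (inj₁ (w , m)) = contradiction m (independent x e₂ Dx l)
        by (inj₂ (u , l)) (inj₂ (w , m)) = contradiction m (independent x e₁ Dx l)

    dihedral-form : ∀ x → Det1 x → InNormalizer (InCyc (b ^ᴹ 2)) x → ∃ λ j → ∃ λ k → x ≈ ((b ^ᴹ j) · (c ^ᴹ k))
    dihedral-form x Dx normal = go (normalizer⇒Monomial x Dx normal)
      where
      go : Monomial x → ∃ λ j → ∃ λ k → x ≈ ((b ^ᴹ j) · (c ^ᴹ k))
      go (inj₁ ((r , l) , (s , m))) = by (log r (U.eigenvalue≢0 x Dx l))
        where
        rs : r * s ≡ 1#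
        rs = *-cancelˡ D₀ (trans (*-comm _ _) (trans (sym (det-scale r s e₂ e₁)) (trans (sym (cong₂ det l m)) (trans (det-∙ e₂ e₁ x Dx) (sym (*-identityʳ _))))))
        by : (∃ λ k → r ≡ t ^ k) → ∃ λ j → ∃ λ k → x ≈ ((b ^ᴹ j) · (c ^ᴹ k))
        by (k , refl) = k , 0 , inj₁ (trans (diagonal x k rs l m) (∙-injective λ v → sym (trans (∙-· v (b ^ᴹ k) one) (∙-one _))))
      go (inj₂ ((u , l) , (w , m))) = by (log u u≢0)
        where
        u≢0 : u ≢ 0#
        u≢0 refl = ∙-nonzero e₂ x Dx e₂-nonzero (trans l (cong₂ _,_ (zeroˡ _) (zeroˡ _)))
        -uw : u * - w ≡ 1#
        -uw = *-cancelˡ (neg-nonzero 1≢0) (trans ((solve 2 (λ u w → (:- (num 1)) :* (u :* (:- w)) := u :* w :* (num 1)) refl) u w) (trans (cong (u * w *_) (sym det-e)) (trans (sym (det-scale u w e₁ e₂))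
          (trans (sym (cong₂ det l m)) (trans (det-∙ e₂ e₁ x Dx) (trans det-e₂e₁ (sym (*-identityʳ _))))))))
        c¹ : ∀ v → v ∙ (c ^ᴹ 1) ≡ v ∙ c
        c¹ v = trans (∙-· v c one) (∙-one _)
        by : (∃ λ k → u ≡ t ^ k) → ∃ λ j → ∃ λ k → x ≈ ((b ^ᴹ j) · (c ^ᴹ k))
        by (k , refl) = k , 1 , inj₁ (basis-injective e₂ e₁ D₀
          (trans l (sym (trans (∙-· e₂ (b ^ᴹ k) (c ^ᴹ 1)) (trans (cong (_∙ (c ^ᴹ 1)) (eigen-^ e₂ b k e₂b)) (trans (∙-scale _ e₂ (c ^ᴹ 1)) (cong (scale (t ^ k)) (trans (c¹ e₂) e₂c)))))))
          (trans m (sym (trans (∙-· e₁ (b ^ᴹ k) (c ^ᴹ 1)) (trans (cong (_∙ (c ^ᴹ 1)) (eigen-^ e₁ b k e₁b)) (trans (∙-scale _ e₁ (c ^ᴹ 1)) (trans (cong (scale ((t ⁻¹) ^ k)) (trans (c¹ e₁) e₁c))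
            (trans (scale-scale _ _ e₂) (cong (λ z → scale z e₂) w≡)))))))))
          where
          w≡ : (t ⁻¹) ^ k * - 1# ≡ w
          w≡ = trans (cong (_* - 1#) (*-cancelˡ (^-nonzero k t≢0) (trans (t^-inverse k) (sym -uw)))) ((solve 1 (λ w → (:- w) :* (:- (num 1)) := w) refl) w)

    dihedral-form⁻ : ∀ x → Det1 x → (∃ λ j → ∃ λ k → x ≈ ((b ^ᴹ j) · (c ^ᴹ k))) → InNormalizer (InCyc (b ^ᴹ 2)) x
    dihedral-form⁻ x Dx (j , k , x≈) = Monomial⇒normalizer x Dx (Monomial-≋ x _ (≈⇒≋ x _ x≈) (Monomial-· (b ^ᴹ j) (c ^ᴹ k)
      (inj₁ ((t ^ j , eigen-^ e₂ b j e₂b) , ((t ⁻¹) ^ j , eigen-^ e₁ b j e₁b))) (Monomial-c^ k)))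

    H : M → Set
    H = U.H Da b Db e₂b

    H⇒Det1 : ∀ y → H y → Det1 y
    H⇒Det1 = U.H⇒Det1 Da b Db e₂b

    H⇒eigen : ∀ y → H y → ∃ λ r → Sq r × e₂ ∙ y ≡ scale r e₂
    H⇒eigen = U.H⇒eigen Da b Db e₂b

    eigen⇒H : ∀ y {r} → Det1 y → Sq r → e₂ ∙ y ≡ scale r e₂ → H y
    eigen⇒H = U.eigen⇒H Da b Db e₂b t-nonsquare normal-form

    -- Conjugating by a matrix that takes e₂ to v shows that v is an eigenvector of x, whatever v
    -- is. The two axes and (1, 1) suffice to make x scalar, and the determinant makes the scalar ±
    -- 1.
    core-free : CoreFree H
    core-free x Dx conj = go (line e₂ e₂-nonzero) (line e₁ e₁-nonzero) (line (1# , 1#) (λ z → 1≢0 (cong proj₁ z)))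
      where
      line : ∀ v → Nonzero v → ∃ λ r → v ∙ x ≡ scale r v
      line v nv = from (row-matrix e₂ v e₂-nonzero nv)
        where
        from : (∃ λ X → Det1 X × e₂ ∙ X ≡ v) → ∃ λ r → v ∙ x ≡ scale r v
        from (X , DX , refl) = by (H⇒eigen _ (conj (inv X) (Det1-inv X DX)))
          where
          Y = inv X
          DY = Det1-inv X DX
          e₂Y : e₂ ∙ inv Y ≡ e₂ ∙ X
          e₂Y = trans (cong (_∙ inv Y) (sym (∙-inv e₂ X DX))) (∙-inv (e₂ ∙ X) Y DY)
          by : (∃ λ r → Sq r × e₂ ∙ (inv Y · (x · Y)) ≡ scale r e₂) → ∃ λ r → e₂ ∙ X ∙ x ≡ scale r (e₂ ∙ X)
          by (r , _ , q) = r , trans (sym (∙-inv (e₂ ∙ X ∙ x) Y DY)) (trans (cong (_∙ inv Y) (trans (cong (λ w → w ∙ x ∙ Y) (sym e₂Y)) (trans (sym (trans (∙-· e₂ (inv Y) (x · Y)) (∙-· (e₂ ∙ inv Y) x Y))) q)))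
            (trans (∙-scale r e₂ (inv Y)) (cong (scale r) e₂Y)))
      go : (∃ λ r → e₂ ∙ x ≡ scale r e₂) → (∃ λ r → e₁ ∙ x ≡ scale r e₁) → (∃ λ r → (1# , 1#) ∙ x ≡ scale r (1# , 1#)) → x ≈ one
      go (r , l) (s , m) (q , n) = ≋⇒≈ x one (r , x²≡1 r²≡1 , λ v → trans (scalar v) (cong (scale r) (sym (∙-one v))))
        where
        sum : (1# , 1#) ≡ comb 1# 1# e₂ e₁
        sum = cong₂ _,_ ((solve 1 (λ x → x := (num 1) :* (num 0) :+ (num 1) :* x) refl) 1#) ((solve 1 (λ x → x := (num 1) :* x :+ (num 1) :* (num 0)) refl) 1#)
        image : (s , r) ≡ (q , q)
        image = trans (cong₂ _,_ ((solve 2 (λ r s → s := (num 1) :* (r :* (num 0)) :+ (num 1) :* (s :* (num 1))) refl) r s) ((solve 2 (λ r s → r := (num 1) :* (r :* (num 1)) :+ (num 1) :* (s :* (num 0))) refl) r s)) (trans (sym (cong₂ (comb 1# 1#) l m))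
          (trans (sym (∙-comb 1# 1# e₂ e₁ x)) (trans (cong (_∙ x) (sym sum)) (trans n (cong₂ _,_ (*-identityʳ q) (*-identityʳ q))))))
        s≡r : s ≡ r
        s≡r = trans (cong proj₁ image) (sym (cong proj₂ image))
        r²≡1 : r * r ≡ 1#
        r²≡1 = *-cancelˡ D₀ (trans (*-comm _ _) (trans (cong (λ s → r * s * det e₂ e₁) (sym s≡r)) (trans (sym (det-scale r s e₂ e₁)) (trans (sym (cong₂ det l m)) (trans (det-∙ e₂ e₁ x Dx) (sym (*-identityʳ _)))))))
        module C = Coordinates e₂ e₁ D₀
        scalar : ∀ v → v ∙ x ≡ scale r v
        scalar v = trans (cong (_∙ x) (sym (C.cramer v))) (trans (∙-comb _ _ e₂ e₁ x) (trans (cong₂ (comb (C.fst v) (C.snd v)) l (trans m (cong (λ s → scale s e₁) s≡r)))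
          (trans (mix (C.fst v) (C.snd v) r e₂ e₁) (cong (scale r) (C.cramer v)))))
          where
          mix : ∀ y z r u w → comb y z (scale r u) (scale r w) ≡ scale r (comb y z u w)
          mix y z r (u , u′) (w , w′) = cong₂ _,_ ((solve 5 (λ y z r u w → y :* (r :* u) :+ z :* (r :* w) := r :* (y :* u :+ z :* w)) refl) y z r u w) ((solve 5 (λ y z r u w → y :* (r :* u) :+ z :* (r :* w) := r :* (y :* u :+ z :* w)) refl) y z r u′ w′)

    -- The case i = 0 of g = c b^(2i); `one` is the zeroth power of b².
    g : M
    g = c · one

    Dg : Det1 g
    Dg = Det1-· c one Dc Det1-one

    e₂g : e₂ ∙ g ≡ e₁
    e₂g = trans (∙-· e₂ c one) (trans (∙-one _) e₂c)

    Dg-value : det e₂ (e₂ ∙ g) ≡ - 1#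
    Dg-value = trans (cong (det e₂) e₂g) det-e₂e₁

    inv-g-value : det e₂ (e₂ ∙ inv g) ≡ 1#
    inv-g-value = trans (sym (det-∙ e₂ (e₂ ∙ inv g) g Dg)) (trans (cong₂ det e₂g (inv-∙ e₂ g Dg)) det-e)

    module DC = DoubleCoset e₂ e₂-nonzero H H⇒Det1 H⇒eigen eigen⇒H g Dg (λ z → neg-nonzero 1≢0 (trans (sym Dg-value) z))
    module DC⁻ = DoubleCoset e₂ e₂-nonzero H H⇒Det1 H⇒eigen eigen⇒H (inv g) (Det1-inv g Dg) (λ z → 1≢0 (trans (sym inv-g-value) z))

    Sq-Dg⇒ : ∀ {d} → Sq (det e₂ (e₂ ∙ g) * d) → Sq d
    Sq-Dg⇒ = Sq-divˡ (subst Sq (sym Dg-value) -1∈Sq)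

    ⇒Sq-Dg : ∀ {d} → Sq d → Sq (det e₂ (e₂ ∙ g) * d)
    ⇒Sq-Dg = Sq-* (subst Sq (sym Dg-value) -1∈Sq)

    -- `det e₂ (e₂ ∙ g)` is -1, and for the inverse of g it is 1. Both are squares, so either double
    -- coset consists of the x for which `det e₂ (e₂ ∙ x)` is a square.
    double-inverse : ∀ x → (InDouble H g x → InDouble H (inv g) x) × (InDouble H (inv g) x → InDouble H g x)
    double-inverse x = (λ dd → DC⁻.⇒double x (Det1-double g Dg x dd) (subst Sq (trans (sym (*-identityˡ _)) (cong (_* det e₂ (e₂ ∙ x)) (sym inv-g-value))) (Sq-Dg⇒ (DC.double⇒ x dd)))) ,
      λ dd → DC.⇒double x (Det1-double (inv g) (Det1-inv g Dg) x dd) (⇒Sq-Dg (subst Sq (trans (cong (_* det e₂ (e₂ ∙ x)) inv-g-value) (*-identityˡ _)) (DC⁻.double⇒ x dd)))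
      where
      Det1-double : ∀ g → Det1 g → ∀ x → InDouble H g x → Det1 x
      Det1-double g Dg x (h₁ , h₂ , H₁ , H₂ , x≈) = Det1-≈ x _ x≈ (Det1-· h₁ (g · h₂) (H⇒Det1 h₁ H₁) (Det1-· g h₂ Dg (H⇒Det1 h₂ H₂)))

    module _ {n} {Γ : Graph n} (connected : Connected Γ) (model : VectorModel Γ 1#) where
      open VectorModel model

      φ : M → Fin n
      φ x = ψ (e₂ ∙ x)

      nonzero : ∀ x → Det1 x → Nonzero (e₂ ∙ x)
      nonzero x Dx = ∙-nonzero e₂ x Dx e₂-nonzero

      φ-onto : ∀ u → ∃ λ x → Det1 x × φ x ≡ u
      φ-onto u = go (onto u)
        where
        go : (∃ λ v → Nonzero v × ψ v ≡ u) → ∃ λ x → Det1 x × φ x ≡ u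
        go (v , nv , q) = by (row-matrix e₂ v e₂-nonzero nv)
          where
          by : (∃ λ X → Det1 X × e₂ ∙ X ≡ v) → ∃ λ x → Det1 x × φ x ≡ u
          by (X , DX , eX) = X , DX , trans (cong ψ eX) q

      φ-≡⇒H : ∀ x y → Det1 x → Det1 y → φ x ≡ φ y → H (x · inv y)
      φ-≡⇒H x y Dx Dy q = go (same (nonzero y Dy) (nonzero x Dx) (sym q))
        where
        go : (∃ λ q → q ≢ 0# × e₂ ∙ x ≡ scale (q * q) (e₂ ∙ y)) → H (x · inv y)
        go (q , q≢0 , e) = DC.⇒H-quotient x y Dx Dy (Sq-square q≢0) e

      H⇒φ-≡ : ∀ x y → Det1 y → H (x · inv y) → φ x ≡ φ y
      H⇒φ-≡ x y Dy Hxy = go (DC.H-quotient⇒ x y Dy Hxy)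
        where
        go : (∃ λ r → Sq r × e₂ ∙ x ≡ scale r (e₂ ∙ y)) → φ x ≡ φ y
        go (_ , (q , q≢0 , refl) , e) = trans (cong ψ e) (scaled q≢0 (nonzero y Dy))

      adj⇒double : ∀ x y → Det1 x → Det1 y → adj Γ (φ x) (φ y) ≡ true → InDouble H g (y · inv x)
      adj⇒double x y Dx Dy q = DC.⇒double-quotient x y Dx Dy (⇒Sq-Dg (subst Sq (*-identityˡ _) (isSq-true (trans (sym (adjacent (nonzero x Dx) (nonzero y Dy))) q))))

      double⇒adj : ∀ x y → Det1 x → Det1 y → InDouble H g (y · inv x) → adj Γ (φ x) (φ y) ≡ true
      double⇒adj x y Dx Dy dd = trans (adjacent (nonzero x Dx) (nonzero y Dy)) (Sq⇒isSq (subst Sq (sym (*-identityˡ _)) (Sq-Dg⇒ (DC.double-quotient⇒ x y Dx dd))))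

      Generated : M → Set
      Generated = Gen (λ y → H y ⊎ y ≡ g)

      extend : ∀ x y → Det1 x → Generated (y · inv x) → Generated x → Generated y
      extend x y Dx G G′ = gen-≈ (gen-mul G G′) (inj₁ (∙-injective λ v → sym (trans (∙-· v (y · inv x) x) (trans (cong (_∙ x) (∙-· v y (inv x))) (inv-∙ (v ∙ y) x Dx)))))

      -- A step of the walk multiplies a representative by an element of HgH, and two
      -- representatives of one vertex differ by an element of H. Connectedness thus becomes
      -- generation by H and g.
      generated-along : ∀ {u v} → Reach Γ u v → ∀ x y → Det1 x → Det1 y → Generated x → φ x ≡ u → φ y ≡ v → Generated y
      generated-along here x y Dx Dy Gx q q′ = extend x y Dx (gen-el (inj₁ (φ-≡⇒H y x Dy Dx (trans q′ (sym q))))) Gx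
      generated-along (step {u} {w} q₀ r) x y Dx Dy Gx q q′ = go (φ-onto w)
        where
        go : (∃ λ z → Det1 z × φ z ≡ w) → Generated y
        go (z , Dz , qz) = generated-along r z y Dz Dy (extend x z Dx (from-double (adj⇒double x z Dx Dz (trans (cong₂ (adj Γ) q qz) q₀))) Gx) qz q′
          where
          from-double : ∀ {w} → InDouble H g w → Generated w
          from-double (h₁ , h₂ , H₁ , H₂ , w≈) = gen-≈ (gen-mul (gen-el (inj₁ H₁)) (gen-mul (gen-el (inj₂ refl)) (gen-el (inj₁ H₂)))) w≈

      generates : ∀ x → Det1 x → Generated x
      generates x Dx = generated-along (connected (φ one) (φ x)) one x Det1-one Dx gen-one refl refl

      isoCoset : IsoCoset Γ H g
      isoCoset = (λ x → φ (proj₁ x)) , (λ u → let (x , Dx , q) = φ-onto u in (x , Dx) , q) ,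
        (λ x y → φ-≡⇒H (proj₁ x) (proj₁ y) (proj₂ x) (proj₂ y) , H⇒φ-≡ (proj₁ x) (proj₁ y) (proj₂ y)) ,
        λ x y → adj⇒double (proj₁ x) (proj₁ y) (proj₂ x) (proj₂ y) , double⇒adj (proj₁ x) (proj₁ y) (proj₂ x) (proj₂ y)

      model⇒coset : InCosetFamily Γ
      model⇒coset = a , b , c , 0 , Da , Db , Dc , a-order , b-order , (λ x Dx → normal-form x Dx , normal-form⁻ x Dx) , c-order , c-inverts-b ,
        (λ x Dx → dihedral-form x Dx , dihedral-form⁻ x Dx) , core-free , generates , double-inverse , isoCoset

-- Passage between the vector model and the family, and the two implications.

module Classification where

  open import Defs hiding (sym)
  open Field
  open Squares
  open Local
  open VectorModels
  open Antipodal
  open ModelTransitive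
  open Icosahedron
  open CosetToModel
  open ModelToCoset
  open import Data.Nat as ℕ using (ℕ; suc; _%_; _/_; s≤s; z≤n)
  import Data.Nat.Properties as ℕ
  open import Data.Nat.DivMod using (m≡m%n+[m/n]*n; [m+kn]%n≡m%n)
  open import Data.Nat.Primality using (Prime)
  open import Data.Bool using (true)
  import Data.Bool.Properties as Bool
  open import Data.Fin as Fin using (Fin)
  open import Data.Fin.Properties using (any?)
  open import Data.Product using (∃; _×_; _,_; proj₁; proj₂)
  open import Data.Sum using (inj₁; inj₂)
  open import Relation.Nullary using (¬_; Dec; yes; no)
  open import Relation.Nullary.Decidable using (_×-dec_)
  open import Relation.Binary.PropositionalEquality hiding ([_])

  Triangle : ∀ {n} → Graph n → Set
  Triangle Γ = ∃ λ x → ∃ λ y → ∃ λ z → adj Γ x y ≡ true × adj Γ x z ≡ true × adj Γ y z ≡ true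

  triangle? : ∀ {n} (Γ : Graph n) → Dec (Triangle Γ)
  triangle? Γ = any? λ x → any? λ y → any? λ z → (adj Γ x y Bool.≟ true) ×-dec (adj Γ x z Bool.≟ true) ×-dec (adj Γ y z Bool.≟ true)

  2-arc⇒2-geodesic : ∀ {n} (Γ : Graph n) → ¬ Triangle Γ → ∀ {u v w} → Is2Arc Γ u v w → Is2Geodesic Γ u v w
  2-arc⇒2-geodesic Γ none {u} {v} {w} arc@(uv , vw , _) = arc , Bool.¬-not λ uw → none (u , v , w , uv , uw , vw)

  2-arc-transitive⇒2-geodesic-transitive : ∀ {n} (Γ : Graph n) → TwoArcTransitive Γ → TwoGeodesicTransitive Γ
  2-arc-transitive⇒2-geodesic-transitive Γ (arcs , 2-arcs) = arcs , λ u v w u′ v′ w′ g g′ → 2-arcs u v w u′ v′ w′ (proj₁ g) (proj₁ g′)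

  four-times : ∀ α → suc (α ℕ.+ α ℕ.+ (α ℕ.+ α)) ≡ 1 ℕ.+ α ℕ.* 4
  four-times α = cong suc (trans (ℕ.+-assoc α α _) (trans (cong (λ k → α ℕ.+ (α ℕ.+ (α ℕ.+ k))) (sym (ℕ.+-identityʳ α))) (ℕ.*-comm 4 α)))

  model⇒InC : ∀ {n} (p : ℕ) (pr : Prime p) α (p-odd : p ≡ suc (α ℕ.+ α ℕ.+ (α ℕ.+ α))) (Γ : Graph n) → Connected Γ →
    Vectors.VectorModel p pr Γ (PrimeField.1# p pr) → InC p pr Γ
  model⇒InC p pr α p-odd Γ connected model = go (p ℕ.≟ 5)
    where
    -- Stated for a variable prime q, so that the equation q ≡ 5 can be eliminated by matching; p
    -- itself is tied to `p-odd`.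
    icosahedral : ∀ q (q-prime : Prime q) → q ≡ 5 → Vectors.VectorModel q q-prime Γ (PrimeField.1# q q-prime) → Isomorphic Γ icosahedron
    icosahedral .5 q-prime refl model = ModelIsomorphisms.models-isomorphic 5 q-prime model (IcosahedronModel.icosahedron-model q-prime)
    5≤p : 5 ℕ.≤ p
    5≤p = subst (5 ℕ.≤_) (sym p-odd) (s≤s (ℕ.+-mono-≤ 2≤h 2≤h))
      where
      2≤h : 2 ℕ.≤ α ℕ.+ α
      2≤h = positive α (SquareClasses.h>0 p pr (α ℕ.+ α) p-odd)
        where
        positive : ∀ α → 0 ℕ.< α ℕ.+ α → 2 ℕ.≤ α ℕ.+ α
        positive (suc α) _ = s≤s (subst (1 ℕ.≤_) (sym (ℕ.+-suc α α)) (s≤s z≤n))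
    go : Dec (p ≡ 5) → InC p pr Γ
    go (yes p≡5) = inj₁ (p≡5 , icosahedral p pr p≡5 model)
    go (no p≢5) = inj₂ (5<p , CosetConstruction.model⇒coset p pr (α ℕ.+ α) p-odd (SquareClasses.Sq-neg-1 p pr (α ℕ.+ α) p-odd α refl) 5<p connected model)
      where
      5<p : 5 ℕ.< p
      5<p = ℕ.≤∧≢⇒< 5≤p (λ e → p≢5 (sym e))

  InC⇒2-geodesic-transitive : ∀ {n} (p : ℕ) (pr : Prime p) (Γ : Graph n) → p % 4 ≡ 1 → InC p pr Γ → TwoGeodesicTransitive Γ
  InC⇒2-geodesic-transitive p pr Γ p%4≡1 = from-InC
    where
    α : ℕ
    α = p / 4
    p-odd : p ≡ suc (α ℕ.+ α ℕ.+ (α ℕ.+ α))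
    p-odd = trans (m≡m%n+[m/n]*n p 4) (trans (cong (ℕ._+ α ℕ.* 4) p%4≡1) (sym (four-times α)))
    -1∈Sq = SquareClasses.Sq-neg-1 p pr (α ℕ.+ α) p-odd α refl
    from-model : ∀ {s} → Vectors.VectorModel p pr Γ s → TwoGeodesicTransitive Γ
    from-model model = ModelGraphs.2-geodesic-transitive p pr (α ℕ.+ α) p-odd Γ model -1∈Sq
    icosahedral : ∀ q (q-prime : Prime q) → q ≡ 5 → Isomorphic Γ icosahedron → Vectors.VectorModel q q-prime Γ (PrimeField.1# q q-prime)
    icosahedral .5 q-prime refl iso = ModelIsomorphisms.transport-model 5 q-prime iso (IcosahedronModel.icosahedron-model q-prime)
    from-InC : InC p pr Γ → TwoGeodesicTransitive Γ
    from-InC (inj₁ (p≡5 , iso)) = from-model (icosahedral p pr p≡5 iso)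
    from-InC (inj₂ (_ , family)) = from-model (proj₂ (CosetModel.coset⇒model p pr (α ℕ.+ α) p-odd -1∈Sq Γ family))

  2-geodesic-transitive⇒InC : ∀ {n} (p : ℕ) (pr : Prime p) (Γ : Graph n) → Connected Γ → NonComplete Γ → Regular Γ p → TwoGeodesicTransitive Γ →
    Triangle Γ → p % 4 ≡ 1 × InC p pr Γ
  2-geodesic-transitive⇒InC p pr Γ connected noncomplete regular 2gt triangle =
    trans (cong (_% 4) (trans p-odd (four-times A.α))) ([m+kn]%n≡m%n 1 A.α 4) , model⇒InC p pr A.α p-odd Γ connected A.vector-model
    where
    module A = Antipodes Γ p pr regular connected 2gt (GraphBasics.noncomplete-geodesic Γ connected noncomplete) triangle
    p-odd : p ≡ suc (A.α ℕ.+ A.α ℕ.+ (A.α ℕ.+ A.α))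
    p-odd = trans A.p-odd (cong (λ k → suc (k ℕ.+ k)) A.h≡2α)

open import Defs
open import Data.Nat using (ℕ; _%_)
open import Data.Nat.Primality using (Prime)
open import Data.Product using (_×_; _,_; proj₁; proj₂)
open import Data.Sum using (_⊎_; inj₁; inj₂)
open import Function.Bundles using (_⇔_; mk⇔)
open import Relation.Nullary using (Dec; yes; no)
open import Relation.Binary.PropositionalEquality using (_≡_)
open Classification

theorem1p3 : (n p : ℕ) (pr : Prime p) (Γ : Graph n) →
    Connected Γ → NonComplete Γ → Regular Γ p →
    TwoGeodesicTransitive Γ ⇔ (TwoArcTransitive Γ ⊎ (p % 4 ≡ 1 × InC p pr Γ))
theorem1p3 n p pr Γ connected noncomplete regular = mk⇔ to from
  where
  by-triangles : TwoGeodesicTransitive Γ → Dec (Triangle Γ) → TwoArcTransitive Γ ⊎ (p % 4 ≡ 1 × InC p pr Γ)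
  by-triangles 2gt (yes triangle) = inj₂ (2-geodesic-transitive⇒InC p pr Γ connected noncomplete regular 2gt triangle)
  by-triangles 2gt (no none) = inj₁ (proj₁ 2gt , λ u v w u′ v′ w′ a a′ →
    proj₂ 2gt u v w u′ v′ w′ (2-arc⇒2-geodesic Γ none a) (2-arc⇒2-geodesic Γ none a′))

  to : TwoGeodesicTransitive Γ → TwoArcTransitive Γ ⊎ (p % 4 ≡ 1 × InC p pr Γ)
  to 2gt = by-triangles 2gt (triangle? Γ)

  from : TwoArcTransitive Γ ⊎ (p % 4 ≡ 1 × InC p pr Γ) → TwoGeodesicTransitive Γ
  from (inj₁ 2at) = 2-arc-transitive⇒2-geodesic-transitive Γ 2at
  from (inj₂ (p%4≡1 , inC)) = InC⇒2-geodesic-transitive p pr Γ p%4≡1 inC
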